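{- Assume the following statement (Conjecture): for every $X_0\in\mathbb{N}$ and $\rho>0$ there is $c=c(\rho)>0$ such that for every $X\in\mathbb{N}$ sufficiently large in terms of $X_0$ and $\rho$, whenever $A,B\subset[X]$ satisfy $|A\bmod p|+|B\bmod p|\le p+1$ for all primes $p\in[X_0,X^{1/4}]$, one of the following holds: (i) $|A\cap[X^{1/2}]|\le X^{1/4-c}$ or $|B\cap[X^{1/2}]|\le X^{1/4-c}$; (ii) there are rational quadratics $\psi_A,\psi_B$ of height at most $X^{\rho}$ such that $|A\setminus\psi_A(\mathbb{Q})|\le X^{1/2-c}$ and $|B\setminus\psi_B(\mathbb{Q})|\le X^{1/2-c}$. Then: if $\mathscr{A},\mathscr{B}$ are two sets of positive integers with $|\mathscr{A}|,|\mathscr{B}|\ge 2$ such that $\mathscr{A}+\mathscr{B}$ contains all sufficiently large primes, then $\mathscr{A}+\mathscr{B}$ also contains infinitely many composite numbers.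
   Context: $[X]:=\{1,\dots,X\}$. A rational quadratic is a degree-2 polynomial with rational coefficients; $\psi(\mathbb{Q})$ its set of values on rationals. It has height at most $H$ if it can be written $\frac1d(ax^2+bx+c)$ with $a,b,c,d\in\mathbb{Z}$, $\max(|a|,|b|,|c|,|d|)\le H$. $\mathscr{A}+\mathscr{B}=\{a+b: a\in\mathscr{A}, b\in\mathscr{B}\}$. -}

module Defs where

open import Data.Nat using (ℕ; zero; suc; _+_; _*_; _^_; _≤_; _≤ᵇ_; _≡ᵇ_)
open import Data.Nat.DivMod using (_%_)
open import Data.Nat.Primality using (Prime; Composite)
open import Data.Bool using (Bool; true; false; _∧_; if_then_else_)
open import Data.List using (List; []; _∷_; upTo; map; length)
open import Data.Bool.ListAction using (any)
open import Data.List.Membership.Propositional using (_∈_)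
open import Data.Integer as ℤ using (ℤ)
open import Data.Rational as ℚ using (ℚ; ↥_; ↧ₙ_)
open import Data.Product using (Σ; _×_)
open import Data.Sum using (_⊎_)
open import Relation.Binary.PropositionalEquality using (_≡_; _≢_)

range : ℕ → List ℕ
range X = map suc (upTo X)

count : (ℕ → Bool) → List ℕ → ℕ
count f []       = 0
count f (x ∷ xs) = if f x then suc (count f xs) else count f xs

SubsetOf : (ℕ → Bool) → ℕ → Set
SubsetOf A X = ∀ n → A n ≡ true → (1 ≤ n) × (n ≤ X)

-- |A mod p| for A ⊆ [X]: number of residues r ∈ {0,…,p-1} hit by A.
-- (p = 0 never occurs in use, since p is prime.)
resCount : (ℕ → Bool) → ℕ → ℕ → ℕ
resCount A X zero    = 0
resCount A X (suc q) =
  count (λ r → any (λ a → A a ∧ ((a % suc q) ≡ᵇ r)) (range X)) (upTo (suc q))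

smallCount : (ℕ → Bool) → ℕ → ℕ
smallCount A X = count (λ n → A n ∧ ((n * n) ≤ᵇ X)) (range X)

-- For X ≥ 1, e ≥ 1 and positive rational c = m/k (lowest terms):
--   N ≤ X^(1/e - c)   ⇔   N^(e k) · X^(e m) ≤ X^k
PowBound : ℕ → ℕ → ℕ → ℚ → Set
PowBound N X e c = N ^ (e * ↧ₙ c) * X ^ (e * ℤ.∣ ↥ c ∣) ≤ X ^ (↧ₙ c)

-- |z| ≤ X^ρ for a positive rational ρ = r/s: |z|^s ≤ X^r
IntBound : ℤ → ℕ → ℚ → Set
IntBound z X ρ = ℤ.∣ z ∣ ^ (↧ₙ ρ) ≤ X ^ ℤ.∣ ↥ ρ ∣

-- a rational quadratic ψ(x) = (a x² + b x + c)/d with a ≠ 0, d ≠ 0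
record RatQuad : Set where
  constructor ratQuad
  field
    qa qb qc qd : ℤ
    qa≢0 : qa ≢ ℤ.0ℤ
    qd≢0 : qd ≢ ℤ.0ℤ

open RatQuad public

HeightAtMost : RatQuad → ℕ → ℚ → Set
HeightAtMost ψ X ρ =
  IntBound (qa ψ) X ρ × IntBound (qb ψ) X ρ × IntBound (qc ψ) X ρ × IntBound (qd ψ) X ρ

ℤtoℚ : ℤ → ℚ
ℤtoℚ z = z ℚ./ 1

-- n ∈ ψ(ℚ): there is x ∈ ℚ with (a x² + b x + c)/d = n, i.e. a x² + b x + c = d n (d ≠ 0)
InImage : RatQuad → ℕ → Set
InImage ψ n = Σ ℚ λ x →
  (ℤtoℚ (qa ψ) ℚ.* x ℚ.* x ℚ.+ ℤtoℚ (qb ψ) ℚ.* x ℚ.+ ℤtoℚ (qc ψ))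
    ≡ ℤtoℚ (qd ψ) ℚ.* ℤtoℚ (ℤ.+ n)

-- |A \ ψ(ℚ)| ≤ X^(1/2 - c): A \ ψ(ℚ) is covered by a list of length ≤ X^(1/2 - c)
FewExceptions : (ℕ → Bool) → RatQuad → ℕ → ℚ → Set
FewExceptions A ψ X c = Σ (List ℕ) λ L →
  PowBound (length L) X 2 c × (∀ n → A n ≡ true → InImage ψ n ⊎ n ∈ L)

Conjecture : Set
Conjecture =
  ∀ (ρ : ℚ) → ℚ.Positive ρ →
  Σ ℚ λ c → ℚ.Positive c ×
  (∀ (X₀ : ℕ) → Σ ℕ λ X₁ → ∀ (X : ℕ) → X₁ ≤ X →
   ∀ (A B : ℕ → Bool) → SubsetOf A X → SubsetOf B X →
   (∀ p → Prime p → X₀ ≤ p → p ^ 4 ≤ X → resCount A X p + resCount B X p ≤ suc p) →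
   (PowBound (smallCount A X) X 4 c ⊎ PowBound (smallCount B X) X 4 c)
   ⊎ (Σ RatQuad λ ψA → Σ RatQuad λ ψB →
        HeightAtMost ψA X ρ × HeightAtMost ψB X ρ ×
        FewExceptions A ψA X c × FewExceptions B ψB X c))

HasTwoElements : (ℕ → Set) → Set
HasTwoElements S = Σ ℕ λ x → Σ ℕ λ y → S x × S y × x ≢ y

InSumset : (ℕ → Set) → (ℕ → Set) → ℕ → Set
InSumset S T n = Σ ℕ λ a → Σ ℕ λ b → S a × T b × (a + b ≡ n)

{-# OPTIONS --safe #-}

-- Suppose no large sum is composite.  Keeping one pair of summands for every prime up to 2ⁿ, we get
-- finite sets all of whose large sums are prime, so that modulo every small prime p the residues
-- of one set avoid the negatives of the residues of the other.  An elementary large sieve (products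
-- of functions of mean zero modulo p, with iterated summation in place of a smooth weight) and
-- |A||B| ≥ π(X) show that both sets have X^(1/2 + o(1)) elements up to X.  Alternative (i) of the
-- conjecture is therefore impossible at every scale, and (ii) makes α a + β and γ b + δ squares for
-- almost all summands a, b.  Again by the sieve, these squares come from almost all residues modulo
-- most small p; the conic γ u² + α v² = γ β + α δ, which has no point (u, v) with such coordinates
-- because p ∤ a + b, has to be degenerate: γ β + α δ = 0 and -α γ is a nonresidue modulo most p.
-- Neighbouring scales share summands, which gives β / α and the square class of α, and likewise
-- of γ, the same value at all scales.  But at the smallest scale a prime p = a + b makes
-- -α γ ≡ (γ u / v)² a residue modulo p.
module Submission where

open import Defs
open import Data.Bool using (Bool; true; false; _∧_; not; if_then_else_)
open import Data.Bool.ListAction using (any)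
open import Data.Bool.Properties using (∧-identityʳ) renaming (_≟_ to _≟ᵇ_)
open import Data.Empty using (⊥; ⊥-elim)
open import Data.Fin using (toℕ; fromℕ<)
import Data.Fin.Properties as FinP
import Data.Integer as ℤ
open import Data.Integer using (ℤ; +_; ∣_∣)
import Data.Integer.DivMod as ℤD
import Data.Integer.Divisibility.Signed as Sg
import Data.Integer.Properties as ℤP
import Data.Integer.Tactic.RingSolver as ℤS
open import Data.List using (List; []; _∷_; length; map; filter; upTo; _++_; cartesianProduct; deduplicate; take; concatMap)
open import Data.List.Membership.Propositional using (_∈_; _∉_; find; lose)
open import Data.List.Membership.Propositional.Properties using (∈-++⁺ˡ; ∈-++⁺ʳ; ∈-filter⁺; ∈-filter⁻; ∈-upTo⁺; ∈-upTo⁻; ∈-map⁺; ∈-cartesianProduct⁺; ∈-∃++; ∈-concatMap⁺; ∈-map⁻; ∈-deduplicate⁺; ∈-deduplicate⁻; ∈-++⁻)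
open import Data.List.Properties using (length-++; length-map; length-upTo; length-take)
import Data.List.Relation.Unary.All as All
open import Data.List.Relation.Unary.All using (All; []; _∷_)
open import Data.List.Relation.Unary.AllPairs using ([]; _∷_)
open import Data.List.Relation.Unary.Any using (here; there; any?; Any) renaming (map to Any-map)
open import Data.List.Relation.Unary.Unique.Propositional using (Unique)
open import Data.List.Relation.Unary.Unique.Propositional.Properties using (filter⁺; upTo⁺; take⁺)
open import Data.Nat
import Data.Nat.Coprimality as Cop
open import Data.Nat.Coprimality using (Coprime; coprime-Bézout; coprime-divisor)
open import Data.Nat.DivMod
open import Data.Nat.Divisibility
open import Data.Nat.GCD using (module Bézout; gcd; gcd[m,n]∣m; gcd[m,n]∣n; gcd[m,n]≢0)
open import Data.Nat.ListAction using (product)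
open import Data.Nat.Primality
open import Data.Nat.Primality.Factorisation using (PrimeFactorisation; factorise)
open import Data.Nat.Properties
import Data.Nat.Tactic.RingSolver as ℕS
open import Data.Product using (Σ; _×_; _,_; proj₁; proj₂)
import Data.Rational as ℚ
open import Data.Rational using (ℚ; mkℚ; toℚᵘ)
import Data.Rational.Properties as ℚP
open import Data.Rational.Solver using (module +-*-Solver)
import Data.Rational.Unnormalised as ℚᵘ
import Data.Rational.Unnormalised.Properties as ℚᵘP
open import Data.Sum using (_⊎_; inj₁; inj₂)
open import Function using (_∘_; id; case_of_)
open import Relation.Binary.PropositionalEquality hiding (J)
open import Relation.Nullary using (¬_; Dec; yes; no; does)
open import Relation.Nullary.Decidable using (dec-true; dec-false; ¬?; decidable-stable; _×-dec_)
import Algebra.Properties.AbelianGroup ℚP.+-0-abelianGroup as ℚG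
import Algebra.Properties.AbelianGroup ℤP.+-0-abelianGroup as ℤG
open import Data.List.Membership.DecPropositional _≟_ using (_∈?_)
open import Data.List.Relation.Unary.Unique.DecPropositional.Properties _≟_ using (deduplicate-!)

-- Periodic functions and iterated summation

Sum : ℕ → (ℕ → ℤ) → ℤ
Sum zero    f = + 0
Sum (suc n) f = Sum n f ℤ.+ f n

Sum-cong : ∀ n {f g : ℕ → ℤ} → (∀ i → i < n → f i ≡ g i) → Sum n f ≡ Sum n g
Sum-cong zero    e = refl
Sum-cong (suc n) e = cong₂ ℤ._+_ (Sum-cong n λ i i<n → e i (m<n⇒m<1+n i<n)) (e n ≤-refl)

Sum-ext : ∀ n {f g : ℕ → ℤ} → (∀ i → f i ≡ g i) → Sum n f ≡ Sum n g
Sum-ext n e = Sum-cong n λ i _ → e i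

interchangeℤ : ∀ a b c d → (a ℤ.+ b) ℤ.+ (c ℤ.+ d) ≡ (a ℤ.+ c) ℤ.+ (b ℤ.+ d)
interchangeℤ = ℤS.solve-∀

Sum-+ : ∀ n f g → Sum n (λ i → f i ℤ.+ g i) ≡ Sum n f ℤ.+ Sum n g
Sum-+ zero    f g = refl
Sum-+ (suc n) f g = trans (cong (ℤ._+ (f n ℤ.+ g n)) (Sum-+ n f g))
                          (interchangeℤ (Sum n f) (Sum n g) (f n) (g n))

Sum-* : ∀ n c f → Sum n (λ i → c ℤ.* f i) ≡ c ℤ.* Sum n f
Sum-* zero    c f = sym (ℤP.*-zeroʳ c)
Sum-* (suc n) c f = trans (cong (ℤ._+ (c ℤ.* f n)) (Sum-* n c f))
                          (sym (ℤP.*-distribˡ-+ c (Sum n f) (f n)))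

Sum-0 : ∀ n → Sum n (λ _ → + 0) ≡ + 0
Sum-0 zero    = refl
Sum-0 (suc n) = cong (ℤ._+ + 0) (Sum-0 n)

Sum-const : ∀ n c → Sum n (λ _ → c) ≡ + n ℤ.* c
Sum-const zero    c = sym (ℤP.*-zeroˡ c)
Sum-const (suc n) c = trans (cong (ℤ._+ c) (Sum-const n c))
                            (trans (ℤP.+-comm (+ n ℤ.* c) c) (sym (ℤP.suc-* (+ n) c)))

Sum-swap : ∀ m n (f : ℕ → ℕ → ℤ) →
  Sum m (λ i → Sum n (λ j → f i j)) ≡ Sum n (λ j → Sum m (λ i → f i j))
Sum-swap zero    n f = sym (Sum-0 n)
Sum-swap (suc m) n f = trans (cong (ℤ._+ Sum n (f m)) (Sum-swap m n f))
                             (sym (Sum-+ n (λ j → Sum m (λ i → f i j)) (f m)))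

Sum-split : ∀ m n f → Sum (m + n) f ≡ Sum m f ℤ.+ Sum n (λ i → f (m + i))
Sum-split m zero    f rewrite +-identityʳ m = sym (ℤP.+-identityʳ _)
Sum-split m (suc n) f rewrite +-suc m n =
  trans (cong (ℤ._+ f (m + n)) (Sum-split m n f))
        (ℤP.+-assoc (Sum m f) (Sum n (λ i → f (m + i))) (f (m + n)))

Sum-abs : ∀ n f H → (∀ i → i < n → ∣ f i ∣ ≤ H) → ∣ Sum n f ∣ ≤ n * H
Sum-abs zero    f H b = z≤n
Sum-abs (suc n) f H b = ≤-trans (ℤP.∣i+j∣≤∣i∣+∣j∣ (Sum n f) (f n))
  (subst (∣ Sum n f ∣ + ∣ f n ∣ ≤_) (+-comm (n * H) H)
    (+-mono-≤ (Sum-abs n f H λ i i<n → b i (m<n⇒m<1+n i<n)) (b n ≤-refl)))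

Sum-mono : ∀ n {f g : ℕ → ℤ} → (∀ i → i < n → f i ℤ.≤ g i) → Sum n f ℤ.≤ Sum n g
Sum-mono zero    b = ℤP.≤-refl
Sum-mono (suc n) b = ℤP.+-mono-≤ (Sum-mono n λ i i<n → b i (m<n⇒m<1+n i<n)) (b n ≤-refl)

Sum-nonneg : ∀ n {f : ℕ → ℤ} → (∀ i → + 0 ℤ.≤ f i) → + 0 ℤ.≤ Sum n f
Sum-nonneg n {f} b = subst (ℤ._≤ Sum n f) (Sum-0 n) (Sum-mono n λ i _ → b i)

Periodic : ℕ → (ℕ → ℤ) → Set
Periodic M f = ∀ n → f (n + M) ≡ f n

periodic-* : ∀ {M f} → Periodic M f → ∀ k n → f (n + k * M) ≡ f n
periodic-* {M} {f} P zero    n = cong f (+-identityʳ n)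
periodic-* {M} {f} P (suc k) n =
  trans (cong f (sym (+-assoc n M (k * M)))) (trans (periodic-* {M} {f} P k (n + M)) (P n))

Sum-shift : ∀ M f → Periodic M f → ∀ c → Sum M (λ i → f (i + c)) ≡ Sum M f
Sum-shift M f P zero    = Sum-ext M λ i → cong f (+-identityʳ i)
Sum-shift M f P (suc c) =
  trans (Sum-ext M λ i → cong f (+-suc i c))
        (trans (ℤG.∙-cancelˡ (f c) _ _ rotate) (Sum-shift M f P c))
  where
  h : ℕ → ℤ
  h i = f (i + c)
  rotate : h 0 ℤ.+ Sum M (h ∘ suc) ≡ h 0 ℤ.+ Sum M h
  rotate = trans (cong (ℤ._+ Sum M (h ∘ suc)) (sym (ℤP.+-identityˡ (h 0))))
    (trans (sym (Sum-split 1 M h))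
      (trans (cong (ℤ._+_ (Sum M h)) (trans (cong f (+-comm M c)) (P c))) (ℤP.+-comm (Sum M h) (h 0))))

Sum-blocks : ∀ k M f → Sum (k * M) f ≡ Sum k (λ i → Sum M (λ j → f (i * M + j)))
Sum-blocks zero    M f = refl
Sum-blocks (suc k) M f =
  trans (cong (λ n → Sum n f) (+-comm M (k * M)))
    (trans (Sum-split (k * M) M f) (cong (ℤ._+ Sum M (λ j → f (k * M + j))) (Sum-blocks k M f)))

-- Only the incomplete last period of a mean-zero periodic function contributes.
Sum-meanzero-abs : ∀ M .{{_ : NonZero M}} f H → Periodic M f → Sum M f ≡ + 0 →
  (∀ i → ∣ f i ∣ ≤ H) → ∀ X s → ∣ Sum X (λ j → f (s + j)) ∣ ≤ M * H
Sum-meanzero-abs M f H P z b X s = subst (λ n → ∣ Sum n (λ j → f (s + j)) ∣ ≤ M * H) (sym X≡)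
  (subst (λ t → ∣ t ∣ ≤ M * H) (sym whole)
    (≤-trans (Sum-abs r _ H λ i _ → b _) (*-monoˡ-≤ H (<⇒≤ (m%n<n X M)))))
  where
  q = X / M
  r = X % M
  X≡ : X ≡ q * M + r
  X≡ = trans (m≡m%n+[m/n]*n X M) (+-comm r (q * M))
  block : ∀ i → Sum M (λ j → f (s + (i * M + j))) ≡ + 0
  block i = trans (Sum-ext M λ j → cong f (trans (sym (+-assoc s (i * M) j)) (+-comm (s + i * M) j)))
                  (trans (Sum-shift M f P (s + i * M)) z)
  whole : Sum (q * M + r) (λ j → f (s + j)) ≡ Sum r (λ i → f (s + (q * M + i)))
  whole = trans (Sum-split (q * M) r (λ j → f (s + j)))
    (trans (cong (λ t → t ℤ.+ Sum r (λ i → f (s + (q * M + i)))) (trans (Sum-blocks q M (λ j → f (s + j))) (trans (Sum-ext q block) (Sum-0 q))))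
           (ℤP.+-identityˡ _))

smooth : ℕ → ℕ → (ℕ → ℤ) → ℕ → ℤ
smooth X zero    f s = f s
smooth X (suc J) f s = Sum X (λ j → smooth X J f (s + j))

smooth-ext : ∀ X J {f g} → (∀ i → f i ≡ g i) → ∀ s → smooth X J f s ≡ smooth X J g s
smooth-ext X zero    e s = e s
smooth-ext X (suc J) e s = Sum-ext X λ j → smooth-ext X J e (s + j)

smooth-+ : ∀ X J f g s → smooth X J (λ i → f i ℤ.+ g i) s ≡ smooth X J f s ℤ.+ smooth X J g s
smooth-+ X zero    f g s = refl
smooth-+ X (suc J) f g s = trans (Sum-ext X λ j → smooth-+ X J f g (s + j))
                                 (Sum-+ X (λ j → smooth X J f (s + j)) (λ j → smooth X J g (s + j)))

smooth-* : ∀ X J c f s → smooth X J (λ i → c ℤ.* f i) s ≡ c ℤ.* smooth X J f s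
smooth-* X zero    c f s = refl
smooth-* X (suc J) c f s = trans (Sum-ext X λ j → smooth-* X J c f (s + j))
                                 (Sum-* X c (λ j → smooth X J f (s + j)))

smooth-const : ∀ X J c s → smooth X J (λ _ → c) s ≡ + (X ^ J) ℤ.* c
smooth-const X zero    c s = sym (ℤP.*-identityˡ c)
smooth-const X (suc J) c s = trans (Sum-ext X λ j → smooth-const X J c (s + j))
  (trans (Sum-const X _) (trans (sym (ℤP.*-assoc (+ X) (+ (X ^ J)) c))
                                (cong (ℤ._* c) (sym (ℤP.pos-* X (X ^ J))))))

smooth-shift : ∀ X J f c s → smooth X J (λ i → f (i + c)) s ≡ smooth X J f (s + c)
smooth-shift X zero    f c s = refl
smooth-shift X (suc J) f c s = Sum-ext X λ j → trans (smooth-shift X J f c (s + j))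
  (cong (smooth X J f) (trans (+-assoc s j c) (trans (cong (_+_ s) (+-comm j c)) (sym (+-assoc s c j)))))

smooth-periodic : ∀ X J M f → Periodic M f → Periodic M (smooth X J f)
smooth-periodic X J M f P s =
  trans (sym (smooth-shift X J f M s)) (smooth-ext X J P s)

smooth-meanzero : ∀ X J M f → Periodic M f → Sum M f ≡ + 0 → Sum M (smooth X J f) ≡ + 0
smooth-meanzero X zero    M f P z = z
smooth-meanzero X (suc J) M f P z =
  trans (Sum-swap M X (λ i j → smooth X J f (i + j)))
    (trans (Sum-ext X λ j → trans (Sum-shift M (smooth X J f) (smooth-periodic X J M f P) j)
                                  (smooth-meanzero X J M f P z))
           (Sum-0 X))

smooth-meanzero-abs : ∀ X J M .{{_ : NonZero M}} f H → Periodic M f → Sum M f ≡ + 0 →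
  (∀ i → ∣ f i ∣ ≤ H) → ∀ s → ∣ smooth X J f s ∣ ≤ M ^ J * H
smooth-meanzero-abs X zero    M f H P z b s = subst (∣ f s ∣ ≤_) (sym (*-identityˡ H)) (b s)
smooth-meanzero-abs X (suc J) M f H P z b s =
  subst (∣ smooth X (suc J) f s ∣ ≤_) (sym (*-assoc M (M ^ J) H))
    (Sum-meanzero-abs M (smooth X J f) (M ^ J * H) (smooth-periodic X J M f P)
      (smooth-meanzero X J M f P z) (smooth-meanzero-abs X J M f H P z b) X s)

record Mean (M : ℕ) (f : ℕ → ℤ) (μ : ℤ) : Set where
  constructor mean
  field
    periodic : Periodic M f
    total    : Sum M f ≡ + M ℤ.* μ

smooth-mean-abs : ∀ X J M .{{_ : NonZero M}} f μ H → Mean M f μ → (∀ i → ∣ f i ∣ ≤ H) →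
  ∀ s → ∣ smooth X J f s ℤ.- + (X ^ J) ℤ.* μ ∣ ≤ M ^ J * (2 * H)
smooth-mean-abs X J M f μ H (mean P T) b s =
  subst (λ t → ∣ t ∣ ≤ M ^ J * (2 * H)) smooth-f₀
    (smooth-meanzero-abs X J M f₀ (2 * H) (λ n → cong (ℤ._+ ℤ.- μ) (P n)) total₀ bound₀ s)
  where
  f₀ : ℕ → ℤ
  f₀ i = f i ℤ.+ ℤ.- μ
  total₀ : Sum M f₀ ≡ + 0
  total₀ = trans (Sum-+ M f (λ _ → ℤ.- μ)) (trans (cong₂ ℤ._+_ T (trans (Sum-const M (ℤ.- μ))
    (sym (ℤP.neg-distribʳ-* (+ M) μ)))) (ℤP.+-inverseʳ (+ M ℤ.* μ)))
  μ≤H : ∣ μ ∣ ≤ H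
  μ≤H = *-cancelˡ-≤ M (subst (_≤ M * H) (trans (cong ∣_∣ T) (ℤP.abs-* (+ M) μ)) (Sum-abs M f H λ i _ → b i))
  bound₀ : ∀ i → ∣ f₀ i ∣ ≤ 2 * H
  bound₀ i = ≤-trans (ℤP.∣i-j∣≤∣i∣+∣j∣ (f i) μ)
    (subst (∣ f i ∣ + ∣ μ ∣ ≤_) (cong (_+_ H) (sym (+-identityʳ H))) (+-mono-≤ (b i) μ≤H))
  smooth-f₀ : smooth X J f₀ s ≡ smooth X J f s ℤ.- + (X ^ J) ℤ.* μ
  smooth-f₀ = trans (smooth-+ X J f (λ _ → ℤ.- μ) s)
    (cong (ℤ._+_ (smooth X J f s)) (trans (smooth-const X J (ℤ.- μ) s) (sym (ℤP.neg-distribʳ-* (+ (X ^ J)) μ))))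

-- The step M is invertible modulo p, so the progression sum does not depend on its start.
Sum-progression : ∀ p M .{{_ : NonZero p}} g → Coprime M p → Periodic p g →
  ∀ j → Sum p (λ i → g (j + i * M)) ≡ Sum p g
Sum-progression p M g cop P j = trans (constant j) (ℤP.*-cancelˡ-≡ (+ p) _ _ {{nz}} average)
  where
  nz : ℤ.NonZero (+ p)
  nz = ℤ.≢-nonZero λ e → ≢-nonZero⁻¹ p (ℤP.+-injective e)
  G : ℕ → ℤ
  G j = Sum p (λ i → g (j + i * M))
  G-p : ∀ j → G (j + p) ≡ G j
  G-p j = Sum-ext p λ i → trans (cong g (trans (+-assoc j p (i * M)) (trans (cong (_+_ j) (+-comm p (i * M)))
    (sym (+-assoc j (i * M) p))))) (P (j + i * M))
  G-M : ∀ j → G (j + M) ≡ G j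
  G-M j = trans (Sum-ext p λ i → cong g (trans (+-assoc j M (i * M)) (cong (λ t → j + t * M) (+-comm 1 i))))
    (Sum-shift p (λ i → g (j + i * M)) (λ i → trans (cong g (split i))
      (periodic-* {p} {g} P M (j + i * M))) 1)
    where
    split : ∀ i → j + (i + p) * M ≡ (j + i * M) + M * p
    split i = lem j i p M
      where
      lem : ∀ j i p M → j + (i + p) * M ≡ (j + i * M) + M * p
      lem = ℕS.solve-∀
  G-suc : ∀ j → G (suc j) ≡ G j
  G-suc j with coprime-Bézout cop
  ... | Bézout.+- x y e = trans (sym (periodic-* {p} {G} G-p y (suc j)))
        (trans (cong G (trans (sym (+-suc j (y * p))) (cong (_+_ j) e))) (periodic-* {M} {G} G-M x j))
  ... | Bézout.-+ x y e = trans (sym (periodic-* {M} {G} G-M x (suc j)))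
        (trans (cong G (trans (sym (+-suc j (x * M))) (cong (_+_ j) e))) (periodic-* {p} {G} G-p y j))
  constant : ∀ j → G j ≡ G 0
  constant zero    = refl
  constant (suc j) = trans (G-suc j) (constant j)
  average : + p ℤ.* G 0 ≡ + p ℤ.* Sum p g
  average = trans (sym (Sum-const p (G 0))) (trans (Sum-ext p λ j → sym (constant j))
    (trans (Sum-swap p p (λ j i → g (j + i * M)))
      (trans (Sum-ext p λ i → Sum-shift p g P (i * M)) (Sum-const p (Sum p g)))))

mean-* : ∀ {M p h g μ ν} .{{_ : NonZero p}} → Coprime M p → Mean M h μ → Mean p g ν →
  Mean (M * p) (λ n → h n ℤ.* g n) (μ ℤ.* ν)
mean-* {M} {p} {h} {g} {μ} {ν} cop (mean Ph Th) (mean Pg Tg) = mean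
  (λ n → cong₂ ℤ._*_ (trans (cong (λ t → h (n + t)) (*-comm M p)) (periodic-* {M} {h} Ph p n))
                     (periodic-* {p} {g} Pg M n))
  (trans (cong (λ t → Sum t hg) (*-comm M p)) (trans (Sum-blocks p M hg)
    (trans (Sum-swap p M (λ i j → hg (i * M + j)))
      (trans (Sum-ext M column) (trans (Sum-ext M λ j → ℤP.*-comm (h j) (Sum p g))
        (trans (Sum-* M (Sum p g) h) (trans (cong₂ ℤ._*_ Tg Th)
          (trans (lem (+ M) (+ p) μ ν) (cong (ℤ._* (μ ℤ.* ν)) (sym (ℤP.pos-* M p)))))))))))
  where
  hg : ℕ → ℤ
  hg n = h n ℤ.* g n
  column : ∀ j → Sum p (λ i → hg (i * M + j)) ≡ h j ℤ.* Sum p g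
  column j = trans (Sum-ext p λ i → trans (cong hg (+-comm (i * M) j))
      (cong (ℤ._* g (j + i * M)) (periodic-* {M} {h} Ph i j)))
    (trans (Sum-* p (h j) (λ i → g (j + i * M))) (cong (h j ℤ.*_) (Sum-progression p M g cop Pg j)))
  lem : ∀ M p μ ν → (p ℤ.* ν) ℤ.* (M ℤ.* μ) ≡ (M ℤ.* p) ℤ.* (μ ℤ.* ν)
  lem = ℤS.solve-∀

-- Every value in the last window is counted X times by the start points of all windows.
smooth-window : ∀ X J ℓ f → (∀ i → + 0 ℤ.≤ f i) →
  + (X ^ J) ℤ.* Sum ℓ (λ i → f (i + J * X)) ℤ.≤ Sum (J * X + ℓ) (smooth X J f)
smooth-window X zero    ℓ f f≥0 = ℤP.≤-reflexive (trans (ℤP.*-identityˡ _)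
  (Sum-ext ℓ λ i → cong f (+-identityʳ i)))
smooth-window X (suc J) ℓ f f≥0 = ℤP.≤-trans
  (ℤP.≤-reflexive (trans (cong (ℤ._* Sum ℓ (λ i → f (i + suc J * X))) (ℤP.pos-* X (X ^ J)))
    (trans (ℤP.*-assoc (+ X) (+ (X ^ J)) _)
      (cong (λ t → + X ℤ.* (+ (X ^ J) ℤ.* t)) (Sum-ext ℓ λ i → cong f
        (trans (cong (_+_ i) (+-comm X (J * X))) (sym (+-assoc i (J * X) X))))))))
  (ℤP.≤-trans (ℤP.*-monoˡ-≤-nonNeg (+ X) (smooth-window X J ℓ (λ i → f (i + X)) (λ i → f≥0 (i + X))))
    (ℤP.≤-trans (ℤP.≤-reflexive (cong (+ X ℤ.*_) (Sum-ext (J * X + ℓ) (smooth-shift X J f X))))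
      (subst (λ n → + X ℤ.* Sum (J * X + ℓ) (λ i → smooth X J f (i + X)) ℤ.≤ Sum n (smooth X (suc J) f))
        (sym (+-assoc X (J * X) ℓ)) (one (smooth X J f) (smooth-nonneg J) (J * X + ℓ)))))
  where
  smooth-nonneg : ∀ J i → + 0 ℤ.≤ smooth X J f i
  smooth-nonneg zero    i = f≥0 i
  smooth-nonneg (suc J) i = Sum-nonneg X λ j → smooth-nonneg J (i + j)
  one : ∀ (g : ℕ → ℤ) → (∀ i → + 0 ℤ.≤ g i) → ∀ m →
    + X ℤ.* Sum m (λ i → g (i + X)) ℤ.≤ Sum (X + m) (λ s → Sum X (λ j → g (s + j)))
  one g g≥0 m = ℤP.≤-trans (ℤP.≤-reflexive (sym (Sum-const X _)))
    (ℤP.≤-trans (Sum-mono X row) (ℤP.≤-reflexive (Sum-swap X (X + m) (λ j s → g (s + j)))))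
    where
    row : ∀ j → j < X → Sum m (λ i → g (i + X)) ℤ.≤ Sum (X + m) (λ s → g (s + j))
    row j j<X = subst₂ (λ a b → a ℤ.≤ Sum b (λ s → g (s + j)))
      (Sum-ext m λ i → cong g (trans (cong (_+ j) (+-comm (X ∸ j) i))
        (trans (+-assoc i (X ∸ j) j) (cong (_+_ i) (m∸n+n≡m (<⇒≤ j<X))))))
      total
      (ℤP.≤-trans drop-head (drop-tail))
      where
      k = X ∸ j
      total : k + m + j ≡ X + m
      total = trans (+-assoc k m j) (trans (cong (_+_ k) (+-comm m j))
        (trans (sym (+-assoc k j m)) (cong (_+ m) (m∸n+n≡m (<⇒≤ j<X)))))
      drop-head : Sum m (λ i → g (k + i + j)) ℤ.≤ Sum (k + m) (λ s → g (s + j))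
      drop-head = subst (Sum m (λ i → g (k + i + j)) ℤ.≤_) (sym (Sum-split k m (λ s → g (s + j))))
        (ℤP.≤-trans (ℤP.≤-reflexive (sym (ℤP.+-identityˡ _)))
          (ℤP.+-monoˡ-≤ _ (Sum-nonneg k λ i → g≥0 (i + j))))
      drop-tail : Sum (k + m) (λ s → g (s + j)) ℤ.≤ Sum (k + m + j) (λ s → g (s + j))
      drop-tail = subst (Sum (k + m) (λ s → g (s + j)) ℤ.≤_) (sym (Sum-split (k + m) j (λ s → g (s + j))))
        (ℤP.≤-trans (ℤP.≤-reflexive (sym (ℤP.+-identityʳ _)))
          (ℤP.+-monoʳ-≤ (Sum (k + m) (λ s → g (s + j))) (Sum-nonneg j λ i → g≥0 (k + m + i + j))))

-- The large sieve

ind : Bool → ℕ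
ind true  = 1
ind false = 0

indZ : Bool → ℤ
indZ b = + ind b

cnt : ℕ → (ℕ → Bool) → ℕ
cnt zero    f = 0
cnt (suc n) f = cnt n f + ind (f n)

Sum-ind : ∀ n f → Sum n (λ i → indZ (f i)) ≡ + cnt n f
Sum-ind zero    f = refl
Sum-ind (suc n) f = trans (cong (ℤ._+ indZ (f n)) (Sum-ind n f)) (sym (ℤP.pos-+ (cnt n f) (ind (f n))))

ind≤1 : ∀ b → ind b ≤ 1
ind≤1 true  = ≤-refl
ind≤1 false = z≤n

^-distribʳ-* : ∀ k m n → (m * n) ^ k ≡ m ^ k * n ^ k
^-distribʳ-* zero    m n = refl
^-distribʳ-* (suc k) m n = trans (cong (_*_ (m * n)) (^-distribʳ-* k m n)) (lem m n (m ^ k) (n ^ k))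
  where
  lem : ∀ m n x y → m * n * (x * y) ≡ m * x * (n * y)
  lem = ℕS.solve-∀

cnt≤ : ∀ n f → cnt n f ≤ n
cnt≤ zero    f = z≤n
cnt≤ (suc n) f = subst (cnt n f + ind (f n) ≤_) (+-comm n 1) (+-mono-≤ (cnt≤ n f) (ind≤1 (f n)))

cnt<-gap : ∀ n f r → r < n → f r ≡ false → cnt n f < n
cnt<-gap (suc n) f r r<n e with r ≟ n
... | yes refl rewrite e | +-identityʳ (cnt n f) = s≤s (cnt≤ n f)
... | no r≢n = subst (cnt n f + ind (f n) <_) (+-comm n 1)
  (+-mono-<-≤ (cnt<-gap n f r (≤∧≢⇒< (≤-pred r<n) r≢n) e) (ind≤1 (f n)))

multiplicity : List ℕ → ℕ → ℕ
multiplicity []       i = 0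
multiplicity (x ∷ xs) i = ind (does (i ≟ x)) + multiplicity xs i

cnt-≟-below : ∀ X x → X ≤ x → cnt X (λ i → does (i ≟ x)) ≡ 0
cnt-≟-below zero    x _ = refl
cnt-≟-below (suc X) x X<x = cong₂ _+_ (cnt-≟-below X x (<⇒≤ X<x)) (cong ind (dec-false (X ≟ x) (<⇒≢ X<x)))

cnt-≟ : ∀ X x → x < X → cnt X (λ i → does (i ≟ x)) ≡ 1
cnt-≟ (suc X) x x<X with X ≟ x
... | yes refl = cong₂ _+_ (cnt-≟-below X X ≤-refl) (cong ind (dec-true (X ≟ X) refl))
... | no X≢x = cong₂ _+_ (cnt-≟ X x (≤∧≢⇒< (≤-pred x<X) λ e → X≢x (sym e))) (cong ind (dec-false (X ≟ x) X≢x))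

Sum-multiplicity : ∀ X xs → (∀ x → x ∈ xs → x < X) → Sum X (λ i → + multiplicity xs i) ≡ + length xs
Sum-multiplicity X []       b = Sum-0 X
Sum-multiplicity X (x ∷ xs) b =
  trans (Sum-ext X λ i → ℤP.pos-+ (ind (does (i ≟ x))) (multiplicity xs i))
    (trans (Sum-+ X (λ i → + ind (does (i ≟ x))) (λ i → + multiplicity xs i))
      (trans (cong₂ ℤ._+_ (trans (Sum-ind X (λ i → does (i ≟ x))) (cong +_ (cnt-≟ X x (b x (here refl)))))
                          (Sum-multiplicity X xs λ y y∈ → b y (there y∈)))
             refl))

multiplicity-∉ : ∀ xs i → i ∉ xs → multiplicity xs i ≡ 0
multiplicity-∉ []       i _ = refl
multiplicity-∉ (x ∷ xs) i i∉ = cong₂ _+_ (cong ind (dec-false (i ≟ x) λ i≡x → i∉ (here i≡x)))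
  (multiplicity-∉ xs i λ i∈ → i∉ (there i∈))

Unique-weight : ∀ xs → Unique xs → ∀ (h : ℕ → ℤ) c → (∀ i → + 0 ℤ.≤ h i) →
  (∀ x → x ∈ xs → c ℤ.≤ h x) → ∀ i → c ℤ.* + multiplicity xs i ℤ.≤ h i
Unique-weight [] u h c h≥0 b i = subst (ℤ._≤ h i) (sym (ℤP.*-zeroʳ c)) (h≥0 i)
Unique-weight (x ∷ xs) (x# ∷ u) h c h≥0 b i with i ≟ x
... | no i≢x = subst (λ b → c ℤ.* + (ind b + multiplicity xs i) ℤ.≤ h i) (sym (dec-false (i ≟ x) i≢x))
  (Unique-weight xs u h c h≥0 (λ y y∈ → b y (there y∈)) i)
... | yes refl = subst (λ m → c ℤ.* + m ℤ.≤ h i)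
  (sym (cong₂ _+_ (cong ind (dec-true (i ≟ x) refl)) (multiplicity-∉ xs i (λ i∈ → All.lookup x# i∈ refl))))
  (subst (ℤ._≤ h i) (sym (ℤP.*-identityʳ c)) (b i (here refl)))

module Weights (sel : ℕ → Bool) (ω : ℕ → ℕ) where

  s : ℕ → ℕ
  s p = p ∸ ω p

  W : ℕ → ℕ
  W zero    = 1
  W (suc i) = if sel (suc i) then s (suc i) * W i else W i

  L : ℕ → ℕ → ℕ
  L zero    zero    = 0
  L zero    (suc _) = 1
  L (suc i) Q = if sel (suc i) then s (suc i) * L i Q + ω (suc i) * L i (Q / suc i) else L i Q

  W≥1 : (∀ p → sel p ≡ true → ω p < p) → ∀ i → 1 ≤ W i
  W≥1 ω< zero = ≤-refl
  W≥1 ω< (suc i) with sel (suc i) in e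
  ... | true  = *-mono-≤ (m<n⇒0<n∸m (ω< (suc i) e)) (W≥1 ω< i)
  ... | false = W≥1 ω< i

  W≤L : ∀ i Q → 1 ≤ Q → W i ≤ L i Q
  W≤L zero    (suc Q) _ = ≤-refl
  W≤L (suc i) Q Q≥1 with sel (suc i)
  ... | true  = ≤-trans (*-monoʳ-≤ (s (suc i)) (W≤L i Q Q≥1)) (m≤m+n _ _)
  ... | false = W≤L i Q Q≥1

  L-mono : ∀ i {Q R} → Q ≤ R → L i Q ≤ L i R
  L-mono zero {zero}  _ = z≤n
  L-mono zero {suc Q} {suc R} _ = ≤-refl
  L-mono (suc i) Q≤R with sel (suc i)
  ... | true  = +-mono-≤ (*-monoʳ-≤ (s (suc i)) (L-mono i Q≤R)) (*-monoʳ-≤ (ω (suc i)) (L-mono i (/-monoˡ-≤ (suc i) Q≤R)))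
  ... | false = L-mono i Q≤R

-- A large sieve: residues in Ω p are forbidden at the selected primes p.  The
-- mean-zero functions g p equal ω p off Ω p; expanding the square of a weighted sum F of their
-- products over squarefree moduli up to Q, smoothing makes all off-diagonal terms negligible.
module Sieve (sel : ℕ → Bool) (Ω : ℕ → ℕ → Bool) (J X : ℕ) where

  ω : ℕ → ℕ
  ω p = cnt p (Ω p)

  open Weights sel ω hiding (W≥1)

  g : ℕ → ℕ → ℤ
  g zero    n = + 0
  g (suc q) n = + ω (suc q) ℤ.- + suc q ℤ.* indZ (Ω (suc q) ((n + J * X * q) % suc q))

  F : ℕ → ℕ → ℕ → ℤ
  F zero    zero    n = + 0
  F zero    (suc _) n = + 1
  F (suc i) Q n = if sel (suc i) then + s (suc i) ℤ.* F i Q n ℤ.+ g (suc i) n ℤ.* F i (Q / suc i) n else F i Q n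

  terms : ℕ → ℕ → ℕ
  terms zero    zero    = 0
  terms zero    (suc _) = 1
  terms (suc i) Q = if sel (suc i) then terms i Q + terms i (Q / suc i) else terms i Q

  terms≤ : ∀ i Q → terms i Q ≤ Q * suc i
  terms≤ zero    zero    = z≤n
  terms≤ zero    (suc Q) = s≤s z≤n
  terms≤ (suc i) Q with sel (suc i)
  ... | false = ≤-trans (terms≤ i Q) (*-monoʳ-≤ Q (n≤1+n (suc i)))
  ... | true  = ≤-trans (+-mono-≤ (terms≤ i Q) (≤-trans (terms≤ i (Q / suc i)) (m/n*n≤m Q (suc i))))
                        (≤-reflexive (trans (+-comm (Q * suc i) Q) (sym (*-suc Q (suc i)))))

  module _ (sel-prime : ∀ p → sel p ≡ true → Prime p) (ω< : ∀ p → sel p ≡ true → ω p < p) where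

    s≥1 : ∀ p → sel p ≡ true → 1 ≤ s p
    s≥1 p e = m<n⇒0<n∸m (ω< p e)

    W≥1 : ∀ i → 1 ≤ W i
    W≥1 = Weights.W≥1 sel ω ω<

    module _ (q : ℕ) where
      p⁺ = suc q

      χ : ℕ → ℤ
      χ n = indZ (Ω p⁺ ((n + J * X * q) % p⁺))

      χ-periodic : Periodic p⁺ χ
      χ-periodic n = cong (λ t → indZ (Ω p⁺ t))
        (trans (cong (_% p⁺) (trans (+-assoc n p⁺ c) (trans (cong (_+_ n) (+-comm p⁺ c)) (sym (+-assoc n c p⁺)))))
               ([m+n]%n≡m%n (n + c) p⁺))
        where c = J * X * q

      Sum-χ : Sum p⁺ χ ≡ + ω p⁺
      Sum-χ = trans (Sum-shift p⁺ (λ n → indZ (Ω p⁺ (n % p⁺)))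
                      (λ n → cong (λ t → indZ (Ω p⁺ t)) ([m+n]%n≡m%n n p⁺)) (J * X * q))
        (trans (Sum-cong p⁺ λ i i<p⁺ → cong (λ t → indZ (Ω p⁺ t)) (m<n⇒m%n≡m i<p⁺)) (Sum-ind p⁺ (Ω p⁺)))

      mean-g : Mean p⁺ (g p⁺) (+ 0)
      mean-g = mean (λ n → cong (λ t → + ω p⁺ ℤ.- + p⁺ ℤ.* t) (χ-periodic n))
        (trans (Sum-ext p⁺ λ n → cong (ℤ._+_ (+ ω p⁺)) (ℤP.neg-distribˡ-* (+ p⁺) (χ n)))
          (trans (Sum-+ p⁺ (λ _ → + ω p⁺) (λ n → ℤ.- + p⁺ ℤ.* χ n))
            (trans (cong₂ ℤ._+_ (Sum-const p⁺ (+ ω p⁺)) (trans (Sum-* p⁺ (ℤ.- + p⁺) χ) (cong (ℤ._*_ (ℤ.- + p⁺)) Sum-χ)))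
              (lem (+ p⁺) (+ ω p⁺)))))
        where
        lem : ∀ p⁺ w → p⁺ ℤ.* w ℤ.+ (ℤ.- p⁺) ℤ.* w ≡ p⁺ ℤ.* + 0
        lem = ℤS.solve-∀

      χ² : ∀ n → χ n ℤ.* χ n ≡ χ n
      χ² n with Ω p⁺ ((n + J * X * q) % p⁺)
      ... | true  = refl
      ... | false = refl

      mean-g² : ω p⁺ ≤ p⁺ → Mean p⁺ (λ n → g p⁺ n ℤ.* g p⁺ n) (+ (ω p⁺ * s p⁺))
      mean-g² ω≤p⁺ = mean (λ n → cong (λ t → (+ ω p⁺ ℤ.- + p⁺ ℤ.* t) ℤ.* (+ ω p⁺ ℤ.- + p⁺ ℤ.* t)) (χ-periodic n))
        (trans (Sum-ext p⁺ λ n → trans (expand (+ p⁺) (+ ω p⁺) (χ n)) (cong (λ t → + ω p⁺ ℤ.* + ω p⁺ ℤ.+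
                 ((ℤ.- (+ 2 ℤ.* + p⁺ ℤ.* + ω p⁺)) ℤ.* χ n ℤ.+ + p⁺ ℤ.* + p⁺ ℤ.* t)) (χ² n)))
          (trans (Sum-ext p⁺ λ n → cong (ℤ._+_ (+ ω p⁺ ℤ.* + ω p⁺)) (sym (ℤP.*-distribʳ-+ (χ n) (ℤ.- (+ 2 ℤ.* + p⁺ ℤ.* + ω p⁺)) (+ p⁺ ℤ.* + p⁺))))
            (trans (Sum-+ p⁺ (λ _ → + ω p⁺ ℤ.* + ω p⁺) (λ n → c ℤ.* χ n))
              (trans (cong₂ ℤ._+_ (Sum-const p⁺ (+ ω p⁺ ℤ.* + ω p⁺)) (trans (Sum-* p⁺ c χ) (cong (ℤ._*_ c) Sum-χ)))
                (trans (lem (+ p⁺) (+ ω p⁺)) (cong (ℤ._*_ (+ p⁺)) (trans (cong (ℤ._*_ (+ ω p⁺)) s≡) (sym (ℤP.pos-* (ω p⁺) (s p⁺))))))))))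
        where
        c = (ℤ.- (+ 2 ℤ.* + p⁺ ℤ.* + ω p⁺)) ℤ.+ + p⁺ ℤ.* + p⁺
        expand : ∀ p⁺ w x → (w ℤ.- p⁺ ℤ.* x) ℤ.* (w ℤ.- p⁺ ℤ.* x) ≡
          w ℤ.* w ℤ.+ ((ℤ.- (+ 2 ℤ.* p⁺ ℤ.* w)) ℤ.* x ℤ.+ p⁺ ℤ.* p⁺ ℤ.* (x ℤ.* x))
        expand = ℤS.solve-∀
        lem : ∀ p⁺ w → p⁺ ℤ.* (w ℤ.* w) ℤ.+ ((ℤ.- (+ 2 ℤ.* p⁺ ℤ.* w)) ℤ.+ p⁺ ℤ.* p⁺) ℤ.* w ≡ p⁺ ℤ.* (w ℤ.* (p⁺ ℤ.- w))
        lem = ℤS.solve-∀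
        s≡ : + p⁺ ℤ.- + ω p⁺ ≡ + s p⁺
        s≡ = trans (ℤP.m-n≡m⊖n p⁺ (ω p⁺)) (ℤP.⊖-≥ ω≤p⁺)

      ∣g∣≤ : ω p⁺ ≤ p⁺ → ∀ n → ∣ g p⁺ n ∣ ≤ p⁺
      ∣g∣≤ ω≤p⁺ n = lem (ω p⁺) p⁺ (Ω p⁺ ((n + J * X * q) % p⁺)) ω≤p⁺
        where
        lem : ∀ w p b → w ≤ p → ∣ + w ℤ.- + p ℤ.* indZ b ∣ ≤ p
        lem w p false w≤p = subst (λ t → ∣ t ∣ ≤ p)
          (sym (trans (cong (λ t → + w ℤ.- t) (ℤP.*-zeroʳ (+ p))) (ℤP.+-identityʳ (+ w)))) w≤p
        lem w p true  w≤p = subst (λ t → ∣ t ∣ ≤ p)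
          (sym (trans (cong (λ t → + w ℤ.- t) (ℤP.*-identityʳ (+ p))) (ℤP.m-n≡m⊖n w p)))
          (subst (_≤ p) (sym (ℤP.∣⊖∣-≤ w≤p)) (m∸n≤m p w))

      g-off : ∀ a → Ω p⁺ (a % p⁺) ≡ false → g p⁺ (a + J * X) ≡ + ω p⁺
      g-off a e = trans (cong (λ t → + ω p⁺ ℤ.- + p⁺ ℤ.* indZ (Ω p⁺ t)) (trans (cong (_% p⁺) (lem a (J * X) q))
          ([m+kn]%n≡m%n a (J * X) p⁺)))
        (trans (cong (λ b → + ω p⁺ ℤ.- + p⁺ ℤ.* indZ b) e)
          (trans (cong (λ t → + ω p⁺ ℤ.- t) (ℤP.*-zeroʳ (+ p⁺))) (ℤP.+-identityʳ (+ ω p⁺))))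
        where
        lem : ∀ a x q → a + x + x * q ≡ a + x * suc q
        lem = ℕS.solve-∀

    F-off : ∀ y Q a → (∀ q → q < y → sel (suc q) ≡ true → Ω (suc q) (a % suc q) ≡ false) →
      F y Q (a + J * X) ≡ + L y Q
    F-off zero zero    a off = refl
    F-off zero (suc Q) a off = refl
    F-off (suc i) Q a off with sel (suc i) in e
    ... | false = F-off i Q a λ q q<i → off q (m<n⇒m<1+n q<i)
    ... | true  = trans (cong₂ ℤ._+_
        (trans (cong (ℤ._*_ (+ s (suc i))) (F-off i Q a off′)) (sym (ℤP.pos-* (s (suc i)) (L i Q))))
        (trans (cong₂ ℤ._*_ (g-off i a (off i ≤-refl e)) (F-off i (Q / suc i) a off′))
               (sym (ℤP.pos-* (ω (suc i)) (L i (Q / suc i))))))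
        (sym (ℤP.pos-+ (s (suc i) * L i Q) (ω (suc i) * L i (Q / suc i))))
      where
      off′ : ∀ q → q < i → sel (suc q) ≡ true → Ω (suc q) (a % suc q) ≡ false
      off′ q q<i = off q (m<n⇒m<1+n q<i)

    err : ℕ → ℕ → ℕ → ℕ → ℕ → ℕ
    err i M H Q R = (M ^ J * (2 * H)) * (W i * W i) * (terms i Q * terms i R) * (Q * R) ^ suc J

    Estimate : ℕ → ℕ → ℕ → (ℕ → ℤ) → ℤ → ℕ → ℕ → Set
    Estimate i M H h μ Q R = ∀ z →
      ∣ smooth X J (λ n → h n ℤ.* (F i Q n ℤ.* F i R n)) z ℤ.- + (X ^ J) ℤ.* (μ ℤ.* + (W i * L i Q)) ∣ ≤ err i M H Q R

    -- The cross terms carry a factor g p to the first power, hence have mean zero.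
    estimate : ∀ i M .{{_ : NonZero M}} h μ H → Mean M h μ → (∀ n → ∣ h n ∣ ≤ H) →
      (∀ p → p ≤ i → sel p ≡ true → Coprime M p) → ∀ Q R → μ ≡ + 0 ⊎ Q ≡ R → Estimate i M H h μ Q R
    estimate zero M h μ H m b cop zero R c z = subst (λ t → ∣ t ∣ ≤ _) (sym vanish) z≤n
      where
      vanish : smooth X J (λ n → h n ℤ.* (+ 0 ℤ.* F zero R n)) z ℤ.- + (X ^ J) ℤ.* (μ ℤ.* + 0) ≡ + 0
      vanish = cong₂ ℤ._-_ (trans (smooth-ext X J (λ n → ℤP.*-zeroʳ (h n)) z)
                 (trans (smooth-const X J (+ 0) z) (ℤP.*-zeroʳ (+ (X ^ J)))))
                 (trans (cong (ℤ._*_ (+ (X ^ J))) (ℤP.*-zeroʳ μ)) (ℤP.*-zeroʳ (+ (X ^ J))))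
    estimate zero M h μ H m b cop (suc Q) zero (inj₁ refl) z = subst (λ t → ∣ t ∣ ≤ _) (sym vanish) z≤n
      where
      vanish : smooth X J (λ n → h n ℤ.* (+ 1 ℤ.* + 0)) z ℤ.- + (X ^ J) ℤ.* (+ 0 ℤ.* + 1) ≡ + 0
      vanish = cong₂ ℤ._-_ (trans (smooth-ext X J (λ n → ℤP.*-zeroʳ (h n)) z)
                 (trans (smooth-const X J (+ 0) z) (ℤP.*-zeroʳ (+ (X ^ J)))))
                 (ℤP.*-zeroʳ (+ (X ^ J)))
    estimate zero M h μ H m b cop (suc Q) (suc R) c z =
      subst₂ (λ f t → ∣ f ℤ.- + (X ^ J) ℤ.* t ∣ ≤ err zero M H (suc Q) (suc R))
        (smooth-ext X J (λ n → sym (ℤP.*-identityʳ (h n))) z) (sym (ℤP.*-identityʳ μ))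
        (≤-trans (smooth-mean-abs X J M h μ H m b z)
          (≤-trans (≤-reflexive (lem (M ^ J * (2 * H)))) (*-monoʳ-≤ (M ^ J * (2 * H) * 1 * 1) (m^n>0 (suc Q * suc R) (suc J)))))
      where
      lem : ∀ a → a ≡ a * 1 * 1 * 1
      lem = ℕS.solve-∀
    estimate (suc i) M h μ H m b cop Q R c z with sel (suc i) in e
    ... | false = estimate i M h μ H m b (λ p p≤i → cop p (m≤n⇒m≤1+n p≤i)) Q R c z
    ... | true  = subst (λ t → ∣ t ∣ ≤ _) (sym decompose) (≤-trans triangle bound)
      where
      p = suc i
      Q′ = Q / p
      R′ = R / p
      pr = sel-prime p e
      ω≤p = <⇒≤ (ω< p e)
      h₁ h₂ : ℕ → ℤ
      h₁ n = h n ℤ.* g p n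
      h₂ n = h n ℤ.* (g p n ℤ.* g p n)
      instance
        nzMp : NonZero (M * p)
        nzMp = m*n≢0 M p
      m₁ : Mean (M * p) h₁ (+ 0)
      m₁ = subst (Mean (M * p) h₁) (ℤP.*-zeroʳ μ) (mean-* (cop p ≤-refl e) m (mean-g i))
      m₂ : Mean (M * p) h₂ (μ ℤ.* + (ω p * s p))
      m₂ = mean-* (cop p ≤-refl e) m (mean-g² i ω≤p)
      b₁ : ∀ n → ∣ h₁ n ∣ ≤ H * p
      b₁ n = subst (_≤ H * p) (sym (ℤP.abs-* (h n) (g p n))) (*-mono-≤ (b n) (∣g∣≤ i ω≤p n))
      b₂ : ∀ n → ∣ h₂ n ∣ ≤ H * (p * p)
      b₂ n = subst (_≤ H * (p * p)) (sym (trans (ℤP.abs-* (h n) _) (cong (_*_ ∣ h n ∣) (ℤP.abs-* (g p n) (g p n)))))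
        (*-mono-≤ (b n) (*-mono-≤ (∣g∣≤ i ω≤p n) (∣g∣≤ i ω≤p n)))
      cop₀ : ∀ r → r ≤ i → sel r ≡ true → Coprime M r
      cop₀ r r≤i = cop r (m≤n⇒m≤1+n r≤i)
      cop₁ : ∀ r → r ≤ i → sel r ≡ true → Coprime (M * p) r
      cop₁ r r≤i er = Cop.sym λ {d} → coprime-*ˡ d (cop₀ r r≤i er)
        where
        coprime-*ˡ : ∀ d → Coprime M r → (d ∣ r) × (d ∣ M * p) → d ≡ 1
        coprime-*ˡ d co (d∣r , d∣Mp) with prime⇒irreducible (sel-prime r er) d∣r
        ... | inj₁ d≡1 = d≡1
        ... | inj₂ refl with euclidsLemma M p (sel-prime r er) d∣Mp
        ...   | inj₁ r∣M = co (r∣M , ∣-refl)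
        ...   | inj₂ r∣p with prime⇒irreducible pr r∣p
        ...     | inj₁ r≡1 = r≡1
        ...     | inj₂ refl = ⊥-elim (<-irrefl refl r≤i)
      c₂ : μ ℤ.* + (ω p * s p) ≡ + 0 ⊎ Q′ ≡ R′
      c₂ = Data.Sum.map (λ μ≡0 → trans (cong (ℤ._* + (ω p * s p)) μ≡0) (ℤP.*-zeroˡ (+ (ω p * s p)))) (cong (_/ p)) c
      XJ = + (X ^ J)
      S = + s p
      wl = + (W i * L i Q)
      wl′ = + (W i * L i Q′)
      t₁ t₂ t₃ t₄ : ℕ → ℤ
      t₁ n = h n ℤ.* (F i Q n ℤ.* F i R n)
      t₂ n = h₁ n ℤ.* (F i Q′ n ℤ.* F i R n)
      t₃ n = h₁ n ℤ.* (F i Q n ℤ.* F i R′ n)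
      t₄ n = h₂ n ℤ.* (F i Q′ n ℤ.* F i R′ n)
      T₁ = smooth X J t₁ z
      T₂ = smooth X J t₂ z
      T₃ = smooth X J t₃ z
      T₄ = smooth X J t₄ z
      d₁ = T₁ ℤ.- XJ ℤ.* (μ ℤ.* wl)
      d₂ = T₂ ℤ.- XJ ℤ.* (+ 0 ℤ.* wl′)
      d₃ = T₃ ℤ.- XJ ℤ.* (+ 0 ℤ.* wl)
      d₄ = T₄ ℤ.- XJ ℤ.* ((μ ℤ.* + (ω p * s p)) ℤ.* wl′)
      expand : ∀ h g s a a′ b b′ → h ℤ.* ((s ℤ.* a ℤ.+ g ℤ.* a′) ℤ.* (s ℤ.* b ℤ.+ g ℤ.* b′)) ≡
        (s ℤ.* s) ℤ.* (h ℤ.* (a ℤ.* b)) ℤ.+ (s ℤ.* (h ℤ.* g ℤ.* (a′ ℤ.* b)) ℤ.+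
        (s ℤ.* (h ℤ.* g ℤ.* (a ℤ.* b′)) ℤ.+ h ℤ.* (g ℤ.* g) ℤ.* (a′ ℤ.* b′)))
      expand = ℤS.solve-∀
      smoothed : smooth X J (λ n → h n ℤ.* ((S ℤ.* F i Q n ℤ.+ g p n ℤ.* F i Q′ n) ℤ.* (S ℤ.* F i R n ℤ.+ g p n ℤ.* F i R′ n))) z ≡
        (S ℤ.* S) ℤ.* T₁ ℤ.+ (S ℤ.* T₂ ℤ.+ (S ℤ.* T₃ ℤ.+ T₄))
      smoothed = trans (smooth-ext X J (λ n → expand (h n) (g p n) S (F i Q n) (F i Q′ n) (F i R n) (F i R′ n)) z)
        (trans (smooth-+ X J (λ n → (S ℤ.* S) ℤ.* t₁ n) (λ n → S ℤ.* t₂ n ℤ.+ (S ℤ.* t₃ n ℤ.+ t₄ n)) z)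
          (cong₂ ℤ._+_ (smooth-* X J (S ℤ.* S) t₁ z)
            (trans (smooth-+ X J (λ n → S ℤ.* t₂ n) (λ n → S ℤ.* t₃ n ℤ.+ t₄ n) z)
              (cong₂ ℤ._+_ (smooth-* X J S t₂ z)
                (trans (smooth-+ X J (λ n → S ℤ.* t₃ n) t₄ z) (cong (ℤ._+ T₄) (smooth-* X J S t₃ z)))))))
      recombine : ∀ S x μ v w l l′ T₁ T₂ T₃ T₄ →
        (S ℤ.* S) ℤ.* T₁ ℤ.+ (S ℤ.* T₂ ℤ.+ (S ℤ.* T₃ ℤ.+ T₄)) ℤ.-
          x ℤ.* (μ ℤ.* ((S ℤ.* w) ℤ.* (S ℤ.* l ℤ.+ v ℤ.* l′))) ≡
        (S ℤ.* S) ℤ.* (T₁ ℤ.- x ℤ.* (μ ℤ.* (w ℤ.* l))) ℤ.+ (S ℤ.* (T₂ ℤ.- x ℤ.* (+ 0 ℤ.* (w ℤ.* l′))) ℤ.+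
          (S ℤ.* (T₃ ℤ.- x ℤ.* (+ 0 ℤ.* (w ℤ.* l))) ℤ.+ (T₄ ℤ.- x ℤ.* ((μ ℤ.* (v ℤ.* S)) ℤ.* (w ℤ.* l′)))))
      recombine = ℤS.solve-∀
      wl≡ : ∀ l → + (W i * l) ≡ + W i ℤ.* + l
      wl≡ = ℤP.pos-* (W i)
      main≡ : + ((s p * W i) * (s p * L i Q + ω p * L i Q′)) ≡
        (S ℤ.* + W i) ℤ.* (S ℤ.* + L i Q ℤ.+ + ω p ℤ.* + L i Q′)
      main≡ = trans (ℤP.pos-* (s p * W i) _) (cong₂ ℤ._*_ (ℤP.pos-* (s p) (W i))
        (trans (ℤP.pos-+ (s p * L i Q) (ω p * L i Q′)) (cong₂ ℤ._+_ (ℤP.pos-* (s p) (L i Q)) (ℤP.pos-* (ω p) (L i Q′)))))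
      decompose : smooth X J (λ n → h n ℤ.* ((S ℤ.* F i Q n ℤ.+ g p n ℤ.* F i Q′ n) ℤ.* (S ℤ.* F i R n ℤ.+ g p n ℤ.* F i R′ n))) z
          ℤ.- XJ ℤ.* (μ ℤ.* + ((s p * W i) * (s p * L i Q + ω p * L i Q′))) ≡
        (S ℤ.* S) ℤ.* d₁ ℤ.+ (S ℤ.* d₂ ℤ.+ (S ℤ.* d₃ ℤ.+ d₄))
      decompose = trans (cong₂ (λ a b → a ℤ.- XJ ℤ.* (μ ℤ.* b)) smoothed main≡)
        (trans (recombine S XJ μ (+ ω p) (+ W i) (+ L i Q) (+ L i Q′) T₁ T₂ T₃ T₄)
          (trans (cong₂ (λ l l′ → shape l l′ (+ ω p ℤ.* S)) (sym (wl≡ (L i Q))) (sym (wl≡ (L i Q′))))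
                 (cong (shape wl wl′) (sym (ℤP.pos-* (ω p) (s p))))))
        where
        shape : ℤ → ℤ → ℤ → ℤ
        shape l l′ v = (S ℤ.* S) ℤ.* (T₁ ℤ.- XJ ℤ.* (μ ℤ.* l)) ℤ.+ (S ℤ.* (T₂ ℤ.- XJ ℤ.* (+ 0 ℤ.* l′)) ℤ.+
          (S ℤ.* (T₃ ℤ.- XJ ℤ.* (+ 0 ℤ.* l)) ℤ.+ (T₄ ℤ.- XJ ℤ.* ((μ ℤ.* v) ℤ.* l′))))
      A = M ^ J * (2 * H)
      w = W i * W i
      K = (Q * R) ^ suc J
      e₁ : ∣ d₁ ∣ ≤ A * w * (terms i Q * terms i R) * K
      e₁ = estimate i M h μ H m b cop₀ Q R c z
      e₂ : ∣ d₂ ∣ ≤ A * w * (terms i Q′ * terms i R) * K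
      e₂ = ≤-trans (estimate i (M * p) h₁ (+ 0) (H * p) m₁ b₁ cop₁ Q′ R (inj₁ refl) z)
        (≤-trans (≤-reflexive reorganise) (*-monoʳ-≤ (A * w * (terms i Q′ * terms i R)) powers))
        where
        lem : ∀ mj pj h p w t k → (mj * pj) * (2 * (h * p)) * w * t * k ≡ mj * (2 * h) * w * t * ((p * pj) * k)
        lem = ℕS.solve-∀
        reorganise : (M * p) ^ J * (2 * (H * p)) * w * (terms i Q′ * terms i R) * (Q′ * R) ^ suc J ≡
          A * w * (terms i Q′ * terms i R) * (p ^ suc J * (Q′ * R) ^ suc J)
        reorganise rewrite ^-distribʳ-* J M p = lem (M ^ J) (p ^ J) H p w (terms i Q′ * terms i R) ((Q′ * R) ^ suc J)
        powers : p ^ suc J * (Q′ * R) ^ suc J ≤ K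
        powers = subst (_≤ K) (^-distribʳ-* (suc J) p (Q′ * R)) (^-monoˡ-≤ (suc J)
          (subst (_≤ Q * R) (trans (cong (_* R) (*-comm Q′ p)) (*-assoc p Q′ R)) (*-monoˡ-≤ R (m/n*n≤m Q p))))
      e₃ : ∣ d₃ ∣ ≤ A * w * (terms i Q * terms i R′) * K
      e₃ = ≤-trans (estimate i (M * p) h₁ (+ 0) (H * p) m₁ b₁ cop₁ Q R′ (inj₁ refl) z)
        (≤-trans (≤-reflexive reorganise) (*-monoʳ-≤ (A * w * (terms i Q * terms i R′)) powers))
        where
        lem : ∀ mj pj h p w t k → (mj * pj) * (2 * (h * p)) * w * t * k ≡ mj * (2 * h) * w * t * ((p * pj) * k)
        lem = ℕS.solve-∀
        reorganise : (M * p) ^ J * (2 * (H * p)) * w * (terms i Q * terms i R′) * (Q * R′) ^ suc J ≡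
          A * w * (terms i Q * terms i R′) * (p ^ suc J * (Q * R′) ^ suc J)
        reorganise rewrite ^-distribʳ-* J M p = lem (M ^ J) (p ^ J) H p w (terms i Q * terms i R′) ((Q * R′) ^ suc J)
        lem₂ : ∀ q r p → q * (r * p) ≡ p * (q * r)
        lem₂ = ℕS.solve-∀
        powers : p ^ suc J * (Q * R′) ^ suc J ≤ K
        powers = subst (_≤ K) (^-distribʳ-* (suc J) p (Q * R′)) (^-monoˡ-≤ (suc J)
          (subst (_≤ Q * R) (lem₂ Q R′ p) (*-monoʳ-≤ Q (m/n*n≤m R p))))
      e₄ : ∣ d₄ ∣ ≤ A * w * (terms i Q′ * terms i R′) * K
      e₄ = ≤-trans (estimate i (M * p) h₂ (μ ℤ.* + (ω p * s p)) (H * (p * p)) m₂ b₂ cop₁ Q′ R′ c₂ z)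
        (≤-trans (≤-reflexive reorganise) (*-monoʳ-≤ (A * w * (terms i Q′ * terms i R′)) powers))
        where
        lem : ∀ mj pj h p w t k → (mj * pj) * (2 * (h * (p * p))) * w * t * k ≡ mj * (2 * h) * w * t * ((p * p * pj) * k)
        lem = ℕS.solve-∀
        reorganise : (M * p) ^ J * (2 * (H * (p * p))) * w * (terms i Q′ * terms i R′) * (Q′ * R′) ^ suc J ≡
          A * w * (terms i Q′ * terms i R′) * ((p * p * p ^ J) * (Q′ * R′) ^ suc J)
        reorganise rewrite ^-distribʳ-* J M p = lem (M ^ J) (p ^ J) H p w (terms i Q′ * terms i R′) ((Q′ * R′) ^ suc J)
        lem₂ : ∀ q r p → (q * p) * (r * p) ≡ p * p * (q * r)
        lem₂ = ℕS.solve-∀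
        powers : p * p * p ^ J * (Q′ * R′) ^ suc J ≤ K
        powers = ≤-trans (*-monoˡ-≤ ((Q′ * R′) ^ suc J)
            (subst (p * p * p ^ J ≤_) (sym (^-distribʳ-* (suc J) p p))
              (subst (_≤ p ^ suc J * p ^ suc J) (lem₃ p (p ^ J)) (*-monoʳ-≤ (p ^ suc J) (p≤ J)))))
          (subst (_≤ K) (^-distribʳ-* (suc J) (p * p) (Q′ * R′)) (^-monoˡ-≤ (suc J)
            (subst (_≤ Q * R) (lem₂ Q′ R′ p) (*-mono-≤ (m/n*n≤m Q p) (m/n*n≤m R p)))))
          where
          lem₃ : ∀ p x → p * x * p ≡ p * p * x
          lem₃ = ℕS.solve-∀
          p≤ : ∀ J → p ≤ p ^ suc J
          p≤ J = subst (_≤ p ^ suc J) (*-identityʳ p) (*-monoʳ-≤ p (m^n>0 p J))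
      σ = s p
      triangle : ∣ (S ℤ.* S) ℤ.* d₁ ℤ.+ (S ℤ.* d₂ ℤ.+ (S ℤ.* d₃ ℤ.+ d₄)) ∣ ≤
        σ * σ * ∣ d₁ ∣ + (σ * ∣ d₂ ∣ + (σ * ∣ d₃ ∣ + ∣ d₄ ∣))
      triangle = ≤-trans (ℤP.∣i+j∣≤∣i∣+∣j∣ ((S ℤ.* S) ℤ.* d₁) _)
        (+-mono-≤ (≤-reflexive (trans (ℤP.abs-* (S ℤ.* S) d₁) (cong (_* ∣ d₁ ∣) (ℤP.abs-* S S))))
          (≤-trans (ℤP.∣i+j∣≤∣i∣+∣j∣ (S ℤ.* d₂) _)
            (+-mono-≤ (≤-reflexive (ℤP.abs-* S d₂))
              (≤-trans (ℤP.∣i+j∣≤∣i∣+∣j∣ (S ℤ.* d₃) d₄) (+-monoˡ-≤ ∣ d₄ ∣ (≤-reflexive (ℤP.abs-* S d₃)))))))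
      bound : σ * σ * ∣ d₁ ∣ + (σ * ∣ d₂ ∣ + (σ * ∣ d₃ ∣ + ∣ d₄ ∣)) ≤
        A * ((σ * W i) * (σ * W i)) * ((terms i Q + terms i Q′) * (terms i R + terms i R′)) * K
      bound = ≤-trans (+-mono-≤ (*-monoʳ-≤ (σ * σ) e₁)
          (+-mono-≤ (*-mono-≤ σ≤ e₂) (+-mono-≤ (*-mono-≤ σ≤ e₃) (≤-trans (≤-reflexive (sym (*-identityˡ _))) (*-mono-≤ (*-mono-≤ σ≥1 σ≥1) e₄)))))
        (≤-reflexive (lem σ A (W i) (terms i Q) (terms i Q′) (terms i R) (terms i R′) K))
        where
        σ≥1 = s≥1 p e
        σ≤ : σ ≤ σ * σ
        σ≤ = subst (_≤ σ * σ) (*-identityʳ σ) (*-monoʳ-≤ σ σ≥1)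
        lem : ∀ σ A w q q′ r r′ K →
          σ * σ * (A * (w * w) * (q * r) * K) + (σ * σ * (A * (w * w) * (q′ * r) * K) +
            (σ * σ * (A * (w * w) * (q * r′) * K) + σ * σ * (A * (w * w) * (q′ * r′) * K))) ≡
          A * ((σ * w) * (σ * w)) * ((q + q′) * (r + r′)) * K
        lem = ℕS.solve-∀

    module _ .{{_ : NonZero X}} where

      -- The hypothesis holds for Q = X^θ with θ < 1/2 once J is large.
      sieve : ∀ y Q A → Unique A → (∀ a → a ∈ A → a < X) →
        (∀ a → a ∈ A → ∀ q → q < y → sel (suc q) ≡ true → Ω (suc q) (a % suc q) ≡ false) →
        1 ≤ Q → 2 * ((Q * suc y) * (Q * suc y)) * (Q * Q) ^ suc J ≤ X ^ J →
        length A * L y Q ≤ 2 * (suc J * X) * W y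
      sieve y Q A u A<X off Q≥1 large = *-cancelˡ-≤ (X ^ J * L y Q) {{m*n≢0 (X ^ J) (L y Q) {{m^n≢0 X J}} {{>-nonZero L≥1}}}}
        (subst₂ _≤_ (lem₁ (X ^ J) (length A) (L y Q)) (lem₂ (X ^ J) (J * X) X (W y) (L y Q))
          (ℤP.drop‿+≤+ (ℤP.≤-trans lower upper)))
        where
        L≥1 : 1 ≤ L y Q
        L≥1 = ≤-trans (W≥1 y) (W≤L y Q Q≥1)
        f : ℕ → ℤ
        f n = F y Q n ℤ.* F y Q n
        sq≥0 : ∀ (i : ℤ) → + 0 ℤ.≤ i ℤ.* i
        sq≥0 (+ n)      = subst (ℤ._≤_ (+ 0)) (ℤP.pos-* n n) (ℤ.+≤+ z≤n)
        sq≥0 ℤ.-[1+ n ] = ℤ.+≤+ z≤n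
        f≥0 : ∀ i → + 0 ℤ.≤ f i
        f≥0 i = sq≥0 (F y Q i)
        lem₁ : ∀ x a l → x * (a * (l * l)) ≡ (x * l) * (a * l)
        lem₁ = ℕS.solve-∀
        lem₂ : ∀ x jx X w l → (jx + X) * (2 * (x * (w * l))) ≡ (x * l) * (2 * (X + jx) * w)
        lem₂ = ℕS.solve-∀
        lower : + (X ^ J * (length A * (L y Q * L y Q))) ℤ.≤ Sum (J * X + X) (smooth X J f)
        lower = ℤP.≤-trans (ℤP.≤-reflexive (trans (ℤP.pos-* (X ^ J) _)
            (cong (ℤ._*_ (+ (X ^ J))) (trans (cong +_ (*-comm (length A) (L y Q * L y Q)))
              (trans (ℤP.pos-* (L y Q * L y Q) (length A)) (trans (cong (ℤ._*_ (+ (L y Q * L y Q))) (sym (Sum-multiplicity X A A<X)))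
                (sym (Sum-* X (+ (L y Q * L y Q)) (λ i → + multiplicity A i)))))))))
          (ℤP.≤-trans (ℤP.*-monoˡ-≤-nonNeg (+ (X ^ J)) (Sum-mono X λ i _ →
              Unique-weight A u (λ i → f (i + J * X)) (+ (L y Q * L y Q)) (λ i → f≥0 (i + J * X)) value i))
            (smooth-window X J X f f≥0))
          where
          value : ∀ a → a ∈ A → + (L y Q * L y Q) ℤ.≤ f (a + J * X)
          value a a∈ = ℤP.≤-reflexive (trans (ℤP.pos-* (L y Q) (L y Q))
            (sym (cong₂ ℤ._*_ (F-off y Q a (off a a∈)) (F-off y Q a (off a a∈)))))
        one : ∀ (i : ℕ) → smooth X J f i ℤ.≤ + (2 * (X ^ J * (W y * L y Q)))
        one z = from-abs (smooth X J f z) (X ^ J * (W y * L y Q)) (≤-trans est small)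
          where
          from-abs : ∀ t c → ∣ t ℤ.- + c ∣ ≤ c → t ℤ.≤ + (2 * c)
          from-abs t c le = subst (ℤ._≤ + (2 * c)) (lem t (+ c))
            (subst (λ u → (t ℤ.- + c) ℤ.+ + c ℤ.≤ + u) (cong (_+_ c) (sym (+-identityʳ c)))
              (ℤP.+-monoˡ-≤ (+ c) (ℤP.≤-trans (i≤∣i∣ (t ℤ.- + c)) (ℤ.+≤+ le))))
            where
            lem : ∀ t c → (t ℤ.- c) ℤ.+ c ≡ t
            lem = ℤS.solve-∀
            i≤∣i∣ : ∀ i → i ℤ.≤ + ∣ i ∣
            i≤∣i∣ (+ n)      = ℤP.≤-refl
            i≤∣i∣ ℤ.-[1+ n ] = ℤ.-≤+
          est : ∣ smooth X J f z ℤ.- + (X ^ J * (W y * L y Q)) ∣ ≤ err y 1 1 Q Q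
          est = subst₂ (λ a b → ∣ a ℤ.- b ∣ ≤ err y 1 1 Q Q)
            (smooth-ext X J (λ n → ℤP.*-identityˡ (f n)) z)
            (trans (cong (ℤ._*_ (+ (X ^ J))) (ℤP.*-identityˡ (+ (W y * L y Q)))) (sym (ℤP.pos-* (X ^ J) (W y * L y Q))))
            (estimate y 1 (λ _ → + 1) (+ 1) 1 (mean (λ _ → refl) refl) (λ _ → ≤-refl)
              (λ p _ _ → Cop.1-coprimeTo p) Q Q (inj₂ refl) z)
          small : err y 1 1 Q Q ≤ X ^ J * (W y * L y Q)
          small = ≤-trans (*-monoˡ-≤ ((Q * Q) ^ suc J) (*-monoʳ-≤ (1 ^ J * (2 * 1) * (W y * W y))
              (*-mono-≤ (terms≤ y Q) (terms≤ y Q))))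
            (≤-trans (≤-reflexive (trans (cong (λ t → t * 2 * (W y * W y) * ((Q * suc y) * (Q * suc y)) * (Q * Q) ^ suc J) (^-zeroˡ J))
                (lem (W y * W y) ((Q * suc y) * (Q * suc y)) ((Q * Q) ^ suc J))))
              (≤-trans (*-monoˡ-≤ (W y * W y) large) (*-monoʳ-≤ (X ^ J) (*-monoʳ-≤ (W y) (W≤L y Q Q≥1)))))
            where
            lem : ∀ w t q → 1 * 2 * w * t * q ≡ 2 * t * q * w
            lem = ℕS.solve-∀
        upper : Sum (J * X + X) (smooth X J f) ℤ.≤ + ((J * X + X) * (2 * (X ^ J * (W y * L y Q))))
        upper = ℤP.≤-trans (Sum-mono (J * X + X) λ i _ → one i)
          (ℤP.≤-reflexive (trans (Sum-const (J * X + X) _) (sym (ℤP.pos-* (J * X + X) _))))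

-- Primes up to 2ⁿ

card≤ : ∀ {A B : Set} (xs : List A) (ys : List B) (_~_ : A → B → Set) → Unique xs →
  (∀ x → x ∈ xs → Σ B λ y → y ∈ ys × x ~ y) → (∀ x x′ y → x ~ y → x′ ~ y → x ≡ x′) → length xs ≤ length ys
card≤ []       ys _~_ u total inj = z≤n
card≤ {B = B} (x ∷ xs) ys _~_ (x# ∷ u) total inj with total x (here refl)
... | y , y∈ , xy with ∈-∃++ y∈
...   | ys₁ , ys₂ , refl = subst (suc (length xs) ≤_) (sym eq)
          (s≤s (subst (length xs ≤_) (length-++ ys₁) (card≤ xs (ys₁ ++ ys₂) _~_ u total′ inj)))
  where
  eq : length (ys₁ ++ y ∷ ys₂) ≡ suc (length ys₁ + length ys₂)
  eq = trans (length-++ ys₁) (+-suc (length ys₁) (length ys₂))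
  total′ : ∀ x′ → x′ ∈ xs → Σ B λ y′ → y′ ∈ ys₁ ++ ys₂ × x′ ~ y′
  total′ x′ x′∈ with total x′ (there x′∈)
  ... | y′ , y′∈ , x′y′ with ∈-++⁻ ys₁ y′∈
  ...   | inj₁ ∈₁ = y′ , ∈-++⁺ˡ ∈₁ , x′y′
  ...   | inj₂ (there ∈₂) = y′ , ∈-++⁺ʳ ys₁ ∈₂ , x′y′
  ...   | inj₂ (here refl) = ⊥-elim (All.lookup x# x′∈ (inj x x′ y′ xy x′y′))

card-⊆ : ∀ {A : Set} {xs ys : List A} → Unique xs → (∀ x → x ∈ xs → x ∈ ys) → length xs ≤ length ys
card-⊆ {xs = xs} {ys} u sub = card≤ xs ys _≡_ u (λ x x∈ → x , sub x x∈ , refl) (λ _ _ _ e e′ → trans e (sym e′))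

prime∣prime : ∀ {p q} → Prime p → Prime q → p ∣ q → p ≡ q
prime∣prime {p} pp pq p∣q with prime⇒irreducible pq p∣q
... | inj₁ refl = ⊥-elim (¬prime[1] pp)
... | inj₂ e = e

prime∣^ : ∀ {p m} k → Prime p → p ∣ m ^ k → p ∣ m
prime∣^ {p} zero pp p∣1 = ⊥-elim (¬prime[1] (subst Prime (∣1⇒≡1 p∣1) pp))
prime∣^ {p} {m} (suc k) pp p∣ with euclidsLemma m (m ^ k) pp p∣
... | inj₁ d = d
... | inj₂ d = prime∣^ k pp d

prime≥2 : ∀ {p} → Prime p → 2 ≤ p
prime≥2 pp = nonTrivial⇒n>1 _ {{prime⇒nonTrivial pp}}

primes : ℕ → List ℕ
primes N = filter prime? (upTo (suc N))

primes-unique : ∀ N → Unique (primes N)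
primes-unique N = filter⁺ prime? (upTo⁺ (suc N))

∈-primes⁺ : ∀ {p N} → Prime p → p ≤ N → p ∈ primes N
∈-primes⁺ pp p≤N = ∈-filter⁺ prime? (∈-upTo⁺ (s≤s p≤N)) pp

∈-primes⁻ : ∀ {p} N → p ∈ primes N → Prime p × p ≤ N
∈-primes⁻ N p∈ with ∈-filter⁻ prime? {xs = upTo (suc N)} p∈
... | p∈′ , pp = pp , ≤-pred (∈-upTo⁻ p∈′)

2^primeDivisors≤ : ∀ ps d → 1 ≤ d → Unique ps → (∀ p → p ∈ ps → Prime p × (p ∣ d)) → 2 ^ length ps ≤ d
2^primeDivisors≤ [] d d≥1 u h = d≥1
2^primeDivisors≤ (p ∷ ps) d d≥1 (p# ∷ u) h with h p (here refl)
... | pp , divides q refl = subst (2 ^ suc (length ps) ≤_) (*-comm p q)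
  (*-mono-≤ (prime≥2 pp) (2^primeDivisors≤ ps q q≥1 u h′))
  where
  q≥1 : 1 ≤ q
  q≥1 = n≢0⇒n>0 λ { refl → <-irrefl refl d≥1 }
  h′ : ∀ r → r ∈ ps → Prime r × (r ∣ q)
  h′ r r∈ with h r (there r∈)
  ... | pr , r∣ with euclidsLemma q p pr r∣
  ...   | inj₁ r∣q = pr , r∣q
  ...   | inj₂ r∣p = ⊥-elim (All.lookup p# r∈ (sym (prime∣prime pr pp r∣p)))

2^-cancel-≤ : ∀ {a b} → 2 ^ a ≤ 2 ^ b → a ≤ b
2^-cancel-≤ {a} {b} le = ≮⇒≥ λ b<a → <⇒≱ (^-monoʳ-< 2 (s≤s (s≤s z≤n)) b<a) le

n<2^n : ∀ n → n < 2 ^ n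
n<2^n zero    = s≤s z≤n
n<2^n (suc n) = subst (suc n <_) (cong (_+_ (2 ^ n)) (sym (+-identityʳ (2 ^ n))))
  (+-mono-≤-< (m^n>0 2 n) (n<2^n n))

maxPower : ∀ p N → 2 ≤ p → 1 ≤ N → Σ ℕ λ e → p ^ e ≤ N × N < p ^ suc e
maxPower p N p≥2 N≥1 = search N (≤-trans (n<2^n N) (^-monoˡ-≤ N p≥2))
  where
  search : ∀ k → N < p ^ k → Σ ℕ λ e → p ^ e ≤ N × N < p ^ suc e
  search zero    N<1 = ⊥-elim (<⇒≱ N<1 N≥1)
  search (suc k) N< with p ^ k ≤? N
  ... | yes le = k , le , N<
  ... | no ¬le = search k (≰⇒> ¬le)

prime-powers⇒∣ : ∀ as → All Prime as → ∀ R → 1 ≤ R →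
  (∀ p e → Prime p → p ^ e ∣ product as → p ^ e ∣ R) → product as ∣ R
prime-powers⇒∣ [] [] R R≥1 h = 1∣ R
prime-powers⇒∣ (p ∷ as) (pp ∷ pas) R R≥1 h with
  h p 1 pp (subst (_∣ p * product as) (sym (*-identityʳ p)) (m∣m*n (product as)))
... | divides R′ refl = subst (_∣ R′ * (p * 1)) (*-comm (product as) p)
  (*-pres-∣ (prime-powers⇒∣ as pas R′ R′≥1 h′) (subst (p ∣_) (sym (*-identityʳ p)) ∣-refl))
  where
  instance _ = prime⇒nonZero pp
  R′≥1 : 1 ≤ R′
  R′≥1 = n≢0⇒n>0 λ { refl → <-irrefl refl R≥1 }
  h′ : ∀ q e → Prime q → q ^ e ∣ product as → q ^ e ∣ R′
  h′ q e pq d with q ≟ p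
  ... | yes refl = *-cancelˡ-∣ q (subst (q ^ suc e ∣_) (trans (cong (_*_ R′) (*-identityʳ q)) (*-comm R′ q))
                     (h q (suc e) pq (*-monoʳ-∣ q d)))
  ... | no q≢p = coprime-divisor cop (subst (q ^ e ∣_) (trans (cong (_*_ R′) (*-identityʳ p)) (*-comm R′ p))
                     (h q e pq (∣-trans d (n∣m*n p))))
    where
    cop : Coprime (q ^ e) p
    cop {i} (i∣qe , i∣p) with prime⇒irreducible pp i∣p
    ... | inj₁ i≡1 = i≡1
    ... | inj₂ refl = ⊥-elim (q≢p (sym (prime∣prime pp pq (prime∣^ e pp i∣qe))))

module _ (N : ℕ) (N≥1 : 1 ≤ N) where

  maxPow : ∀ ps → (∀ p → p ∈ ps → Prime p × p ≤ N) → ℕ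
  maxPow []       h = 1
  maxPow (p ∷ ps) h = p ^ proj₁ (maxPower p N (prime≥2 (proj₁ (h p (here refl)))) N≥1) * maxPow ps (λ q q∈ → h q (there q∈))

  maxPow≤ : ∀ ps h → maxPow ps h ≤ N ^ length ps
  maxPow≤ []       h = ≤-refl
  maxPow≤ (p ∷ ps) h = *-mono-≤ (proj₁ (proj₂ (maxPower p N (prime≥2 (proj₁ (h p (here refl)))) N≥1))) (maxPow≤ ps _)

  maxPow≥1 : ∀ ps h → 1 ≤ maxPow ps h
  maxPow≥1 []       h = ≤-refl
  maxPow≥1 (p ∷ ps) h = *-mono-≤ (m^n>0 p {{prime⇒nonZero (proj₁ (h p (here refl)))}} (proj₁ (maxPower p N (prime≥2 (proj₁ (h p (here refl)))) N≥1))) (maxPow≥1 ps λ q q∈ → h q (there q∈))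

  ^∣maxPow : ∀ ps h p e → p ∈ ps → p ^ e ≤ N → p ^ e ∣ maxPow ps h
  ^∣maxPow (p ∷ ps) h .p e (here refl) le with maxPower p N (prime≥2 (proj₁ (h p (here refl)))) N≥1
  ... | e₀ , le₀ , lt₀ = ∣-trans (subst (p ^ e ∣_) (trans (sym (^-distribˡ-+-* p e (e₀ ∸ e)))
          (cong (_^_ p) (m+[n∸m]≡n e≤e₀))) (m∣m*n (p ^ (e₀ ∸ e)))) (m∣m*n _)
    where
    instance _ = prime⇒nonZero (proj₁ (h p (here refl)))
    e≤e₀ : e ≤ e₀
    e≤e₀ = ≤-pred (≰⇒> λ e₀<e → <⇒≱ lt₀ (≤-trans (^-monoʳ-≤ p e₀<e) le))
  ^∣maxPow (q ∷ ps) h p e (there p∈) le = ∣-trans (^∣maxPow ps (λ r r∈ → h r (there r∈)) p e p∈ le)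
    (n∣m*n (q ^ proj₁ (maxPower q N (prime≥2 (proj₁ (h q (here refl)))) N≥1)))

  lcmBound : ℕ
  lcmBound = maxPow (primes N) (λ _ → ∈-primes⁻ N)

  ∣lcmBound : ∀ k → 1 ≤ k → k ≤ N → k ∣ lcmBound
  ∣lcmBound k k≥1 k≤N = subst (_∣ lcmBound) (sym isF) (prime-powers⇒∣ factors factorsPrime lcmBound
    (maxPow≥1 (primes N) _) go)
    where
    instance
      nzk : NonZero k
      nzk = >-nonZero k≥1
    open PrimeFactorisation (factorise k) renaming (isFactorisation to isF)
    go : ∀ p e → Prime p → p ^ e ∣ product factors → p ^ e ∣ lcmBound
    go p zero    pp d = 1∣ lcmBound
    go p (suc e) pp d = ^∣maxPow (primes N) _ p (suc e) (∈-primes⁺ pp (≤-trans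
        (subst (_≤ p ^ suc e) (*-identityʳ p) (*-monoʳ-≤ p (m^n>0 p e))) pe≤N)) pe≤N
      where
      instance _ = prime⇒nonZero pp
      pe≤N : p ^ suc e ≤ N
      pe≤N = ≤-trans (∣⇒≤ (subst (p ^ suc e ∣_) (sym isF) d)) k≤N

!≥1 : ∀ n → 1 ≤ n !
!≥1 n = >-nonZero⁻¹ (n !) {{n !≢0}}

-- beta i j = R ∫₀¹ xⁱ(1-x)ʲ dx = R i! j! / (i+j+1)!, an integer as soon as R is divisible by
-- 1, …, i+j+1.
module _ (N R : ℕ) (R≥1 : 1 ≤ R) (divisible : ∀ k → 1 ≤ k → k ≤ N → k ∣ R) where

  beta : ℕ → ℕ → ℤ
  beta i zero    = + (R / suc i)
  beta i (suc j) = beta i j ℤ.- beta (suc i) j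

  beta-! : ∀ j i → i + j < N → beta i j ℤ.* + (suc (i + j) !) ≡ + (R * (i ! * j !))
  beta-! zero i i<N rewrite +-identityʳ i = trans (sym (ℤP.pos-* (R / suc i) (suc i !)))
    (cong +_ (trans (sym (*-assoc (R / suc i) (suc i) (i !)))
      (trans (cong (_* i !) (m/n*n≡m (divisible (suc i) (s≤s z≤n) i<N))) (cong (_*_ R) (sym (*-identityʳ (i !)))))))
  beta-! (suc j) i lt rewrite +-suc i j =
    trans (cong (ℤ._*_ (beta i j ℤ.- beta (suc i) j)) (ℤP.pos-* (suc (suc (i + j))) (suc (i + j) !)))
      (trans (split (beta i j) (beta (suc i) j) (+ suc (suc (i + j))) (+ (suc (i + j) !)))
        (trans (cong₂ (λ a b → + suc (suc (i + j)) ℤ.* a ℤ.- b)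
                 (beta-! j i (<-trans (n<1+n (i + j)) lt))
                 (trans (cong (ℤ._*_ (beta (suc i) j)) (sym (ℤP.pos-* (suc (suc (i + j))) (suc (i + j) !)))) (beta-! j (suc i) lt)))
          (trans (cong (ℤ._- + (R * (suc i ! * j !))) (sym (ℤP.pos-* (suc (suc (i + j))) (R * (i ! * j !)))))
            (trans (ℤP.m-n≡m⊖n _ (R * (suc i ! * j !)))
              (trans (cong (ℤ._⊖ (R * (suc i ! * j !))) (lem i j R (i !) (j !)))
                (trans (cong ((R * (suc i ! * j !) + R * (i ! * (suc j !))) ℤ.⊖_) (sym (+-identityʳ (R * (suc i ! * j !)))))
                  (ℤP.+-cancelˡ-⊖ (R * (suc i ! * j !)) (R * (i ! * (suc j !))) 0)))))))
    where
    split : ∀ a b c d → (a ℤ.- b) ℤ.* (c ℤ.* d) ≡ c ℤ.* (a ℤ.* d) ℤ.- b ℤ.* (c ℤ.* d)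
    split = ℤS.solve-∀
    lem : ∀ i j R x y → suc (suc (i + j)) * (R * (x * y)) ≡ R * ((x + i * x) * y) + R * (x * (y + j * y))
    lem = ℕS.solve-∀

  4^m*m!*m!≤ : ∀ m → 4 ^ m * (m ! * m !) ≤ suc (m + m) !
  4^m*m!*m!≤ zero = ≤-refl
  4^m*m!*m!≤ (suc m) rewrite +-suc m m = ≤-trans
    (≤-reflexive (lem m (4 ^ m) (m !)))
    (≤-trans (*-monoʳ-≤ (4 * (suc m * suc m)) (4^m*m!*m!≤ m))
      (≤-trans (*-monoˡ-≤ (suc (m + m) !) (≤-trans (m≤m+n (4 * (suc m * suc m)) (2 * suc m)) (≤-reflexive (lem₂ m))))
        (≤-reflexive (*-assoc (suc (suc (suc (m + m)))) (suc (suc (m + m))) (suc (m + m) !)))))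
    where
    lem : ∀ m a x → 4 * a * ((x + m * x) * (x + m * x)) ≡ 4 * (suc m * suc m) * (a * (x * x))
    lem = ℕS.solve-∀
    lem₂ : ∀ m → 4 * (suc m * suc m) + 2 * suc m ≡ suc (suc (suc (m + m))) * suc (suc (m + m))
    lem₂ = ℕS.solve-∀

  4^≤ : ∀ m → m + m < N → 4 ^ m ≤ R
  4^≤ m lt = *-cancelʳ-≤ (4 ^ m) R (m ! * m !) {{m*n≢0 (m !) (m !) {{m !≢0}} {{m !≢0}}}} (≤-trans (4^m*m!*m!≤ m) (positive (beta m m) (beta-! m m lt)))
    where
    positive : ∀ b → b ℤ.* + (suc (m + m) !) ≡ + (R * (m ! * m !)) → suc (m + m) ! ≤ R * (m ! * m !)
    positive (+ zero) e = ⊥-elim (<-irrefl (ℤP.+-injective e) (*-mono-≤ R≥1 (*-mono-≤ (!≥1 m) (!≥1 m))))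
    positive (+ suc b) e = subst (suc (m + m) ! ≤_) (ℤP.+-injective (trans (ℤP.pos-* (suc b) _) e)) (m≤m+n _ _)
    positive ℤ.-[1+ b ] e with suc (m + m) ! in q
    ... | zero = ⊥-elim (n≮0 (subst (1 ≤_) q (!≥1 (suc (m + m)))))
    ... | suc c with e
    ...   | ()

chebyshev : ∀ n → 1 ≤ n → 2 ^ n ≤ n * length (primes (2 ^ n)) + 2
chebyshev (suc n) _ = subst (_≤ suc n * length (primes N) + 2) N≡ (+-monoˡ-≤ 2 (2^-cancel-≤
    (subst₂ _≤_ (trans (cong (_^ m) refl) (trans (^-*-assoc 2 2 m) (cong (_^_ 2) (cong (_+_ m) (+-identityʳ m)))))
      (^-*-assoc 2 (suc n) (length (primes N)))
      (≤-trans (4^≤ N (lcmBound N N≥1) (maxPow≥1 N N≥1 (primes N) _) (∣lcmBound N N≥1) m m+m<N)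
               (maxPow≤ N N≥1 (primes N) _)))))
  where
  N = 2 ^ suc n
  N≥1 : 1 ≤ N
  N≥1 = m^n>0 2 (suc n)
  m = 2 ^ n ∸ 1
  m+1 : m + 1 ≡ 2 ^ n
  m+1 = m∸n+n≡m (m^n>0 2 n)
  N≡ : m + m + 2 ≡ N
  N≡ = trans (lem m) (trans (cong₂ _+_ m+1 m+1) (cong (_+_ (2 ^ n)) (sym (+-identityʳ (2 ^ n)))))
    where
    lem : ∀ m → m + m + 2 ≡ (m + 1) + (m + 1)
    lem = ℕS.solve-∀
  m+m<N : m + m < N
  m+m<N = subst (m + m <_) N≡ (m<m+n (m + m) (s≤s z≤n))

-- Lower bounds for the sieve weights

does-true⁻ : ∀ {P : Set} (d : Dec P) → does d ≡ true → P
does-true⁻ (yes p) _ = p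

does-false⁻ : ∀ {P : Set} (d : Dec P) → does d ≡ false → ¬ P
does-false⁻ (no ¬p) _ = ¬p

not-true : ∀ {b} → not b ≡ true → b ≡ false
not-true {false} _ = refl

-- In rational terms L κ / W κ has local factor 1 + κ/(p - κ) = (1 - κ/p)⁻¹, and
-- (1 - κ/p)⁻¹ (1 - l/p)⁻¹ ≤ (1 - (κ + l)/p)⁻¹.
module Powers (sel : ℕ → Bool) where

  module _ (κ : ℕ) where
    open Weights sel (λ _ → κ) public

  L-product : ∀ κ l → (∀ p → sel p ≡ true → κ + l ≤ p) → ∀ i Q R →
    L κ i Q * L l i R * W (κ + l) i ≤ L (κ + l) i (Q * R) * (W κ i * W l i)
  L-product κ l big zero zero    R = z≤n
  L-product κ l big zero (suc Q) zero    = z≤n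
  L-product κ l big zero (suc Q) (suc R) = ≤-refl
  L-product κ l big (suc i) Q R with sel (suc i) in e
  ... | false = L-product κ l big i Q R
  ... | true  = step (L κ i Q) (L κ i (Q / p)) (L l i R) (L l i (R / p)) (W (κ + l) i)
                  (L (κ + l) i (Q * R)) (L (κ + l) i ((Q * R) / p)) (W κ i * W l i) (W κ i) (W l i) refl
                  (L-product κ l big i Q R)
                  (≤-trans (L-product κ l big i (Q / p) R) (*-monoˡ-≤ _ (L-mono (κ + l) i (shrinkˡ Q R))))
                  (≤-trans (L-product κ l big i Q (R / p)) (*-monoˡ-≤ _ (L-mono (κ + l) i (shrinkʳ Q R))))
                  (≤-trans (L-product κ l big i (Q / p) (R / p)) (*-monoˡ-≤ _ (L-mono (κ + l) i
                    (≤-trans (*-monoʳ-≤ (Q / p) (m/n≤m R p)) (shrinkˡ Q R)))))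
    where
    p = suc i
    shrinkˡ : ∀ Q R → Q / p * R ≤ (Q * R) / p
    shrinkˡ Q R = subst (_≤ (Q * R) / p) (m*n/n≡m (Q / p * R) p)
      (/-monoˡ-≤ p (subst (_≤ Q * R) (lem (Q / p) p R) (*-monoˡ-≤ R (m/n*n≤m Q p))))
      where
      lem : ∀ q p r → q * p * r ≡ q * r * p
      lem = ℕS.solve-∀
    shrinkʳ : ∀ Q R → Q * (R / p) ≤ (Q * R) / p
    shrinkʳ Q R = subst₂ _≤_ (*-comm (R / p) Q) (cong (_/ p) (*-comm R Q)) (shrinkˡ R Q)
    r = p ∸ (κ + l)
    κ+l≤p = big p e
    sκ : p ∸ κ ≡ r + l
    sκ = trans (cong (_∸ κ) (trans (sym (m∸n+n≡m κ+l≤p)) (lem r κ l))) (m+n∸n≡m (r + l) κ)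
      where
      lem : ∀ r k l → r + (k + l) ≡ r + l + k
      lem = ℕS.solve-∀
    sl : p ∸ l ≡ r + κ
    sl = trans (cong (_∸ l) (trans (sym (m∸n+n≡m κ+l≤p)) (sym (+-assoc r κ l)))) (m+n∸n≡m (r + κ) l)
    step : ∀ a a′ b b′ w c c′ v v₁ v₂ → v ≡ v₁ * v₂ → a * b * w ≤ c * v → a′ * b * w ≤ c′ * v → a * b′ * w ≤ c′ * v → a′ * b′ * w ≤ c′ * v →
      ((p ∸ κ) * a + κ * a′) * ((p ∸ l) * b + l * b′) * (r * w) ≤ (r * c + (κ + l) * c′) * ((p ∸ κ) * v₁ * ((p ∸ l) * v₂))
    step a a′ b b′ w c c′ v v₁ v₂ refl h₁ h₂ h₃ h₄ rewrite sκ | sl =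
      ≤-trans (≤-reflexive (lem₁ r κ l a a′ b b′ w))
        (≤-trans (+-mono-≤ (*-monoʳ-≤ (r * (r + l) * (r + κ)) h₁) (+-mono-≤ (*-monoʳ-≤ (r * κ * (r + κ)) h₂)
            (+-mono-≤ (*-monoʳ-≤ (r * l * (r + l)) h₃) (*-monoʳ-≤ (r * κ * l) h₄))))
          (≤-trans (m≤m+n _ (c′ * (v₁ * v₂) * (r * κ * l + (κ + l) * κ * l))) (≤-reflexive (lem₂ r κ l c c′ v₁ v₂))))
      where
      lem₁ : ∀ r k l a a′ b b′ w → ((r + l) * a + k * a′) * ((r + k) * b + l * b′) * (r * w) ≡
        r * (r + l) * (r + k) * (a * b * w) + (r * k * (r + k) * (a′ * b * w) + (r * l * (r + l) * (a * b′ * w) + r * k * l * (a′ * b′ * w)))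
      lem₁ = ℕS.solve-∀
      lem₂ : ∀ r k l c c′ v v′ → (r * (r + l) * (r + k) * (c * (v * v′)) + (r * k * (r + k) * (c′ * (v * v′)) + (r * l * (r + l) * (c′ * (v * v′)) + r * k * l * (c′ * (v * v′))))) + c′ * (v * v′) * (r * k * l + (k + l) * k * l) ≡
        (r * c + (k + l) * c′) * ((r + l) * v * ((r + k) * v′))
      lem₂ = ℕS.solve-∀

  L-power : ∀ κ → (∀ p → sel p ≡ true → κ < p) → ∀ i Q → 1 ≤ Q →
    L 1 i Q ^ κ * W κ i ≤ L κ i (Q ^ κ) * W 1 i ^ κ
  L-power zero big i Q Q≥1 = subst₂ _≤_ (sym (+-identityʳ (W 0 i))) (sym (*-identityʳ (L 0 i 1))) (W≤L 0 i 1 ≤-refl)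
  L-power (suc κ) big i Q Q≥1 = *-cancelʳ-≤ _ _ (W κ i) {{>-nonZero (W≥1 κ big′ i)}}
    (≤-trans (≤-reflexive (lem₁ (L 1 i Q) (L 1 i Q ^ κ) (W (suc κ) i) (W κ i)))
      (≤-trans (*-monoʳ-≤ (L 1 i Q * W (suc κ) i) (L-power κ big′ i Q Q≥1))
        (≤-trans (≤-reflexive (lem₂ (L 1 i Q) (W (suc κ) i) (L κ i (Q ^ κ)) (W 1 i ^ κ)))
          (≤-trans (*-monoʳ-≤ (W 1 i ^ κ) (L-product 1 κ (λ p e → <⇒≤ (big p e)) i Q (Q ^ κ)))
            (≤-reflexive (lem₃ (W 1 i ^ κ) (L (suc κ) i (Q * Q ^ κ)) (W 1 i) (W κ i)))))))
    where
    big′ : ∀ p → sel p ≡ true → κ < p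
    big′ p e = <-trans (n<1+n κ) (big p e)
    lem₁ : ∀ l lk w v → l * lk * w * v ≡ l * w * (lk * v)
    lem₁ = ℕS.solve-∀
    lem₂ : ∀ l w m x → l * w * (m * x) ≡ x * (l * m * w)
    lem₂ = ℕS.solve-∀
    lem₃ : ∀ x m w v → x * (m * (w * v)) ≡ m * (w * x) * v
    lem₃ = ℕS.solve-∀

module _ (sel : ℕ → Bool) (κ ω : ℕ → ℕ) where
  private
    module K = Weights sel κ
    module O = Weights sel ω

  L-mono-ω : (∀ p → sel p ≡ true → κ p ≤ ω p) → (∀ p → sel p ≡ true → ω p ≤ p) → ∀ i Q → K.L i Q * O.W i ≤ O.L i Q * K.W i
  L-mono-ω κ≤ω ω≤ zero zero    = z≤n
  L-mono-ω κ≤ω ω≤ zero (suc Q) = ≤-refl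
  L-mono-ω κ≤ω ω≤ (suc i) Q with sel (suc i) in e
  ... | false = L-mono-ω κ≤ω ω≤ i Q
  ... | true  = step (K.L i Q) (K.L i (Q / suc i)) (O.W i) (O.L i Q) (O.L i (Q / suc i)) (K.W i)
                  (L-mono-ω κ≤ω ω≤ i Q) (L-mono-ω κ≤ω ω≤ i (Q / suc i))
    where
    k = κ (suc i)
    d = ω (suc i) ∸ k
    r = suc i ∸ ω (suc i)
    ω≡ : ω (suc i) ≡ d + k
    ω≡ = sym (m∸n+n≡m (κ≤ω (suc i) e))
    sκ : suc i ∸ k ≡ r + d
    sκ = trans (cong (_∸ k) (trans (sym (m∸n+n≡m (ω≤ (suc i) e))) (trans (cong (_+_ r) ω≡) (sym (+-assoc r d k))))) (m+n∸n≡m (r + d) k)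
    step : ∀ a a′ w c c′ v → a * w ≤ c * v → a′ * w ≤ c′ * v →
      ((suc i ∸ k) * a + k * a′) * (r * w) ≤ (r * c + ω (suc i) * c′) * ((suc i ∸ k) * v)
    step a a′ w c c′ v h₁ h₂ rewrite sκ = ≤-trans (≤-reflexive (lem₁ r d k a a′ w))
      (≤-trans (+-mono-≤ (*-monoʳ-≤ (r * (r + d)) h₁) (*-monoʳ-≤ (r * k) h₂))
        (≤-trans (m≤m+n _ (c′ * v * ((r + d) * d + d * k))) (≤-reflexive (trans (lem₂ r d k c c′ v)
          (cong (λ t → (r * c + t * c′) * ((r + d) * v)) (sym ω≡))))))
      where
      lem₁ : ∀ r d k a a′ w → ((r + d) * a + k * a′) * (r * w) ≡ r * (r + d) * (a * w) + r * k * (a′ * w)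
      lem₁ = ℕS.solve-∀
      lem₂ : ∀ r d k c c′ v → (r * (r + d) * (c * v) + r * k * (c′ * v)) + c′ * v * ((r + d) * d + d * k) ≡ (r * c + (d + k) * c′) * ((r + d) * v)
      lem₂ = ℕS.solve-∀

bernoulli : ∀ k w → suc w ^ suc k ≤ w ^ suc k + suc k * suc w ^ k
bernoulli zero    w = ≤-reflexive (lem w)
  where
  lem : ∀ w → suc w * 1 ≡ w * 1 + 1 * 1
  lem = ℕS.solve-∀
bernoulli (suc k) w = ≤-trans (+-monoʳ-≤ (suc w ^ suc k) (*-monoʳ-≤ w (bernoulli k w)))
  (≤-trans (m≤m+n _ (suc k * suc w ^ k)) (≤-reflexive (lem w (w ^ k) (suc w ^ k) (suc k))))
  where
  lem : ∀ w x y k → suc w * y + w * (w * x + k * y) + k * y ≡ w * (w * x) + suc k * (suc w * y)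
  lem = ℕS.solve-∀

∸-bernoulli : ∀ K k → (suc K ∸ suc k) ^ suc k ≤ (K ∸ suc k) ^ suc k + suc k * (K ∸ k) ^ k
∸-bernoulli K k with K ∸ k in e
... | zero = z≤n
... | suc w = subst (λ t → suc w ^ suc k ≤ t ^ suc k + suc k * suc w ^ k)
  (trans (cong pred (sym e)) (pred[m∸n]≡m∸[1+n] K k)) (bernoulli k w)

module _ (sel : ℕ → Bool) (ω : ℕ → ℕ) (V Y : ℕ) (dense : ∀ p → sel p ≡ true → p ∸ ω p ≤ ω p * V) where
  open Weights sel ω

  L-count : 1 ≤ Y → ∀ i k → i ≤ Y → W i * (cnt i (sel ∘ suc) ∸ k) ^ k ≤ L i (Y ^ k) * (V ^ k * k !)
  L-count Y≥1 zero zero i≤Y = ≤-refl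
  L-count Y≥1 zero (suc k) i≤Y = z≤n
  L-count Y≥1 (suc i) zero i≤Y = *-monoˡ-≤ 1 (W≤L (suc i) 1 ≤-refl)
  L-count Y≥1 (suc i) (suc k) i<Y with sel (suc i) in e
  ... | false rewrite +-identityʳ (cnt i (sel ∘ suc)) = L-count Y≥1 i (suc k) (<⇒≤ i<Y)
  ... | true rewrite +-comm (cnt i (sel ∘ suc)) 1 = ≤-trans (*-monoʳ-≤ (s p * W i) (∸-bernoulli K k))
    (≤-trans (≤-reflexive (lem₁ (s p) (W i) ((K ∸ suc k) ^ suc k) (suc k) ((K ∸ k) ^ k)))
      (≤-trans (+-mono-≤ (*-monoʳ-≤ (s p) (L-count Y≥1 i (suc k) (<⇒≤ i<Y)))
          (*-mono-≤ (*-monoˡ-≤ (suc k) (dense p e)) (≤-trans (L-count Y≥1 i k (<⇒≤ i<Y)) (*-monoˡ-≤ (V ^ k * k !) (L-mono i shrink)))))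
        (≤-reflexive (lem₂ (s p) (ω p) (L i (Y ^ suc k)) (L i (Y ^ suc k / p)) V (V ^ k) (suc k) (k !)))))
    where
    p = suc i
    K = cnt i (sel ∘ suc)
    shrink : Y ^ k ≤ Y ^ suc k / p
    shrink = subst (_≤ Y ^ suc k / p) (m*n/n≡m (Y ^ k) p) (/-monoˡ-≤ p (subst (Y ^ k * p ≤_) (*-comm (Y ^ k) Y) (*-monoʳ-≤ (Y ^ k) i<Y)))
    lem₁ : ∀ s w x k y → s * w * (x + k * y) ≡ s * (w * x) + s * k * (w * y)
    lem₁ = ℕS.solve-∀
    lem₂ : ∀ s o l l′ V v k f → s * (l * (V * v * (k * f))) + o * V * k * (l′ * (v * f)) ≡ (s * l + o * l′) * (V * v * (k * f))
    lem₂ = ℕS.solve-∀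

sumℕ : ℕ → (ℕ → ℕ) → ℕ
sumℕ zero    f = 0
sumℕ (suc n) f = sumℕ n f + f n

suc-/ : ∀ Q i → (suc i ∣ suc Q × suc Q / suc i ≡ suc (Q / suc i) × suc Q ≡ suc i * suc (Q / suc i)) ⊎
  (¬ (suc i ∣ suc Q) × suc Q / suc i ≡ Q / suc i)
suc-/ Q i with suc (Q % suc i) <? suc i
... | yes lt = inj₂ (nd , trans (cong (_/ suc i) eq) (trans (+-distrib-/-∣ʳ (suc r) (divides t refl))
        (cong₂ _+_ (m<n⇒m/n≡0 lt) (m*n/n≡m t (suc i)))))
  where
  r = Q % suc i
  t = Q / suc i
  eq : suc Q ≡ suc r + t * suc i
  eq = cong suc (m≡m%n+[m/n]*n Q (suc i))
  nd : ¬ (suc i ∣ suc Q)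
  nd d = <⇒≱ lt (∣⇒≤ (∣m+n∣m⇒∣n (subst (suc i ∣_) (trans eq (+-comm (suc r) (t * suc i))) d) (divides t refl)))
... | no ¬lt = inj₁ (divides (suc t) (trans eq (*-comm (suc i) (suc t))) , trans (cong (_/ suc i) (trans eq (*-comm (suc i) (suc t)))) (m*n/n≡m (suc t) (suc i)) , eq)
  where
  t = Q / suc i
  eq : suc Q ≡ suc i * suc t
  eq = trans (cong suc (m≡m%n+[m/n]*n Q (suc i))) (trans (cong (_+ t * suc i) (≤-antisym (m%n<n Q (suc i)) (≮⇒≥ ¬lt)))
    (*-comm (suc t) (suc i)))

primeDivisor : ∀ n → 2 ≤ n → Σ ℕ λ p → Prime p × (p ∣ n)
primeDivisor n n≥2 = go (PrimeFactorisation.factors f) (PrimeFactorisation.isFactorisation f) (PrimeFactorisation.factorsPrime f)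
  where
  f = factorise n {{>-nonZero (<⇒≤ n≥2)}}
  go : ∀ as → n ≡ product as → All Prime as → Σ ℕ λ p → Prime p × (p ∣ n)
  go [] refl _ = ⊥-elim (<-irrefl refl n≥2)
  go (p ∷ as) refl (pp ∷ _) = p , pp , m∣m*n (product as)

isPrime : ℕ → Bool
isPrime p = does (prime? p)

isPrime⁻ : ∀ p → isPrime p ≡ true → Prime p
isPrime⁻ p e with prime? p
... | yes pp = pp

private
  module AllPrimes = Weights isPrime (λ _ → 1)

module _ (Λ : ℕ) where

  weighted : (ℕ → Bool) → ℕ → ℕ
  weighted f n = if f n then Λ / suc (pred n) else 0

  harmonic : (ℕ → Bool) → ℕ → ℕ
  harmonic f Q = sumℕ Q (λ j → weighted f (suc j))

  harmonic-split : ∀ i f Q → suc i * harmonic f Q ≤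
    suc i * harmonic (λ n → f n ∧ not (does (suc i ∣? n))) Q + harmonic (λ n → f (suc i * n)) (Q / suc i)
  harmonic-split i f zero rewrite *-zeroʳ i = z≤n
  harmonic-split i f (suc Q) with suc-/ Q i
  ... | inj₂ (nd , eq) rewrite eq = ≤-trans (≤-reflexive (*-distribˡ-+ p (harmonic f Q) (weighted f (suc Q))))
      (≤-trans (+-monoˡ-≤ _ (harmonic-split i f Q)) (≤-reflexive (trans
        (cong (λ t → p * harmonic f₀ Q + harmonic f₁ (Q / p) + p * t) (cong (λ b → if b then Λ / suc Q else 0) same))
        (lem p (harmonic f₀ Q) (harmonic f₁ (Q / p)) (weighted f₀ (suc Q))))))
    where
    p = suc i
    f₀ f₁ : ℕ → Bool
    f₀ n = f n ∧ not (does (p ∣? n))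
    f₁ n = f (p * n)
    same : f (suc Q) ≡ f₀ (suc Q)
    same with f (suc Q)
    ... | false = refl
    ... | true  = sym (cong not (dec-false (p ∣? suc Q) nd))
    lem : ∀ p a b c → p * a + b + p * c ≡ p * (a + c) + b
    lem = ℕS.solve-∀
  ... | inj₁ (d , eq , eq′) rewrite eq = ≤-trans (≤-reflexive (*-distribˡ-+ p (harmonic f Q) (weighted f (suc Q))))
      (≤-trans (+-mono-≤ (harmonic-split i f Q) term) (≤-trans (≤-reflexive (lem (p * harmonic f₀ Q) (harmonic f₁ (Q / p)) (weighted f₁ (suc (Q / p)))))
        (+-monoˡ-≤ _ (*-monoʳ-≤ p (m≤m+n (harmonic f₀ Q) _)))))
    where
    p = suc i
    f₀ f₁ : ℕ → Bool
    f₀ n = f n ∧ not (does (p ∣? n))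
    f₁ n = f (p * n)
    lem : ∀ a b c → a + b + c ≡ a + (b + c)
    lem = +-assoc
    term : p * weighted f (suc Q) ≤ weighted f₁ (suc (Q / p))
    term = subst (λ n → p * (if f n then Λ / suc Q else 0) ≤ weighted f₁ (suc (Q / p))) (sym eq′) quotient-term
      where
      n′ = Q / p
      quotient-term : p * (if f (p * suc n′) then Λ / suc Q else 0) ≤ (if f (p * suc n′) then Λ / suc n′ else 0)
      quotient-term with f (p * suc n′)
      ... | false = ≤-reflexive (*-zeroʳ p)
      ... | true = subst (_≤ Λ / suc n′) (*-comm (Λ / suc Q) p)
        (subst (_≤ Λ / suc n′) (m*n/n≡m (Λ / suc Q * p) (suc n′))
          (/-monoˡ-≤ (suc n′) (subst (_≤ Λ) (trans (cong (Λ / suc Q *_) eq′) (sym (*-assoc (Λ / suc Q) p (suc n′)))) (m/n*n≤m Λ (suc Q)))))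

  Smooth : ℕ → (ℕ → Bool) → Set
  Smooth i f = ∀ n → 1 ≤ n → f n ≡ true → ∀ q → Prime q → q ∣ n → q ≤ i

  harmonic≤ : ∀ i f → Smooth i f → ∀ Q → harmonic f Q * AllPrimes.W i ≤ Λ * AllPrimes.L i Q
  harmonic≤ zero f sm zero = z≤n
  harmonic≤ zero f sm (suc Q) = subst₂ _≤_ (sym (*-identityʳ _)) (sym (*-identityʳ Λ)) (first Q)
    where
    first : ∀ Q → harmonic f (suc Q) ≤ Λ
    first zero with f 1
    ... | true  = ≤-reflexive (n/1≡n Λ)
    ... | false = z≤n
    first (suc Q) with f (suc (suc Q)) in e
    ... | false = subst (_≤ Λ) (sym (+-identityʳ (harmonic f (suc Q)))) (first Q)
    ... | true with primeDivisor (suc (suc Q)) (s≤s (s≤s z≤n))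
    ...   | p , pp , p∣n = ⊥-elim (n≮0 (<-≤-trans (prime≥2 pp) (≤-trans (sm _ (s≤s z≤n) e p pp p∣n) z≤n)))
  harmonic≤ (suc i) f sm Q with prime? (suc i)
  ... | no ¬p = harmonic≤ i f (λ n n≥1 e q pq q∣n → ≤-pred (≤∧≢⇒< (sm n n≥1 e q pq q∣n) λ { refl → ¬p pq })) Q
  ... | yes pp = go Q f sm Q ≤-refl
    where
    p = suc i
    go : ∀ fuel f → Smooth (suc i) f → ∀ Q → Q ≤ fuel → harmonic f Q * (i * AllPrimes.W i) ≤ Λ * (i * AllPrimes.L i Q + 1 * AllPrimes.L i (Q / p))
    go fuel f sm zero Q≤ = z≤n
    go (suc fuel) f sm Q@(suc Q-1) Q≤ = *-cancelˡ-≤ p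
      (≤-trans (≤-reflexive (lem₁ p (harmonic f Q) (i * AllPrimes.W i)))
        (≤-trans (*-monoˡ-≤ (i * AllPrimes.W i) (harmonic-split i f Q))
          (≤-trans (≤-reflexive (lem₂ p (harmonic f₀ Q) (harmonic f₁ (Q / p)) i (AllPrimes.W i)))
            (≤-trans (+-mono-≤ (*-monoʳ-≤ (p * i) (harmonic≤ i f₀ sm₀ Q))
                       (≤-trans (go fuel f₁ sm₁ (Q / p) Q/p≤) (*-monoʳ-≤ Λ (+-monoʳ-≤ (i * AllPrimes.L i (Q / p)) (*-monoʳ-≤ 1 (AllPrimes.L-mono i (m/n≤m (Q / p) p)))))))
              (≤-reflexive (lem₃ i Λ (AllPrimes.L i Q) (AllPrimes.L i (Q / p))))))))
      where
      f₀ f₁ : ℕ → Bool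
      f₀ n = f n ∧ not (does (p ∣? n))
      f₁ n = f (p * n)
      Q/p≤ : Q / p ≤ fuel
      Q/p≤ = ≤-pred (<-≤-trans (m/n<m Q p (prime≥2 pp)) Q≤)
      sm₀ : Smooth i f₀
      sm₀ n n≥1 e q pq q∣n with f n in e′
      ... | true = ≤-pred (≤∧≢⇒< (sm n n≥1 e′ q pq q∣n) λ { refl → does-false⁻ (p ∣? n) (not-true e) q∣n })
      sm₁ : Smooth (suc i) f₁
      sm₁ n n≥1 e q pq q∣n = sm (p * n) (*-mono-≤ (s≤s (z≤n {i})) n≥1) e q pq (∣-trans q∣n (n∣m*n p))
      lem₁ : ∀ p h w → p * (h * w) ≡ p * h * w
      lem₁ = ℕS.solve-∀
      lem₂ : ∀ p a b i w → (p * a + b) * (i * w) ≡ p * i * (a * w) + b * (i * w)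
      lem₂ = ℕS.solve-∀
      lem₃ : ∀ i Λ l l′ → suc i * i * (Λ * l) + Λ * (i * l′ + 1 * l′) ≡ suc i * (Λ * (i * l + 1 * l′))
      lem₃ = ℕS.solve-∀

sumℕ-split : ∀ m n f → sumℕ (m + n) f ≡ sumℕ m f + sumℕ n (λ i → f (m + i))
sumℕ-split m zero    f rewrite +-identityʳ m = sym (+-identityʳ _)
sumℕ-split m (suc n) f rewrite +-suc m n = trans (cong (_+ f (m + n)) (sumℕ-split m n f)) (+-assoc (sumℕ m f) _ _)

sumℕ-≥ : ∀ n f c → (∀ i → i < n → c ≤ f i) → n * c ≤ sumℕ n f
sumℕ-≥ zero    f c h = z≤n
sumℕ-≥ (suc n) f c h = subst (_≤ sumℕ n f + f n) (+-comm (n * c) c)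
  (+-mono-≤ (sumℕ-≥ n f c λ i i<n → h i (m<n⇒m<1+n i<n)) (h n ≤-refl))

sumℕ-cong : ∀ n {f g} → (∀ i → i < n → f i ≡ g i) → sumℕ n f ≡ sumℕ n g
sumℕ-cong zero    e = refl
sumℕ-cong (suc n) e = cong₂ _+_ (sumℕ-cong n λ i i<n → e i (m<n⇒m<1+n i<n)) (e n ≤-refl)

harmonic-dyadic : ∀ k j → j ≤ k → j * 2 ^ k ≤ 2 * harmonic (2 ^ k) (λ _ → true) (2 ^ j)
harmonic-dyadic k zero    j≤k = z≤n
harmonic-dyadic k (suc j) j<k rewrite +-identityʳ (2 ^ j) | sumℕ-split (2 ^ j) (2 ^ j) (λ i → 2 ^ k / suc i) =
  subst (2 ^ k + j * 2 ^ k ≤_) (trans (+-comm _ (2 * H)) (sym (*-distribˡ-+ 2 H _)))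
    (+-mono-≤ (subst (_≤ 2 * sumℕ (2 ^ j) (λ i → 2 ^ k / suc (2 ^ j + i))) two
        (*-monoʳ-≤ 2 (sumℕ-≥ (2 ^ j) (λ i → 2 ^ k / suc (2 ^ j + i)) (2 ^ (k ∸ suc j)) each)))
      (harmonic-dyadic k j (<⇒≤ j<k)))
  where
  H = sumℕ (2 ^ j) (λ i → 2 ^ k / suc i)
  pow : 2 ^ suc j * 2 ^ (k ∸ suc j) ≡ 2 ^ k
  pow = trans (sym (^-distribˡ-+-* 2 (suc j) (k ∸ suc j))) (cong (2 ^_) (m+[n∸m]≡n j<k))
  two : 2 * (2 ^ j * 2 ^ (k ∸ suc j)) ≡ 2 ^ k
  two = trans (sym (*-assoc 2 (2 ^ j) (2 ^ (k ∸ suc j)))) pow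
  each : ∀ i → i < 2 ^ j → 2 ^ (k ∸ suc j) ≤ 2 ^ k / suc (2 ^ j + i)
  each i i< = subst (_≤ 2 ^ k / suc (2 ^ j + i)) (m*n/n≡m (2 ^ (k ∸ suc j)) (suc (2 ^ j + i)))
    (/-monoˡ-≤ (suc (2 ^ j + i)) (subst (2 ^ (k ∸ suc j) * suc (2 ^ j + i) ≤_) (trans (*-comm (2 ^ (k ∸ suc j)) (2 ^ suc j)) pow)
      (*-monoʳ-≤ (2 ^ (k ∸ suc j)) (subst (suc (2 ^ j + i) ≤_) (cong (_+_ (2 ^ j)) (sym (+-identityʳ (2 ^ j))))
        (subst (_≤ 2 ^ j + 2 ^ j) (+-suc (2 ^ j) i) (+-monoʳ-≤ (2 ^ j) i<))))))

bigPrime : ℕ → ℕ → Bool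
bigPrime b p = isPrime p ∧ does (b <? p)

bigPrime⁻ : ∀ b p → bigPrime b p ≡ true → Prime p × b < p
bigPrime⁻ b p e with prime? p
... | yes pp = pp , does-true⁻ (b <? p) e

module _ (b : ℕ) (b≥1 : 1 ≤ b) where
  private
    module B = Weights (bigPrime b) (λ _ → 1)

  -- Discarding the primes up to b costs at most the factor ∏_{p ≤ b} p/(p-1) ≤ b.
  L-discard : ∀ i Q → AllPrimes.L i Q * B.W i ≤ ((i ⊓ b) ⊔ 1) * (B.L i Q * AllPrimes.W i)
  L-discard zero zero    = z≤n
  L-discard zero (suc Q) = ≤-refl
  L-discard (suc i) Q with prime? (suc i)
  ... | no _ = ≤-trans (L-discard i Q) (*-monoˡ-≤ _ (⊔-monoˡ-≤ 1 (⊓-monoˡ-≤ b (n≤1+n i))))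
  ... | yes pp with does (b <? suc i) in e
  ...   | true = ≤-trans (≤-reflexive (lem₁ i (AllPrimes.L i Q) (AllPrimes.L i (Q / p)) (B.W i)))
        (≤-trans (+-mono-≤ (*-monoʳ-≤ (i * i) (L-discard i Q)) (*-monoʳ-≤ i (L-discard i (Q / p))))
          (≤-trans (≤-reflexive (lem₂ i ((i ⊓ b) ⊔ 1) (B.L i Q) (B.L i (Q / p)) (AllPrimes.W i)))
            (*-monoˡ-≤ _ (⊔-monoˡ-≤ 1 (⊓-monoˡ-≤ b (n≤1+n i))))))
    where
    p = suc i
    lem₁ : ∀ i a a′ w → (i * a + 1 * a′) * (i * w) ≡ i * i * (a * w) + i * (a′ * w)
    lem₁ = ℕS.solve-∀
    lem₂ : ∀ i c l l′ w → i * i * (c * (l * w)) + i * (c * (l′ * w)) ≡ c * ((i * l + 1 * l′) * (i * w))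
    lem₂ = ℕS.solve-∀
  ...   | false rewrite m≤n⇒m⊓n≡m (≮⇒≥ (does-false⁻ (b <? suc i) e)) = ≤-trans (*-monoˡ-≤ (B.W i) (+-monoʳ-≤ (i * AllPrimes.L i Q) (*-monoʳ-≤ 1 (AllPrimes.L-mono i (m/n≤m Q (suc i))))))
        (≤-trans (≤-reflexive (lem₁ i (AllPrimes.L i Q) (B.W i)))
          (≤-trans (*-monoʳ-≤ (suc i) (subst (λ t → AllPrimes.L i Q * B.W i ≤ t * (B.L i Q * AllPrimes.W i)) c≡ (L-discard i Q)))
            (≤-reflexive (trans (lem₂ i (B.L i Q) (AllPrimes.W i)) (cong (λ t → suc t * (B.L i Q * (i * AllPrimes.W i))) (sym (⊔-identityʳ i)))))))
    where
    p≤b : suc i ≤ b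
    p≤b = ≮⇒≥ (does-false⁻ (b <? suc i) e)
    c≡ : (i ⊓ b) ⊔ 1 ≡ i
    c≡ = trans (cong (_⊔ 1) (m≤n⇒m⊓n≡m (≤-trans (n≤1+n i) p≤b))) (m≥n⇒m⊔n≡m (≤-pred (prime≥2 pp)))
    lem₁ : ∀ i a w → (i * a + 1 * a) * w ≡ suc i * (a * w)
    lem₁ = ℕS.solve-∀
    lem₂ : ∀ i l w → suc i * (i * (l * w)) ≡ suc i * (l * (i * w))
    lem₂ = ℕS.solve-∀

  L-log : ∀ k y → 2 ^ k ≤ y → k * B.W y ≤ 2 * b * B.L y (2 ^ k)
  L-log k y 2^k≤y = *-cancelʳ-≤ _ _ (2 ^ k * AllPrimes.W y) {{m*n≢0 (2 ^ k) (AllPrimes.W y) {{m^n≢0 2 k}} {{>-nonZero A≥1}}}}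
    (≤-trans (≤-reflexive (lem₁ k (B.W y) (2 ^ k) (AllPrimes.W y)))
      (≤-trans (*-monoʳ-≤ (B.W y) (*-monoˡ-≤ (AllPrimes.W y) (subst (λ t → k * 2 ^ k ≤ 2 * t) H≡ (harmonic-dyadic k k ≤-refl))))
        (≤-trans (≤-reflexive (lem₂ (B.W y) (harmonic (2 ^ k) f (2 ^ k)) (AllPrimes.W y)))
          (≤-trans (*-monoʳ-≤ (2 * B.W y) all)
            (≤-trans (≤-reflexive (lem₃ (B.W y) (2 ^ k) (AllPrimes.L y (2 ^ k))))
              (≤-trans (*-monoʳ-≤ (2 * 2 ^ k) (≤-trans (L-discard y (2 ^ k)) (*-monoˡ-≤ _ (⊔-lub (m⊓n≤n y b) b≥1))))
                (≤-reflexive (lem₄ (2 ^ k) b (B.L y (2 ^ k)) (AllPrimes.W y)))))))))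
    where
    A≥1 : 1 ≤ AllPrimes.W y
    A≥1 = AllPrimes.W≥1 (λ p e → prime≥2 (isPrime⁻ p e)) y
    f : ℕ → Bool
    f n = does (n ≤? y)
    all : harmonic (2 ^ k) f (2 ^ k) * AllPrimes.W y ≤ 2 ^ k * AllPrimes.L y (2 ^ k)
    all = harmonic≤ (2 ^ k) y f (λ n n≥1 e q pq q∣n → ≤-trans (∣⇒≤ {{>-nonZero n≥1}} q∣n) (does-true⁻ (n ≤? y) e)) (2 ^ k)
    H≡ : harmonic (2 ^ k) (λ _ → true) (2 ^ k) ≡ harmonic (2 ^ k) f (2 ^ k)
    H≡ = sumℕ-cong (2 ^ k) λ i i< → sym (cong (λ b → if b then 2 ^ k / suc i else 0) (dec-true (suc i ≤? y) (≤-trans i< 2^k≤y)))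
    lem₁ : ∀ k b t a → k * b * (t * a) ≡ b * (k * t * a)
    lem₁ = ℕS.solve-∀
    lem₂ : ∀ b h a → b * (2 * h * a) ≡ 2 * b * (h * a)
    lem₂ = ℕS.solve-∀
    lem₃ : ∀ b t l → 2 * b * (t * l) ≡ 2 * t * (l * b)
    lem₃ = ℕS.solve-∀
    lem₄ : ∀ t b l a → 2 * t * (b * (l * a)) ≡ 2 * b * l * (t * a)
    lem₄ = ℕS.solve-∀

-- Summands of the primes

pow+ : ∀ a b → 2 ^ a * 2 ^ b ≡ 2 ^ (a + b)
pow+ a b = sym (^-distribˡ-+-* 2 a b)

2^-mono : ∀ {a b} → a ≤ b → 2 ^ a ≤ 2 ^ b
2^-mono = ^-monoʳ-≤ 2

exp-beats-linear : ∀ C → Σ ℕ λ l₀ → ∀ l → l₀ ≤ l → C * suc l < 2 ^ l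
exp-beats-linear C = 4 * C , λ l 4C≤l → let h = l / 2 in
  ≤-<-trans (*-monoʳ-≤ C (≤-trans (suc≤ l) (*-monoʳ-≤ 2 (n<2^n h))))
    (<-≤-trans (subst (_< 2 ^ h * 2 ^ h) (lem C (2 ^ h)) (*-monoˡ-< (2 ^ h) {{m^n≢0 2 h}}
        (<-≤-trans (n<2^n (2 * C)) (2^-mono (2C≤ C l 4C≤l)))))
      (subst (_≤ 2 ^ l) (sym (pow+ h h)) (2^-mono (subst (_≤ l) (*2 h) (m/n*n≤m l 2)))))
  where
  *2 : ∀ h → h * 2 ≡ h + h
  *2 = ℕS.solve-∀
  lem : ∀ C x → 2 * C * x ≡ C * (2 * x)
  lem = ℕS.solve-∀
  suc≤ : ∀ l → suc l ≤ 2 * suc (l / 2)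
  suc≤ l = subst (suc l ≤_) (*-comm (suc (l / 2)) 2) (subst (_< suc (l / 2) * 2) (sym (m≡m%n+[m/n]*n l 2)) (+-monoˡ-< (l / 2 * 2) (m%n<n l 2)))
  2C≤ : ∀ C l → 4 * C ≤ l → 2 * C ≤ l / 2
  2C≤ C l le = subst (_≤ l / 2) (m*n/n≡m (2 * C) 2) (/-monoˡ-≤ 2 (subst (_≤ l) (lem₂ C) le))
    where
    lem₂ : ∀ C → 4 * C ≡ 2 * C * 2
    lem₂ = ℕS.solve-∀

log-small : ∀ c → Σ ℕ λ n₀ → ∀ n → n₀ ≤ n → ∀ l → 2 ^ l ≤ c * n → c * suc l ≤ n
log-small c with exp-beats-linear (c * c)
... | l₀ , beats = c * suc l₀ , go
  where
  go : ∀ n → c * suc l₀ ≤ n → ∀ l → 2 ^ l ≤ c * n → c * suc l ≤ n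
  go n n≥ l le with l ≤? l₀
  ... | yes l≤ = ≤-trans (*-monoʳ-≤ c (s≤s l≤)) n≥
  ... | no l≰ = ≮⇒≥ λ n< → <⇒≱ (beats l (<⇒≤ (≰⇒> l≰))) (≤-trans le (subst (c * n ≤_) (sym (*-assoc c c (suc l))) (*-monoʳ-≤ c (<⇒≤ n<))))

log2 : ∀ n → 1 ≤ n → Σ ℕ λ l → n ≤ 2 ^ l × 2 ^ l ≤ 2 * n
log2 n n≥1 with maxPower 2 n ≤-refl n≥1
... | e , le , lt = suc e , <⇒≤ lt , *-monoʳ-≤ 2 le

trues : ℕ → (ℕ → Bool) → List ℕ
trues zero    f = []
trues (suc n) f = if f n then n ∷ trues n f else trues n f

length-trues : ∀ n f → length (trues n f) ≡ cnt n f
length-trues zero    f = refl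
length-trues (suc n) f with f n
... | true  = trans (cong suc (length-trues n f)) (+-comm 1 (cnt n f))
... | false = trans (length-trues n f) (sym (+-identityʳ (cnt n f)))

∈-trues : ∀ n f i → i < n → f i ≡ true → i ∈ trues n f
∈-trues (suc n) f i i<n e with i ≟ n
... | yes refl rewrite e = here refl
... | no i≢n with f n | ∈-trues n f i (≤∧≢⇒< (≤-pred i<n) i≢n) e
...   | true  | i∈ = there i∈
...   | false | i∈ = i∈

dist : ℕ → ℕ → ℕ
dist m n = (m ∸ n) + (n ∸ m)

dist≢0 : ∀ m n → m ≢ n → 1 ≤ dist m n
dist≢0 m n m≢n = n≢0⇒n>0 λ e → m≢n (≤-antisym (m∸n≡0⇒m≤n (m+n≡0⇒m≡0 _ e)) (m∸n≡0⇒m≤n (m+n≡0⇒n≡0 (m ∸ n) e)))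

dist< : ∀ m n b → m < b → n < b → dist m n < b
dist< m n b m< n< with ≤-total m n
... | inj₁ m≤n rewrite m≤n⇒m∸n≡0 m≤n = ≤-<-trans (m∸n≤m n m) n<
... | inj₂ n≤m rewrite m≤n⇒m∸n≡0 n≤m | +-identityʳ (m ∸ n) = ≤-<-trans (m∸n≤m m n) m<

∣dist : ∀ p r m n → p ∣ r + m → p ∣ r + n → p ∣ dist m n
∣dist p r m n d e with ≤-total m n
... | inj₁ m≤n rewrite m≤n⇒m∸n≡0 m≤n = ∣m+n∣m⇒∣n (subst (p ∣_) (trans (cong (_+_ r) (sym (m+[n∸m]≡n m≤n))) (sym (+-assoc r m (n ∸ m)))) e) d
... | inj₂ n≤m rewrite m≤n⇒m∸n≡0 n≤m | +-identityʳ (m ∸ n) = ∣m+n∣m⇒∣n (subst (p ∣_) (trans (cong (_+_ r) (sym (m+[n∸m]≡n n≤m))) (sym (+-assoc r n (m ∸ n)))) d) e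

∣-% : ∀ {p a b} .{{_ : NonZero p}} → p ∣ a % p + b → p ∣ a + b
∣-% {p} {a} {b} d = subst (p ∣_) (trans (lem (a / p * p) (a % p) b) (cong (_+ b) (sym (m≡m%n+[m/n]*n a p)))) (∣m∣n⇒∣m+n (n∣m*n (a / p)) d)
  where
  lem : ∀ q r b → q + (r + b) ≡ r + q + b
  lem = ℕS.solve-∀

%-∣ : ∀ {p a b} .{{_ : NonZero p}} → p ∣ a + b → p ∣ a % p + b
%-∣ {p} {a} {b} d = ∣m+n∣m⇒∣n (subst (p ∣_) (trans (cong (_+ b) (m≡m%n+[m/n]*n a p)) (lem (a / p * p) (a % p) b)) d) (n∣m*n (a / p))
  where
  lem : ∀ q r b → r + q + b ≡ q + (r + b)
  lem = ℕS.solve-∀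

cnt-mono : ∀ n f g → (∀ i → f i ≡ true → g i ≡ true) → cnt n f ≤ cnt n g
cnt-mono zero    f g h = z≤n
cnt-mono (suc n) f g h with f n in e
... | false = ≤-trans (≤-reflexive (+-identityʳ (cnt n f))) (≤-trans (cnt-mono n f g h) (m≤m+n (cnt n g) _))
... | true rewrite h n e = +-monoˡ-≤ 1 (cnt-mono n f g h)

cnt-extend : ∀ n f g r → r < n → (∀ i → f i ≡ true → g i ≡ true) → f r ≡ false → g r ≡ true → suc (cnt n f) ≤ cnt n g
cnt-extend (suc n) f g r r<n h fr gr with r ≟ n
... | yes refl rewrite fr | gr = subst (_≤ cnt n g + 1) (trans (+-comm (cnt n f) 1) (cong suc (sym (+-identityʳ (cnt n f))))) (+-monoˡ-≤ 1 (cnt-mono n f g h))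
... | no r≢n = +-mono-≤ (cnt-extend n f g r (≤∧≢⇒< (≤-pred r<n) r≢n) h fr gr) (ind-mono (f n) (g n) (h n))
  where
  ind-mono : ∀ a b → (a ≡ true → b ≡ true) → ind a ≤ ind b
  ind-mono false b _ = z≤n
  ind-mono true  b h rewrite h refl = ≤-refl

negClass : List ℕ → ℕ → ℕ → Bool
negClass B p r = does (any? (λ b → p ∣? (r + b)) B)

collide : ℕ → ℕ → List ℕ → Bool
collide p b bs = does (any? (λ b′ → p ∣? dist b b′) bs)

collisions : ℕ → List ℕ → ℕ
collisions p []       = 0
collisions p (b ∷ bs) = ind (collide p b bs) + collisions p bs

length≤classes+collisions : ∀ q B → length B ≤ cnt (suc q) (negClass B (suc q)) + collisions (suc q) B
length≤classes+collisions q [] = z≤n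
length≤classes+collisions q (b ∷ bs) with collide p b bs in e
  where p = suc q
... | true = ≤-trans (s≤s (length≤classes+collisions q bs)) (≤-trans (≤-reflexive (sym (+-suc _ (collisions (suc q) bs))))
    (+-monoˡ-≤ _ (cnt-mono (suc q) (negClass bs (suc q)) (negClass (b ∷ bs) (suc q)) weaken)))
  where
  weaken : ∀ r → negClass bs (suc q) r ≡ true → negClass (b ∷ bs) (suc q) r ≡ true
  weaken r t = dec-true (any? _ (b ∷ bs)) (there (does-true⁻ (any? _ bs) t))
... | false = ≤-trans (s≤s (length≤classes+collisions q bs)) (+-monoˡ-≤ _ (cnt-extend p (negClass bs p) (negClass (b ∷ bs) p) r
      (m%n<n (b * q) p) weaken off (dec-true (any? _ (b ∷ bs)) (here p∣r+b))))
  where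
  p = suc q
  r = (b * q) % p
  p∣r+b : p ∣ r + b
  p∣r+b = %-∣ {p} {b * q} {b} (subst (p ∣_) (trans (*-suc b q) (+-comm b (b * q))) (n∣m*n b))
  weaken : ∀ r → negClass bs p r ≡ true → negClass (b ∷ bs) p r ≡ true
  weaken r t = dec-true (any? _ (b ∷ bs)) (there (does-true⁻ (any? _ bs) t))
  off : negClass bs p r ≡ false
  off = dec-false (any? _ bs) λ a → does-false⁻ (any? (λ b′ → p ∣? dist b b′) bs) e (Any-map (λ {b′} d → ∣dist p r b b′ p∣r+b d) a)

sumOver : List ℕ → (ℕ → ℕ) → ℕ
sumOver []       f = 0
sumOver (x ∷ xs) f = f x + sumOver xs f

sumOver-+ : ∀ xs f g → sumOver xs (λ x → f x + g x) ≡ sumOver xs f + sumOver xs g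
sumOver-+ []       f g = refl
sumOver-+ (x ∷ xs) f g rewrite sumOver-+ xs f g = lem (f x) (g x) (sumOver xs f) (sumOver xs g)
  where
  lem : ∀ a b c d → a + b + (c + d) ≡ a + c + (b + d)
  lem = ℕS.solve-∀

sumOver-mono : ∀ xs f g → (∀ x → f x ≤ g x) → sumOver xs f ≤ sumOver xs g
sumOver-mono []       f g h = z≤n
sumOver-mono (x ∷ xs) f g h = +-mono-≤ (h x) (sumOver-mono xs f g h)

sumOver-≥ : ∀ xs f c → (∀ x → x ∈ xs → c ≤ f x) → length xs * c ≤ sumOver xs f
sumOver-≥ []       f c h = z≤n
sumOver-≥ (x ∷ xs) f c h = +-mono-≤ (h x (here refl)) (sumOver-≥ xs f c λ y y∈ → h y (there y∈))

sumOver-∣ : ∀ ps d → sumOver ps (λ p → ind (does (p ∣? d))) ≡ length (filter (_∣? d) ps)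
sumOver-∣ []       d = refl
sumOver-∣ (p ∷ ps) d with does (p ∣? d)
... | true  = cong suc (sumOver-∣ ps d)
... | false = sumOver-∣ ps d

sumOver-0 : ∀ xs → sumOver xs (λ _ → 0) ≡ 0
sumOver-0 []       = refl
sumOver-0 (x ∷ xs) = sumOver-0 xs

module _ (n : ℕ) (ps : List ℕ) (ps! : Unique ps) (ps-prime : ∀ p → p ∈ ps → Prime p) where

  divisors≤ : ∀ d → 1 ≤ d → d < 2 ^ n → sumOver ps (λ p → ind (does (p ∣? d))) ≤ n
  divisors≤ d d≥1 d< = subst (_≤ n) (sym (sumOver-∣ ps d)) (2^-cancel-≤ (≤-trans
    (2^primeDivisors≤ (filter (_∣? d) ps) d d≥1 (filter⁺ (_∣? d) ps!) λ p p∈ → let (p∈′ , p∣d) = ∈-filter⁻ (_∣? d) {xs = ps} p∈ in ps-prime p p∈′ , p∣d)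
    (<⇒≤ d<)))

  collide≤ : ∀ b bs → b < 2 ^ n → (∀ b′ → b′ ∈ bs → b′ < 2 ^ n × b ≢ b′) → sumOver ps (λ p → ind (collide p b bs)) ≤ length bs * n
  collide≤ b [] b< h = ≤-reflexive (sumOver-0 ps)
  collide≤ b (b′ ∷ bs) b< h = ≤-trans (sumOver-mono ps _ (λ p → ind (does (p ∣? dist b b′)) + ind (collide p b bs)) pointwise)
    (≤-trans (≤-reflexive (sumOver-+ ps _ _)) (+-mono-≤
      (divisors≤ (dist b b′) (dist≢0 b b′ (proj₂ (h b′ (here refl)))) (dist< b b′ (2 ^ n) b< (proj₁ (h b′ (here refl)))))
      (collide≤ b bs b< λ c c∈ → h c (there c∈))))
    where
    pointwise : ∀ p → ind (collide p b (b′ ∷ bs)) ≤ ind (does (p ∣? dist b b′)) + ind (collide p b bs)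
    pointwise p with does (p ∣? dist b b′)
    ... | true  = s≤s z≤n
    ... | false = ≤-refl

  collisions≤ : ∀ B → Unique B → (∀ b → b ∈ B → b < 2 ^ n) → sumOver ps (λ p → collisions p B) ≤ length B * (length B * n)
  collisions≤ [] u h = ≤-reflexive (sumOver-0 ps)
  collisions≤ (b ∷ bs) (b# ∷ u) h = ≤-trans (≤-reflexive (sumOver-+ ps _ _))
    (≤-trans (+-mono-≤ (collide≤ b bs (h b (here refl)) λ b′ b′∈ → h b′ (there b′∈) , All.lookup b# b′∈)
                       (collisions≤ bs u λ b′ b′∈ → h b′ (there b′∈)))
      (≤-trans (m≤m+n _ (n + length bs * n)) (≤-reflexive (lem (length bs) n))))
    where
    lem : ∀ m n → m * n + m * (m * n) + (n + m * n) ≡ suc m * (suc m * n)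
    lem = ℕS.solve-∀

no-collisions : ∀ p B c → Unique B → (∀ b → b ∈ B → b < c) → c < p → collisions p B ≡ 0
no-collisions p [] c u h c<p = refl
no-collisions p (b ∷ bs) c (b# ∷ u) h c<p = cong₂ _+_ (cong ind (dec-false (any? (λ b′ → p ∣? dist b b′) bs) none))
  (no-collisions p bs c u (λ b′ b′∈ → h b′ (there b′∈)) c<p)
  where
  none : ¬ Any (λ b′ → p ∣ dist b b′) bs
  none a with find a
  ... | b′ , b′∈ , d = <⇒≱ (<-trans (dist< b b′ c (h b (here refl)) (h b′ (there b′∈))) c<p)
    (∣⇒≤ {{>-nonZero (dist≢0 b b′ (All.lookup b# b′∈))}} d)

-- LA n and LB n are the summands chosen for the primes up to 2ⁿ.
record Decomposition : Set where
  field
    P₀ N₀ n₀  : ℕ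
    LA LB     : ℕ → List ℕ
    LA-unique : ∀ n → Unique (LA n)
    LB-unique : ∀ n → Unique (LB n)
    LA-mono   : ∀ {m n} → m ≤ n → ∀ a → a ∈ LA m → a ∈ LA n
    LB-mono   : ∀ {m n} → m ≤ n → ∀ b → b ∈ LB m → b ∈ LB n
    LA-bound  : ∀ n → n₀ ≤ n → ∀ a → a ∈ LA n → a < 2 ^ n
    LB-bound  : ∀ n → n₀ ≤ n → ∀ b → b ∈ LB n → b < 2 ^ n
    cover     : ∀ n p → Prime p → P₀ ≤ p → p ≤ 2 ^ n → Σ ℕ λ a → Σ ℕ λ b → a ∈ LA n × b ∈ LB n × a + b ≡ p
    LA-pos    : ∀ n a → a ∈ LA n → 1 ≤ a
    LB-pos    : ∀ n b → b ∈ LB n → 1 ≤ b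
    LA-two    : 2 ≤ length (LA n₀)
    LB-two    : 2 ≤ length (LB n₀)

  Pure : ℕ → Set
  Pure M = ∀ a b → a ∈ LA M → b ∈ LB M → N₀ ≤ a + b → Prime (a + b)

swap : Decomposition → Decomposition
swap D = record
  { P₀ = P₀ ; N₀ = N₀ ; n₀ = n₀ ; LA = LB ; LB = LA ; LA-unique = LB-unique ; LB-unique = LA-unique
  ; LA-mono = LB-mono ; LB-mono = LA-mono ; LA-bound = LB-bound ; LB-bound = LA-bound
  ; cover = λ n p pp P₀≤ p≤ → case cover n p pp P₀≤ p≤ of λ { (a , b , a∈ , b∈ , e) → b , a , b∈ , a∈ , trans (+-comm b a) e }
  ; LA-pos = LB-pos ; LB-pos = LA-pos ; LA-two = LB-two ; LB-two = LA-two }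
  where open Decomposition D

swap-pure : ∀ D M → Decomposition.Pure D M → Decomposition.Pure (swap D) M
swap-pure D M pure b a b∈ a∈ N₀≤ = subst Prime (+-comm a b) (pure a b a∈ b∈ (subst (Decomposition.N₀ D ≤_) (+-comm b a) N₀≤))

sieve-exponents : ∀ J n h k → 3 + 2 * k + 2 * h + 2 * k * suc J ≤ n * J →
  2 * ((2 ^ k * suc (2 ^ h)) * (2 ^ k * suc (2 ^ h))) * (2 ^ k * 2 ^ k) ^ suc J ≤ (2 ^ n) ^ J
sieve-exponents J n h k le = ≤-trans (*-monoˡ-≤ ((2 ^ k * 2 ^ k) ^ suc J) (*-monoʳ-≤ 2 (*-mono-≤ y≤ y≤)))
  (≤-trans (≤-reflexive eq) (≤-trans (2^-mono le) (≤-reflexive (sym (^-*-assoc 2 n J)))))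
  where
  y≤ : 2 ^ k * suc (2 ^ h) ≤ 2 ^ (k + suc h)
  y≤ = subst (2 ^ k * suc (2 ^ h) ≤_) (pow+ k (suc h)) (*-monoʳ-≤ (2 ^ k)
    (subst (suc (2 ^ h) ≤_) (cong (_+_ (2 ^ h)) (sym (+-identityʳ (2 ^ h)))) (+-monoˡ-≤ (2 ^ h) (m^n>0 2 h))))
  eq : 2 * (2 ^ (k + suc h) * 2 ^ (k + suc h)) * (2 ^ k * 2 ^ k) ^ suc J ≡ 2 ^ (3 + 2 * k + 2 * h + 2 * k * suc J)
  eq = trans (cong₂ _*_ (cong (2 *_) (pow+ (k + suc h) (k + suc h))) (trans (cong (_^ suc J) (pow+ k k)) (^-*-assoc 2 (k + k) (suc J))))
    (trans (pow+ (suc (k + suc h + (k + suc h))) ((k + k) * suc J)) (cong (2 ^_) (lem k h (suc J))))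
    where
    lem : ∀ k h j → suc (k + suc h + (k + suc h)) + (k + k) * j ≡ 3 + 2 * k + 2 * h + 2 * k * j
    lem = ℕS.solve-∀

W-cong : ∀ sel sel′ ω y i → i ≤ y → (∀ p → p ≤ y → sel p ≡ sel′ p) → Weights.W sel ω i ≡ Weights.W sel′ ω i
W-cong sel sel′ ω y zero    i≤y e = refl
W-cong sel sel′ ω y (suc i) i<y e rewrite e (suc i) i<y | W-cong sel sel′ ω y i (<⇒≤ i<y) e = refl

L-cong : ∀ sel sel′ ω y i → i ≤ y → (∀ p → p ≤ y → sel p ≡ sel′ p) → ∀ Q → Weights.L sel ω i Q ≡ Weights.L sel′ ω i Q
L-cong sel sel′ ω y zero    i≤y e zero    = refl
L-cong sel sel′ ω y zero    i≤y e (suc Q) = refl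
L-cong sel sel′ ω y (suc i) i<y e Q
  rewrite e (suc i) i<y | L-cong sel sel′ ω y i (<⇒≤ i<y) e Q | L-cong sel sel′ ω y i (<⇒≤ i<y) e (Q / suc i) = refl

∧-true₁ : ∀ {a b} → a ∧ b ≡ true → a ≡ true
∧-true₁ {true} _ = refl

∧-true₂ : ∀ {a b} → a ∧ b ≡ true → b ≡ true
∧-true₂ {true} e = e

module OneSided (D : Decomposition) where
  open Decomposition D

  -- a + b is a prime exceeding y, so no selected prime p ≤ y divides it.
  sieve-by : ∀ M → Pure M → ∀ B → (∀ b → b ∈ B → b ∈ LB M) → ∀ sel → (∀ p → sel p ≡ true → Prime p) →
    ∀ J X .{{_ : NonZero X}} y Q A → Unique A → (∀ a → a ∈ A → a ∈ LA M × a < X × y < a × N₀ ≤ a) → 1 ≤ Q →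
    2 * ((Q * suc y) * (Q * suc y)) * (Q * Q) ^ suc J ≤ X ^ J →
    let open Weights sel (λ p → cnt p (negClass B p)) in (length A ≡ 0 ⊎ 1 ≤ W y) × length A * L y Q ≤ 2 * (suc J * X) * W y
  sieve-by M pure B B⊆ sel sel-prime J X y Q [] u hA Q≥1 large = inj₁ refl , z≤n
  sieve-by M pure B B⊆ sel sel-prime J X y Q A@(a₀ ∷ _) u hA Q≥1 large =
    inj₂ (subst (1 ≤_) (W-cong sel′ sel ω y y ≤-refl agree)
      (Weights.W≥1 sel′ ω (λ p e → ω<y p (does-true⁻ (p ≤? y) (∧-true₂ e)) (∧-true₁ e)) y)) ,
    subst₂ (λ l w → length A * l ≤ 2 * (suc J * X) * w) (L-cong sel′ sel ω y y ≤-refl agree Q) (W-cong sel′ sel ω y y ≤-refl agree)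
      (Sieve.sieve sel′ (negClass B) J X (λ p e → sel-prime p (∧-true₁ e)) (λ p e → ω<y p (does-true⁻ (p ≤? y) (∧-true₂ e)) (∧-true₁ e))
        y Q A u (λ a a∈ → proj₁ (proj₂ (hA a a∈))) (λ a a∈ q q<y e → off a a∈ q q<y (∧-true₁ e)) Q≥1 large)
    where
    ω : ℕ → ℕ
    ω p = cnt p (negClass B p)
    sel′ : ℕ → Bool
    sel′ p = sel p ∧ does (p ≤? y)
    off : ∀ a → a ∈ A → ∀ q → q < y → sel (suc q) ≡ true → negClass B (suc q) (a % suc q) ≡ false
    off a a∈ q q<y e with hA a a∈
    ... | a∈LA , a<X , y<a , N₀≤a = dec-false (any? _ B) λ any → case find any of λ
      { (b , b∈ , d) → <⇒≢ (≤-<-trans q<y (<-≤-trans y<a (m≤m+n a b)))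
          (prime∣prime (sel-prime (suc q) e) (pure a b a∈LA (B⊆ b b∈) (≤-trans N₀≤a (m≤m+n a b))) (∣-% {suc q} {a} {b} d)) }
    ω<y : ∀ p → p ≤ y → sel p ≡ true → cnt p (negClass B p) < p
    ω<y zero    _ e = ⊥-elim (¬prime[0] (sel-prime 0 e))
    ω<y (suc q) q<y e = cnt<-gap (suc q) (negClass B (suc q)) (a₀ % suc q) (m%n<n a₀ (suc q)) (off a₀ (here refl) q q<y e)
    agree : ∀ p → p ≤ y → sel′ p ≡ sel p
    agree p p≤y = trans (cong (sel p ∧_) (dec-true (p ≤? y) p≤y)) (∧-identityʳ (sel p))

-- The number of summands

length-product : ∀ (xs ys : List ℕ) → length (cartesianProduct xs ys) ≡ length xs * length ys
length-product []       ys = refl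
length-product (x ∷ xs) ys = trans (length-++ (map (x ,_) ys)) (cong₂ _+_ (length-map (x ,_) ys) (length-product xs ys))

length≤above : ∀ T A → Unique A → length A ≤ length (filter (T <?_) A) + suc T
length≤above T A u = subst (length A ≤_) (trans (length-++ (filter (T <?_) A)) (cong (_+_ (length (filter (T <?_) A))) (length-upTo (suc T))))
  (card-⊆ u covered)
  where
  covered : ∀ a → a ∈ A → a ∈ filter (T <?_) A ++ upTo (suc T)
  covered a a∈ with T <? a
  ... | yes T<a = ∈-++⁺ˡ (∈-filter⁺ (T <?_) a∈ T<a)
  ... | no T≮a = ∈-++⁺ʳ (filter (T <?_) A) (∈-upTo⁺ (s≤s (≮⇒≥ T≮a)))

∈-take : ∀ {A : Set} k (xs : List A) {x} → x ∈ take k xs → x ∈ xs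
∈-take (suc k) (y ∷ xs) (here e) = here e
∈-take (suc k) (y ∷ xs) (there x∈) = there (∈-take k xs x∈)

length-take≤ : ∀ {A : Set} k (xs : List A) → k ≤ length xs → length (take k xs) ≡ k
length-take≤ k xs le = trans (length-take k xs) (m≤n⇒m⊓n≡m le)

module Growth (D : Decomposition) where
  open Decomposition D
  open OneSided D

  prime-pairs : ∀ n → length (primes (2 ^ n)) ≤ P₀ + length (LA n) * length (LB n)
  prime-pairs n = subst (length (primes (2 ^ n)) ≤_)
    (trans (length-++ (upTo P₀)) (cong₂ _+_ (length-upTo P₀) (trans (length-map add (cartesianProduct (LA n) (LB n))) (length-product (LA n) (LB n)))))
    (card-⊆ (primes-unique (2 ^ n)) covered)
    where
    add : ℕ × ℕ → ℕ
    add (a , b) = a + b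
    covered : ∀ p → p ∈ primes (2 ^ n) → p ∈ upTo P₀ ++ map add (cartesianProduct (LA n) (LB n))
    covered p p∈ with ∈-primes⁻ (2 ^ n) p∈ | P₀ ≤? p
    ... | pp , p≤ | no P₀≰p = ∈-++⁺ˡ (∈-upTo⁺ (≰⇒> P₀≰p))
    ... | pp , p≤ | yes P₀≤p with cover n p pp P₀≤p p≤
    ...   | a , b , a∈ , b∈ , refl = ∈-++⁺ʳ (upTo P₀) (∈-map⁺ add (∈-cartesianProduct⁺ a∈ b∈))

  pairs-bound : Σ ℕ λ n₁ → ∀ n → n₁ ≤ n → 2 ^ n ≤ 2 * n * (length (LA n) * length (LB n))
  pairs-bound with exp-beats-linear (2 * P₀ + 4)
  ... | l₀ , beats = suc l₀ , λ n n> → +-cancelʳ-≤ (2 ^ n) _ _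
    (≤-trans (≤-reflexive (lem₀ (2 ^ n)))
      (≤-trans (*-monoʳ-≤ 2 (≤-trans (chebyshev n (≤-trans (s≤s z≤n) n>)) (+-monoˡ-≤ 2 (*-monoʳ-≤ n (prime-pairs n)))))
        (≤-trans (≤-reflexive (lem₁ n P₀ (length (LA n) * length (LB n))))
          (+-monoʳ-≤ (2 * n * (length (LA n) * length (LB n)))
            (≤-trans (m≤m+n (2 * (n * P₀ + 2)) (2 * P₀ + 4 * n)) (≤-trans (≤-reflexive (lem₂ n P₀)) (<⇒≤ (beats n (<⇒≤ n>)))))))))
    where
    lem₀ : ∀ x → x + x ≡ 2 * x
    lem₀ = ℕS.solve-∀
    lem₁ : ∀ n P x → 2 * (n * (P + x) + 2) ≡ 2 * n * x + 2 * (n * P + 2)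
    lem₁ = ℕS.solve-∀
    lem₂ : ∀ n P → 2 * (n * P + 2) + (2 * P + 4 * n) ≡ (2 * P + 4) * suc n
    lem₂ = ℕS.solve-∀

  few-from-sieve : ∀ β B → Unique B → (∀ b → b ∈ B → b < 2 ^ β) → ∀ k → 1 ≤ length B → ∀ N c →
    let open Weights (bigPrime (2 ^ β)) (λ p → cnt p (negClass B p)) ; y = 2 ^ (k * length B) in
    N ≡ 0 ⊎ 1 ≤ W y → N * L y y ≤ c * W y → N * k ^ length B ≤ c * (2 * 2 ^ β) ^ length B
  few-from-sieve β B uB hB k κ≥1 N c (inj₁ refl) _ = z≤n
  few-from-sieve β B uB hB k κ≥1 N c (inj₂ Wω≥1) sieved₀ = *-cancelʳ-≤ _ _ (W₁ ^ κ * Wκ * Wω)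
      {{m*n≢0 (W₁ ^ κ * Wκ) Wω {{m*n≢0 (W₁ ^ κ) Wκ {{m^n≢0 W₁ κ {{>-nonZero W₁≥1}}}} {{>-nonZero Wκ≥1}}}} {{>-nonZero Wω≥1}}}}
    (≤-trans (≤-reflexive (lem₁ (N) (k ^ κ) (W₁ ^ κ) Wκ Wω))
      (≤-trans (*-monoʳ-≤ (N * Wκ * Wω) (subst₂ _≤_ (^-distribʳ-* κ k W₁) (^-distribʳ-* κ (2 * b) L₁) (^-monoˡ-≤ κ logs)))
        (≤-trans (≤-reflexive (lem₂ (N) Wκ Wω ((2 * b) ^ κ) (L₁ ^ κ)))
          (≤-trans (*-monoʳ-≤ (N * Wω * (2 * b) ^ κ) power)
            (≤-trans (≤-reflexive (lem₃ (N) Wω ((2 * b) ^ κ) Lκ (W₁ ^ κ)))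
              (≤-trans (*-monoʳ-≤ (N * (2 * b) ^ κ * W₁ ^ κ) by-ω)
                (≤-trans (≤-reflexive (lem₄ (N) ((2 * b) ^ κ) (W₁ ^ κ) Lω Wκ))
                  (≤-trans (*-monoʳ-≤ ((2 * b) ^ κ * W₁ ^ κ * Wκ) sieved)
                    (≤-reflexive (lem₅ c ((2 * b) ^ κ) (W₁ ^ κ) Wκ Wω))))))))))
    where
    κ = length B
    b = 2 ^ β
    sel = bigPrime b
    y = 2 ^ (k * κ)
    Q = (2 ^ k) ^ κ
    Q≡y : Q ≡ y
    Q≡y = ^-*-assoc 2 k κ
    module P = Powers sel
    ω : ℕ → ℕ
    ω p = cnt p (negClass B p)
    module O = Weights sel ω
    W₁ = P.W 1 y
    L₁ = P.L 1 y (2 ^ k)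
    Wκ = P.W κ y
    Lκ = P.L κ y Q
    Wω = O.W y
    Lω = O.L y Q
    κ≤b : κ ≤ b
    κ≤b = subst (κ ≤_) (length-upTo b) (card-⊆ uB λ x x∈ → ∈-upTo⁺ (hB x x∈))
    W₁≥1 : 1 ≤ W₁
    W₁≥1 = P.W≥1 1 (λ p e → prime≥2 (proj₁ (bigPrime⁻ b p e))) y
    Wκ≥1 : 1 ≤ Wκ
    Wκ≥1 = P.W≥1 κ (λ p e → ≤-<-trans κ≤b (proj₂ (bigPrime⁻ b p e))) y
    κ≤ω : ∀ p → sel p ≡ true → κ ≤ ω p
    κ≤ω zero    e = ⊥-elim (¬prime[0] (proj₁ (bigPrime⁻ b 0 e)))
    κ≤ω (suc q) e = subst (κ ≤_) (trans (cong (_+_ (ω (suc q))) (no-collisions (suc q) B b uB (λ x x∈ → hB x x∈) (proj₂ (bigPrime⁻ b (suc q) e)))) (+-identityʳ (ω (suc q))))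
      (length≤classes+collisions q B)
    ω≤ : ∀ p → ω p ≤ p
    ω≤ p = cnt≤ p (negClass B p)
    k≤kκ : 1 ≤ κ → 2 ^ k ≤ y
    k≤kκ κ≥1 = 2^-mono (subst (_≤ k * κ) (*-identityʳ k) (*-monoʳ-≤ k κ≥1))
    logs : k * W₁ ≤ 2 * b * L₁
    logs = L-log b (m^n>0 2 β) k y (k≤kκ κ≥1)
    power : L₁ ^ κ * Wκ ≤ Lκ * W₁ ^ κ
    power = P.L-power κ (λ p e → ≤-<-trans κ≤b (proj₂ (bigPrime⁻ b p e))) y (2 ^ k) (m^n>0 2 k)
    by-ω : Lκ * Wω ≤ Lω * Wκ
    by-ω = L-mono-ω sel (λ _ → κ) ω κ≤ω (λ p _ → ω≤ p) y Q
    sieved : N * Lω ≤ c * Wω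
    sieved = subst (λ q → N * O.L y q ≤ c * Wω) (sym Q≡y) sieved₀
    lem₁ : ∀ a k w v u → a * k * (w * v * u) ≡ a * v * u * (k * w)
    lem₁ = ℕS.solve-∀
    lem₂ : ∀ a v u b l → a * v * u * (b * l) ≡ a * u * b * (l * v)
    lem₂ = ℕS.solve-∀
    lem₃ : ∀ a u b l w → a * u * b * (l * w) ≡ a * b * w * (l * u)
    lem₃ = ℕS.solve-∀
    lem₄ : ∀ a b w l v → a * b * w * (l * v) ≡ b * w * v * (a * l)
    lem₄ = ℕS.solve-∀
    lem₅ : ∀ x b w v u → b * w * v * (x * u) ≡ x * b * (w * v * u)
    lem₅ = ℕS.solve-∀

  sieve-few : ∀ M → Pure M → ∀ β B → Unique B → (∀ b → b ∈ B → b ∈ LB M × b < 2 ^ β) →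
    ∀ J n k → 1 ≤ length B → let x = k * length B in 3 + 2 * x + 2 * x + 2 * x * suc J ≤ n * J →
    ∀ A → Unique A → (∀ a → a ∈ A → a ∈ LA M × a < 2 ^ n × 2 ^ (k * length B) < a × N₀ ≤ a) →
    length A * k ^ length B ≤ 2 * (suc J * 2 ^ n) * (2 * 2 ^ β) ^ length B
  sieve-few M pure β B uB hB J n k κ≥1 exponents A uA hA =
    few-from-sieve β B uB (λ b b∈ → proj₂ (hB b b∈)) k κ≥1 (length A) (2 * (suc J * 2 ^ n)) (proj₁ sieved) (proj₂ sieved)
    where
    x = k * length B
    sieved = sieve-by M pure B (λ b b∈ → proj₁ (hB b b∈)) (bigPrime (2 ^ β)) (λ p e → proj₁ (bigPrime⁻ (2 ^ β) p e))
      J (2 ^ n) {{m^n≢0 2 n}} (2 ^ x) (2 ^ x) A uA hA (m^n>0 2 x) (sieve-exponents J n x x exponents)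

  sieve-few-exponents : ∀ n x → 2 ≤ n → 4 * x ≤ n → 3 + 2 * x + 2 * x + 2 * x * 9 ≤ n * 8
  sieve-few-exponents n x n≥2 4x≤n = *-cancelˡ-≤ 4 (≤-trans (≤-reflexive (lem x))
      (≤-trans (+-mono-≤ (*-monoʳ-≤ 6 n≥2) (*-monoʳ-≤ 22 4x≤n)) (≤-trans (m≤m+n _ (4 * n)) (≤-reflexive (lem₂ n)))))
    where
    lem : ∀ x → 4 * (3 + 2 * x + 2 * x + 2 * x * 9) ≡ 6 * 2 + 22 * (4 * x)
    lem = ℕS.solve-∀
    lem₂ : ∀ n → 6 * n + 22 * n + 4 * n ≡ 4 * (n * 8)
    lem₂ = ℕS.solve-∀

  C-few : ℕ → ℕ → ℕ → ℕ
  C-few J κ β = (8 * κ) ^ κ * (2 * suc J * (2 * 2 ^ β) ^ κ)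

  -- A κ-dimensional sieve: |A| = O(2ⁿ / n^κ), while |A||B| is at least the number of primes.
  grow-by : ∀ J → J ≡ 8 → ∀ κ β → 1 ≤ κ → Σ ℕ λ C → Σ ℕ λ n₁ → 1 ≤ C × (∀ n → n₁ ≤ n → ∀ M → n ≤ M → Pure M →
    ∀ B → Unique B → length B ≡ κ → (∀ b → b ∈ B → b ∈ LB M × b < 2 ^ β) → n ^ κ ≤ C * (n * length (LB n)))
  grow-by J J≡8 κ β κ≥1 with log-small (2 * (κ + N₀ + 2)) | pairs-bound
  ... | nl , small | np , pairs = 2 * suc (C-few J κ β) , n₀ + (8 * κ + (2 + (nl + np))) , s≤s z≤n , go
    where
    go : ∀ n → n₀ + (8 * κ + (2 + (nl + np))) ≤ n → ∀ M → n ≤ M → Pure M →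
      ∀ B → Unique B → length B ≡ κ → (∀ b → b ∈ B → b ∈ LB M × b < 2 ^ β) → n ^ κ ≤ 2 * suc (C-few J κ β) * (n * length (LB n))
    go n n≥ M n≤M pure B uB refl hB = *-cancelˡ-≤ (2 ^ n) {{m^n≢0 2 n}}
      (≤-trans (*-monoˡ-≤ (n ^ κ) (pairs n np≤))
        (≤-trans (≤-reflexive (lem₁ n (length (LA n)) (length (LB n)) (n ^ κ)))
          (≤-trans (*-monoʳ-≤ (2 * n * length (LB n)) few)
            (≤-reflexive (lem₂ n (length (LB n)) (C-few J κ β) (2 ^ n))))))
      where
      lem₁ : ∀ n x z y → 2 * n * (x * z) * y ≡ 2 * n * z * (x * y)
      lem₁ = ℕS.solve-∀
      lem₂ : ∀ n z C x → 2 * n * z * (suc C * x) ≡ x * (2 * suc C * (n * z))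
      lem₂ = ℕS.solve-∀
      rest₁ : 8 * κ + (2 + (nl + np)) ≤ n
      rest₁ = m+n≤o⇒n≤o n₀ n≥
      rest₂ : 2 + (nl + np) ≤ n
      rest₂ = m+n≤o⇒n≤o (8 * κ) rest₁
      rest₃ : nl + np ≤ n
      rest₃ = m+n≤o⇒n≤o 2 rest₂
      n≥2 : 2 ≤ n
      n≥2 = m+n≤o⇒m≤o 2 rest₂
      np≤ : np ≤ n
      np≤ = m+n≤o⇒n≤o nl rest₃
      8κ≤n : 8 * κ ≤ n
      8κ≤n = m+n≤o⇒m≤o (8 * κ) rest₁
      instance
        nz4κ : NonZero (4 * κ)
        nz4κ = m*n≢0 4 κ {{_}} {{>-nonZero κ≥1}}
      k = n / (4 * κ)
      k4κ≤n : 4 * (k * κ) ≤ n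
      k4κ≤n = subst (_≤ n) (lem k κ) (m/n*n≤m n (4 * κ))
        where
        lem : ∀ k κ → k * (4 * κ) ≡ 4 * (k * κ)
        lem = ℕS.solve-∀
      n≤8κk : n ≤ 8 * κ * k
      n≤8κk = +-cancelʳ-≤ n _ _ (≤-trans (≤-reflexive (cong (_+_ n) (sym (+-identityʳ n))))
        (≤-trans (*-monoʳ-≤ 2 (<⇒≤ (subst (_< 4 * κ + k * (4 * κ)) (sym (m≡m%n+[m/n]*n n (4 * κ))) (+-monoˡ-< (k * (4 * κ)) (m%n<n n (4 * κ))))))
          (≤-trans (≤-reflexive (lem κ k)) (+-monoʳ-≤ (8 * κ * k) 8κ≤n))))
        where
        lem : ∀ κ k → 2 * (4 * κ + k * (4 * κ)) ≡ 8 * κ * k + 8 * κ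
        lem = ℕS.solve-∀
      T = 2 ^ (k * κ) + N₀
      A′ = filter (T <?_) (LA n)
      hA′ : ∀ a → a ∈ A′ → a ∈ LA M × a < 2 ^ n × 2 ^ (k * κ) < a × N₀ ≤ a
      hA′ a a∈ with ∈-filter⁻ (T <?_) {xs = LA n} a∈
      ... | a∈LA , T<a = LA-mono n≤M a a∈LA , LA-bound n (m+n≤o⇒m≤o n₀ n≥) a a∈LA , ≤-<-trans (m≤m+n _ N₀) T<a , <⇒≤ (≤-<-trans (m≤n+m N₀ _) T<a)
      exponents : let x = k * κ in 3 + 2 * x + 2 * x + 2 * x * suc J ≤ n * J
      exponents = subst (λ J → let x = k * κ in 3 + 2 * x + 2 * x + 2 * x * suc J ≤ n * J) (sym J≡8) (sieve-few-exponents n (k * κ) n≥2 k4κ≤n)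
      large : length A′ * n ^ κ ≤ C-few J κ β * 2 ^ n
      large = ≤-trans (*-monoʳ-≤ (length A′) (subst (n ^ κ ≤_) (^-distribʳ-* κ (8 * κ) k) (^-monoˡ-≤ κ n≤8κk)))
        (≤-trans (≤-reflexive (lem (length A′) ((8 * κ) ^ κ) (k ^ κ)))
          (≤-trans (*-monoʳ-≤ ((8 * κ) ^ κ) (sieve-few M pure β B uB hB J n k κ≥1 exponents A′ (filter⁺ (T <?_) (LA-unique n)) hA′))
            (≤-reflexive (lem′ ((8 * κ) ^ κ) (suc J) (2 ^ n) ((2 * 2 ^ β) ^ κ)))))
        where
        lem : ∀ a c k → a * (c * k) ≡ c * (a * k)
        lem = ℕS.solve-∀
        lem′ : ∀ c j x b → c * (2 * (j * x) * b) ≡ c * (2 * j * b) * x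
        lem′ = ℕS.solve-∀
      smallT : suc T * n ^ κ ≤ 2 ^ n
      smallT with log2 n (<⇒≤ n≥2)
      ... | l , n≤2^l , 2^l≤2n = ≤-trans (*-mono-≤ sucT (≤-trans (^-monoˡ-≤ κ n≤2^l) (≤-reflexive (^-*-assoc 2 l κ))))
          (≤-trans (≤-reflexive (pow+ (k * κ + (N₀ + 2)) (l * κ))) (2^-mono exponent))
        where
        sucT : suc T ≤ 2 ^ (k * κ + (N₀ + 2))
        sucT = subst (suc T ≤_) (pow+ (k * κ) (N₀ + 2)) (≤-trans (≤-trans (≤-reflexive (sym (+-suc (2 ^ (k * κ)) N₀)))
            (+-mono-≤ (≤-reflexive (sym (*-identityʳ _))) (≤-trans (≤-reflexive (sym (*-identityˡ (suc N₀)))) (*-monoˡ-≤ (suc N₀) (m^n>0 2 (k * κ))))))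
          (≤-trans (≤-reflexive (sym (*-distribˡ-+ (2 ^ (k * κ)) 1 (suc N₀)))) (*-monoʳ-≤ (2 ^ (k * κ)) (subst (_≤ 2 ^ (N₀ + 2)) (+-comm N₀ 2) (<⇒≤ (n<2^n (N₀ + 2)))))))
        exponent : k * κ + (N₀ + 2) + l * κ ≤ n
        exponent = *-cancelˡ-≤ 2 (≤-trans (≤-trans (m≤m+n _ (2 * (k * κ) + (2 * κ + 2 * l * (N₀ + 2)))) (≤-reflexive (lem (k * κ) κ l N₀)))
          (≤-trans (+-mono-≤ k4κ≤n (small n (m+n≤o⇒m≤o nl rest₃) l (≤-trans 2^l≤2n (*-monoˡ-≤ n (*-monoʳ-≤ 2 (≤-trans (s≤s z≤n) (m≤n+m 2 (κ + N₀))))))))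
            (≤-reflexive (cong (_+_ n) (sym (+-identityʳ n))))))
          where
          lem : ∀ x κ l N → 2 * (x + (N + 2) + l * κ) + (2 * x + (2 * κ + 2 * l * (N + 2))) ≡ 4 * x + 2 * (κ + N + 2) * suc l
          lem = ℕS.solve-∀
      few : length (LA n) * n ^ κ ≤ suc (C-few J κ β) * 2 ^ n
      few = ≤-trans (*-monoˡ-≤ (n ^ κ) (length≤above T (LA n) (LA-unique n)))
        (≤-trans (≤-reflexive (*-distribʳ-+ (n ^ κ) (length A′) (suc T)))
          (≤-trans (+-mono-≤ large smallT) (≤-reflexive (+-comm (C-few J κ β * 2 ^ n) (2 ^ n)))))

  grow : ∀ κ β → 1 ≤ κ → Σ ℕ λ C → Σ ℕ λ n₁ → 1 ≤ C × (∀ n → n₁ ≤ n → ∀ M → n ≤ M → Pure M →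
    ∀ B → Unique B → length B ≡ κ → (∀ b → b ∈ B → b ∈ LB M × b < 2 ^ β) → n ^ κ ≤ C * (n * length (LB n)))
  grow = grow-by 8 refl

  poly-growth : ∀ e → Σ ℕ λ n₁ → ∀ n → n₁ ≤ n → ∀ M → n ≤ M → Pure M → n ^ e ≤ length (LB n)
  poly-growth e with grow 2 n₀ (s≤s z≤n)
  ... | C₂ , n₂ , C₂≥1 , grow₂ = n₃ + (proj₁ (proj₂ g) + C) , go
    where
    κ = e + 2
    n₃ = n₀ + (n₂ + suc (C₂ * κ))
    g = grow κ n₃ (≤-trans (s≤s z≤n) (m≤n+m 2 e))
    C = proj₁ g
    κ≤ : ∀ M → n₃ ≤ M → Pure M → κ ≤ length (LB n₃)
    κ≤ M n₃≤M pure = *-cancelˡ-≤ C₂ {{>-nonZero C₂≥1}} (≤-trans (≤-trans (n≤1+n (C₂ * κ)) (≤-trans (m≤n+m _ n₂) (m≤n+m _ n₀)))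
      (*-cancelˡ-≤ n₃ {{>-nonZero (≤-trans (s≤s z≤n) (≤-trans (m≤n+m (suc (C₂ * κ)) n₂) (m≤n+m _ n₀)))}}
        (subst₂ _≤_ (cong (n₃ *_) (*-identityʳ n₃)) (lem C₂ n₃ (length (LB n₃)))
          (grow₂ n₃ (≤-trans (m≤m+n n₂ _) (m≤n+m _ n₀)) M n₃≤M pure (take 2 (LB n₀)) (take⁺ 2 (LB-unique n₀)) (length-take≤ 2 (LB n₀) LB-two)
            λ b b∈ → LB-mono (≤-trans (m≤m+n n₀ _) n₃≤M) b (∈-take 2 (LB n₀) b∈) , LB-bound n₀ ≤-refl b (∈-take 2 (LB n₀) b∈)))))
      where
      lem : ∀ C n x → C * (n * x) ≡ n * (C * x)
      lem = ℕS.solve-∀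
    go : ∀ n → n₃ + (proj₁ (proj₂ g) + C) ≤ n → ∀ M → n ≤ M → Pure M → n ^ e ≤ length (LB n)
    go n n≥ M n≤M pure = *-cancelˡ-≤ (n * n) {{m*n≢0 n n {{nzn}} {{nzn}}}}
      (≤-trans (≤-reflexive (trans (*-comm (n * n) (n ^ e)) (trans (cong (n ^ e *_) (cong (n *_) (sym (*-identityʳ n)))) (sym (^-distribˡ-+-* n e 2)))))
        (≤-trans (proj₂ (proj₂ (proj₂ g)) n (m+n≤o⇒m≤o _ (m+n≤o⇒n≤o n₃ n≥)) M n≤M pure (take κ (LB n₃)) (take⁺ κ (LB-unique n₃))
            (length-take≤ κ (LB n₃) (κ≤ M n₃≤M pure))
            λ b b∈ → LB-mono n₃≤M b (∈-take κ (LB n₃) b∈) , LB-bound n₃ (m≤m+n n₀ _) b (∈-take κ (LB n₃) b∈))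
          (≤-trans (*-monoˡ-≤ (n * length (LB n)) (m+n≤o⇒n≤o _ (m+n≤o⇒n≤o n₃ n≥))) (≤-reflexive (sym (*-assoc n n (length (LB n))))))))
      where
      n₃≤n : n₃ ≤ n
      n₃≤n = m+n≤o⇒m≤o n₃ n≥
      n₃≤M : n₃ ≤ M
      n₃≤M = ≤-trans n₃≤n n≤M
      nzn : NonZero n
      nzn = >-nonZero (≤-trans (≤-trans (s≤s z≤n) (≤-trans (m≤n+m (suc (C₂ * κ)) n₂) (m≤n+m _ n₀))) n₃≤n)

!≤^ : ∀ k c → k ≤ c → k ! ≤ c ^ k
!≤^ zero    c _ = ≤-refl
!≤^ (suc k) c k<c = *-mono-≤ k<c (!≤^ k c (<⇒≤ k<c))

module Bounds (D : Decomposition) where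
  open Decomposition D
  open OneSided D
  open Growth D

  module _ (M : ℕ) (pure : Pure M) (n : ℕ) (n₀≤n : n₀ ≤ n) (n≤M : n ≤ M) (l d k : ℕ)
    (n≤2^l : n ≤ 2 ^ l) (l≥2 : 2 ≤ l) (many : 2 ^ suc d ≤ length (LB n)) where
    private
      g w h V y : ℕ
      g = d + l + 2
      w = 2 * l + 4
      h = d + w
      V = 2 ^ w
      y = 2 ^ h
      B : List ℕ
      B = take (2 ^ suc d) (LB n)
      ω : ℕ → ℕ
      ω p = cnt p (negClass B p)
      sel : ℕ → Bool
      sel p = isPrime p ∧ does (p ≤? ω p * V)
      bad? : ∀ p → Dec (¬ (p ≤ ω p * V))
      bad? p = ¬? (p ≤? ω p * V)
      bad : List ℕ
      bad = filter bad? (primes y)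
      module O = Weights sel ω

    private
      length-B : length B ≡ 2 ^ suc d
      length-B = length-take≤ (2 ^ suc d) (LB n) many

      bad-collisions : ∀ p → p ∈ bad → 2 ^ d ≤ collisions p B
      bad-collisions p p∈ with ∈-filter⁻ bad? {xs = primes y} p∈
      bad-collisions zero    p∈ | p∈′ , _ = ⊥-elim (¬prime[0] (proj₁ (∈-primes⁻ y p∈′)))
      bad-collisions (suc q) p∈ | p∈′ , sparse = +-cancelˡ-≤ (2 ^ d) _ _
        (≤-trans (≤-reflexive (trans (cong (_+_ (2 ^ d)) (sym (+-identityʳ (2 ^ d)))) (sym length-B)))
          (≤-trans (length≤classes+collisions q B) (+-monoˡ-≤ (collisions (suc q) B) (<⇒≤ ω<))))
        where
        ω< : ω (suc q) < 2 ^ d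
        ω< = *-cancelʳ-< V (ω (suc q)) (2 ^ d) (<-≤-trans (≰⇒> sparse)
          (subst (suc q ≤_) (sym (pow+ d w)) (proj₂ (∈-primes⁻ y p∈′))))

      length-bad : length bad ≤ 2 ^ g
      length-bad = *-cancelʳ-≤ _ _ (2 ^ d) {{m^n≢0 2 d}}
        (≤-trans (sumOver-≥ bad (λ p → collisions p B) (2 ^ d) bad-collisions)
          (≤-trans (collisions≤ n bad (filter⁺ bad? (primes-unique y))
              (λ p p∈ → proj₁ (∈-primes⁻ y (proj₁ (∈-filter⁻ bad? {xs = primes y} p∈))))
              B (take⁺ _ (LB-unique n)) λ b b∈ → LB-bound n n₀≤n b (∈-take _ (LB n) b∈))
            (subst (λ m → m * (m * n) ≤ 2 ^ g * 2 ^ d) (sym length-B)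
              (≤-trans (*-monoʳ-≤ (2 ^ suc d) (*-monoʳ-≤ (2 ^ suc d) n≤2^l))
                (≤-reflexive (trans (cong (2 ^ suc d *_) (pow+ (suc d) l)) (trans (pow+ (suc d) (suc d + l))
                  (trans (cong (2 ^_) (lem d l)) (sym (pow+ g d))))))))))
        where
        lem : ∀ d l → suc d + (suc d + l) ≡ d + l + 2 + d
        lem = ℕS.solve-∀

      many-primes : h ≤ 2 ^ l → 4 * 2 ^ g ≤ length (primes y)
      many-primes h≤ = ≤-pred (*-cancelˡ-< (2 ^ l) (4 * 2 ^ g) (suc (length (primes y))) (≤-<-trans (≤-reflexive eq)
        (≤-<-trans (≤-trans (chebyshev h (≤-trans (≤-trans (s≤s z≤n) (m≤n+m 4 (2 * l))) (m≤n+m w d))) (+-monoˡ-≤ 2 (*-monoˡ-≤ (length (primes y)) h≤)))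
          (<-≤-trans (+-monoʳ-< (2 ^ l * length (primes y)) {2} {2 ^ l} (<-≤-trans (s≤s (s≤s (s≤s z≤n))) (2^-mono l≥2)))
            (≤-reflexive (trans (+-comm (2 ^ l * length (primes y)) (2 ^ l)) (sym (*-suc (2 ^ l) (length (primes y))))))))))
        where
        eq : 2 ^ l * (4 * 2 ^ g) ≡ 2 ^ h
        eq = trans (cong (2 ^ l *_) (pow+ 2 g)) (trans (pow+ l (2 + g)) (cong (2 ^_) (lem d l)))
          where
          lem : ∀ d l → l + (2 + (d + l + 2)) ≡ d + (2 * l + 4)
          lem = ℕS.solve-∀

      split-primes : length (primes y) ≤ length bad + cnt y (sel ∘ suc)
      split-primes = subst (length (primes y) ≤_) (trans (length-++ bad) (cong (_+_ (length bad))
          (trans (length-map suc (trues y (sel ∘ suc))) (length-trues y (sel ∘ suc)))))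
        (card-⊆ (primes-unique y) covered)
        where
        covered : ∀ p → p ∈ primes y → p ∈ bad ++ map suc (trues y (sel ∘ suc))
        covered p p∈ with p ≤? ω p * V
        covered p p∈ | no sparse = ∈-++⁺ˡ (∈-filter⁺ bad? p∈ sparse)
        covered zero p∈ | yes _ = ⊥-elim (¬prime[0] (proj₁ (∈-primes⁻ y p∈)))
        covered (suc q) p∈ | yes dense = ∈-++⁺ʳ bad (∈-map⁺ suc (∈-trues y (sel ∘ suc) q (proj₂ (∈-primes⁻ y p∈))
          (cong₂ _∧_ (dec-true (prime? (suc q)) (proj₁ (∈-primes⁻ y p∈))) (dec-true (suc q ≤? ω (suc q) * V) dense))))

      many-selected : h ≤ 2 ^ l → k ≤ 2 ^ g → 2 ^ g ≤ cnt y (sel ∘ suc) ∸ k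
      many-selected h≤ k≤ = m+n≤o⇒m≤o∸n (2 ^ g) (+-cancelʳ-≤ (2 ^ g) _ _
        (≤-trans (+-monoˡ-≤ (2 ^ g) (+-monoʳ-≤ (2 ^ g) k≤)) (≤-trans (≤-trans (m≤m+n _ (2 ^ g)) (≤-reflexive (lem (2 ^ g))))
          (≤-trans (many-primes h≤) (≤-trans split-primes (≤-trans (+-monoˡ-≤ _ length-bad) (≤-reflexive (+-comm (2 ^ g) _))))))))
        where
        lem : ∀ x → x + x + x + x ≡ 4 * x
        lem = ℕS.solve-∀

    sieve-dense : ∀ J → h ≤ 2 ^ l → k ≤ 2 ^ g → k ≤ 2 ^ l →
      3 + 2 * (h * k) + 2 * h + 2 * (h * k) * suc J ≤ n * J →
      ∀ A → Unique A → (∀ a → a ∈ A → a ∈ LA M × a < 2 ^ n × y < a × N₀ ≤ a) →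
      length A * 2 ^ (g * k) ≤ 2 * (suc J * 2 ^ n) * (2 ^ (w * k) * 2 ^ (l * k))
    sieve-dense J h≤ k≤g k≤l exponents A uA hA with sieve-by M pure B
        (λ b b∈ → LB-mono n≤M b (∈-take _ (LB n) b∈)) sel (λ p e → isPrime⁻ p (∧-true₁ e)) J (2 ^ n) {{m^n≢0 2 n}} y (2 ^ (h * k)) A uA hA
        (m^n>0 2 (h * k)) (sieve-exponents J n h (h * k) exponents)
    ... | inj₁ empty , _ = subst (λ t → t * 2 ^ (g * k) ≤ 2 * (suc J * 2 ^ n) * (2 ^ (w * k) * 2 ^ (l * k))) (sym empty) z≤n
    ... | inj₂ W≥1 , sieved = *-cancelʳ-≤ _ _ (O.W y) {{>-nonZero W≥1}}
      (≤-trans (≤-reflexive (lem₁ (length A) (2 ^ (g * k)) (O.W y)))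
        (≤-trans (*-monoʳ-≤ (length A) (≤-trans (*-monoʳ-≤ (O.W y) (≤-trans (≤-reflexive (sym (^-*-assoc 2 g k))) (^-monoˡ-≤ k (many-selected h≤ k≤g))))
            (L-count sel ω V y dense (m^n>0 2 h) y k ≤-refl)))
          (≤-trans (≤-reflexive (trans (sym (*-assoc (length A) (O.L y (y ^ k)) (V ^ k * k !))) (cong (λ q → length A * O.L y q * (V ^ k * k !)) (^-*-assoc 2 h k))))
            (≤-trans (*-mono-≤ sieved (*-mono-≤ (≤-reflexive (^-*-assoc 2 w k)) (≤-trans (!≤^ k (2 ^ l) k≤l) (≤-reflexive (^-*-assoc 2 l k)))))
              (≤-reflexive (lem₂ (2 * (suc J * 2 ^ n)) (O.W y) (2 ^ (w * k) * 2 ^ (l * k))))))))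
      where
      dense : ∀ p → sel p ≡ true → p ∸ ω p ≤ ω p * V
      dense p e = ≤-trans (m∸n≤m p (ω p)) (does-true⁻ (p ≤? ω p * V) (∧-true₂ e))
      lem₁ : ∀ a x w → a * x * w ≡ a * (w * x)
      lem₁ = ℕS.solve-∀
      lem₂ : ∀ x w v → x * w * v ≡ x * v * w
      lem₂ = ℕS.solve-∀

  private module UpperAt (s′ : ℕ) where
    s e : ℕ
    s = suc s′
    e = 10 * s + N₀ + 10

    module At
      (nl : ℕ) (small : ∀ n → nl ≤ n → ∀ l → 2 ^ l ≤ 2 * s * e * n → 2 * s * e * suc l ≤ n)
      (ng : ℕ) (growth : ∀ n → ng ≤ n → ∀ M → n ≤ M → Pure M → n ^ (10 * s) ≤ length (LB n))
      (l₀ : ℕ) (beats : ∀ l → l₀ ≤ l → 5 * s * suc l < 2 ^ l)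
      (r : ℕ) (r> : n₀ + (nl + (ng + 2 ^ (l₀ + 6))) < r) (M : ℕ) (n≤M : 2 * s * r ≤ M) (pure : Pure M)
      (A : List ℕ) (uA : Unique A) (hA : ∀ a → a ∈ A → a ∈ LA M × a < 2 ^ (2 * s * r)) where

      n = 2 * s * r
      r≥1 : 1 ≤ r
      r≥1 = ≤-trans (s≤s z≤n) r>
      r≤n : r ≤ n
      r≤n = subst (_≤ n) (*-identityˡ r) (*-monoˡ-≤ r {1} {2 * s} (s≤s z≤n))
      rest₀ : n₀ + (nl + (ng + 2 ^ (l₀ + 6))) ≤ n
      rest₀ = ≤-trans (<⇒≤ r>) r≤n
      rest₁ : nl + (ng + 2 ^ (l₀ + 6)) ≤ n
      rest₁ = m+n≤o⇒n≤o n₀ rest₀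
      rest₂ : ng + 2 ^ (l₀ + 6) ≤ n
      rest₂ = m+n≤o⇒n≤o nl rest₁
      n≥2 : 2 ≤ n
      n≥2 = ≤-trans (≤-trans (2^-mono {1} {l₀ + 6} (≤-trans (s≤s z≤n) (m≤n+m 6 l₀))) (m≤n+m (2 ^ (l₀ + 6)) ng)) rest₂
      lg = log2 n (<⇒≤ n≥2)
      l = proj₁ lg
      n≤2^l = proj₁ (proj₂ lg)
      2^l≤2n = proj₂ (proj₂ lg)
      l≥ : l₀ + 6 ≤ l
      l≥ = 2^-cancel-≤ (≤-trans (≤-trans (m≤n+m (2 ^ (l₀ + 6)) ng) rest₂) n≤2^l)
      l≥6 : 6 ≤ l
      l≥6 = ≤-trans (m≤n+m 6 l₀) l≥
      w = 2 * l + 4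
      h = 5 * s * l
      5l≤h : 5 * l ≤ h
      5l≤h = *-monoˡ-≤ l (m≤m*n 5 s)
      w≤h : w ≤ h
      w≤h = ≤-trans (≤-trans (+-monoʳ-≤ (2 * l) (≤-trans (≤-trans (m≤n+m 4 2) l≥6) (m≤m+n l (2 * l)))) (≤-reflexive (lem l))) 5l≤h
        where
        lem : ∀ l → 2 * l + (l + 2 * l) ≡ 5 * l
        lem = ℕS.solve-∀
      d = h ∸ w
      d+w : d + w ≡ h
      d+w = m∸n+n≡m w≤h
      g = d + l + 2
      g+ : g + (l + 2) ≡ h
      g+ = trans (lem d l) d+w
        where
        lem : ∀ d l → d + l + 2 + (l + 2) ≡ d + (2 * l + 4)
        lem = ℕS.solve-∀
      l≤g : l ≤ g
      l≤g = +-cancelʳ-≤ (l + 2) l g (≤-trans (≤-trans (+-monoʳ-≤ l (+-monoʳ-≤ l (≤-trans (≤-trans (m≤n+m 2 4) l≥6) (m≤m+n l (2 * l))))) (≤-reflexive (lem l))) (≤-trans 5l≤h (≤-reflexive (sym g+))))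
        where
        lem : ∀ l → l + (l + (l + 2 * l)) ≡ 5 * l
        lem = ℕS.solve-∀
      instance
        nzh : NonZero h
        nzh = >-nonZero (≤-trans (≤-trans (≤-trans (s≤s z≤n) l≥6) (m≤m+n l (4 * l))) 5l≤h)
      k = (s′ * r) / h
      hk≤ : h * k ≤ s′ * r
      hk≤ = subst (_≤ s′ * r) (*-comm k h) (m/n*n≤m (s′ * r) h)
      s′r≤ : s′ * r ≤ h * k + h
      s′r≤ = ≤-trans (≤-reflexive (m≡m%n+[m/n]*n (s′ * r) h)) (≤-trans (+-monoˡ-≤ (k * h) (<⇒≤ (m%n<n (s′ * r) h)))
        (≤-reflexive (trans (+-comm h (k * h)) (cong (_+ h) (*-comm k h)))))
      k≤2^l : k ≤ 2 ^ l
      k≤2^l = ≤-trans (m/n≤m (s′ * r) h) (≤-trans (*-monoˡ-≤ r (≤-trans (n≤1+n s′) (m≤n*m s 2))) n≤2^l)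
      e*l≤r : e * suc l ≤ r
      e*l≤r = *-cancelˡ-≤ (2 * s) (subst (_≤ n) (*-assoc (2 * s) e (suc l))
        (small n (m+n≤o⇒m≤o nl rest₁) l (≤-trans 2^l≤2n (*-monoˡ-≤ n
          (≤-trans (≤-trans (≤-reflexive (sym (*-identityʳ 2))) (*-monoʳ-≤ 2 (s≤s z≤n))) (m≤m*n (2 * s) e {{>-nonZero (≤-trans (s≤s z≤n) (m≤n+m 10 (10 * s + N₀)))}}))))))
      2h+ : 2 * h + (10 * s + N₀ + 10) ≤ r
      2h+ = ≤-trans (≤-trans (m≤m+n _ (l * N₀ + 10 * l)) (≤-reflexive (lem s l N₀))) e*l≤r
        where
        lem : ∀ s l N → 2 * (5 * s * l) + (10 * s + N + 10) + (l * N + 10 * l) ≡ (10 * s + N + 10) * suc l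
        lem = ℕS.solve-∀
      many : 2 ^ suc d ≤ length (LB n)
      many = ≤-trans (2^-mono (subst (suc d ≤_) d+w (≤-trans (≤-reflexive (+-comm 1 d)) (+-monoʳ-≤ d (≤-trans (s≤s z≤n) (m≤n+m 4 (2 * l)))))))
        (≤-trans (subst (_≤ n ^ (10 * s)) (trans (^-*-assoc 2 l (5 * s)) (cong (2 ^_) (*-comm l (5 * s))))
          (subst ((2 ^ l) ^ (5 * s) ≤_) (trans (cong (_^ (5 * s)) (cong (n *_) (sym (*-identityʳ n)))) (trans (^-*-assoc n 2 (5 * s)) (cong (n ^_) (sym (*-assoc 2 5 s)))))
            (^-monoˡ-≤ (5 * s) (≤-trans 2^l≤2n (*-monoˡ-≤ n n≥2)))))
          (growth n (m+n≤o⇒m≤o ng rest₂) M n≤M pure))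
      J = 3 * s
      exponents : 3 + 2 * ((d + w) * k) + 2 * (d + w) + 2 * ((d + w) * k) * suc J ≤ n * J
      exponents = subst (λ t → 3 + 2 * (t * k) + 2 * t + 2 * (t * k) * suc J ≤ n * J) (sym d+w) (≤-trans (+-mono-≤ (+-monoˡ-≤ (2 * h) (+-monoʳ-≤ 3 (*-monoʳ-≤ 2 hk≤))) (*-monoˡ-≤ (suc J) (*-monoʳ-≤ 2 hk≤)))
        (≤-trans (≤-reflexive (lem₁ s′ r h)) (≤-trans (+-monoʳ-≤ (2 * s′ * (3 * s + 2) * r) (≤-trans (≤-trans (+-monoʳ-≤ (2 * h) (≤-trans (s≤s (s≤s (s≤s (z≤n {7})))) (m≤n+m 10 (10 * s + N₀)))) 2h+) (m≤m+n r (2 * s′ * r + 5 * r))))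
          (≤-reflexive (lem₂ s′ r)))))
        where
        lem₁ : ∀ s r h → 3 + 2 * (s * r) + 2 * h + 2 * (s * r) * suc (3 * suc s) ≡ 2 * s * (3 * suc s + 2) * r + (2 * h + 3)
        lem₁ = ℕS.solve-∀
        lem₂ : ∀ s r → 2 * s * (3 * suc s + 2) * r + (r + (2 * s * r + 5 * r)) ≡ 2 * suc s * r * (3 * suc s)
        lem₂ = ℕS.solve-∀
      T = 2 ^ h + N₀
      A′ = filter (T <?_) A
      hA′ : ∀ a → a ∈ A′ → a ∈ LA M × a < 2 ^ n × 2 ^ (d + w) < a × N₀ ≤ a
      hA′ a a∈ = proj₁ (hA a a∈A) , proj₂ (hA a a∈A) , ≤-<-trans (subst (λ t → 2 ^ t ≤ T) (sym d+w) (m≤m+n (2 ^ h) N₀)) T<a ,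
          <⇒≤ (≤-<-trans (m≤n+m N₀ (2 ^ h)) T<a)
        where
        a∈A = proj₁ (∈-filter⁻ (T <?_) {xs = A} a∈)
        T<a = proj₂ (∈-filter⁻ (T <?_) {xs = A} a∈)
      h≤2^l : d + w ≤ 2 ^ l
      h≤2^l = subst (_≤ 2 ^ l) (sym d+w) (≤-trans (*-monoʳ-≤ (5 * s) (n≤1+n l)) (<⇒≤ (beats l (≤-trans (m≤m+n l₀ 6) l≥))))
      dense : length A′ * 2 ^ (g * k) ≤ 2 * (suc J * 2 ^ n) * (2 ^ (w * k) * 2 ^ (l * k))
      dense = sieve-dense M pure n (m+n≤o⇒m≤o n₀ rest₀) n≤M l d k n≤2^l (≤-trans (s≤s (s≤s z≤n)) l≥6) many J h≤2^l
        (≤-trans k≤2^l (2^-mono l≤g)) k≤2^l exponents A′ (filter⁺ (T <?_) uA) hA′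
      5lk≤r : 5 * l * k ≤ r
      5lk≤r = *-cancelˡ-≤ s (≤-trans (≤-reflexive (lem s l k)) (≤-trans hk≤ (*-monoˡ-≤ r (n≤1+n s′))))
        where
        lem : ∀ s l k → s * (5 * l * k) ≡ 5 * s * l * k
        lem = ℕS.solve-∀
      few : length A′ ≤ 2 ^ ((s′ + 4) * r)
      few = *-cancelʳ-≤ _ _ (2 ^ (s′ * r)) {{m^n≢0 2 (s′ * r)}}
        (≤-trans (*-monoʳ-≤ (length A′) (2^-mono (≤-trans s′r≤ (≤-reflexive (cong (λ t → t * k + h) (sym g+))))))
          (≤-trans (≤-reflexive (trans (cong (length A′ *_) (trans (cong (2 ^_) (lem₁ g l k h)) (sym (pow+ (g * k) ((l + 2) * k + h))))) (sym (*-assoc (length A′) _ _))))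
            (≤-trans (*-monoˡ-≤ (2 ^ ((l + 2) * k + h)) dense)
              (≤-trans (*-monoˡ-≤ (2 ^ ((l + 2) * k + h)) (*-monoˡ-≤ (2 ^ (w * k) * 2 ^ (l * k)) (*-monoʳ-≤ 2 (*-monoˡ-≤ (2 ^ n) (n<2^n J)))))
                (≤-trans (≤-reflexive collect) (≤-trans (2^-mono final) (≤-reflexive (sym (pow+ ((s′ + 4) * r) (s′ * r))))))))))
        where
        lem₁ : ∀ g l k h → (g + (l + 2)) * k + h ≡ g * k + ((l + 2) * k + h)
        lem₁ = ℕS.solve-∀
        collect : 2 * (2 ^ J * 2 ^ n) * (2 ^ (w * k) * 2 ^ (l * k)) * 2 ^ ((l + 2) * k + h) ≡ 2 ^ (suc (J + n) + (w * k + l * k) + ((l + 2) * k + h))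
        collect = trans (cong₂ (λ a b → 2 * a * b * 2 ^ ((l + 2) * k + h)) (pow+ J n) (pow+ (w * k) (l * k)))
          (trans (cong (_* 2 ^ ((l + 2) * k + h)) (pow+ (suc (J + n)) (w * k + l * k))) (pow+ (suc (J + n) + (w * k + l * k)) ((l + 2) * k + h)))
        final : suc (J + n) + (w * k + l * k) + ((l + 2) * k + h) ≤ (s′ + 4) * r + s′ * r
        final = ≤-trans (≤-reflexive (lem₂ s′ r l k h))
          (≤-trans (+-monoʳ-≤ (2 * suc s′ * r) (+-mono-≤ (≤-trans (*-monoˡ-≤ k (≤-trans (+-monoʳ-≤ (4 * l) l≥6) (≤-reflexive (lem₃ l)))) 5lk≤r)
              (≤-trans (≤-trans (m≤m+n (h + suc (3 * s)) (h + (7 * s + N₀ + 9))) (≤-reflexive (lem₄ h s N₀))) 2h+)))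
            (≤-reflexive (lem₅ s′ r)))
          where
          lem₂ : ∀ s r l k h → suc (3 * suc s + 2 * suc s * r) + ((2 * l + 4) * k + l * k) + ((l + 2) * k + h) ≡ 2 * suc s * r + ((4 * l + 6) * k + (h + suc (3 * suc s)))
          lem₂ = ℕS.solve-∀
          lem₃ : ∀ l → 4 * l + l ≡ 5 * l
          lem₃ = ℕS.solve-∀
          lem₄ : ∀ h s N → h + suc (3 * s) + (h + (7 * s + N + 9)) ≡ 2 * h + (10 * s + N + 10)
          lem₄ = ℕS.solve-∀
          lem₅ : ∀ s r → 2 * suc s * r + (r + r) ≡ (s + 4) * r + s * r
          lem₅ = ℕS.solve-∀
      smallT : suc T ≤ 2 ^ ((s′ + 4) * r)
      smallT = ≤-trans (≤-trans (≤-reflexive (sym (+-suc (2 ^ h) N₀)))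
          (≤-trans (+-mono-≤ (≤-trans (≤-reflexive (sym (*-identityʳ _))) (*-monoʳ-≤ (2 ^ h) (m^n>0 2 N₀))) (≤-trans (n<2^n N₀) (≤-trans (≤-reflexive (sym (*-identityˡ _))) (*-monoˡ-≤ (2 ^ N₀) (m^n>0 2 h)))))
            (≤-reflexive (trans (cong₂ _+_ (pow+ h N₀) (pow+ h N₀)) (cong (_+_ (2 ^ (h + N₀))) (sym (+-identityʳ _)))))))
        (2^-mono (≤-trans (≤-trans (≤-trans (m≤m+n (suc (h + N₀)) (h + (10 * s + 9))) (≤-reflexive (lem h s N₀))) 2h+) (≤-trans (≤-reflexive (sym (*-identityˡ r))) (*-monoˡ-≤ r (≤-trans (s≤s z≤n) (m≤n+m 4 s′))))))
        where
        lem : ∀ h s N → suc (h + N) + (h + (10 * s + 9)) ≡ 2 * h + (10 * s + N + 10)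
        lem = ℕS.solve-∀
      exponentA : suc ((s′ + 4) * r) ≤ (s′ + 5) * r
      exponentA = ≤-trans (+-monoˡ-≤ ((s′ + 4) * r) r≥1) (≤-reflexive (lem s′ r))
        where
        lem : ∀ s r → r + (s + 4) * r ≡ (s + 5) * r
        lem = ℕS.solve-∀

      conclusion : length A ≤ 2 ^ ((s′ + 5) * r)
      conclusion = ≤-trans (length≤above T A uA)
        (≤-trans (+-mono-≤ few smallT) (≤-trans (≤-reflexive (cong (_+_ (2 ^ ((s′ + 4) * r))) (sym (+-identityʳ _)))) (2^-mono exponentA)))

  -- For X = 2^(2(s+1)r) the bound is X^(1/2 + 2/(s+1)).
  upper : ∀ s → Σ ℕ λ r₀ → ∀ r → r₀ ≤ r → ∀ M → 2 * suc s * r ≤ M → Pure M →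
    ∀ A → Unique A → (∀ a → a ∈ A → a ∈ LA M × a < 2 ^ (2 * suc s * r)) → length A ≤ 2 ^ ((s + 5) * r)
  upper s′ = suc (n₀ + (proj₁ f + (proj₁ g + 2 ^ (proj₁ b + 6)))) , λ r r> M n≤M pure A uA hA →
    UpperAt.At.conclusion s′ (proj₁ f) (proj₂ f) (proj₁ g) (proj₂ g) (proj₁ b) (proj₂ b) r r> M n≤M pure A uA hA
    where
    f = log-small (2 * suc s′ * (10 * suc s′ + N₀ + 10))
    g = poly-growth (10 * suc s′)
    b = exp-beats-linear (5 * suc s′)

module LowerAt (D : Decomposition) (s : ℕ) where
  open Decomposition D

  module At
    (np : ℕ) (pairs : ∀ n → np ≤ n → 2 ^ n ≤ 2 * n * (length (LA n) * length (LB n)))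
    (ru : ℕ) (up : ∀ r → ru ≤ r → ∀ M → 2 * suc s * r ≤ M → Decomposition.Pure (swap D) M →
      ∀ A → Unique A → (∀ a → a ∈ A → a ∈ LB M × a < 2 ^ (2 * suc s * r)) → length A ≤ 2 ^ ((s + 5) * r))
    (nl : ℕ) (small : ∀ n → nl ≤ n → ∀ l → 2 ^ l ≤ 4 * suc s * n → 4 * suc s * suc l ≤ n)
    (r : ℕ) (r> : n₀ + (np + (ru + nl)) < r) (M : ℕ) (n≤M : 2 * suc s * r ≤ M) (pure : Pure M) where

    n = 2 * suc s * r
    rest₀ = <⇒≤ r>
    rest₁ = m+n≤o⇒n≤o n₀ rest₀
    rest₂ = m+n≤o⇒n≤o np rest₁
    r≤n : r ≤ n
    r≤n = subst (_≤ n) (*-identityˡ r) (*-monoˡ-≤ r {1} {2 * suc s} (s≤s z≤n))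
    LB≤ : length (LB n) ≤ 2 ^ ((s + 5) * r)
    LB≤ = up r (m+n≤o⇒m≤o ru rest₂) M n≤M (swap-pure D M pure) (LB n) (LB-unique n)
      λ b b∈ → LB-mono n≤M b b∈ , LB-bound n (≤-trans (m+n≤o⇒m≤o n₀ rest₀) r≤n) b b∈
    lg = log2 r (≤-trans (s≤s z≤n) r>)
    l = proj₁ lg
    r≤2^l = proj₁ (proj₂ lg)
    2^l≤2r = proj₂ (proj₂ lg)
    2n≤ : 2 * n ≤ 2 ^ r
    2n≤ = ≤-trans (≤-reflexive (lem₃ s r)) (≤-trans (*-mono-≤ (<⇒≤ (n<2^n (4 * suc s))) r≤2^l)
        (≤-trans (≤-reflexive (pow+ (4 * suc s) l)) (2^-mono (≤-trans (≤-trans (+-monoʳ-≤ (4 * suc s) (m≤n*m l (4 * suc s))) (≤-reflexive (sym (*-suc (4 * suc s) l))))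
          (small r (m+n≤o⇒n≤o ru rest₂) l (≤-trans 2^l≤2r (*-monoˡ-≤ r (≤-trans (s≤s (s≤s (z≤n {2}))) (m≤m*n 4 (suc s))))))))))
      where
      lem₃ : ∀ s r → 2 * (2 * suc s * r) ≡ 4 * suc s * r
      lem₃ = ℕS.solve-∀
    lem : ∀ x a y → x * (a * y) ≡ a * (x * y)
    lem = ℕS.solve-∀
    lem₂ : ∀ s r → r + (s + 5) * r ≡ (s + 6) * r
    lem₂ = ℕS.solve-∀

    conclusion : 2 ^ (2 * suc s * r) ≤ length (LA (2 * suc s * r)) * 2 ^ ((s + 6) * r)
    conclusion = ≤-trans (pairs n (≤-trans (m+n≤o⇒m≤o np rest₁) r≤n))
      (≤-trans (*-mono-≤ 2n≤ (*-monoʳ-≤ (length (LA n)) LB≤))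
        (≤-reflexive (trans (lem (2 ^ r) (length (LA n)) (2 ^ ((s + 5) * r))) (cong (length (LA n) *_) (trans (pow+ r ((s + 5) * r)) (cong (2 ^_) (lem₂ s r)))))))

lower : ∀ D s → let open Decomposition D in Σ ℕ λ r₀ → ∀ r → r₀ ≤ r → ∀ M → 2 * suc s * r ≤ M → Pure M →
  2 ^ (2 * suc s * r) ≤ length (LA (2 * suc s * r)) * 2 ^ ((s + 6) * r)
lower D s = suc (Decomposition.n₀ D + (proj₁ p + (proj₁ u + proj₁ f))) , λ r r> M n≤M pure →
  LowerAt.At.conclusion D s (proj₁ p) (proj₂ p) (proj₁ u) (proj₂ u) (proj₁ f) (proj₂ f) r r> M n≤M pure
  where
  p = Growth.pairs-bound D
  u = Bounds.upper (swap D) s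
  f = log-small (4 * suc s)

-- Conics modulo a prime

module Mod (p : ℕ) (pp : Prime p) where
  private instance
    nzp : NonZero p
    nzp = prime⇒nonZero pp

  D : ℤ → Set
  D z = + p Sg.∣ z

  D-resp : ∀ {a b} → a ≡ b → D a → D b
  D-resp = subst D

  D-+ : ∀ {a b} → D a → D b → D (a ℤ.+ b)
  D-+ = Sg.∣m∣n⇒∣m+n

  D-* : ∀ c {a} → D a → D (c ℤ.* a)
  D-* c = Sg.∣n⇒∣m*n c

  D-neg : ∀ {a} → D a → D (ℤ.- a)
  D-neg = Sg.∣m⇒∣-m

  D? : ∀ z → Dec (D z)
  D? z = + p Sg.∣? z

  D⇒∣ : ∀ {z} → D z → p ∣ (∣ z ∣)
  D⇒∣ = Sg.∣⇒∣ᵤ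

  ∣⇒D : ∀ {z} → p ∣ (∣ z ∣) → D z
  ∣⇒D = Sg.∣ᵤ⇒∣

  D-euclid : ∀ x y → D (x ℤ.* y) → D x ⊎ D y
  D-euclid x y d = Data.Sum.map ∣⇒D ∣⇒D (euclidsLemma (∣ x ∣) (∣ y ∣) pp (subst (p ∣_) (ℤP.abs-* x y) (D⇒∣ d)))

  D-cancel : ∀ x y → ¬ D x → D (x ℤ.* y) → D y
  D-cancel x y ¬x d with D-euclid x y d
  ... | inj₁ dx = ⊥-elim (¬x dx)
  ... | inj₂ dy = dy

  D-nat : ∀ {m} → m < p → D (+ m) → m ≡ 0
  D-nat {zero}  _   _ = refl
  D-nat {suc m} m<p d = ⊥-elim (<⇒≱ m<p (∣⇒≤ (D⇒∣ d)))

  D-small : ∀ m n → m < p → n < p → D (+ m ℤ.- + n) → m ≡ n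
  D-small m n m<p n<p d with ≤-total n m
  ... | inj₁ n≤m = ≤-antisym (m∸n≡0⇒m≤n (D-nat (≤-<-trans (m∸n≤m m n) m<p)
          (D-resp (trans (ℤP.m-n≡m⊖n m n) (ℤP.⊖-≥ n≤m)) d))) n≤m
  ... | inj₂ m≤n = ≤-antisym m≤n (m∸n≡0⇒m≤n (D-nat (≤-<-trans (m∸n≤m n m) n<p)
          (D-resp (trans (flip (+ m) (+ n)) (trans (ℤP.m-n≡m⊖n n m) (ℤP.⊖-≥ m≤n))) (D-neg d))))
    where
    flip : ∀ a b → ℤ.- (a ℤ.- b) ≡ b ℤ.- a
    flip = ℤS.solve-∀

  res : ℤ → ℕ
  res z = z ℤD.%ℕ p

  res< : ∀ z → res z < p
  res< z = ℤD.n%ℕd<d z p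

  D-res : ∀ z → D (z ℤ.- + res z)
  D-res z = Sg.divides (z ℤD./ℕ p) (trans (cong (ℤ._- + res z) (ℤD.a≡a%ℕn+[a/ℕn]*n z p)) (lem (+ res z) (z ℤD./ℕ p ℤ.* + p)))
    where
    lem : ∀ r t → (r ℤ.+ t) ℤ.- r ≡ t
    lem = ℤS.solve-∀

  inverse : ∀ x → ¬ D x → Σ ℤ λ k → D (x ℤ.* k ℤ.- + 1)
  inverse x ¬x with coprime-Bézout (prime⇒coprime′ (res x) r≢0 (res< x))
    where
    r≢0 : res x ≢ 0
    r≢0 e = ¬x (D-resp (trans (cong (λ r → x ℤ.- + r) e) (ℤP.+-identityʳ x)) (D-res x))
    prime⇒coprime′ : ∀ r → r ≢ 0 → r < p → Coprime p r
    prime⇒coprime′ zero    r≢0 _   = ⊥-elim (r≢0 refl)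
    prime⇒coprime′ (suc r) _   r<p = Cop.prime⇒coprime pp r<p
  ... | Bézout.+- a b e = ℤ.- + b , Sg.divides (ℤ.- + a ℤ.- t ℤ.* + b)
      (trans (cong (λ x → x ℤ.* (ℤ.- + b) ℤ.- + 1) (ℤD.a≡a%ℕn+[a/ℕn]*n x p)) (trans (lem (+ r) t (+ p) (+ b)) (trans (cong (λ u → ℤ.- u ℤ.- t ℤ.* + b ℤ.* + p) e′) (lem₂ (+ a) t (+ b) (+ p)))))
    where
    r = res x
    t = x ℤD./ℕ p
    e′ : + 1 ℤ.+ + b ℤ.* + r ≡ + a ℤ.* + p
    e′ = trans (cong (ℤ._+_ (+ 1)) (sym (ℤP.pos-* b r))) (trans (cong +_ e) (ℤP.pos-* a p))
    lem : ∀ r t p b → (r ℤ.+ t ℤ.* p) ℤ.* (ℤ.- b) ℤ.- + 1 ≡ ℤ.- (+ 1 ℤ.+ b ℤ.* r) ℤ.- t ℤ.* b ℤ.* p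
    lem = ℤS.solve-∀
    lem₂ : ∀ a t b p → ℤ.- (a ℤ.* p) ℤ.- t ℤ.* b ℤ.* p ≡ (ℤ.- a ℤ.- t ℤ.* b) ℤ.* p
    lem₂ = ℤS.solve-∀
  ... | Bézout.-+ a b e = + b , Sg.divides (+ a ℤ.+ t ℤ.* + b)
      (trans (cong (λ x → x ℤ.* + b ℤ.- + 1) (ℤD.a≡a%ℕn+[a/ℕn]*n x p)) (trans (lem (+ r) t (+ p) (+ b)) (trans (cong (λ u → u ℤ.- + 1 ℤ.+ t ℤ.* + b ℤ.* + p) (sym e′)) (lem₂ (+ a) t (+ b) (+ p)))))
    where
    r = res x
    t = x ℤD./ℕ p
    e′ : + 1 ℤ.+ + a ℤ.* + p ≡ + b ℤ.* + r
    e′ = trans (cong (ℤ._+_ (+ 1)) (sym (ℤP.pos-* a p))) (trans (cong +_ e) (ℤP.pos-* b r))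
    lem : ∀ r t p b → (r ℤ.+ t ℤ.* p) ℤ.* b ℤ.- + 1 ≡ b ℤ.* r ℤ.- + 1 ℤ.+ t ℤ.* b ℤ.* p
    lem = ℤS.solve-∀
    lem₂ : ∀ a t b p → (+ 1 ℤ.+ a ℤ.* p) ℤ.- + 1 ℤ.+ t ℤ.* b ℤ.* p ≡ (a ℤ.+ t ℤ.* b) ℤ.* p
    lem₂ = ℤS.solve-∀

  squares-differ : ∀ c → ¬ D c → ∀ i j → i < j → i + j < p → ¬ D (c ℤ.* (+ i ℤ.* + i) ℤ.- c ℤ.* (+ j ℤ.* + j))
  squares-differ c ¬c i j i<j i+j<p d = Data.Sum.[ difference , total ]
      (D-euclid (+ j ℤ.- + i) (+ i ℤ.+ + j) (D-cancel c _ ¬c (D-resp (lem c (+ i) (+ j)) (D-neg d))))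
    where
    lem : ∀ c i j → ℤ.- (c ℤ.* (i ℤ.* i) ℤ.- c ℤ.* (j ℤ.* j)) ≡ c ℤ.* ((j ℤ.- i) ℤ.* (i ℤ.+ j))
    lem = ℤS.solve-∀
    j<p : j < p
    j<p = ≤-<-trans (m≤n+m j i) i+j<p
    difference : D (+ j ℤ.- + i) → ⊥
    difference d₁ = <⇒≢ i<j (sym (D-small j i j<p (<-trans i<j j<p) d₁))
    total : D (+ i ℤ.+ + j) → ⊥
    total d₂ = <⇒≢ (<-≤-trans (≤-<-trans z≤n i<j) (m≤n+m j i)) (sym (D-nat i+j<p d₂))

  Point : ℤ → ℤ → ℤ → ℕ → ℕ → Set
  Point γ α E u v = D (γ ℤ.* (+ u ℤ.* + u) ℤ.+ α ℤ.* (+ v ℤ.* + v) ℤ.- E)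

  module Half (q : ℕ) (p≤ : p ≤ suc (q + q)) (q+q<p : q + q < p) (γ α E : ℤ) (¬γ : ¬ D γ) (¬α : ¬ D α) where

    val : ℕ → ℤ
    val i = if does (i ≤? q) then γ ℤ.* (+ i ℤ.* + i) else E ℤ.- α ℤ.* (+ (i ∸ suc q) ℤ.* + (i ∸ suc q))

    val-small : ∀ i → i ≤ q → val i ≡ γ ℤ.* (+ i ℤ.* + i)
    val-small i i≤q = cong (λ b → if b then γ ℤ.* (+ i ℤ.* + i) else E ℤ.- α ℤ.* (+ (i ∸ suc q) ℤ.* + (i ∸ suc q))) (dec-true (i ≤? q) i≤q)

    val-large : ∀ i → ¬ (i ≤ q) → val i ≡ E ℤ.- α ℤ.* (+ (i ∸ suc q) ℤ.* + (i ∸ suc q))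
    val-large i i≰q = cong (λ b → if b then γ ℤ.* (+ i ℤ.* + i) else E ℤ.- α ℤ.* (+ (i ∸ suc q) ℤ.* + (i ∸ suc q))) (dec-false (i ≤? q) i≰q)

    small-sum : ∀ i j → i < j → j ≤ q → i + j < p
    small-sum i j i<j j≤q = ≤-<-trans (+-mono-≤ (≤-trans (<⇒≤ i<j) j≤q) j≤q) q+q<p

    collision : ∀ i j → i < j → j < suc p → D (val i ℤ.- val j) → Dec (i ≤ q) → Dec (j ≤ q) → Σ ℕ λ u → Σ ℕ λ v → Point γ α E u v
    collision i j i<j j≤p same (yes i≤q) (yes j≤q) =
      ⊥-elim (squares-differ γ ¬γ i j i<j (small-sum i j i<j j≤q) (D-resp (cong₂ ℤ._-_ (val-small i i≤q) (val-small j j≤q)) same))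
    collision i j i<j j≤p same (no i≰q) (yes j≤q) = ⊥-elim (i≰q (≤-trans (<⇒≤ i<j) j≤q))
    collision i j i<j j≤p same (yes i≤q) (no j≰q) = i , j ∸ suc q ,
      D-resp (lem (γ ℤ.* (+ i ℤ.* + i)) E _) (D-resp (cong₂ ℤ._-_ (val-small i i≤q) (val-large j j≰q)) same)
      where
      lem : ∀ a e b → a ℤ.- (e ℤ.- b) ≡ a ℤ.+ b ℤ.- e
      lem = ℤS.solve-∀
    collision i j i<j j≤p same (no i≰q) (no j≰q) =
      ⊥-elim (squares-differ α ¬α (i ∸ suc q) (j ∸ suc q) i′<j′ (small-sum _ _ i′<j′
        (≤-trans (∸-monoˡ-≤ (suc q) (≤-trans (≤-pred j≤p) p≤)) (≤-reflexive (m+n∸m≡n (suc q) q))))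
        (D-resp (lem E _ _) (D-neg (D-resp (cong₂ ℤ._-_ (val-large i i≰q) (val-large j j≰q)) same))))
      where
      i′<j′ : i ∸ suc q < j ∸ suc q
      i′<j′ = ∸-monoˡ-< i<j (≰⇒> i≰q)
      lem : ∀ e a b → ℤ.- ((e ℤ.- a) ℤ.- (e ℤ.- b)) ≡ a ℤ.- b
      lem = ℤS.solve-∀

    same-residue : ∀ x y → res x ≡ res y → D (x ℤ.- y)
    same-residue x y e = D-resp (lem x y (+ res x)) (D-+ (D-res x) (D-neg (D-resp (cong (λ r → y ℤ.- + r) (sym e)) (D-res y))))
      where
      lem : ∀ a b r → (a ℤ.- r) ℤ.+ (ℤ.- (b ℤ.- r)) ≡ a ℤ.- b
      lem = ℤS.solve-∀

    -- {γ i²} and {E - α j²}, for 0 ≤ i, j ≤ q, have p + 1 elements altogether.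
    point : Σ ℕ λ u → Σ ℕ λ v → Point γ α E u v
    point = collision (toℕ i) (toℕ j) (proj₁ (proj₂ (proj₂ pair))) (FinP.toℕ<n j)
        (same-residue (val (toℕ i)) (val (toℕ j)) (trans (sym (FinP.toℕ-fromℕ< (res< (val (toℕ i)))))
          (trans (cong toℕ (proj₂ (proj₂ (proj₂ pair)))) (FinP.toℕ-fromℕ< (res< (val (toℕ j)))))))
        (toℕ i ≤? q) (toℕ j ≤? q)
      where
      pair = FinP.pigeonhole {p} {suc p} ≤-refl (λ i → fromℕ< (res< (val (toℕ i))))
      i = proj₁ pair
      j = proj₁ (proj₂ pair)

  conic-point : 3 ≤ p → ∀ γ α E → ¬ D γ → ¬ D α → Σ ℕ λ u → Σ ℕ λ v → Point γ α E u v
  conic-point p≥3 γ α E ¬γ ¬α = Half.point (p / 2) p≤ q+q<p γ α E ¬γ ¬α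
    where
    *2 : ∀ q → q * 2 ≡ q + q
    *2 = ℕS.solve-∀
    p≤ : p ≤ suc (p / 2 + p / 2)
    p≤ = ≤-trans (≤-reflexive (m≡m%n+[m/n]*n p 2)) (+-mono-≤ (≤-pred (m%n<n p 2)) (≤-reflexive (*2 (p / 2))))
    q+q<p : p / 2 + p / 2 < p
    q+q<p = ≤∧≢⇒< (subst (_≤ p) (*2 (p / 2)) (m/n*n≤m p 2)) λ e →
      <⇒≢ p≥3 (prime∣prime prime[2] pp (divides (p / 2) (trans (sym e) (sym (*2 (p / 2))))))

  quad : ℤ → ℤ → ℤ → ℕ → ℤ
  quad A B C m = A ℤ.* + m ℤ.* + m ℤ.+ B ℤ.* + m ℤ.+ C

  roots : ℤ → ℤ → ℤ → List ℕ
  roots A B C = filter (λ m → D? (quad A B C m)) (upTo p)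

  roots≤2 : ∀ A B C → ¬ (D A × D B × D C) → length (roots A B C) ≤ 2
  roots≤2 A B C nz = go (roots A B C) (filter⁺ (λ m → D? (quad A B C m)) (upTo⁺ p))
      (λ m m∈ → let (m∈′ , d) = ∈-filter⁻ (λ m → D? (quad A B C m)) {xs = upTo p} m∈ in ∈-upTo⁻ m∈′ , d)
    where
    secant : ∀ m n → m < p → n < p → m ≢ n → D (quad A B C m) → D (quad A B C n) → D (A ℤ.* (+ m ℤ.+ + n) ℤ.+ B)
    secant m n m<p n<p m≢n dm dn = D-cancel (+ m ℤ.- + n) _ (λ d → m≢n (D-small m n m<p n<p d))
      (D-resp (lem A B C (+ m) (+ n)) (D-+ dm (D-neg dn)))
      where
      lem : ∀ A B C m n → (A ℤ.* m ℤ.* m ℤ.+ B ℤ.* m ℤ.+ C) ℤ.+ (ℤ.- (A ℤ.* n ℤ.* n ℤ.+ B ℤ.* n ℤ.+ C)) ≡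
        (m ℤ.- n) ℤ.* (A ℤ.* (m ℤ.+ n) ℤ.+ B)
      lem = ℤS.solve-∀
    go : ∀ xs → Unique xs → (∀ m → m ∈ xs → m < p × D (quad A B C m)) → length xs ≤ 2
    go [] u h = z≤n
    go (_ ∷ []) u h = s≤s z≤n
    go (_ ∷ _ ∷ []) u h = s≤s (s≤s z≤n)
    go (a ∷ b ∷ c ∷ xs) ((a≢b ∷ a≢c ∷ _) ∷ (b≢c ∷ _) ∷ _) h = ⊥-elim (nz (dA , dB , dC))
      where
      ha = h a (here refl)
      hb = h b (there (here refl))
      hc = h c (there (there (here refl)))
      sab = secant a b (proj₁ ha) (proj₁ hb) a≢b (proj₂ ha) (proj₂ hb)
      sac = secant a c (proj₁ ha) (proj₁ hc) a≢c (proj₂ ha) (proj₂ hc)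
      lem : ∀ A B a b c → (A ℤ.* (a ℤ.+ b) ℤ.+ B) ℤ.+ (ℤ.- (A ℤ.* (a ℤ.+ c) ℤ.+ B)) ≡ (b ℤ.- c) ℤ.* A
      lem = ℤS.solve-∀
      dA : D A
      dA = D-cancel (+ b ℤ.- + c) A (λ d → b≢c (D-small b c (proj₁ hb) (proj₁ hc) d)) (D-resp (lem A B (+ a) (+ b) (+ c)) (D-+ sab (D-neg sac)))
      lemB : ∀ s A B → (A ℤ.* s ℤ.+ B) ℤ.+ (ℤ.- (s ℤ.* A)) ≡ B
      lemB = ℤS.solve-∀
      dB : D B
      dB = D-resp (lemB (+ a ℤ.+ + b) A B) (D-+ sab (D-neg (D-* (+ a ℤ.+ + b) dA)))
      lemC : ∀ A B C a → (A ℤ.* a ℤ.* a ℤ.+ B ℤ.* a ℤ.+ C) ℤ.+ ((ℤ.- (a ℤ.* a ℤ.* A)) ℤ.+ (ℤ.- (a ℤ.* B))) ≡ C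
      lemC = ℤS.solve-∀
      dC : D C
      dC = D-resp (lemC A B C (+ a)) (D-+ (proj₂ ha) (D-+ (D-neg (D-* (+ a ℤ.* + a) dA)) (D-neg (D-* (+ a) dB))))

  ∈-roots : ∀ A B C m → m < p → D (quad A B C m) → m ∈ roots A B C
  ∈-roots A B C m m<p d = ∈-filter⁺ (λ m → D? (quad A B C m)) (∈-upTo⁺ m<p) d

  concatMap≤ : ∀ (f : ℕ → List ℕ) xs → (∀ x → length (f x) ≤ 2) → length (concatMap f xs) ≤ 2 * length xs
  concatMap≤ f [] h = z≤n
  concatMap≤ f (x ∷ xs) h = subst (_≤ 2 * suc (length xs)) (sym (length-++ (f x)))
    (≤-trans (+-mono-≤ (h x) (concatMap≤ f xs h)) (≤-reflexive (sym (*-suc 2 (length xs)))))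

  module _ (hU hV : ℕ → Bool) (8mU≤p : 8 * cnt p (not ∘ hU) ≤ p) (8mV≤p : 8 * cnt p (not ∘ hV) ≤ p) (γ α : ℤ) (¬γ : ¬ D γ) (¬α : ¬ D α) where
    private
      missU missV : List ℕ
      missU = trues p (not ∘ hU)
      missV = trues p (not ∘ hV)
      ∈-miss : ∀ h u → u < p → h u ≡ false → u ∈ trues p (not ∘ h)
      ∈-miss h u u<p e = ∈-trues p (not ∘ h) u u<p (cong not e)

    NoPoint : ℤ → Set
    NoPoint E = ∀ u v → u < p → v < p → hU u ≡ true → hV v ≡ true → ¬ D (γ ℤ.* (+ u ℤ.* + u) ℤ.+ α ℤ.* (+ v ℤ.* + v) ℤ.- E)

    -- The lines through the origin of the degenerate conic.
    no-cone : ∀ z → D (z ℤ.* z ℤ.+ α ℤ.* γ) → NoPoint (+ 0) → ⊥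
    no-cone z dz none = <⇒≱ {4 * p} {8 * p} (*-monoˡ-< p {4} {8} (s≤s (s≤s (s≤s (s≤s (s≤s z≤n))))))
      (≤-trans (*-monoʳ-≤ 8 p≤) (≤-trans (≤-reflexive (lem (length missV) (length missU)))
        (≤-trans (+-mono-≤ (subst (λ t → 8 * t ≤ p) (sym (length-trues p (not ∘ hV))) 8mV≤p)
                           (*-monoʳ-≤ 2 (subst (λ t → 8 * t ≤ p) (sym (length-trues p (not ∘ hU))) 8mU≤p)))
          (*-monoˡ-≤ p (n≤1+n 3)))))
      where
      lem : ∀ a b → 8 * (a + 2 * b) ≡ 8 * a + 2 * (8 * b)
      lem = ℕS.solve-∀
      ¬z : ¬ D z
      ¬z d = Data.Sum.[ ¬α , ¬γ ] (D-euclid α γ (D-resp (lem₁ z (α ℤ.* γ)) (D-+ dz (D-neg (D-* z d)))))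
        where
        lem₁ : ∀ z c → (z ℤ.* z ℤ.+ c) ℤ.+ (ℤ.- (z ℤ.* z)) ≡ c
        lem₁ = ℤS.solve-∀
      k = proj₁ (inverse γ ¬γ)
      dk = proj₂ (inverse γ ¬γ)
      line : ℕ → List ℕ
      line u = roots (+ 0) z (ℤ.- (γ ℤ.* + u))
      module _ (v : ℕ) (v<p : v < p) where
        u′ = z ℤ.* + v ℤ.* k
        u = res u′
        onU : D (quad (+ 0) z (ℤ.- (γ ℤ.* + u)) v)
        onU = D-resp (lem₂ z (+ v) k γ (+ u)) (D-+ (D-neg (D-* (z ℤ.* + v) dk)) (D-* γ (D-res u′)))
          where
          lem₂ : ∀ z v k γ u → (ℤ.- (z ℤ.* v ℤ.* (γ ℤ.* k ℤ.- + 1))) ℤ.+ γ ℤ.* (z ℤ.* v ℤ.* k ℤ.- u) ≡ + 0 ℤ.* v ℤ.* v ℤ.+ z ℤ.* v ℤ.+ (ℤ.- (γ ℤ.* u))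
          lem₂ = ℤS.solve-∀
        on : D (γ ℤ.* (+ u ℤ.* + u) ℤ.+ α ℤ.* (+ v ℤ.* + v) ℤ.- + 0)
        on = D-resp (lem₂ z (+ v) k γ α (+ u))
            (D-+ (D-* (ℤ.- (γ ℤ.* (u′ ℤ.+ + u))) (D-res u′))
              (D-+ (D-* (k ℤ.* z ℤ.* z ℤ.* + v ℤ.* + v) dk) (D-+ (D-* (k ℤ.* + v ℤ.* + v) dz) (D-neg (D-* (α ℤ.* + v ℤ.* + v) dk)))))
          where
          lem₂ : ∀ z v k γ α u → (ℤ.- (γ ℤ.* (z ℤ.* v ℤ.* k ℤ.+ u))) ℤ.* (z ℤ.* v ℤ.* k ℤ.- u) ℤ.+
            (k ℤ.* z ℤ.* z ℤ.* v ℤ.* v ℤ.* (γ ℤ.* k ℤ.- + 1) ℤ.+ (k ℤ.* v ℤ.* v ℤ.* (z ℤ.* z ℤ.+ α ℤ.* γ) ℤ.+ (ℤ.- (α ℤ.* v ℤ.* v ℤ.* (γ ℤ.* k ℤ.- + 1))))) ≡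
            γ ℤ.* (u ℤ.* u) ℤ.+ α ℤ.* (v ℤ.* v) ℤ.- + 0
          lem₂ = ℤS.solve-∀
        hit : ∀ bU bV → hU u ≡ bU → hV v ≡ bV → v ∈ missV ++ concatMap line missU
        hit _     false eU eV = ∈-++⁺ˡ (∈-miss hV v v<p eV)
        hit false true  eU eV = ∈-++⁺ʳ missV (∈-concatMap⁺ line (lose (∈-miss hU u (res< u′) eU) (∈-roots (+ 0) z (ℤ.- (γ ℤ.* + u)) v v<p onU)))
        hit true  true  eU eV = ⊥-elim (none u v (res< u′) v<p eU eV on)
      covered : ∀ v → v ∈ upTo p → v ∈ missV ++ concatMap line missU
      covered v v∈ = hit v (∈-upTo⁻ v∈) (hU (u v (∈-upTo⁻ v∈))) (hV v) refl refl
      p≤ : p ≤ length missV + 2 * length missU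
      p≤ = ≤-trans (subst (_≤ length (missV ++ concatMap line missU)) (length-upTo p) (card-⊆ (upTo⁺ p) covered))
        (subst (_≤ length missV + 2 * length missU) (sym (length-++ missV)) (+-monoʳ-≤ (length missV)
          (concatMap≤ line missU λ u → roots≤2 (+ 0) z _ (¬z ∘ proj₁ ∘ proj₂))))

    module _ (E : ℤ) (¬E : ¬ D E) (p≥5 : 5 ≤ p) where

      private
        base : Σ ℕ λ u → Σ ℕ λ v → Point γ α E u v
        base = conic-point (≤-trans (s≤s (s≤s (s≤s z≤n))) p≥5) γ α E ¬γ ¬α

        u₀ v₀ : ℤ
        u₀ = + proj₁ base
        v₀ = + proj₁ (proj₂ base)

        d₀ : D (γ ℤ.* (u₀ ℤ.* u₀) ℤ.+ α ℤ.* (v₀ ℤ.* v₀) ℤ.- E)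
        d₀ = proj₂ (proj₂ base)

        2p : ¬ D (+ 2)
        2p d = 1+n≢0 (D-nat (≤-trans (s≤s (s≤s (s≤s z≤n))) p≥5) d)

        not-both : D u₀ → D v₀ → ⊥
        not-both du dv = ¬E (D-resp (lem γ α u₀ v₀ E) (D-+ (D-+ (D-* (γ ℤ.* u₀) du) (D-* (α ℤ.* v₀) dv)) (D-neg d₀)))
          where
          lem : ∀ γ α u v E → (γ ℤ.* u ℤ.* u ℤ.+ α ℤ.* v ℤ.* v) ℤ.+ (ℤ.- (γ ℤ.* (u ℤ.* u) ℤ.+ α ℤ.* (v ℤ.* v) ℤ.- E)) ≡ E
          lem = ℤS.solve-∀

        ±-zero : ∀ c w → ¬ D c → ∀ x → D ((x ℤ.- w) ℤ.* c) → D ((x ℤ.+ w) ℤ.* c) → D w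
        ±-zero c w ¬c x d₁ d₂ = D-cancel (+ 2) w 2p (D-cancel c (+ 2 ℤ.* w) ¬c (D-resp (lem c w x) (D-+ d₂ (D-neg d₁))))
          where
          lem : ∀ c w x → ((x ℤ.+ w) ℤ.* c) ℤ.+ (ℤ.- ((x ℤ.- w) ℤ.* c)) ≡ c ℤ.* (+ 2 ℤ.* w)
          lem = ℤS.solve-∀

        lineU lineV : ℕ → List ℕ
        lineU u = roots ((+ u ℤ.- u₀) ℤ.* α) (+ 2 ℤ.* α ℤ.* v₀) ((+ u ℤ.+ u₀) ℤ.* γ)
        lineV v = roots ((+ v ℤ.+ v₀) ℤ.* α) (+ 2 ℤ.* γ ℤ.* u₀) ((+ v ℤ.- v₀) ℤ.* γ)

        lineU≤ : ∀ u → length (lineU u) ≤ 2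
        lineU≤ u = roots≤2 ((+ u ℤ.- u₀) ℤ.* α) (+ 2 ℤ.* α ℤ.* v₀) ((+ u ℤ.+ u₀) ℤ.* γ) λ d → let dA = proj₁ d ; dB = proj₁ (proj₂ d) ; dC = proj₂ (proj₂ d) in not-both
          (±-zero (α ℤ.* γ) u₀ (Data.Sum.[ ¬α , ¬γ ] ∘ D-euclid α γ) (+ u)
            (D-resp (lem₁ (+ u ℤ.- u₀) α γ) (D-* γ dA)) (D-resp (lem₂ (+ u ℤ.+ u₀) α γ) (D-* α dC)))
          (D-cancel α v₀ ¬α (D-cancel (+ 2) (α ℤ.* v₀) 2p (D-resp (lem₃ α v₀) dB)))
          where
          lem₁ : ∀ x a c → c ℤ.* (x ℤ.* a) ≡ x ℤ.* (a ℤ.* c)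
          lem₁ = ℤS.solve-∀
          lem₂ : ∀ x a c → a ℤ.* (x ℤ.* c) ≡ x ℤ.* (a ℤ.* c)
          lem₂ = ℤS.solve-∀
          lem₃ : ∀ a v → + 2 ℤ.* a ℤ.* v ≡ + 2 ℤ.* (a ℤ.* v)
          lem₃ = ℤS.solve-∀

        lineV≤ : ∀ v → length (lineV v) ≤ 2
        lineV≤ v = roots≤2 ((+ v ℤ.+ v₀) ℤ.* α) (+ 2 ℤ.* γ ℤ.* u₀) ((+ v ℤ.- v₀) ℤ.* γ) λ d → let dA = proj₁ d ; dB = proj₁ (proj₂ d) ; dC = proj₂ (proj₂ d) in not-both
          (D-cancel γ u₀ ¬γ (D-cancel (+ 2) (γ ℤ.* u₀) 2p (D-resp (lem₃ γ u₀) dB)))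
          (±-zero (α ℤ.* γ) v₀ (Data.Sum.[ ¬α , ¬γ ] ∘ D-euclid α γ) (+ v)
            (D-resp (lem₂ (+ v ℤ.- v₀) α γ) (D-* α dC)) (D-resp (lem₁ (+ v ℤ.+ v₀) α γ) (D-* γ dA)))
          where
          lem₁ : ∀ x a c → c ℤ.* (x ℤ.* a) ≡ x ℤ.* (a ℤ.* c)
          lem₁ = ℤS.solve-∀
          lem₂ : ∀ x a c → a ℤ.* (x ℤ.* c) ≡ x ℤ.* (a ℤ.* c)
          lem₂ = ℤS.solve-∀
          lem₃ : ∀ a v → + 2 ℤ.* a ℤ.* v ≡ + 2 ℤ.* (a ℤ.* v)
          lem₃ = ℤS.solve-∀

        singular : List ℕ
        singular = roots α (+ 0) γ

        covers : List ℕ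
        covers = singular ++ (concatMap lineU missU ++ concatMap lineV missV)

        covers≤ : length covers ≤ 2 + (2 * length missU + 2 * length missV)
        covers≤ = subst (_≤ 2 + (2 * length missU + 2 * length missV)) (sym (trans (length-++ singular) (cong (_+_ (length singular)) (length-++ (concatMap lineU missU)))))
          (+-mono-≤ (roots≤2 α (+ 0) γ (¬α ∘ proj₁)) (+-mono-≤ (concatMap≤ lineU missU lineU≤) (concatMap≤ lineV missV lineV≤)))

        -- A slope m gives a second point (u, v) on the line of slope m through (u₀, v₀).
        slope-covered : NoPoint E → ∀ m → m < p → ∀ k → D (quad α (+ 0) γ m ℤ.* k ℤ.- + 1) → m ∈ covers
        slope-covered none m m<p k dk = second (hU u) (hV v) refl refl
          where
          M = + m
          δ = quad α (+ 0) γ m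
          w = γ ℤ.* u₀ ℤ.+ α ℤ.* v₀ ℤ.* M
          s = w ℤ.* k
          u′ = u₀ ℤ.- + 2 ℤ.* s
          v′ = v₀ ℤ.- + 2 ℤ.* M ℤ.* s
          u = res u′
          v = res v′
          lemU : ∀ u₀ w δ k u →
            (ℤ.- (δ ℤ.* (u₀ ℤ.- + 2 ℤ.* (w ℤ.* k) ℤ.- u))) ℤ.+ (ℤ.- (+ 2 ℤ.* w ℤ.* (δ ℤ.* k ℤ.- + 1))) ≡
            (u ℤ.- u₀) ℤ.* δ ℤ.+ + 2 ℤ.* w
          lemU = ℤS.solve-∀
          lemV : ∀ v₀ m w δ k v →
            (ℤ.- (δ ℤ.* (v₀ ℤ.- + 2 ℤ.* m ℤ.* (w ℤ.* k) ℤ.- v))) ℤ.+ (ℤ.- (+ 2 ℤ.* m ℤ.* w ℤ.* (δ ℤ.* k ℤ.- + 1))) ≡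
            (v ℤ.- v₀) ℤ.* δ ℤ.+ + 2 ℤ.* (m ℤ.* w)
          lemV = ℤS.solve-∀
          lemU′ : ∀ α γ m u₀ v₀ u → (u ℤ.- u₀) ℤ.* (α ℤ.* m ℤ.* m ℤ.+ + 0 ℤ.* m ℤ.+ γ) ℤ.+ + 2 ℤ.* (γ ℤ.* u₀ ℤ.+ α ℤ.* v₀ ℤ.* m) ≡
            (u ℤ.- u₀) ℤ.* α ℤ.* m ℤ.* m ℤ.+ + 2 ℤ.* α ℤ.* v₀ ℤ.* m ℤ.+ (u ℤ.+ u₀) ℤ.* γ
          lemU′ = ℤS.solve-∀
          lemV′ : ∀ α γ m u₀ v₀ v → (v ℤ.- v₀) ℤ.* (α ℤ.* m ℤ.* m ℤ.+ + 0 ℤ.* m ℤ.+ γ) ℤ.+ + 2 ℤ.* (m ℤ.* (γ ℤ.* u₀ ℤ.+ α ℤ.* v₀ ℤ.* m)) ≡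
            (v ℤ.+ v₀) ℤ.* α ℤ.* m ℤ.* m ℤ.+ + 2 ℤ.* γ ℤ.* u₀ ℤ.* m ℤ.+ (v ℤ.- v₀) ℤ.* γ
          lemV′ = ℤS.solve-∀
          point : ∀ α γ m u₀ v₀ s → γ ℤ.* ((u₀ ℤ.- + 2 ℤ.* s) ℤ.* (u₀ ℤ.- + 2 ℤ.* s)) ℤ.+ α ℤ.* ((v₀ ℤ.- + 2 ℤ.* m ℤ.* s) ℤ.* (v₀ ℤ.- + 2 ℤ.* m ℤ.* s)) ≡
            γ ℤ.* (u₀ ℤ.* u₀) ℤ.+ α ℤ.* (v₀ ℤ.* v₀) ℤ.+ + 4 ℤ.* s ℤ.* (s ℤ.* (α ℤ.* m ℤ.* m ℤ.+ + 0 ℤ.* m ℤ.+ γ) ℤ.- (γ ℤ.* u₀ ℤ.+ α ℤ.* v₀ ℤ.* m))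
          point = ℤS.solve-∀
          lemP : ∀ c s w δ k E → (c ℤ.- E) ℤ.+ + 4 ℤ.* s ℤ.* w ℤ.* (δ ℤ.* k ℤ.- + 1) ≡ (c ℤ.+ + 4 ℤ.* s ℤ.* (w ℤ.* k ℤ.* δ ℤ.- w)) ℤ.- E
          lemP = ℤS.solve-∀
          replace : ∀ γ α u v u′ v′ E → (γ ℤ.* (u′ ℤ.* u′) ℤ.+ α ℤ.* (v′ ℤ.* v′) ℤ.- E) ℤ.+
            ((ℤ.- (γ ℤ.* (u′ ℤ.+ u))) ℤ.* (u′ ℤ.- u) ℤ.+ (ℤ.- (α ℤ.* (v′ ℤ.+ v))) ℤ.* (v′ ℤ.- v)) ≡ γ ℤ.* (u ℤ.* u) ℤ.+ α ℤ.* (v ℤ.* v) ℤ.- E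
          replace = ℤS.solve-∀
          on-conic : D (γ ℤ.* (u′ ℤ.* u′) ℤ.+ α ℤ.* (v′ ℤ.* v′) ℤ.- E)
          on-conic = D-resp (trans (lemP (γ ℤ.* (u₀ ℤ.* u₀) ℤ.+ α ℤ.* (v₀ ℤ.* v₀)) s w δ k E) (cong (ℤ._- E) (sym (point α γ M u₀ v₀ s))))
            (D-+ d₀ (D-* (+ 4 ℤ.* s ℤ.* w) dk))
          onU : D (quad ((+ u ℤ.- u₀) ℤ.* α) (+ 2 ℤ.* α ℤ.* v₀) ((+ u ℤ.+ u₀) ℤ.* γ) m)
          onU = D-resp (trans (lemU u₀ w δ k (+ u)) (lemU′ α γ M u₀ v₀ (+ u))) (D-+ (D-neg (D-* δ (D-res u′))) (D-neg (D-* (+ 2 ℤ.* w) dk)))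
          onV : D (quad ((+ v ℤ.+ v₀) ℤ.* α) (+ 2 ℤ.* γ ℤ.* u₀) ((+ v ℤ.- v₀) ℤ.* γ) m)
          onV = D-resp (trans (lemV v₀ M w δ k (+ v)) (lemV′ α γ M u₀ v₀ (+ v))) (D-+ (D-neg (D-* δ (D-res v′))) (D-neg (D-* (+ 2 ℤ.* M ℤ.* w) dk)))
          on : Point γ α E u v
          on = D-resp (replace γ α (+ u) (+ v) u′ v′ E)
                (D-+ on-conic (D-+ (D-* (ℤ.- (γ ℤ.* (u′ ℤ.+ + u))) (D-res u′)) (D-* (ℤ.- (α ℤ.* (v′ ℤ.+ + v))) (D-res v′))))
          second : ∀ bU bV → hU u ≡ bU → hV v ≡ bV → m ∈ covers
          second false _     eU eV = ∈-++⁺ʳ singular (∈-++⁺ˡ (∈-concatMap⁺ lineU (lose (∈-miss hU u (res< u′) eU) (∈-roots ((+ u ℤ.- u₀) ℤ.* α) (+ 2 ℤ.* α ℤ.* v₀) ((+ u ℤ.+ u₀) ℤ.* γ) m m<p onU))))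
          second true  false eU eV = ∈-++⁺ʳ singular (∈-++⁺ʳ (concatMap lineU missU) (∈-concatMap⁺ lineV (lose (∈-miss hV v (res< v′) eV) (∈-roots ((+ v ℤ.+ v₀) ℤ.* α) (+ 2 ℤ.* γ ℤ.* u₀) ((+ v ℤ.- v₀) ℤ.* γ) m m<p onV))))
          second true  true  eU eV = ⊥-elim (none u v (res< u′) (res< v′) eU eV on)

      no-conic : NoPoint E → ⊥
      no-conic none = <⇒≱ {16 + 4 * p} {8 * p} numeric (≤-trans (*-monoʳ-≤ 8 p≤) (≤-trans (≤-reflexive (lem (length missU) (length missV)))
          (+-monoʳ-≤ 16 (≤-trans (+-mono-≤ (*-monoʳ-≤ 2 (subst (λ t → 8 * t ≤ p) (sym (length-trues p (not ∘ hU))) 8mU≤p))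
                                           (*-monoʳ-≤ 2 (subst (λ t → 8 * t ≤ p) (sym (length-trues p (not ∘ hV))) 8mV≤p)))
            (≤-reflexive (sym (*-distribʳ-+ p 2 2)))))))
        where
        lem : ∀ a b → 8 * (2 + (2 * a + 2 * b)) ≡ 16 + (2 * (8 * a) + 2 * (8 * b))
        lem = ℕS.solve-∀
        numeric : 16 + 4 * p < 8 * p
        numeric = subst (16 + 4 * p <_) (sym (*-distribʳ-+ p 4 4)) (+-monoˡ-< (4 * p) (≤-trans (s≤s (m≤m+n 16 3)) (*-monoʳ-≤ 4 p≥5)))
        covered : ∀ m → m ∈ upTo p → m ∈ covers
        covered m m∈ = by-slope (D? (quad α (+ 0) γ m))
          where
          by-slope : Dec (D (quad α (+ 0) γ m)) → m ∈ covers
          by-slope (yes d) = ∈-++⁺ˡ (∈-roots α (+ 0) γ m (∈-upTo⁻ m∈) d)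
          by-slope (no ¬d) = slope-covered none m (∈-upTo⁻ m∈) (proj₁ (inverse (quad α (+ 0) γ m) ¬d)) (proj₂ (inverse (quad α (+ 0) γ m) ¬d))
        p≤ : p ≤ 2 + (2 * length missU + 2 * length missV)
        p≤ = ≤-trans (subst (_≤ length covers) (length-upTo p) (card-⊆ (upTo⁺ p) covered)) covers≤

-- Values of rational quadratics

square-quotient : ∀ c u z → 1 ≤ u → c * (u * u) ≡ z * z → Σ ℕ λ k → c ≡ k * k
square-quotient c u z u≥1 e = z₁ , c≡
  where
  g = gcd u z
  instance
    nzg : NonZero g
    nzg = ≢-nonZero (gcd[m,n]≢0 u z (inj₁ λ u≡0 → <⇒≢ u≥1 (sym u≡0)))
  u₁ = u / g
  z₁ = z / g
  eu : u₁ * g ≡ u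
  eu = m/n*n≡m (gcd[m,n]∣m u z)
  ez : z₁ * g ≡ z
  ez = m/n*n≡m (gcd[m,n]∣n u z)
  cop : Coprime u₁ z₁
  cop = Cop.coprime-/gcd u z
  e₁ : c * (u₁ * u₁) ≡ z₁ * z₁
  e₁ = *-cancelʳ-≡ _ _ (g * g) {{m*n≢0 g g}} (trans (lem c u₁ g) (trans (cong₂ (λ a b → c * (a * b)) eu eu) (trans e (trans (sym (cong₂ _*_ ez ez)) (lem′ z₁ g)))))
    where
    lem : ∀ c u g → c * (u * u) * (g * g) ≡ c * (u * g * (u * g))
    lem = ℕS.solve-∀
    lem′ : ∀ z g → z * g * (z * g) ≡ z * z * (g * g)
    lem′ = ℕS.solve-∀
  u₁≡1 : u₁ ≡ 1
  u₁≡1 = cop (∣-refl , coprime-divisor cop (subst (u₁ ∣_) e₁ (∣-trans (m∣m*n u₁) (n∣m*n c))))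
  c≡ : c ≡ z₁ * z₁
  c≡ = trans (sym (*-identityʳ c)) (trans (cong (λ t → c * (t * t)) (sym u₁≡1)) e₁)

ℤtoℚ-+ : ∀ a b → ℤtoℚ (a ℤ.+ b) ≡ ℤtoℚ a ℚ.+ ℤtoℚ b
ℤtoℚ-+ a b = ℚP.toℚᵘ-injective (ℚᵘP.≃-trans (ℚP.toℚᵘ-fromℚᵘ (ℚᵘ.mkℚᵘ (a ℤ.+ b) 0))
  (ℚᵘP.≃-trans (ℚᵘ.*≡* (lem a b)) (ℚᵘP.≃-trans (ℚᵘP.+-cong (ℚᵘP.≃-sym (ℚP.toℚᵘ-fromℚᵘ (ℚᵘ.mkℚᵘ a 0))) (ℚᵘP.≃-sym (ℚP.toℚᵘ-fromℚᵘ (ℚᵘ.mkℚᵘ b 0))))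
    (ℚᵘP.≃-sym (ℚP.toℚᵘ-homo-+ (ℤtoℚ a) (ℤtoℚ b))))))
  where
  lem : ∀ a b → (a ℤ.+ b) ℤ.* + 1 ≡ (a ℤ.* + 1 ℤ.+ b ℤ.* + 1) ℤ.* + 1
  lem = ℤS.solve-∀

ℤtoℚ-* : ∀ a b → ℤtoℚ (a ℤ.* b) ≡ ℤtoℚ a ℚ.* ℤtoℚ b
ℤtoℚ-* a b = ℚP.toℚᵘ-injective (ℚᵘP.≃-trans (ℚP.toℚᵘ-fromℚᵘ (ℚᵘ.mkℚᵘ (a ℤ.* b) 0))
  (ℚᵘP.≃-trans (ℚᵘP.*-cong (ℚᵘP.≃-sym (ℚP.toℚᵘ-fromℚᵘ (ℚᵘ.mkℚᵘ a 0))) (ℚᵘP.≃-sym (ℚP.toℚᵘ-fromℚᵘ (ℚᵘ.mkℚᵘ b 0))))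
    (ℚᵘP.≃-sym (ℚP.toℚᵘ-homo-* (ℤtoℚ a) (ℤtoℚ b)))))

rational-square : ∀ (w : ℚ) m → w ℚ.* w ≡ ℤtoℚ m → Σ ℕ λ u → + (u * u) ≡ m
rational-square w@(mkℚ num den-1 _) m e = natural m (trans (sym (ℤP.*-identityʳ (num ℤ.* num))) (ℚᵘP.drop-*≡* eq))
  where
  den = suc den-1
  eq : toℚᵘ w ℚᵘ.* toℚᵘ w ℚᵘ.≃ ℚᵘ.mkℚᵘ m 0
  eq = ℚᵘP.≃-trans (ℚᵘP.≃-sym (ℚP.toℚᵘ-homo-* w w)) (ℚᵘP.≃-trans (ℚP.toℚᵘ-cong e) (ℚP.toℚᵘ-fromℚᵘ (ℚᵘ.mkℚᵘ m 0)))
  natural : ∀ m → num ℤ.* num ≡ m ℤ.* + (den * den) → Σ ℕ λ u → + (u * u) ≡ m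
  natural (+ c) e′ = proj₁ k , cong +_ (sym (proj₂ k))
    where
    k = square-quotient c den (∣ num ∣) (s≤s z≤n) (trans (sym (trans (ℤP.abs-* (+ c) (+ (den * den))) refl)) (trans (cong ∣_∣ (sym e′)) (ℤP.abs-* num num)))
  natural ℤ.-[1+ c ] e′ = ⊥-elim (negative num e′)
    where
    negative : ∀ i → ¬ (i ℤ.* i ≡ ℤ.-[1+ c ] ℤ.* + (den * den))
    negative (+ zero)  ()
    negative (+ suc i) ()
    negative ℤ.-[1+ i ] ()

discriminant : RatQuad → ℤ
discriminant ψ = qb ψ ℤ.* qb ψ ℤ.- + 4 ℤ.* qa ψ ℤ.* qc ψ

-- n = ψ(x) gives (2ax + b)² = 4adn + b² - 4ac.
image-square : ∀ ψ n → InImage ψ n → Σ ℕ λ u → + (u * u) ≡ + 4 ℤ.* qa ψ ℤ.* qd ψ ℤ.* + n ℤ.+ discriminant ψ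
image-square ψ n (x , e) = rational-square w m (ℚG.∙-cancelʳ (ℤtoℚ k) (w ℚ.* w) (ℤtoℚ m) eq)
  where
  a = qa ψ
  b = qb ψ
  c = qc ψ
  d = qd ψ
  m k : ℤ
  m = + 4 ℤ.* a ℤ.* d ℤ.* + n ℤ.+ discriminant ψ
  k = (a ℤ.* c ℤ.+ a ℤ.* c) ℤ.+ (a ℤ.* c ℤ.+ a ℤ.* c)
  w : ℚ
  w = (ℤtoℚ a ℚ.* x ℚ.+ ℤtoℚ a ℚ.* x) ℚ.+ ℤtoℚ b
  open +-*-Solver
  complete : ∀ a b c x → ((a ℚ.* x ℚ.+ a ℚ.* x) ℚ.+ b) ℚ.* ((a ℚ.* x ℚ.+ a ℚ.* x) ℚ.+ b) ℚ.+ ((a ℚ.* c ℚ.+ a ℚ.* c) ℚ.+ (a ℚ.* c ℚ.+ a ℚ.* c)) ≡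
    (a ℚ.* (a ℚ.* x ℚ.* x ℚ.+ b ℚ.* x ℚ.+ c) ℚ.+ a ℚ.* (a ℚ.* x ℚ.* x ℚ.+ b ℚ.* x ℚ.+ c)) ℚ.+
    (a ℚ.* (a ℚ.* x ℚ.* x ℚ.+ b ℚ.* x ℚ.+ c) ℚ.+ a ℚ.* (a ℚ.* x ℚ.* x ℚ.+ b ℚ.* x ℚ.+ c)) ℚ.+ b ℚ.* b
  complete = solve 4 (λ a b c x → ((a :* x :+ a :* x) :+ b) :* ((a :* x :+ a :* x) :+ b) :+ ((a :* c :+ a :* c) :+ (a :* c :+ a :* c)) :=
    (a :* (a :* x :* x :+ b :* x :+ c) :+ a :* (a :* x :* x :+ b :* x :+ c)) :+
    (a :* (a :* x :* x :+ b :* x :+ c) :+ a :* (a :* x :* x :+ b :* x :+ c)) :+ b :* b) refl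
  double : ∀ y → ℤtoℚ (y ℤ.+ y ℤ.+ (y ℤ.+ y)) ≡ (ℤtoℚ y ℚ.+ ℤtoℚ y) ℚ.+ (ℤtoℚ y ℚ.+ ℤtoℚ y)
  double y = trans (ℤtoℚ-+ (y ℤ.+ y) (y ℤ.+ y)) (cong₂ ℚ._+_ (ℤtoℚ-+ y y) (ℤtoℚ-+ y y))
  adn : ℤtoℚ (a ℤ.* (d ℤ.* + n)) ≡ ℤtoℚ a ℚ.* (ℤtoℚ a ℚ.* x ℚ.* x ℚ.+ ℤtoℚ b ℚ.* x ℚ.+ ℤtoℚ c)
  adn = trans (ℤtoℚ-* a (d ℤ.* + n)) (cong (ℤtoℚ a ℚ.*_) (trans (ℤtoℚ-* d (+ n)) (sym e)))
  collect : ∀ a b c d n → (a ℤ.* (d ℤ.* n) ℤ.+ a ℤ.* (d ℤ.* n)) ℤ.+ (a ℤ.* (d ℤ.* n) ℤ.+ a ℤ.* (d ℤ.* n)) ℤ.+ b ℤ.* b ≡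
    (+ 4 ℤ.* a ℤ.* d ℤ.* n ℤ.+ (b ℤ.* b ℤ.- + 4 ℤ.* a ℤ.* c)) ℤ.+ ((a ℤ.* c ℤ.+ a ℤ.* c) ℤ.+ (a ℤ.* c ℤ.+ a ℤ.* c))
  collect = ℤS.solve-∀
  y = a ℤ.* (d ℤ.* + n)
  eq : w ℚ.* w ℚ.+ ℤtoℚ k ≡ ℤtoℚ m ℚ.+ ℤtoℚ k
  eq = trans (cong (w ℚ.* w ℚ.+_) (trans (double (a ℤ.* c)) (cong (λ t → (t ℚ.+ t) ℚ.+ (t ℚ.+ t)) (ℤtoℚ-* a c))))
    (trans (complete (ℤtoℚ a) (ℤtoℚ b) (ℤtoℚ c) x)
      (trans (cong₂ ℚ._+_ (trans (cong (λ t → (t ℚ.+ t) ℚ.+ (t ℚ.+ t)) (sym adn)) (sym (double y))) (sym (ℤtoℚ-* b b)))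
        (trans (sym (ℤtoℚ-+ (y ℤ.+ y ℤ.+ (y ℤ.+ y)) (b ℤ.* b))) (trans (cong ℤtoℚ (collect a b c d (+ n))) (ℤtoℚ-+ m k)))))

module Residues (U : List ℕ) where

  hit : ℕ → ℕ → Bool
  hit zero    r = false
  hit (suc q) r = does (any? (λ u → u % suc q ≟ r) U)

  misses : ℕ → ℕ
  misses p = cnt p (not ∘ hit p)

  sparse : ℕ → Bool
  sparse p = isPrime p ∧ does (p <? 8 * misses p)

  hit⁻ : ∀ q r → hit (suc q) r ≡ true → Σ ℕ λ u → u ∈ U × u % suc q ≡ r
  hit⁻ q r e = find (does-true⁻ (any? (λ u → u % suc q ≟ r) U) e)

  hit⁺ : ∀ q u → u ∈ U → hit (suc q) (u % suc q) ≡ true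
  hit⁺ q u u∈ = dec-true (any? (λ v → v % suc q ≟ u % suc q) U) (lose u∈ refl)

  sparse-few-of : ∀ J z h → Unique U → (∀ u → u ∈ U → u < 2 ^ z) → 3 + 2 * h + 2 * h + 2 * h * suc J ≤ z * J →
    length U ≡ 0 ⊎ length U * (cnt (2 ^ h) (sparse ∘ suc) ∸ 1) ≤ 16 * (suc J * 2 ^ z)
  sparse-few-of J z h uU U< exponents = nonempty U refl
    where
    y = 2 ^ h
    Ω : ℕ → ℕ → Bool
    Ω p = not ∘ hit p
    ω : ℕ → ℕ
    ω p = cnt p (Ω p)
    open Weights sparse ω using (L; W)
    off : ∀ q u → u ∈ U → Ω (suc q) (u % suc q) ≡ false
    off q u u∈ = cong not (hit⁺ q u u∈)
    dense : ∀ p → sparse p ≡ true → p ∸ ω p ≤ ω p * 8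
    dense p e = ≤-trans (m∸n≤m p (ω p)) (≤-trans (<⇒≤ (does-true⁻ (p <? 8 * misses p) (∧-true₂ e))) (≤-reflexive (*-comm 8 (misses p))))
    module Nonempty (u₀ : ℕ) (u₀∈ : u₀ ∈ U) where
      ω< : ∀ p → sparse p ≡ true → ω p < p
      ω< zero    ()
      ω< (suc q) e = cnt<-gap (suc q) (Ω (suc q)) (u₀ % suc q) (m%n<n u₀ (suc q)) (off q u₀ u₀∈)
      sieved : length U * L y y ≤ 2 * (suc J * 2 ^ z) * W y
      sieved = Sieve.sieve sparse Ω J (2 ^ z) (λ p e → isPrime⁻ p (∧-true₁ e)) ω< {{m^n≢0 2 z}} y y U uU U< (λ u u∈ q _ _ → off q u u∈)
        (m^n>0 2 h) (sieve-exponents J z h h exponents)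
      K = cnt y (sparse ∘ suc) ∸ 1
      counted : W y * K ≤ L y y * 8
      counted = subst₂ (λ a b → W y * a ≤ L y b * 8) (*-identityʳ K) (*-identityʳ y)
        (L-count sparse ω 8 y dense (m^n>0 2 h) y 1 ≤-refl)
      conclusion : length U * K ≤ 16 * (suc J * 2 ^ z)
      conclusion = *-cancelʳ-≤ _ _ (W y) {{>-nonZero (Weights.W≥1 sparse ω ω< y)}}
        (≤-trans (≤-reflexive (lem (length U) K (W y))) (≤-trans (*-monoʳ-≤ (length U) counted)
          (≤-trans (≤-reflexive (sym (*-assoc (length U) (L y y) 8))) (≤-trans (*-monoˡ-≤ 8 sieved) (≤-reflexive (lem′ (suc J * 2 ^ z) (W y)))))))
        where
        lem : ∀ u k w → u * k * w ≡ u * (w * k)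
        lem = ℕS.solve-∀
        lem′ : ∀ x w → 2 * x * w * 8 ≡ 16 * x * w
        lem′ = ℕS.solve-∀
    nonempty : ∀ V → V ≡ U → length U ≡ 0 ⊎ length U * (cnt y (sparse ∘ suc) ∸ 1) ≤ 16 * (suc J * 2 ^ z)
    nonempty []      e = inj₁ (cong length (sym e))
    nonempty (u ∷ V) e = inj₂ (Nonempty.conclusion u (subst (u ∈_) e (here refl)))

-- Comparison of the quadratics

record Sizes (D : Decomposition) (S r₀ M : ℕ) : Set where
  open Decomposition D
  field
    pure : Pure M
    up   : ∀ r → r₀ ≤ r → 2 * S * r ≤ M → ∀ A → Unique A → (∀ a → a ∈ A → a ∈ LA M × a < 2 ^ (2 * S * r)) →
      length A ≤ 2 ^ ((S + 4) * r)
    low  : ∀ r → r₀ ≤ r → 2 * S * r ≤ M → 2 ^ (2 * S * r) ≤ length (LA (2 * S * r)) * 2 ^ ((S + 5) * r)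

sizes : ∀ D S → 1 ≤ S → Σ ℕ λ r₀ → ∀ M → Decomposition.Pure D M → Sizes D S r₀ M
sizes D (suc s) _ = proj₁ u + proj₁ l , λ M pure → record
  { pure = pure
  ; up = λ r r≥ n≤M A uA hA → subst (λ t → length A ≤ 2 ^ (t * r)) (+-suc s 4) (proj₂ u r (m+n≤o⇒m≤o (proj₁ u) r≥) M n≤M pure A uA hA)
  ; low = λ r r≥ n≤M → subst (λ t → 2 ^ (2 * suc s * r) ≤ length (Decomposition.LA D (2 * suc s * r)) * 2 ^ (t * r)) (+-suc s 5)
      (proj₂ l r (m+n≤o⇒n≤o (proj₁ u) r≥) M n≤M pure) }
  where
  u = Bounds.upper D s
  l = lower D s

-- The outcome of the conjecture for X = 2^(8kst): a summand a is exceptional or α a + β is a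
-- square, where α = 4 qa qd and β = discriminant ψ.
record Patch (D : Decomposition) (k s t : ℕ) : Set where
  open Decomposition D
  S = k * s
  field
    α    : ℕ
    β    : ℤ
    α≥1  : 1 ≤ α
    α≤   : α ≤ 2 ^ (16 * k * t + 2)
    β≤   : ∣ β ∣ ≤ 2 ^ (16 * k * t + 3)
    exc  : List ℕ
    exc≤ : length exc * 2 ^ (8 * s * t) ≤ 2 ^ (4 * S * t)
    root : ∀ a → a ∈ LA (2 * S * (4 * t)) → 2 ^ (2 * S * t) ≤ a → a ∉ exc → Σ ℕ λ u → + (u * u) ≡ + (α * a) ℤ.+ β

module PatchFacts (D : Decomposition) (k s t r₀ M : ℕ) (k≥1 : 1 ≤ k) (s≥ : 100 ≤ s) (t≥1 : 1 ≤ t)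
  (Z : Sizes D (k * s) r₀ M) (P : Patch D k s t) (r₀≤t : r₀ ≤ t) (n≤M : 2 * (k * s) * (4 * t) ≤ M)
  (n₀≤n : Decomposition.n₀ D ≤ 2 * (k * s) * (4 * t)) where
  open Decomposition D
  open Sizes Z
  open Patch P

  n : ℕ
  n = 2 * S * (4 * t)

  S≥s : s ≤ S
  S≥s = subst (_≤ S) (*-identityˡ s) (*-monoˡ-≤ s k≥1)

  S≥ : 100 ≤ S
  S≥ = ≤-trans s≥ S≥s

  t≤4t : t ≤ 4 * t
  t≤4t = m≤m+n t (3 * t)

  large? : ∀ a → Dec (2 ^ (2 * S * t) ≤ a × ¬ (a ∈ exc))
  large? a = (2 ^ (2 * S * t) ≤? a) ×-dec ¬? (a ∈? exc)

  good : List ℕ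
  good = filter large? (LA n)

  good⁻ : ∀ a → a ∈ good → a ∈ LA n × 2 ^ (2 * S * t) ≤ a × ¬ (a ∈ exc)
  good⁻ a a∈ = ∈-filter⁻ large? {xs = LA n} a∈

  small : List ℕ
  small = filter (_<? 2 ^ (2 * S * t)) (LA n)

  length-small : length small ≤ 2 ^ ((S + 4) * t)
  length-small = up t r₀≤t (≤-trans (*-monoʳ-≤ (2 * S) t≤4t) n≤M) small (filter⁺ (_<? 2 ^ (2 * S * t)) (LA-unique n))
    λ a a∈ → let f = ∈-filter⁻ (_<? 2 ^ (2 * S * t)) {xs = LA n} a∈ in LA-mono n≤M a (proj₁ f) , proj₂ f

  split : ∀ a → a ∈ LA n → (a ∈ good) ⊎ (a ∈ small ++ exc)
  split a a∈ = by-size (a <? 2 ^ (2 * S * t)) (a ∈? exc)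
    where
    by-size : Dec (a < 2 ^ (2 * S * t)) → Dec (a ∈ exc) → (a ∈ good) ⊎ (a ∈ small ++ exc)
    by-size (yes a<) _        = inj₂ (∈-++⁺ˡ (∈-filter⁺ (_<? 2 ^ (2 * S * t)) a∈ a<))
    by-size (no a≮) (yes a∈e) = inj₂ (∈-++⁺ʳ small a∈e)
    by-size (no a≮) (no a∉e)  = inj₁ (∈-filter⁺ large? a∈ (≮⇒≥ a≮ , a∉e))

  length-LA : length (LA n) ≤ length good + (length small + length exc)
  length-LA = subst (length (LA n) ≤_) (trans (length-++ good) (cong (_+_ (length good)) (length-++ small)))
    (card-⊆ (LA-unique n) λ a a∈ → Data.Sum.[ ∈-++⁺ˡ , ∈-++⁺ʳ good ]′ (split a a∈))

  4*small : 4 * (length small * 2 ^ (20 * t)) ≤ 2 ^ (4 * S * t)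
  4*small = ≤-trans (*-monoʳ-≤ 4 (*-monoˡ-≤ (2 ^ (20 * t)) length-small))
    (≤-trans (≤-reflexive (trans (cong (4 *_) (pow+ ((S + 4) * t) (20 * t))) (pow+ 2 ((S + 4) * t + 20 * t)))) (2^-mono exponent))
    where
    exponent : 2 + ((S + 4) * t + 20 * t) ≤ 4 * S * t
    exponent = ≤-trans (+-monoˡ-≤ ((S + 4) * t + 20 * t) (*-monoʳ-≤ 2 t≥1)) (≤-trans (≤-reflexive (lem S t))
        (≤-trans (*-monoˡ-≤ t (+-monoʳ-≤ S (≤-trans (m≤m+n 26 74) S≥))) (≤-trans (*-monoˡ-≤ t (m≤m+n (S + S) (2 * S))) (≤-reflexive (lem₂ S t)))))
      where
      lem : ∀ S t → 2 * t + ((S + 4) * t + 20 * t) ≡ (S + 26) * t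
      lem = ℕS.solve-∀
      lem₂ : ∀ S t → (S + S + 2 * S) * t ≡ 4 * S * t
      lem₂ = ℕS.solve-∀

  4*exc : 4 * (length exc * 2 ^ (20 * t)) ≤ 2 ^ (4 * S * t)
  4*exc = ≤-trans (≤-reflexive (lem (length exc) (2 ^ (20 * t)))) (≤-trans (*-monoʳ-≤ (length exc)
      (≤-trans (≤-reflexive (pow+ 2 (20 * t))) (2^-mono exponent))) exc≤)
    where
    lem : ∀ e x → 4 * (e * x) ≡ e * (4 * x)
    lem = ℕS.solve-∀
    exponent : 2 + 20 * t ≤ 8 * s * t
    exponent = ≤-trans (+-monoˡ-≤ (20 * t) (*-monoʳ-≤ 2 t≥1)) (≤-trans (≤-reflexive (sym (*-distribʳ-+ t 2 20)))
      (*-monoˡ-≤ t (≤-trans (≤-trans (m≤m+n 22 78) s≥) (m≤n*m s 8))))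

  -- |LA n| ≥ 2^((4S - 20)t), and the small and the exceptional elements are at most half of it.
  length-good : 2 ^ (4 * S * t) ≤ length good * 2 ^ (21 * t)
  length-good = ≤-trans half (*-monoʳ-≤ (length good) (≤-trans (*-monoˡ-≤ (2 ^ (20 * t)) (2^-mono t≥1))
      (≤-reflexive (trans (pow+ t (20 * t)) (cong (2 ^_) (lem₀ t))))))
    where
    lem₀ : ∀ t → t + 20 * t ≡ 21 * t
    lem₀ = ℕS.solve-∀
    lem₁ : ∀ S t → 4 * S * t + 4 * S * t ≡ 2 * S * (4 * t)
    lem₁ = ℕS.solve-∀
    lem₂ : ∀ S t → (S + 5) * (4 * t) ≡ 20 * t + 4 * S * t
    lem₂ = ℕS.solve-∀
    many : 2 ^ (4 * S * t) ≤ length (LA n) * 2 ^ (20 * t)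
    many = *-cancelʳ-≤ _ _ (2 ^ (4 * S * t)) {{m^n≢0 2 (4 * S * t)}}
      (≤-trans (≤-reflexive (trans (pow+ (4 * S * t) (4 * S * t)) (cong (2 ^_) (lem₁ S t))))
        (≤-trans (low (4 * t) (≤-trans r₀≤t t≤4t) n≤M)
          (≤-reflexive (trans (cong (λ e → length (LA n) * 2 ^ e) (lem₂ S t)) (trans (cong (length (LA n) *_) (sym (pow+ (20 * t) (4 * S * t))))
            (sym (*-assoc (length (LA n)) (2 ^ (20 * t)) (2 ^ (4 * S * t)))))))))
    half : 2 ^ (4 * S * t) ≤ length good * (2 * 2 ^ (20 * t))
    half = *-cancelˡ-≤ 2 (+-cancelʳ-≤ (2 ^ (4 * S * t) + 2 ^ (4 * S * t)) _ _
      (≤-trans (≤-reflexive (lem₃ (2 ^ (4 * S * t)))) (≤-trans (*-monoʳ-≤ 4 (≤-trans many (*-monoˡ-≤ (2 ^ (20 * t)) length-LA)))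
        (≤-trans (≤-reflexive (lem₄ (length good) (length small) (length exc) (2 ^ (20 * t))))
          (+-monoʳ-≤ (2 * (length good * (2 * 2 ^ (20 * t)))) (+-mono-≤ 4*small 4*exc))))))
      where
      lem₃ : ∀ x → 2 * x + (x + x) ≡ 4 * x
      lem₃ = ℕS.solve-∀
      lem₄ : ∀ g a b x → 4 * ((g + (a + b)) * x) ≡ 2 * (g * (2 * x)) + (4 * (a * x) + 4 * (b * x))
      lem₄ = ℕS.solve-∀

  z : ℕ
  z = 4 * S * t + 8 * k * t + 3

  is-root? : ∀ u a → Dec (+ (u * u) ≡ + (α * a) ℤ.+ β)
  is-root? u a = + (u * u) ℤP.≟ + (α * a) ℤ.+ β

  roots-of : ∀ u → Dec (Any (λ a → + (u * u) ≡ + (α * a) ℤ.+ β) good)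
  roots-of u = any? (is-root? u) good

  U : List ℕ
  U = filter roots-of (upTo (2 ^ z))

  U-unique : Unique U
  U-unique = filter⁺ roots-of (upTo⁺ (2 ^ z))

  U< : ∀ u → u ∈ U → u < 2 ^ z
  U< u u∈ = ∈-upTo⁻ (proj₁ (∈-filter⁻ roots-of {xs = upTo (2 ^ z)} u∈))

  U⁻ : ∀ u → u ∈ U → Σ ℕ λ a → a ∈ good × + (u * u) ≡ + (α * a) ℤ.+ β
  U⁻ u u∈ = find (proj₂ (∈-filter⁻ roots-of {xs = upTo (2 ^ z)} u∈))

  root< : ∀ a u → a < 2 ^ n → + (u * u) ≡ + (α * a) ℤ.+ β → u < 2 ^ z
  root< a u a< e = ≰⇒> λ z≤u → <⇒≱ u²< (*-mono-≤ z≤u z≤u)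
    where
    e₁ = 16 * k * t
    abs : u * u ≤ α * a + ∣ β ∣
    abs = ≤-trans (≤-reflexive (cong ∣_∣ e)) (ℤP.∣i+j∣≤∣i∣+∣j∣ (+ (α * a)) β)
    αa : α * a ≤ 2 ^ (e₁ + 2 + n)
    αa = ≤-trans (*-mono-≤ α≤ (<⇒≤ a<)) (≤-reflexive (pow+ (e₁ + 2) n))
    β< : ∣ β ∣ ≤ 2 ^ (e₁ + 3 + n)
    β< = ≤-trans β≤ (2^-mono (m≤m+n (e₁ + 3) n))
    u²< : u * u < 2 ^ z * 2 ^ z
    u²< = ≤-<-trans abs (≤-<-trans (+-mono-≤ (≤-trans αa (2^-mono (+-monoˡ-≤ n (+-monoʳ-≤ e₁ (n≤1+n 2))))) β<)
      (≤-<-trans (≤-reflexive (trans (cong (_+_ (2 ^ (e₁ + 3 + n))) (sym (+-identityʳ _))) refl))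
        (subst (2 ^ suc (e₁ + 3 + n) <_) (sym (pow+ z z)) (^-monoʳ-< 2 (s≤s (s≤s z≤n)) exponent))))
      where
      exponent : suc (e₁ + 3 + n) < z + z
      exponent = ≤-trans (m≤m+n _ 1) (≤-reflexive (lem′ S k t))
        where
        lem′ : ∀ S k t → suc (suc (16 * k * t + 3 + 2 * S * (4 * t))) + 1 ≡ (4 * S * t + 8 * k * t + 3) + (4 * S * t + 8 * k * t + 3)
        lem′ = ℕS.solve-∀

  length-U : length good ≤ length U
  length-U = card≤ good U (λ a u → + (u * u) ≡ + (α * a) ℤ.+ β) (filter⁺ large? (LA-unique n)) total injective
    where
    total : ∀ a → a ∈ good → Σ ℕ λ u → u ∈ U × + (u * u) ≡ + (α * a) ℤ.+ β
    total a a∈ = u , ∈-filter⁺ roots-of (∈-upTo⁺ (root< a u (LA-bound n n₀≤n a (proj₁ g)) e)) (lose a∈ e) , e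
      where
      g = good⁻ a a∈
      r = root a (proj₁ g) (proj₁ (proj₂ g)) (proj₂ (proj₂ g))
      u = proj₁ r
      e = proj₂ r
    injective : ∀ a a′ u → + (u * u) ≡ + (α * a) ℤ.+ β → + (u * u) ≡ + (α * a′) ℤ.+ β → a ≡ a′
    injective a a′ u e e′ = *-cancelˡ-≡ a a′ α {{>-nonZero α≥1}} (ℤP.+-injective (ℤG.∙-cancelʳ β (+ (α * a)) (+ (α * a′)) (trans (sym e) e′)))

  open Residues U using (hit; misses; sparse; hit⁻; sparse-few-of)

  sparse-few : ∀ J → J ≡ 8 → ∀ h → h ≤ S * t → cnt (2 ^ h) (sparse ∘ suc) ≤ 2 ^ (41 * k * t)
  sparse-few J J≡8 h h≤ = ≤-trans (m≤n+m∸n (cnt (2 ^ h) (sparse ∘ suc)) 1) (≤-trans (s≤s few) final)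
    where
    N = cnt (2 ^ h) (sparse ∘ suc) ∸ 1
    exponents : 3 + 2 * h + 2 * h + 2 * h * suc J ≤ z * J
    exponents = subst (λ J → 3 + 2 * h + 2 * h + 2 * h * suc J ≤ z * J) (sym J≡8)
      (≤-trans (≤-reflexive (lem h)) (≤-trans (+-monoʳ-≤ 3 (*-monoʳ-≤ 22 h≤)) (≤-trans (m≤m+n _ (21 + (10 * (S * t) + 64 * k * t))) (≤-reflexive (lem₂ S k t)))))
      where
      lem : ∀ h → 3 + 2 * h + 2 * h + 2 * h * 9 ≡ 3 + 22 * h
      lem = ℕS.solve-∀
      lem₂ : ∀ S k t → 3 + 22 * (S * t) + (21 + (10 * (S * t) + 64 * k * t)) ≡ (4 * S * t + 8 * k * t + 3) * 8
      lem₂ = ℕS.solve-∀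
    nonempty : ¬ (length U ≡ 0)
    nonempty e = <⇒≱ (m^n>0 2 (4 * S * t)) (≤-trans length-good (*-monoˡ-≤ (2 ^ (21 * t)) (≤-trans length-U (≤-reflexive e))))
    bounded : length U * N ≤ 16 * (suc J * 2 ^ z)
    bounded = by-cases (sparse-few-of J z h U-unique U< exponents)
      where
      by-cases : length U ≡ 0 ⊎ length U * N ≤ 16 * (suc J * 2 ^ z) → length U * N ≤ 16 * (suc J * 2 ^ z)
      by-cases (inj₁ e) = ⊥-elim (nonempty e)
      by-cases (inj₂ b) = b
    few : N ≤ 2 ^ (8 * k * t + 21 * t + 11)
    few = *-cancelˡ-≤ (2 ^ (4 * S * t)) {{m^n≢0 2 (4 * S * t)}}
      (≤-trans (*-monoˡ-≤ N (≤-trans length-good (*-monoˡ-≤ (2 ^ (21 * t)) length-U)))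
        (≤-trans (≤-reflexive (lem (length U) (2 ^ (21 * t)) N)) (≤-trans (*-monoʳ-≤ (2 ^ (21 * t)) bounded)
          (≤-trans (*-monoʳ-≤ (2 ^ (21 * t)) (*-monoʳ-≤ 16 (*-monoˡ-≤ (2 ^ z) (≤-trans (≤-reflexive (cong suc J≡8)) (m≤m+n 9 7)))))
            (≤-reflexive (trans (cong (2 ^ (21 * t) *_) (trans (cong (16 *_) (pow+ 4 z)) (pow+ 4 (4 + z)))) (trans (pow+ (21 * t) (4 + (4 + z)))
              (trans (cong (2 ^_) (lem₂ S k t)) (sym (pow+ (4 * S * t) (8 * k * t + 21 * t + 11)))))))))))
      where
      lem : ∀ u x n → u * x * n ≡ x * (u * n)
      lem = ℕS.solve-∀
      lem₂ : ∀ S k t → 21 * t + (4 + (4 + (4 * S * t + 8 * k * t + 3))) ≡ 4 * S * t + (8 * k * t + 21 * t + 11)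
      lem₂ = ℕS.solve-∀
    final : suc (2 ^ (8 * k * t + 21 * t + 11)) ≤ 2 ^ (41 * k * t)
    final = ≤-trans (+-monoˡ-≤ (2 ^ e) (m^n>0 2 e)) (≤-trans (≤-reflexive (cong (_+_ (2 ^ e)) (sym (+-identityʳ (2 ^ e))))) (2^-mono exponent))
      where
      e = 8 * k * t + 21 * t + 11
      exponent : suc e ≤ 41 * k * t
      exponent = ≤-trans (≤-reflexive (lem k t)) (≤-trans (+-monoʳ-≤ (8 * k * t) (+-mono-≤ (*-monoʳ-≤ 21 t≤kt) (*-monoʳ-≤ 12 (≤-trans t≥1 t≤kt)))) (≤-reflexive (lem₂ k t)))
        where
        t≤kt : t ≤ k * t
        t≤kt = subst (_≤ k * t) (*-identityˡ t) (*-monoˡ-≤ t k≥1)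
        lem : ∀ k t → suc (8 * k * t + 21 * t + 11) ≡ 8 * k * t + (21 * t + 12 * 1)
        lem = ℕS.solve-∀
        lem₂ : ∀ k t → 8 * k * t + (21 * (k * t) + 12 * (k * t)) ≡ 41 * k * t
        lem₂ = ℕS.solve-∀

prime-outside : ∀ h excl → 2 ≤ h → length excl * (4 * h) ≤ 2 ^ h → Σ ℕ λ p → Prime p × p ≤ 2 ^ h × p ∉ excl
prime-outside h excl h≥2 few = search (any? (λ p → ¬? (p ∈? excl)) (primes (2 ^ h)))
  where
  π = length (primes (2 ^ h))
  search : Dec (Any (λ p → p ∉ excl) (primes (2 ^ h))) → Σ ℕ λ p → Prime p × p ≤ 2 ^ h × p ∉ excl
  search (yes a) = let (p , p∈ , p∉) = find a ; (pp , p≤) = ∈-primes⁻ (2 ^ h) p∈ in p , pp , p≤ , p∉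
  search (no none) = ⊥-elim (<⇒≱ 8< 3y≤8)
    where
    π≤ : π ≤ length excl
    π≤ = card-⊆ (primes-unique (2 ^ h)) λ p p∈ → decidable-stable (p ∈? excl) λ p∉ → none (lose p∈ p∉)
    3y≤8 : 3 * 2 ^ h ≤ 8
    3y≤8 = +-cancelʳ-≤ (2 ^ h) _ _ (≤-trans (≤-reflexive (lem (2 ^ h))) (≤-trans (*-monoʳ-≤ 4 (chebyshev h (<⇒≤ h≥2)))
      (≤-trans (≤-reflexive (lem₂ h π)) (+-monoʳ-≤ 8 (≤-trans (*-monoˡ-≤ (4 * h) π≤) few)))))
      where
      lem : ∀ y → 3 * y + y ≡ 4 * y
      lem = ℕS.solve-∀
      lem₂ : ∀ h π → 4 * (h * π + 2) ≡ 8 + π * (4 * h)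
      lem₂ = ℕS.solve-∀
    8< : 8 < 3 * 2 ^ h
    8< = ≤-trans (m≤m+n 9 3) (*-monoʳ-≤ 3 (2^-mono h≥2))

divisors : ℕ → ℕ → List ℕ
divisors y d = filter (_∣? d) (primes y)

divisors-few : ∀ y d b → 1 ≤ d → d ≤ 2 ^ b → length (divisors y d) ≤ b
divisors-few y d b d≥1 d≤ = 2^-cancel-≤ (≤-trans (2^primeDivisors≤ (divisors y d) d d≥1 (filter⁺ (_∣? d) (primes-unique y))
  λ p p∈ → let f = ∈-filter⁻ (_∣? d) {xs = primes y} p∈ in proj₁ (∈-primes⁻ y (proj₁ f)) , proj₂ f) d≤)

divisors-complete : ∀ y d p → Prime p → p ≤ y → p ∉ divisors y d → ¬ (p ∣ d)
divisors-complete y d p pp p≤ p∉ p∣d = p∉ (∈-filter⁺ (_∣? d) (∈-primes⁺ pp p≤) p∣d)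

sparsePrimes : List ℕ → ℕ → List ℕ
sparsePrimes U y = map suc (trues y (Residues.sparse U ∘ suc))

dense-outside : ∀ U y p → Prime p → p ≤ y → p ∉ sparsePrimes U y → 8 * Residues.misses U p ≤ p
dense-outside U y zero    pp _ _ = z≤n
dense-outside U y (suc q) pp q<y p∉ = ≮⇒≥ λ lt → p∉ (∈-map⁺ suc (∈-trues y (Residues.sparse U ∘ suc) q q<y
  (cong₂ _∧_ (dec-true (prime? (suc q)) pp) (dec-true (suc q <? 8 * Residues.misses U (suc q)) lt))))

∉-++ : ∀ {x : ℕ} xs {ys} → x ∉ xs ++ ys → x ∉ xs × x ∉ ys
∉-++ xs x∉ = (λ x∈ → x∉ (∈-++⁺ˡ x∈)) , (λ x∈ → x∉ (∈-++⁺ʳ xs x∈))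

++-few : ∀ (xs ys : List ℕ) {m n} → length xs ≤ m → length ys ≤ n → length (xs ++ ys) ≤ m + n
++-few xs ys {m} {n} xs≤ ys≤ = subst (_≤ m + n) (sym (length-++ xs {ys})) (+-mono-≤ xs≤ ys≤)

record Roots (T : ℕ → Set) (b h c : ℕ) : Set where
  field
    α   : ℕ
    β   : ℤ
    α≥1 : 1 ≤ α
    α≤  : α ≤ 2 ^ b
    β≤  : ∣ β ∣ ≤ 2 ^ b
    U   : List ℕ
    U⁻  : ∀ u → u ∈ U → Σ ℕ λ a → T a × + (u * u) ≡ + (α * a) ℤ.+ β
    few : cnt (2 ^ h) (Residues.sparse U ∘ suc) ≤ 2 ^ c

module Pair (TA TB : ℕ → Set) (b h c : ℕ) (RA : Roots TA b h c) (RB : Roots TB b h c)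
  (coprime-sums : ∀ a a′ p → TA a → TB a′ → Prime p → p ≤ 2 ^ h → ¬ (p ∣ a + a′)) where
  private
    module A = Roots RA
    module B = Roots RB
    y = 2 ^ h

  E : ℤ
  E = + B.α ℤ.* A.β ℤ.+ + A.α ℤ.* B.β

  bad : List ℕ
  bad = upTo 5 ++ (sparsePrimes A.U y ++ (sparsePrimes B.U y ++ (divisors y A.α ++ divisors y B.α)))

  bad-few : length bad ≤ 5 + (2 ^ c + (2 ^ c + (b + b)))
  bad-few = ++-few (upTo 5) (sA ++ (sB ++ (dA ++ dB))) ≤-refl (++-few sA (sB ++ (dA ++ dB)) (sp A.U A.few) (++-few sB (dA ++ dB) (sp B.U B.few)
      (++-few dA dB (divisors-few y A.α b A.α≥1 A.α≤) (divisors-few y B.α b B.α≥1 B.α≤))))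
    where
    sA = sparsePrimes A.U y
    sB = sparsePrimes B.U y
    dA = divisors y A.α
    dB = divisors y B.α
    sp : ∀ U → cnt y (Residues.sparse U ∘ suc) ≤ 2 ^ c → length (sparsePrimes U y) ≤ 2 ^ c
    sp U le = ≤-trans (≤-reflexive (trans (length-map suc (trues y (Residues.sparse U ∘ suc))) (length-trues y (Residues.sparse U ∘ suc)))) le

  module At (q : ℕ) (pp : Prime (suc q)) (p≤ : suc q ≤ y) (p∉ : suc q ∉ bad) where
    private
      p = suc q
      open Mod p pp
      o₁ = ∉-++ (upTo 5) p∉
      o₂ = ∉-++ (sparsePrimes A.U y) (proj₂ o₁)
      o₃ = ∉-++ (sparsePrimes B.U y) (proj₂ o₂)
      o₄ = ∉-++ (divisors y A.α) (proj₂ o₃)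

    p≥5 : 5 ≤ p
    p≥5 = ≮⇒≥ λ p<5 → proj₁ o₁ (∈-upTo⁺ p<5)

    ¬α : ¬ D (+ A.α)
    ¬α d = divisors-complete y A.α p pp p≤ (proj₁ o₄) (D⇒∣ d)

    ¬γ : ¬ D (+ B.α)
    ¬γ d = divisors-complete y B.α p pp p≤ (proj₂ o₄) (D⇒∣ d)

    private
      module C = Mod p pp
      hA = Residues.hit A.U p
      hB = Residues.hit B.U p
      dA : 8 * cnt p (not ∘ hA) ≤ p
      dA = dense-outside A.U y p pp p≤ (proj₁ o₂)
      dB : 8 * cnt p (not ∘ hB) ≤ p
      dB = dense-outside B.U y p pp p≤ (proj₁ o₃)

      D-% : ∀ u r → u % p ≡ r → D (+ u ℤ.- + r)
      D-% u r e = Sg.divides (+ (u / p)) (trans (cong (λ t → + t ℤ.- + r) (trans (m≡m%n+[m/n]*n u p) (cong (_+ u / p * p) e)))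
        (trans (cong (ℤ._- + r) (ℤP.pos-+ r (u / p * p))) (trans (lem (+ r) (+ (u / p * p))) (ℤP.pos-* (u / p) p))))
        where
        lem : ∀ r x → (r ℤ.+ x) ℤ.- r ≡ x
        lem = ℤS.solve-∀

    -- The conic γu² + αv² = E has u² = αa + β and v² = γa′ + δ as a point iff αγ(a + a′) = 0.
    no-point : NoPoint hA hB dA dB (+ B.α) (+ A.α) ¬γ ¬α E
    no-point u v u<p v<p eu ev d = contradiction′ (Residues.hit⁻ A.U q u eu) (Residues.hit⁻ B.U q v ev)
      where
      contradiction′ : (Σ ℕ λ u′ → u′ ∈ A.U × u′ % p ≡ u) → (Σ ℕ λ v′ → v′ ∈ B.U × v′ % p ≡ v) → ⊥
      contradiction′ (u′ , u′∈ , eu′) (v′ , v′∈ , ev′) = use (A.U⁻ u′ u′∈) (B.U⁻ v′ v′∈)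
        where
        lift : ∀ γ α u v u′ v′ E → (γ ℤ.* (u ℤ.* u) ℤ.+ α ℤ.* (v ℤ.* v) ℤ.- E) ℤ.+
          (γ ℤ.* (u′ ℤ.+ u) ℤ.* (u′ ℤ.- u) ℤ.+ α ℤ.* (v′ ℤ.+ v) ℤ.* (v′ ℤ.- v)) ≡ γ ℤ.* (u′ ℤ.* u′) ℤ.+ α ℤ.* (v′ ℤ.* v′) ℤ.- E
        lift = ℤS.solve-∀
        on : D (+ B.α ℤ.* (+ u′ ℤ.* + u′) ℤ.+ + A.α ℤ.* (+ v′ ℤ.* + v′) ℤ.- E)
        on = D-resp (lift (+ B.α) (+ A.α) (+ u) (+ v) (+ u′) (+ v′) E)
          (D-+ d (D-+ (D-* (+ B.α ℤ.* (+ u′ ℤ.+ + u)) (D-% u′ u eu′)) (D-* (+ A.α ℤ.* (+ v′ ℤ.+ + v)) (D-% v′ v ev′))))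
        value : ∀ α β γ δ a b → γ ℤ.* (α ℤ.* a ℤ.+ β) ℤ.+ α ℤ.* (γ ℤ.* b ℤ.+ δ) ℤ.- (γ ℤ.* β ℤ.+ α ℤ.* δ) ≡ γ ℤ.* (α ℤ.* (a ℤ.+ b))
        value = ℤS.solve-∀
        square : ∀ u α a β → + (u * u) ≡ + (α * a) ℤ.+ β → + u ℤ.* + u ≡ + α ℤ.* + a ℤ.+ β
        square u α a β e = trans (sym (ℤP.pos-* u u)) (trans e (cong (ℤ._+ β) (ℤP.pos-* α a)))
        use : (Σ ℕ λ a → TA a × + (u′ * u′) ≡ + (A.α * a) ℤ.+ A.β) → (Σ ℕ λ a′ → TB a′ × + (v′ * v′) ≡ + (B.α * a′) ℤ.+ B.β) → ⊥
        use (a , ta , ea) (a′ , tb , eb) = coprime-sums a a′ p ta tb pp p≤ (D⇒∣ (D-cancel (+ A.α) (+ (a + a′)) ¬α (D-cancel (+ B.α) _ ¬γ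
          (D-resp (trans (cong₂ (λ x y → + B.α ℤ.* x ℤ.+ + A.α ℤ.* y ℤ.- E) (square u′ A.α a A.β ea) (square v′ B.α a′ B.β eb))
            (trans (value (+ A.α) A.β (+ B.α) B.β (+ a) (+ a′)) (cong (λ t → + B.α ℤ.* (+ A.α ℤ.* t)) (sym (ℤP.pos-+ a a′))))) on))))

    E≡0-mod : ¬ ¬ D E
    E≡0-mod ¬E = no-conic hA hB dA dB (+ B.α) (+ A.α) ¬γ ¬α E ¬E p≥5 no-point

    nonresidue : E ≡ + 0 → ∀ z → ¬ D (z ℤ.* z ℤ.+ + A.α ℤ.* + B.α)
    nonresidue E≡0 z d = no-cone hA hB dA dB (+ B.α) (+ A.α) ¬γ ¬α z d (subst (NoPoint hA hB dA dB (+ B.α) (+ A.α) ¬γ ¬α) E≡0 no-point)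

  ∣E∣≤ : ∣ E ∣ ≤ 2 ^ suc (b + b)
  ∣E∣≤ = ≤-trans (ℤP.∣i+j∣≤∣i∣+∣j∣ (+ B.α ℤ.* A.β) (+ A.α ℤ.* B.β))
    (≤-trans (+-mono-≤ (≤-trans (≤-reflexive (ℤP.abs-* (+ B.α) A.β)) (*-mono-≤ B.α≤ A.β≤)) (≤-trans (≤-reflexive (ℤP.abs-* (+ A.α) B.β)) (*-mono-≤ A.α≤ B.β≤)))
      (≤-reflexive (trans (cong₂ _+_ (pow+ b b) (pow+ b b)) (cong (_+_ (2 ^ (b + b))) (sym (+-identityʳ _))))))

  E≡0 : 2 ≤ h → (5 + (2 ^ c + (2 ^ c + (b + b))) + suc (b + b)) * (4 * h) ≤ 2 ^ h → E ≡ + 0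
  E≡0 h≥2 room = decidable-stable (E ℤP.≟ + 0) refute
    where
    refute : ¬ ¬ (E ≡ + 0)
    refute E≢0 = at (prime-outside h excl h≥2 (≤-trans (*-monoˡ-≤ (4 * h) excl-few) room))
      where
      excl = bad ++ divisors y (∣ E ∣)
      excl-few : length excl ≤ 5 + (2 ^ c + (2 ^ c + (b + b))) + suc (b + b)
      excl-few = ++-few bad (divisors y (∣ E ∣)) bad-few (divisors-few y (∣ E ∣) (suc (b + b)) (n≢0⇒n>0 λ e → E≢0 (ℤP.∣i∣≡0⇒i≡0 e)) ∣E∣≤)
      at : (Σ ℕ λ p → Prime p × p ≤ y × p ∉ excl) → ⊥
      at (zero  , pp , _ , _) = ¬prime[0] pp
      at (suc q , pp , p≤ , p∉) = At.E≡0-mod q pp p≤ (proj₁ (∉-++ bad p∉))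
        λ d → divisors-complete y (∣ E ∣) (suc q) pp p≤ (proj₂ (∉-++ bad p∉)) (Mod.D⇒∣ (suc q) pp d)

by-square : ∀ u α a β → + (u * u) ≡ + (α * a) ℤ.+ β → + u ℤ.* + u ≡ + α ℤ.* + a ℤ.+ β
by-square u α a β e = trans (sym (ℤP.pos-* u u)) (trans e (cong (ℤ._+ β) (ℤP.pos-* α a)))

module BottomPrime (q : ℕ) (pp : Prime (suc q)) (α γ a b u v : ℕ) (β δ : ℤ)
  (a+b : a + b ≡ suc q) (eu : + (u * u) ≡ + (α * a) ℤ.+ β) (ev : + (v * v) ≡ + (γ * b) ℤ.+ δ)
  (E≡0 : + γ ℤ.* β ℤ.+ + α ℤ.* δ ≡ + 0) (p∤α : ¬ (suc q ∣ α)) (p∤γ : ¬ (suc q ∣ γ)) where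
  private
    p = suc q
    open Mod p pp

    conic : + γ ℤ.* (+ u ℤ.* + u) ℤ.+ + α ℤ.* (+ v ℤ.* + v) ≡ + α ℤ.* + γ ℤ.* + p
    conic = trans (cong₂ (λ x y → + γ ℤ.* x ℤ.+ + α ℤ.* y) (by-square u α a β eu) (by-square v γ b δ ev))
      (trans (lem (+ α) (+ γ) β δ (+ a) (+ b)) (trans (cong₂ (λ x y → + α ℤ.* + γ ℤ.* x ℤ.+ y) (trans (sym (ℤP.pos-+ a b)) (cong +_ a+b)) E≡0)
        (ℤP.+-identityʳ _)))
      where
      lem : ∀ α γ β δ a b → γ ℤ.* (α ℤ.* a ℤ.+ β) ℤ.+ α ℤ.* (γ ℤ.* b ℤ.+ δ) ≡ α ℤ.* γ ℤ.* (a ℤ.+ b) ℤ.+ (γ ℤ.* β ℤ.+ α ℤ.* δ)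
      lem = ℤS.solve-∀

    ¬α : ¬ D (+ α)
    ¬α d = p∤α (D⇒∣ d)

    ¬γ : ¬ D (+ γ)
    ¬γ d = p∤γ (D⇒∣ d)

    ¬αγ : ¬ D (+ α ℤ.* + γ)
    ¬αγ = Data.Sum.[ ¬α , ¬γ ]′ ∘ D-euclid (+ α) (+ γ)

    ¬v : ¬ D (+ v)
    ¬v dv = square-factor (D⇒∣ du) (D⇒∣ dv)
      where
      lem : ∀ γ α u v p → (α ℤ.* γ ℤ.* p) ℤ.+ (ℤ.- (α ℤ.* v ℤ.* v)) ≡ (α ℤ.* γ ℤ.* p) ℤ.- α ℤ.* (v ℤ.* v)
      lem = ℤS.solve-∀
      lem₂ : ∀ x y → (x ℤ.+ y) ℤ.- y ≡ x
      lem₂ = ℤS.solve-∀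
      duu : D (+ u ℤ.* + u)
      duu = D-cancel (+ γ) _ ¬γ (D-resp (trans (lem (+ γ) (+ α) (+ u) (+ v) (+ p)) (trans (cong (ℤ._- + α ℤ.* (+ v ℤ.* + v)) (sym conic))
        (lem₂ (+ γ ℤ.* (+ u ℤ.* + u)) (+ α ℤ.* (+ v ℤ.* + v))))) (D-+ (D-* (+ α ℤ.* + γ) Sg.∣-refl) (D-neg (D-* (+ α ℤ.* + v) dv))))
      du : D (+ u)
      du = Data.Sum.[ id , id ]′ (D-euclid (+ u) (+ u) duu)
      square-factor : p ∣ u → p ∣ v → ⊥
      square-factor (divides u₁ refl) (divides v₁ refl) = ¬αγ (Sg.divides (+ γ ℤ.* (+ u₁ ℤ.* + u₁) ℤ.+ + α ℤ.* (+ v₁ ℤ.* + v₁))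
        (ℤP.*-cancelʳ-≡ (+ α ℤ.* + γ) _ (+ p) (trans (sym conic) (trans (cong₂ (λ x y → + γ ℤ.* (x ℤ.* x) ℤ.+ + α ℤ.* (y ℤ.* y)) (ℤP.pos-* u₁ p) (ℤP.pos-* v₁ p))
          (lem₃ (+ γ) (+ α) (+ u₁) (+ v₁) (+ p))))))
        where
        lem₃ : ∀ γ α u v p → γ ℤ.* ((u ℤ.* p) ℤ.* (u ℤ.* p)) ℤ.+ α ℤ.* ((v ℤ.* p) ℤ.* (v ℤ.* p)) ≡ ((γ ℤ.* (u ℤ.* u) ℤ.+ α ℤ.* (v ℤ.* v)) ℤ.* p) ℤ.* p
        lem₃ = ℤS.solve-∀

  -- -αγ ≡ (γu/v)², and α α₁, γ γ₁ are squares.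
  residue : ∀ α₁ γ₁ κ l → α * α₁ ≡ κ * κ → γ * γ₁ ≡ l * l → Σ ℤ λ z → Mod.D p pp (z ℤ.* z ℤ.+ + α₁ ℤ.* + γ₁)
  residue α₁ γ₁ κ l eκ el = z , D-resp (trans (final m i m₁ w (+ κ ℤ.* + l)) (trans (cong (λ t → z ℤ.* z ℤ.+ m₁ ℤ.+ m ℤ.* i ℤ.* i ℤ.* (t ℤ.- m ℤ.* m₁)) squares) (simplify m m₁ i (z ℤ.* z))))
      (D-+ (D-* ((+ κ ℤ.* + l) ℤ.* i ℤ.* ((+ κ ℤ.* + l) ℤ.* i)) dw) (D-neg (D-* (m₁ ℤ.* (m ℤ.* i ℤ.+ + 1)) di)))
    where
    m m₁ : ℤ
    m = + α ℤ.* + γ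
    m₁ = + α₁ ℤ.* + γ₁
    i = proj₁ (inverse m ¬αγ)
    di = proj₂ (inverse m ¬αγ)
    k = proj₁ (inverse (+ v) ¬v)
    dk = proj₂ (inverse (+ v) ¬v)
    w = + γ ℤ.* + u ℤ.* k
    z = w ℤ.* (+ κ ℤ.* + l) ℤ.* i
    lem : ∀ γ α u v k p → γ ℤ.* k ℤ.* k ℤ.* (α ℤ.* γ ℤ.* p) ℤ.+ (ℤ.- (α ℤ.* γ ℤ.* (v ℤ.* k ℤ.+ + 1) ℤ.* (v ℤ.* k ℤ.- + 1))) ≡
      γ ℤ.* k ℤ.* k ℤ.* (α ℤ.* γ ℤ.* p ℤ.- α ℤ.* (v ℤ.* v)) ℤ.+ α ℤ.* γ
    lem = ℤS.solve-∀
    lem₂ : ∀ γ α u v k → γ ℤ.* k ℤ.* k ℤ.* ((γ ℤ.* (u ℤ.* u) ℤ.+ α ℤ.* (v ℤ.* v)) ℤ.- α ℤ.* (v ℤ.* v)) ℤ.+ α ℤ.* γ ≡ (γ ℤ.* u ℤ.* k) ℤ.* (γ ℤ.* u ℤ.* k) ℤ.+ α ℤ.* γ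
    lem₂ = ℤS.solve-∀
    dw : D (w ℤ.* w ℤ.+ m)
    dw = D-resp (trans (lem (+ γ) (+ α) (+ u) (+ v) k (+ p)) (trans (cong (λ t → + γ ℤ.* k ℤ.* k ℤ.* (t ℤ.- + α ℤ.* (+ v ℤ.* + v)) ℤ.+ m) (sym conic)) (lem₂ (+ γ) (+ α) (+ u) (+ v) k)))
      (D-+ (D-* (+ γ ℤ.* k ℤ.* k) (D-* m Sg.∣-refl)) (D-neg (D-* (m ℤ.* (+ v ℤ.* k ℤ.+ + 1)) dk)))
    final : ∀ m i m₁ w c → (c ℤ.* i ℤ.* (c ℤ.* i)) ℤ.* (w ℤ.* w ℤ.+ m) ℤ.+ (ℤ.- (m₁ ℤ.* (m ℤ.* i ℤ.+ + 1) ℤ.* (m ℤ.* i ℤ.- + 1))) ≡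
      w ℤ.* c ℤ.* i ℤ.* (w ℤ.* c ℤ.* i) ℤ.+ m₁ ℤ.+ m ℤ.* i ℤ.* i ℤ.* (c ℤ.* c ℤ.- m ℤ.* m₁)
    final = ℤS.solve-∀
    regroup : ∀ a b c d → (a ℤ.* b) ℤ.* (c ℤ.* d) ≡ (a ℤ.* c) ℤ.* (b ℤ.* d)
    regroup = ℤS.solve-∀
    squares : (+ κ ℤ.* + l) ℤ.* (+ κ ℤ.* + l) ≡ m ℤ.* m₁
    squares = trans (regroup (+ κ) (+ l) (+ κ) (+ l)) (trans (cong₂ ℤ._*_ (trans (sym (ℤP.pos-* κ κ)) (trans (cong +_ (sym eκ)) (ℤP.pos-* α α₁)))
      (trans (sym (ℤP.pos-* l l)) (trans (cong +_ (sym el)) (ℤP.pos-* γ γ₁)))) (regroup (+ α) (+ α₁) (+ γ) (+ γ₁)))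
    simplify : ∀ m m₁ i x → x ℤ.+ m₁ ℤ.+ m ℤ.* i ℤ.* i ℤ.* (m ℤ.* m₁ ℤ.- m ℤ.* m₁) ≡ x ℤ.+ m₁
    simplify = ℤS.solve-∀

SquareRelated : ℕ → ℕ → Set
SquareRelated x y = Σ ℕ λ κ → x * y ≡ κ * κ

square-trans : ∀ {x y z} → 1 ≤ y → SquareRelated x y → SquareRelated y z → SquareRelated x z
square-trans {x} {y} {z} y≥1 (κ , e) (l , e′) = square-quotient (x * z) y (κ * l) y≥1 (trans (lem x y z) (trans (cong₂ _*_ e e′) (lem′ κ l)))
  where
  lem : ∀ x y z → x * z * (y * y) ≡ x * y * (y * z)
  lem = ℕS.solve-∀
  lem′ : ∀ κ l → κ * κ * (l * l) ≡ κ * l * (κ * l)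
  lem′ = ℕS.solve-∀

module Link (D : Decomposition) (k s t t′ r₀ M : ℕ) (k≥1 : 1 ≤ k) (s≥ : 100 ≤ s) (t≥1 : 1 ≤ t)
  (Z : Sizes D (k * s) r₀ M) (P : Patch D k s t) (P′ : Patch D k s t′) (r₀≤t : r₀ ≤ t) (t≤t′ : t ≤ t′)
  (t′≤2t : t′ ≤ 2 * t) (k[t′-t]≤t : k * t′ ≤ k * t + t) (n′≤M : 2 * (k * s) * (4 * t′) ≤ M)
  (n₀≤n : Decomposition.n₀ D ≤ 2 * (k * s) * (4 * t)) where
  open Decomposition D
  private
    S n n′ : ℕ
    S = k * s
    n = 2 * S * (4 * t)
    n′ = 2 * S * (4 * t′)
    n≤n′ : n ≤ n′
    n≤n′ = *-monoʳ-≤ (2 * S) (*-monoʳ-≤ 4 t≤t′)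
    module P = Patch P
    module P′ = Patch P′
    module F = PatchFacts D k s t r₀ M k≥1 s≥ t≥1 Z P r₀≤t (≤-trans n≤n′ n′≤M) n₀≤n

    small′ : List ℕ
    small′ = filter (_<? 2 ^ (2 * S * t′)) (LA n)

    small′-few : length small′ ≤ 2 ^ ((S + 4) * t′)
    small′-few = Sizes.up Z t′ (≤-trans r₀≤t t≤t′) (≤-trans (*-monoʳ-≤ (2 * S) (m≤m+n t′ (3 * t′))) n′≤M) small′ (filter⁺ (_<? 2 ^ (2 * S * t′)) (LA-unique n))
      λ a a∈ → let f = ∈-filter⁻ (_<? 2 ^ (2 * S * t′)) {xs = LA n} a∈ in LA-mono (≤-trans n≤n′ n′≤M) a (proj₁ f) , proj₂ f

    4*small′ : 4 * (length small′ * 2 ^ (21 * t)) ≤ 2 ^ (4 * S * t)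
    4*small′ = ≤-trans (*-monoʳ-≤ 4 (*-monoˡ-≤ (2 ^ (21 * t)) small′-few))
      (≤-trans (≤-reflexive (trans (cong (4 *_) (pow+ ((S + 4) * t′) (21 * t))) (pow+ 2 ((S + 4) * t′ + 21 * t)))) (2^-mono exponent))
      where
      exponent : 2 + ((S + 4) * t′ + 21 * t) ≤ 4 * S * t
      exponent = ≤-trans (+-mono-≤ (*-monoʳ-≤ 2 t≥1) (+-monoˡ-≤ (21 * t) (*-monoʳ-≤ (S + 4) t′≤2t))) (≤-trans (≤-reflexive (lem S t))
          (≤-trans (*-monoˡ-≤ t (+-monoʳ-≤ (2 * S) (≤-trans (m≤m+n 31 69) (≤-trans F.S≥ (m≤m+n S S))))) (≤-reflexive (lem₂ S t))))
        where
        lem : ∀ S t → 2 * t + ((S + 4) * (2 * t) + 21 * t) ≡ (2 * S + 31) * t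
        lem = ℕS.solve-∀
        lem₂ : ∀ S t → (2 * S + (S + S)) * t ≡ 4 * S * t
        lem₂ = ℕS.solve-∀

    4*exc′ : 4 * (length P′.exc * 2 ^ (21 * t)) ≤ 2 ^ (4 * S * t)
    4*exc′ = *-cancelʳ-≤ _ _ (2 ^ (4 * s * t)) {{m^n≢0 2 (4 * s * t)}}
      (≤-trans (≤-reflexive (lem₁ (length P′.exc) (2 ^ (21 * t)) (2 ^ (4 * s * t))))
        (≤-trans (*-monoʳ-≤ (length P′.exc) (≤-trans (≤-reflexive (trans (cong (4 *_) (pow+ (21 * t) (4 * s * t))) (pow+ 2 (21 * t + 4 * s * t)))) (2^-mono exponent)))
          (≤-trans P′.exc≤ (≤-trans (2^-mono exponent′) (≤-reflexive (sym (pow+ (4 * S * t) (4 * s * t))))))))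
      where
      lem₁ : ∀ e x y → 4 * (e * x) * y ≡ e * (4 * (x * y))
      lem₁ = ℕS.solve-∀
      exponent : 2 + (21 * t + 4 * s * t) ≤ 8 * s * t′
      exponent = ≤-trans (+-monoˡ-≤ (21 * t + 4 * s * t) (*-monoʳ-≤ 2 t≥1)) (≤-trans (≤-reflexive (lem s t))
          (≤-trans (*-monoˡ-≤ t (+-monoˡ-≤ (4 * s) (≤-trans (≤-trans (m≤m+n 23 77) s≥) (m≤n*m s 4)))) (≤-trans (≤-reflexive (lem₂ s t)) (*-monoʳ-≤ (8 * s) t≤t′))))
        where
        lem : ∀ s t → 2 * t + (21 * t + 4 * s * t) ≡ (23 + 4 * s) * t
        lem = ℕS.solve-∀
        lem₂ : ∀ s t → (4 * s + 4 * s) * t ≡ 8 * s * t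
        lem₂ = ℕS.solve-∀
      exponent′ : 4 * S * t′ ≤ 4 * S * t + 4 * s * t
      exponent′ = ≤-trans (≤-reflexive (lem k s t′)) (≤-trans (*-monoʳ-≤ (4 * s) k[t′-t]≤t) (≤-reflexive (lem₂ k s t)))
        where
        lem : ∀ k s t → 4 * (k * s) * t ≡ 4 * s * (k * t)
        lem = ℕS.solve-∀
        lem₂ : ∀ k s t → 4 * s * (k * t + t) ≡ 4 * (k * s) * t + 4 * s * t
        lem₂ = ℕS.solve-∀

    common? : ∀ a → Dec (2 ^ (2 * S * t′) ≤ a × ¬ (a ∈ P′.exc))
    common? a = (2 ^ (2 * S * t′) ≤? a) ×-dec ¬? (a ∈? P′.exc)

    common : Σ ℕ λ a → a ∈ F.good × 2 ^ (2 * S * t′) ≤ a × ¬ (a ∈ P′.exc)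
    common = search (any? common? F.good)
      where
      search : Dec (Any (λ a → 2 ^ (2 * S * t′) ≤ a × ¬ (a ∈ P′.exc)) F.good) → Σ ℕ λ a → a ∈ F.good × 2 ^ (2 * S * t′) ≤ a × ¬ (a ∈ P′.exc)
      search (yes x) = find x
      search (no none) = ⊥-elim (<⇒≱ {2 * Y} {4 * Y} (*-monoˡ-< Y {{m^n≢0 2 (4 * S * t)}} {2} {4} (s≤s (s≤s (s≤s z≤n)))) too-few)
        where
        Y = 2 ^ (4 * S * t)
        covered : ∀ a → a ∈ F.good → a ∈ small′ ++ P′.exc
        covered a a∈ = by-size (a <? 2 ^ (2 * S * t′)) (a ∈? P′.exc)
          where
          by-size : Dec (a < 2 ^ (2 * S * t′)) → Dec (a ∈ P′.exc) → a ∈ small′ ++ P′.exc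
          by-size (yes a<) _        = ∈-++⁺ˡ (∈-filter⁺ (_<? 2 ^ (2 * S * t′)) (proj₁ (F.good⁻ a a∈)) a<)
          by-size (no a≮) (yes a∈e) = ∈-++⁺ʳ small′ a∈e
          by-size (no a≮) (no a∉e)  = ⊥-elim (none (lose a∈ (≮⇒≥ a≮ , a∉e)))
        few : length F.good ≤ length small′ + length P′.exc
        few = ≤-trans (card-⊆ (filter⁺ F.large? (LA-unique n)) covered) (≤-reflexive (length-++ small′))
        too-few : 4 * Y ≤ 2 * Y
        too-few = ≤-trans (*-monoʳ-≤ 4 (≤-trans F.length-good (*-monoˡ-≤ (2 ^ (21 * t)) few)))
          (≤-trans (≤-reflexive (lem (length small′) (length P′.exc) (2 ^ (21 * t)))) (≤-trans (+-mono-≤ 4*small′ 4*exc′) (≤-reflexive (cong (_+_ Y) (sym (+-identityʳ Y))))))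
          where
          lem : ∀ a b x → 4 * ((a + b) * x) ≡ 4 * (a * x) + 4 * (b * x)
          lem = ℕS.solve-∀

  -- A common element gives α′u² = αu′².
  linked : + P′.α ℤ.* P.β ≡ + P.α ℤ.* P′.β → SquareRelated P.α P′.α
  linked proportional = square-quotient (P.α * P′.α) u (P.α * u′) u≥1 squares
    where
    a = proj₁ common
    g = F.good⁻ a (proj₁ (proj₂ common))
    r = P.root a (proj₁ g) (proj₁ (proj₂ g)) (proj₂ (proj₂ g))
    r′ = P′.root a (LA-mono n≤n′ a (proj₁ g)) (proj₁ (proj₂ (proj₂ common))) (proj₂ (proj₂ (proj₂ common)))
    u = proj₁ r
    u′ = proj₁ r′
    β<a : ∣ P.β ∣ < a
    β<a = ≤-<-trans P.β≤ (<-≤-trans (^-monoʳ-< 2 (s≤s (s≤s z≤n)) exponent) (proj₁ (proj₂ g)))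
      where
      exponent : 16 * k * t + 3 < 2 * S * t
      exponent = ≤-trans (+-monoʳ-≤ (suc (16 * k * t)) (*-monoʳ-≤ 3 (*-mono-≤ k≥1 t≥1))) (≤-trans (≤-trans (s≤s (≤-reflexive (lem k t))) (+-monoˡ-≤ (19 * (k * t)) (*-mono-≤ k≥1 t≥1)))
          (≤-trans (≤-trans (≤-reflexive (lem₃ k t)) (*-monoˡ-≤ (k * t) (≤-trans (m≤m+n 20 80) (≤-trans s≥ (m≤n*m s 2))))) (≤-reflexive (lem₂ k s t))))
        where
        lem : ∀ k t → 16 * k * t + 3 * (k * t) ≡ 19 * (k * t)
        lem = ℕS.solve-∀
        lem₂ : ∀ k s t → 2 * s * (k * t) ≡ 2 * (k * s) * t
        lem₂ = ℕS.solve-∀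
        lem₃ : ∀ k t → k * t + 19 * (k * t) ≡ 20 * (k * t)
        lem₃ = ℕS.solve-∀
    u≥1 : 1 ≤ u
    u≥1 = n≢0⇒n>0 λ u≡0 → <⇒≱ β<a (≤-trans (m≤n*m a P.α {{>-nonZero P.α≥1}}) (≤-reflexive (size (sym (trans (cong (λ u → + (u * u)) (sym u≡0)) (proj₂ r))))))
      where
      size : + (P.α * a) ℤ.+ P.β ≡ + 0 → P.α * a ≡ ∣ P.β ∣
      size e = trans (cong ∣_∣ {x = + (P.α * a)} (trans (lem (+ (P.α * a)) P.β) (trans (cong (ℤ._- P.β) e) (ℤP.+-identityˡ (ℤ.- P.β))))) (ℤP.∣-i∣≡∣i∣ P.β)
        where
        lem : ∀ x y → x ≡ (x ℤ.+ y) ℤ.- y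
        lem = ℤS.solve-∀
    cross : P′.α * (u * u) ≡ P.α * (u′ * u′)
    cross = ℤP.+-injective (trans (ℤP.pos-* P′.α (u * u)) (trans (cong (ℤ._*_ (+ P′.α)) (trans (proj₂ r) (cong (ℤ._+ P.β) (ℤP.pos-* P.α a))))
      (trans (lem (+ P′.α) (+ P.α) (+ a) P.β P′.β) (trans (cong (λ x → + P.α ℤ.* (+ P′.α ℤ.* + a ℤ.+ P′.β) ℤ.+ (x ℤ.- + P.α ℤ.* P′.β)) proportional)
        (trans (lem₂ (+ P.α ℤ.* (+ P′.α ℤ.* + a ℤ.+ P′.β)) (+ P.α ℤ.* P′.β)) (trans (cong (ℤ._*_ (+ P.α)) (sym (trans (proj₂ r′) (cong (ℤ._+ P′.β) (ℤP.pos-* P′.α a))))) (sym (ℤP.pos-* P.α (u′ * u′)))))))))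
      where
      lem : ∀ α′ α a β β′ → α′ ℤ.* (α ℤ.* a ℤ.+ β) ≡ α ℤ.* (α′ ℤ.* a ℤ.+ β′) ℤ.+ (α′ ℤ.* β ℤ.- α ℤ.* β′)
      lem = ℤS.solve-∀
      lem₂ : ∀ x y → x ℤ.+ (y ℤ.- y) ≡ x
      lem₂ = ℤS.solve-∀
    squares : P.α * P′.α * (u * u) ≡ P.α * u′ * (P.α * u′)
    squares = trans (*-assoc P.α P′.α (u * u)) (trans (cong (P.α *_) cross) (lem P.α u′))
      where
      lem : ∀ α u → α * (α * (u * u)) ≡ α * u * (α * u)
      lem = ℕS.solve-∀

Large : Decomposition → ℕ → ℕ → ℕ → Set
Large D M e a = a ∈ Decomposition.LA D M × 2 ^ e ≤ a

record Parameters (D : Decomposition) (k s t r₀ M : ℕ) : Set where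
  open Decomposition D
  field
    k≥1  : 1 ≤ k
    s≥   : 1000 ≤ s
    t≥   : 128 * s ≤ t
    r₀≤t : r₀ ≤ t
    n₀≤t : n₀ ≤ t
    N₀≤t : N₀ ≤ t
    P₀≤t : P₀ ≤ t
    M≥   : 2 * (k * s) * (4 * (8 * k * t)) ≤ M

  S R : ℕ
  S = k * s
  R = k * (k * t)

  s≥100 : 100 ≤ s
  s≥100 = ≤-trans (m≤m+n 100 900) s≥
  s≥1 : 1 ≤ s
  s≥1 = ≤-trans (m≤m+n 1 99) s≥100
  t≥1 : 1 ≤ t
  t≥1 = ≤-trans (≤-trans s≥1 (m≤n*m s 128)) t≥
  S≥1 : 1 ≤ S
  S≥1 = *-mono-≤ k≥1 s≥1
  t≤kt : t ≤ k * t
  t≤kt = m≤n*m t k {{>-nonZero k≥1}}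
  kt≤R : k * t ≤ R
  kt≤R = m≤n*m (k * t) k {{>-nonZero k≥1}}
  kt≥1 : 1 ≤ k * t
  kt≥1 = ≤-trans t≥1 t≤kt
  R≥1 : 1 ≤ R
  R≥1 = ≤-trans kt≥1 kt≤R

  module Index (j : ℕ) (lo : k ≤ j) (hi : j ≤ 8 * k) where
    t≤jt : t ≤ j * t
    t≤jt = ≤-trans t≤kt (*-monoˡ-≤ t lo)
    jt≥1 : 1 ≤ j * t
    jt≥1 = ≤-trans t≥1 t≤jt
    r₀≤jt : r₀ ≤ j * t
    r₀≤jt = ≤-trans r₀≤t t≤jt
    n≤M : 2 * (k * s) * (4 * (j * t)) ≤ M
    n≤M = ≤-trans (*-monoʳ-≤ (2 * S) (*-monoʳ-≤ 4 (*-monoˡ-≤ t hi))) M≥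
    n₀≤n : n₀ ≤ 2 * (k * s) * (4 * (j * t))
    n₀≤n = ≤-trans (≤-trans n₀≤t t≤jt) (≤-trans (m≤n*m (j * t) 4) (m≤n*m (4 * (j * t)) (2 * S) {{m*n≢0 2 S {{_}} {{>-nonZero S≥1}}}}))

swap-parameters : ∀ {D k s t r₀ M} → Parameters D k s t r₀ M → Parameters (swap D) k s t r₀ M
swap-parameters Q = record { k≥1 = k≥1 ; s≥ = s≥ ; t≥ = t≥ ; r₀≤t = r₀≤t ; n₀≤t = n₀≤t ; N₀≤t = N₀≤t ; P₀≤t = P₀≤t ; M≥ = M≥ }
  where open Parameters Q

module Side (D : Decomposition) (k s t r₀ M : ℕ) (Q : Parameters D k s t r₀ M) (Z : Sizes D (k * s) r₀ M)
  (P : ∀ j → k ≤ j → j ≤ 8 * k → Patch D k s (j * t)) where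
  open Decomposition D
  open Parameters Q

  module Facts (j : ℕ) (lo : k ≤ j) (hi : j ≤ 8 * k) where
    open Index j lo hi
    open PatchFacts D k s (j * t) r₀ M k≥1 s≥100 jt≥1 Z (P j lo hi) r₀≤jt n≤M n₀≤n public

  module _ (j : ℕ) (lo : k ≤ j) (hi : j ≤ 8 * k) where
    open Index j lo hi
    private
      module F = Facts j lo hi
      module P′ = Patch (P j lo hi)
      lem : ∀ c k t → c * k * (8 * k * t) ≡ c * 8 * (k * (k * t))
      lem = ℕS.solve-∀
      scale : ∀ c → c * k * (j * t) ≤ c * 8 * R
      scale c = ≤-trans (*-monoʳ-≤ (c * k) (*-monoˡ-≤ t hi)) (≤-reflexive (lem c k t))

    roots-at : ∀ e h → e ≤ 2 * S * (j * t) → h ≤ S * (j * t) → Roots (Large D M e) (128 * R + 3) h (328 * R)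
    roots-at e h e≤ h≤ = record
      { α = P′.α ; β = P′.β ; α≥1 = P′.α≥1
      ; α≤ = ≤-trans P′.α≤ (2^-mono (+-mono-≤ (scale 16) (n≤1+n 2)))
      ; β≤ = ≤-trans P′.β≤ (2^-mono (+-monoˡ-≤ 3 (scale 16)))
      ; U = F.U
      ; U⁻ = λ u u∈ → let r = F.U⁻ u u∈ ; g = F.good⁻ (proj₁ r) (proj₁ (proj₂ r)) in
          proj₁ r , (LA-mono n≤M (proj₁ r) (proj₁ g) , ≤-trans (2^-mono e≤) (proj₁ (proj₂ g))) , proj₂ (proj₂ r)
      ; few = ≤-trans (F.sparse-few 8 refl h h≤) (2^-mono (scale 41)) }

  α : ∀ j → k ≤ j → j ≤ 8 * k → ℕ
  α j lo hi = Patch.α (P j lo hi)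

  β : ∀ j → k ≤ j → j ≤ 8 * k → ℤ
  β j lo hi = Patch.β (P j lo hi)

  Proportional : Set
  Proportional = ∀ j lo hi lo′ hi′ → + α (suc j) lo′ hi′ ℤ.* β j lo hi ≡ + α j lo hi ℤ.* β (suc j) lo′ hi′

  link : Proportional → ∀ j lo hi lo′ hi′ → SquareRelated (α j lo hi) (α (suc j) lo′ hi′)
  link prop j lo hi lo′ hi′ = Link.linked D k s (j * t) (suc j * t) r₀ M k≥1 s≥100 jt≥1 Z (P j lo hi) (P (suc j) lo′ hi′)
      r₀≤jt (m≤n+m (j * t) t) (≤-trans (+-monoˡ-≤ (j * t) t≤jt) (≤-reflexive (cong (_+_ (j * t)) (sym (+-identityʳ (j * t))))))
      (≤-trans (≤-reflexive (lem k j t)) (+-monoʳ-≤ (k * (j * t)) (*-monoˡ-≤ t lo)))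
      (Index.n≤M (suc j) lo′ hi′) n₀≤n (prop j lo hi lo′ hi′)
    where
    open Index j lo hi
    lem : ∀ k j t → k * (suc j * t) ≡ k * (j * t) + k * t
    lem = ℕS.solve-∀

  chain : Proportional → ∀ lo hi d lo′ hi′ → SquareRelated (α k lo hi) (α (d + k) lo′ hi′)
  chain prop lo hi zero lo′ hi′ = α k lo hi , cong₂ (λ x y → α k lo hi * α k x y) (≤-irrelevant lo′ lo) (≤-irrelevant hi′ hi)
  chain prop lo hi (suc d) lo′ hi′ = square-trans {α k lo hi} {α (d + k) lo″ hi″} {α (suc d + k) lo′ hi′} (Patch.α≥1 (P (d + k) lo″ hi″)) (chain prop lo hi d lo″ hi″) (link prop (d + k) lo″ hi″ lo′ hi′)
    where
    lo″ = m≤n+m k d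
    hi″ = ≤-trans (n≤1+n (d + k)) hi′

module Contradiction (D : Decomposition) (k s t r₀ M : ℕ) (Q : Parameters D k s t r₀ M)
  (ZA : Sizes D (k * s) r₀ M) (ZB : Sizes (swap D) (k * s) r₀ M)
  (PA : ∀ j → k ≤ j → j ≤ 8 * k → Patch D k s (j * t)) (PB : ∀ j → k ≤ j → j ≤ 8 * k → Patch (swap D) k s (j * t)) where
  open Decomposition D
  open Parameters Q
  private
    module A = Side D k s t r₀ M Q ZA PA
    module B = Side (swap D) k s t r₀ M (swap-parameters Q) ZB PB

    b c : ℕ
    b = 128 * R + 3
    c = 328 * R

    N₀≤2^ : ∀ e → t ≤ e → N₀ ≤ 2 ^ e
    N₀≤2^ e t≤e = ≤-trans (≤-trans N₀≤t t≤e) (<⇒≤ (n<2^n e))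

    coprime-sums : ∀ e h → t ≤ e → h ≤ e → ∀ a a′ p → Large D M e a → Large (swap D) M e a′ → Prime p → p ≤ 2 ^ h → ¬ (p ∣ a + a′)
    coprime-sums e h t≤e h≤e a a′ p (a∈ , a≥) (a′∈ , a′≥) pp p≤ p∣ = <⇒≱ p<a+a′ (≤-reflexive (sym (prime∣prime pp
        (Sizes.pure ZA a a′ a∈ a′∈ (≤-trans (≤-trans (N₀≤2^ e t≤e) a≥) (m≤m+n a a′))) p∣)))
      where
      p<a+a′ : p < a + a′
      p<a+a′ = ≤-<-trans (≤-trans p≤ (≤-trans (2^-mono h≤e) a≥)) (m<m+n a (LB-pos M a′ a′∈))

    R≤2^R : R ≤ 2 ^ R
    R≤2^R = <⇒≤ (n<2^n R)

    linear≤ : 512 * R + 18 ≤ 2 ^ c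
    linear≤ = ≤-trans (+-monoʳ-≤ (512 * R) (*-monoʳ-≤ 18 R≥1)) (≤-trans (≤-reflexive (sym (*-distribʳ-+ R 512 18)))
      (≤-trans (*-mono-≤ (m≤m+n 530 494) R≤2^R) (≤-trans (≤-reflexive (pow+ 10 R)) (2^-mono (≤-trans (+-monoˡ-≤ R (*-monoʳ-≤ 10 R≥1))
        (≤-trans (≤-reflexive (lem R)) (*-monoˡ-≤ R (m≤m+n 11 317))))))))
      where
      lem : ∀ R → 10 * R + R ≡ 11 * R
      lem = ℕS.solve-∀

    few≤ : 5 + (2 ^ c + (2 ^ c + (b + b))) + suc (b + b) ≤ 3 * 2 ^ c
    few≤ = ≤-trans (≤-reflexive (lem R (2 ^ c))) (≤-trans (+-monoʳ-≤ (2 * 2 ^ c) linear≤) (≤-reflexive (lem₂ (2 ^ c))))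
      where
      lem : ∀ R x → 5 + (x + (x + (128 * R + 3 + (128 * R + 3)))) + suc (128 * R + 3 + (128 * R + 3)) ≡ 2 * x + (512 * R + 18)
      lem = ℕS.solve-∀
      lem₂ : ∀ x → 2 * x + x ≡ 3 * x
      lem₂ = ℕS.solve-∀

    room : ∀ h → s * R ≤ h → 4 * h ≤ 2 ^ (2 * R) → 2 * (4 * 2 ^ c * (4 * h)) ≤ 2 ^ h
    room h sR≤h 4h≤ = ≤-trans (*-monoʳ-≤ 2 (*-monoʳ-≤ (4 * 2 ^ c) 4h≤))
      (≤-trans (≤-reflexive (trans (cong (λ x → 2 * (x * 2 ^ (2 * R))) (pow+ 2 c)) (trans (cong (2 *_) (pow+ (2 + c) (2 * R))) (pow+ 1 (2 + c + 2 * R)))))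
        (2^-mono (≤-trans exponent sR≤h)))
      where
      exponent : 1 + (2 + 328 * R + 2 * R) ≤ s * R
      exponent = ≤-trans (≤-reflexive (lem R)) (≤-trans (+-monoʳ-≤ (330 * R) (*-monoʳ-≤ 3 R≥1)) (≤-trans (≤-reflexive (sym (*-distribʳ-+ R 330 3)))
          (*-monoˡ-≤ R (≤-trans (m≤m+n 333 667) s≥))))
        where
        lem : ∀ R → 1 + (2 + 328 * R + 2 * R) ≡ 330 * R + 3 * 1
        lem = ℕS.solve-∀

    kt = k * t
    h₀ = S * kt
    h₁ = 2 * S * (4 * kt)

    lem-h : ∀ k s t → s * (k * (k * t)) ≡ k * s * (k * t)
    lem-h = ℕS.solve-∀

    4h₁≤ : 4 * h₁ ≤ 2 ^ (2 * kt)
    4h₁≤ = ≤-trans (≤-reflexive (lem k s t)) (≤-trans (*-monoˡ-≤ (k * (k * t)) (≤-trans (*-monoˡ-≤ s (m≤m+n 32 96)) t≥))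
      (≤-trans (≤-reflexive (lem₂ k t)) (≤-trans (*-mono-≤ (<⇒≤ (n<2^n kt)) (<⇒≤ (n<2^n kt))) (≤-reflexive (trans (pow+ kt kt) (cong (λ x → 2 ^ (kt + x)) (sym (+-identityʳ kt))))))))
      where
      lem : ∀ k s t → 4 * (2 * (k * s) * (4 * (k * t))) ≡ 32 * s * (k * (k * t))
      lem = ℕS.solve-∀
      lem₂ : ∀ k t → t * (k * (k * t)) ≡ (k * t) * (k * t)
      lem₂ = ℕS.solve-∀

    4h₁≤R : 4 * h₁ ≤ 2 ^ (2 * R)
    4h₁≤R = ≤-trans 4h₁≤ (2^-mono (*-monoʳ-≤ 2 kt≤R))

    h₀≤h₁ : h₀ ≤ h₁
    h₀≤h₁ = *-mono-≤ (m≤n*m S 2) (m≤n*m kt 4)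

    t≤h₀ : t ≤ h₀
    t≤h₀ = ≤-trans t≤kt (m≤n*m kt S {{>-nonZero S≥1}})

    h₀≥2 : 2 ≤ h₀
    h₀≥2 = ≤-trans (≤-trans (≤-trans (m≤m+n 2 998) s≥) (≤-trans (m≤n*m s 128) t≥)) t≤h₀

    h₁≥2 : 2 ≤ h₁
    h₁≥2 = ≤-trans h₀≥2 h₀≤h₁

    zero-at : ∀ i lo hi j lo′ hi′ → + B.α j lo′ hi′ ℤ.* A.β i lo hi ℤ.+ + A.α i lo hi ℤ.* B.β j lo′ hi′ ≡ + 0
    zero-at i lo hi j lo′ hi′ = Pair.E≡0 (Large D M e) (Large (swap D) M e) b h₀ c
        (A.roots-at i lo hi e h₀ (*-monoʳ-≤ (2 * S) (*-monoˡ-≤ t lo)) (*-monoʳ-≤ S (*-monoˡ-≤ t lo)))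
        (B.roots-at j lo′ hi′ e h₀ (*-monoʳ-≤ (2 * S) (*-monoˡ-≤ t lo′)) (*-monoʳ-≤ S (*-monoˡ-≤ t lo′)))
        (coprime-sums e h₀ (≤-trans t≤h₀ h₀≤e) h₀≤e) h₀≥2
        (≤-trans (*-monoˡ-≤ (4 * h₀) (≤-trans few≤ (*-monoˡ-≤ (2 ^ c) (n≤1+n 3)))) (≤-trans (m≤n*m _ 2)
          (room h₀ (≤-reflexive (lem-h k s t)) (≤-trans (*-monoʳ-≤ 4 h₀≤h₁) 4h₁≤R))))
      where
      e = 2 * S * kt
      h₀≤e : h₀ ≤ e
      h₀≤e = *-monoˡ-≤ kt (m≤n*m S 2)

    cancel : ∀ γ δ α β α′ β′ → ¬ (γ ≡ + 0) → γ ℤ.* β ℤ.+ α ℤ.* δ ≡ + 0 → γ ℤ.* β′ ℤ.+ α′ ℤ.* δ ≡ + 0 → α′ ℤ.* β ≡ α ℤ.* β′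
    cancel γ δ α β α′ β′ γ≢0 e e′ = ℤP.*-cancelˡ-≡ γ _ _ {{ℤ.≢-nonZero γ≢0}}
      (trans (lem γ δ α β α′) (trans (cong (λ x → α′ ℤ.* x ℤ.- α ℤ.* (α′ ℤ.* δ)) e)
        (sym (trans (lem₂ γ δ α α′ β′) (trans (cong (λ x → α ℤ.* x ℤ.- α ℤ.* (α′ ℤ.* δ)) e′) (trans (cong (ℤ._- α ℤ.* (α′ ℤ.* δ)) (ℤP.*-zeroʳ α)) (cong (ℤ._- α ℤ.* (α′ ℤ.* δ)) (sym (ℤP.*-zeroʳ α′)))))))))
      where
      lem : ∀ γ δ α β α′ → γ ℤ.* (α′ ℤ.* β) ≡ α′ ℤ.* (γ ℤ.* β ℤ.+ α ℤ.* δ) ℤ.- α ℤ.* (α′ ℤ.* δ)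
      lem = ℤS.solve-∀
      lem₂ : ∀ γ δ α α′ β′ → γ ℤ.* (α ℤ.* β′) ≡ α ℤ.* (γ ℤ.* β′ ℤ.+ α′ ℤ.* δ) ℤ.- α ℤ.* (α′ ℤ.* δ)
      lem₂ = ℤS.solve-∀

    nonzero : ∀ {x} → 1 ≤ x → ¬ (+ x ≡ + 0)
    nonzero x≥1 e = <⇒≢ x≥1 (sym (ℤP.+-injective e))

    proportionalA : A.Proportional
    proportionalA j lo hi lo′ hi′ = cancel (+ B.α j lo hi) (B.β j lo hi) (+ A.α j lo hi) (A.β j lo hi) (+ A.α (suc j) lo′ hi′) (A.β (suc j) lo′ hi′)
      (nonzero (Patch.α≥1 (PB j lo hi))) (zero-at j lo hi j lo hi) (zero-at (suc j) lo′ hi′ j lo hi)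

    proportionalB : B.Proportional
    proportionalB j lo hi lo′ hi′ = cancel (+ A.α j lo hi) (A.β j lo hi) (+ B.α j lo hi) (B.β j lo hi) (+ B.α (suc j) lo′ hi′) (B.β (suc j) lo′ hi′)
      (nonzero (Patch.α≥1 (PA j lo hi))) (trans (ℤP.+-comm (+ A.α j lo hi ℤ.* B.β j lo hi) _) (zero-at j lo hi j lo hi))
      (trans (ℤP.+-comm (+ A.α j lo hi ℤ.* B.β (suc j) lo′ hi′) _) (zero-at j lo hi (suc j) lo′ hi′))

    lo₀ : k ≤ k
    lo₀ = ≤-refl
    hi₀ : k ≤ 8 * k
    hi₀ = m≤n*m k 8
    d₁ = 7 * k
    lo₁ : k ≤ d₁ + k
    lo₁ = m≤n+m k d₁
    top≡ : d₁ + k ≡ 8 * k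
    top≡ = lem k
      where
      lem : ∀ k → 7 * k + k ≡ 8 * k
      lem = ℕS.solve-∀
    hi₁ : d₁ + k ≤ 8 * k
    hi₁ = ≤-reflexive top≡

    squareA : SquareRelated (A.α k lo₀ hi₀) (A.α (d₁ + k) lo₁ hi₁)
    squareA = A.chain proportionalA lo₀ hi₀ d₁ lo₁ hi₁

    squareB : SquareRelated (B.α k lo₀ hi₀) (B.α (d₁ + k) lo₁ hi₁)
    squareB = B.chain proportionalB lo₀ hi₀ d₁ lo₁ hi₁

    e₁ = 2 * S * ((d₁ + k) * t)

    h₁≤top : h₁ ≤ S * ((d₁ + k) * t)
    h₁≤top = ≤-reflexive (trans (lem S k t) (cong (λ j → S * (j * t)) (sym top≡)))
      where
      lem : ∀ S k t → 2 * S * (4 * (k * t)) ≡ S * (8 * k * t)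
      lem = ℕS.solve-∀

    h₁≤e₁ : h₁ ≤ e₁
    h₁≤e₁ = ≤-trans h₁≤top (*-monoˡ-≤ ((d₁ + k) * t) (m≤n*m S 2))

    module Top = Pair (Large D M e₁) (Large (swap D) M e₁) b h₁ c (A.roots-at (d₁ + k) lo₁ hi₁ e₁ h₁ ≤-refl h₁≤top)
      (B.roots-at (d₁ + k) lo₁ hi₁ e₁ h₁ ≤-refl h₁≤top) (coprime-sums e₁ h₁ (≤-trans (≤-trans t≤h₀ h₀≤h₁) h₁≤e₁) h₁≤e₁)

    module FA = A.Facts k lo₀ hi₀
    module FB = B.Facts k lo₀ hi₀
    module PAk = Patch (PA k lo₀ hi₀)
    module PBk = Patch (PB k lo₀ hi₀)

    exA exB : List ℕ
    exA = FA.small ++ PAk.exc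
    exB = FB.small ++ PBk.exc

    add : ℕ × ℕ → ℕ
    add (a , b) = a + b

    exceptional : List ℕ
    exceptional = map add (cartesianProduct exA (LB h₁)) ++ map add (cartesianProduct (LA h₁) exB)

    n≤M : h₁ ≤ M
    n≤M = Index.n≤M k lo₀ hi₀
    n₀≤n : n₀ ≤ h₁
    n₀≤n = Index.n₀≤n k lo₀ hi₀

    x20 Y : ℕ
    x20 = 2 ^ (20 * kt)
    Y = 2 ^ (4 * S * kt)

    ex-few : ∀ (xs ys : List ℕ) → 4 * (length xs * x20) ≤ Y → 4 * (length ys * x20) ≤ Y → 4 * (length (xs ++ ys) * x20) ≤ 2 * Y
    ex-few xs ys xs≤ ys≤ = ≤-trans (≤-reflexive (trans (cong (λ l → 4 * (l * x20)) (length-++ xs)) (lem (length xs) (length ys) x20)))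
        (≤-trans (+-mono-≤ xs≤ ys≤) (≤-reflexive (cong (_+_ Y) (sym (+-identityʳ Y)))))
      where
      lem : ∀ a b x → 4 * ((a + b) * x) ≡ 4 * (a * x) + 4 * (b * x)
      lem = ℕS.solve-∀

    full : ℕ
    full = 2 ^ ((S + 4) * (4 * kt))

    r₀≤4kt : r₀ ≤ 4 * kt
    r₀≤4kt = ≤-trans (Index.r₀≤jt k lo₀ hi₀) (m≤n*m kt 4)

    LA≤ : length (LA h₁) ≤ full
    LA≤ = Sizes.up ZA (4 * kt) r₀≤4kt n≤M (LA h₁) (LA-unique h₁) λ a a∈ → LA-mono n≤M a a∈ , LA-bound h₁ n₀≤n a a∈

    LB≤ : length (LB h₁) ≤ full
    LB≤ = Sizes.up ZB (4 * kt) r₀≤4kt n≤M (LB h₁) (LB-unique h₁) λ a a∈ → LB-mono n≤M a a∈ , LB-bound h₁ n₀≤n a a∈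

    exceptional≤ : length exceptional ≤ length exA * full + full * length exB
    exceptional≤ = ++-few (map add (cartesianProduct exA (LB h₁))) (map add (cartesianProduct (LA h₁) exB))
      (≤-trans (≤-reflexive (trans (length-map add (cartesianProduct exA (LB h₁))) (length-product exA (LB h₁)))) (*-monoʳ-≤ (length exA) LB≤))
      (≤-trans (≤-reflexive (trans (length-map add (cartesianProduct (LA h₁) exB)) (length-product (LA h₁) exB))) (*-monoˡ-≤ (length exB) LA≤))

    exceptional-few : 2 * (length exceptional * (4 * h₁)) ≤ 2 ^ h₁
    exceptional-few = ≤-trans (*-monoʳ-≤ 2 (*-monoʳ-≤ (length exceptional) 4h₁≤))
      (≤-trans (≤-reflexive (lem₁ (length exceptional) (2 ^ (2 * kt)))) (≤-trans (*-monoʳ-≤ (length exceptional) (2^-mono exponent)) saved))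
      where
      lem₁ : ∀ x y → 2 * (x * y) ≡ x * (2 * y)
      lem₁ = ℕS.solve-∀
      exponent : suc (2 * kt) ≤ 4 * kt
      exponent = ≤-trans (+-monoˡ-≤ (2 * kt) kt≥1) (≤-trans (m≤m+n _ kt) (≤-reflexive (lem kt)))
        where
        lem : ∀ x → x + 2 * x + x ≡ 4 * x
        lem = ℕS.solve-∀
      saved : length exceptional * 2 ^ (4 * kt) ≤ 2 ^ h₁
      saved = *-cancelʳ-≤ _ _ (2 ^ (16 * kt)) {{m^n≢0 2 (16 * kt)}} (≤-trans (≤-reflexive (trans (*-assoc (length exceptional) (2 ^ (4 * kt)) (2 ^ (16 * kt)))
          (cong (length exceptional *_) (trans (pow+ (4 * kt) (16 * kt)) (cong (2 ^_) (sym (*-distribʳ-+ kt 4 16)))))))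
        (≤-trans (*-cancelˡ-≤ 4 quadruple) (≤-reflexive (trans (pow+ (4 * S * kt) ((S + 4) * (4 * kt))) (trans (cong (2 ^_) (lem S kt)) (sym (pow+ h₁ (16 * kt))))))))
        where
        lem : ∀ S x → 4 * S * x + (S + 4) * (4 * x) ≡ 2 * S * (4 * x) + 16 * x
        lem = ℕS.solve-∀
        lem₂ : ∀ a b f x → 4 * ((a * f + f * b) * x) ≡ 4 * (a * x) * f + 4 * (b * x) * f
        lem₂ = ℕS.solve-∀
        lem₃ : ∀ y f → 2 * y * f + 2 * y * f ≡ 4 * (y * f)
        lem₃ = ℕS.solve-∀
        quadruple : 4 * (length exceptional * x20) ≤ 4 * (Y * full)
        quadruple = ≤-trans (*-monoʳ-≤ 4 (*-monoˡ-≤ x20 exceptional≤)) (≤-trans (≤-reflexive (lem₂ (length exA) (length exB) full x20))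
          (≤-trans (+-mono-≤ (*-monoˡ-≤ full (ex-few FA.small PAk.exc FA.4*small FA.4*exc)) (*-monoˡ-≤ full (ex-few FB.small PBk.exc FB.4*small FB.4*exc)))
            (≤-reflexive (lem₃ Y full))))

    divs : List ℕ
    divs = divisors (2 ^ h₁) PAk.α ++ divisors (2 ^ h₁) PBk.α

    others excl : List ℕ
    others = upTo P₀ ++ (Top.bad ++ divs)
    excl = others ++ exceptional

    α≤b : ∀ {D} (P : Patch D k s kt) → Patch.α P ≤ 2 ^ b
    α≤b P = ≤-trans (Patch.α≤ P) (2^-mono (+-mono-≤ (≤-trans (≤-reflexive (lem k t)) (*-monoˡ-≤ R (m≤m+n 16 112))) (n≤1+n 2)))
      where
      lem : ∀ k t → 16 * k * (k * t) ≡ 16 * (k * (k * t))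
      lem = ℕS.solve-∀

    others-few : length others ≤ 4 * 2 ^ c
    others-few = ≤-trans (++-few (upTo P₀) (Top.bad ++ divs) (≤-trans (≤-reflexive (length-upTo P₀)) P₀≤) (++-few Top.bad divs Top.bad-few
        (≤-trans (++-few (divisors (2 ^ h₁) PAk.α) (divisors (2 ^ h₁) PBk.α) (divisors-few (2 ^ h₁) PAk.α b PAk.α≥1 (α≤b (PA k lo₀ hi₀))) (divisors-few (2 ^ h₁) PBk.α b PBk.α≥1 (α≤b (PB k lo₀ hi₀))))
          (n≤1+n (b + b)))))
      (+-monoʳ-≤ (2 ^ c) few≤)
      where
      P₀≤ : P₀ ≤ 2 ^ c
      P₀≤ = ≤-trans (≤-trans P₀≤t (≤-trans t≤kt kt≤R)) (≤-trans R≤2^R (2^-mono (m≤n*m R 328)))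

    excl-few : length excl * (4 * h₁) ≤ 2 ^ h₁
    excl-few = *-cancelˡ-≤ 2 (≤-trans (*-monoʳ-≤ 2 (*-monoˡ-≤ (4 * h₁) (++-few others exceptional others-few ≤-refl)))
      (≤-trans (≤-reflexive (lem (4 * 2 ^ c) (length exceptional) (4 * h₁)))
        (≤-trans (+-mono-≤ (room h₁ (≤-trans (≤-reflexive (lem-h k s t)) h₀≤h₁) 4h₁≤R) exceptional-few) (≤-reflexive (cong (_+_ (2 ^ h₁)) (sym (+-identityʳ _)))))))
      where
      lem : ∀ a b x → 2 * ((a + b) * x) ≡ 2 * (a * x) + 2 * (b * x)
      lem = ℕS.solve-∀

  -- A prime p that is unexceptional at the bottom scale makes -αγ a square modulo p, whereas
  -- the sieve at the top scale makes it a nonresidue.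
  contradiction : ⊥
  contradiction = at (prime-outside h₁ excl h₁≥2 excl-few)
    where
    at : (Σ ℕ λ p → Prime p × p ≤ 2 ^ h₁ × p ∉ excl) → ⊥
    at (zero  , pp , _) = ¬prime[0] pp
    at (suc q , pp , p≤ , p∉) = summands (cover h₁ p pp P₀≤p p≤)
      where
      p = suc q
      o = ∉-++ others p∉
      o₁ = ∉-++ (upTo P₀) (proj₁ o)
      o₂ = ∉-++ Top.bad (proj₂ o₁)
      o₃ = ∉-++ (divisors (2 ^ h₁) PAk.α) (proj₂ o₂)
      o₄ = ∉-++ (map add (cartesianProduct exA (LB h₁))) (proj₂ o)
      P₀≤p : P₀ ≤ p
      P₀≤p = ≮⇒≥ λ p<P₀ → proj₁ o₁ (∈-upTo⁺ p<P₀)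
      summands : (Σ ℕ λ a → Σ ℕ λ b → a ∈ LA h₁ × b ∈ LB h₁ × a + b ≡ p) → ⊥
      summands (a , b , a∈ , b∈ , a+b) = both (FA.split a a∈) (FB.split b b∈)
        where
        both : (a ∈ FA.good) ⊎ (a ∈ exA) → (b ∈ FB.good) ⊎ (b ∈ exB) → ⊥
        both (inj₂ a∈ex) _ = proj₁ o₄ (subst (_∈ map add (cartesianProduct exA (LB h₁))) a+b (∈-map⁺ add (∈-cartesianProduct⁺ a∈ex b∈)))
        both (inj₁ _) (inj₂ b∈ex) = proj₂ o₄ (subst (_∈ map add (cartesianProduct (LA h₁) exB)) a+b (∈-map⁺ add (∈-cartesianProduct⁺ a∈ b∈ex)))
        both (inj₁ ga) (inj₁ gb) = Top.At.nonresidue q pp p≤ (proj₁ o₂) (zero-at (d₁ + k) lo₁ hi₁ (d₁ + k) lo₁ hi₁) (proj₁ z) (proj₂ z)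
          where
          fa = FA.good⁻ a ga
          fb = FB.good⁻ b gb
          ra = PAk.root a (proj₁ fa) (proj₁ (proj₂ fa)) (proj₂ (proj₂ fa))
          rb = PBk.root b (proj₁ fb) (proj₁ (proj₂ fb)) (proj₂ (proj₂ fb))
          z = BottomPrime.residue q pp PAk.α PBk.α a b (proj₁ ra) (proj₁ rb) PAk.β PBk.β a+b (proj₂ ra) (proj₂ rb) (zero-at k lo₀ hi₀ k lo₀ hi₀)
            (divisors-complete (2 ^ h₁) PAk.α p pp p≤ (proj₁ o₃)) (divisors-complete (2 ^ h₁) PBk.α p pp p≤ (proj₂ o₃))
            (A.α (d₁ + k) lo₁ hi₁) (B.α (d₁ + k) lo₁ hi₁) (proj₁ squareA) (proj₁ squareB) (proj₂ squareA) (proj₂ squareB)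

-- Application of the conjecture

^-cancelˡ-≤ : ∀ a b n → 1 ≤ n → a ^ n ≤ b ^ n → a ≤ b
^-cancelˡ-≤ a b n n≥1 le = ≮⇒≥ λ b<a → <⇒≱ (^-monoˡ-< n {{>-nonZero n≥1}} b<a) le

select : (ℕ → Bool) → List ℕ → List ℕ
select f = filter (λ x → f x ≟ᵇ true)

count≡length : ∀ f xs → count f xs ≡ length (select f xs)
count≡length f [] = refl
count≡length f (x ∷ xs) with f x
... | true  = cong suc (count≡length f xs)
... | false = count≡length f xs

count-not : ∀ f xs → count f xs + count (not ∘ f) xs ≡ length xs
count-not f [] = refl
count-not f (x ∷ xs) with f x
... | true  = cong suc (count-not f xs)
... | false = trans (+-suc (count f xs) (count (not ∘ f) xs)) (cong suc (count-not f xs))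

any-true : ∀ (f : ℕ → Bool) xs → any f xs ≡ true → Σ ℕ λ x → x ∈ xs × f x ≡ true
any-true f (x ∷ xs) e with f x in fx
... | true  = x , here refl , fx
... | false = let (y , y∈ , fy) = any-true f xs e in y , there y∈ , fy

∈-range : ∀ n X → 1 ≤ n → n ≤ X → n ∈ range X
∈-range (suc n) X _ n<X = ∈-map⁺ suc (∈-upTo⁺ n<X)

-- Negation maps the residues of B into the complement of those of A.
residues≤ : ∀ A B X q → (∀ a b → A a ≡ true → B b ≡ true → ¬ (suc q ∣ a + b)) → resCount A X (suc q) + resCount B X (suc q) ≤ suc q
residues≤ A B X q disjoint = subst (resCount A X p + resCount B X p ≤_) (trans (count-not hA (upTo p)) (length-upTo p))
    (+-monoʳ-≤ (resCount A X p) (subst₂ _≤_ (sym (count≡length hB (upTo p))) (sym (count≡length (not ∘ hA) (upTo p)))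
      (card≤ (select hB (upTo p)) (select (not ∘ hA) (upTo p)) (λ r r′ → r < p × p ∣ r′ + r) (filter⁺ (λ x → hB x ≟ᵇ true) (upTo⁺ p)) total injective)))
  where
  p = suc q
  hit : (ℕ → Bool) → ℕ → Bool
  hit F r = any (λ a → F a ∧ ((a % p) ≡ᵇ r)) (range X)
  hA hB : ℕ → Bool
  hA = hit A
  hB = hit B
  hit⁻ : ∀ F r → hit F r ≡ true → Σ ℕ λ a → F a ≡ true × a % p ≡ r
  hit⁻ F r e = let (a , _ , e′) = any-true (λ a → F a ∧ ((a % p) ≡ᵇ r)) (range X) e in a , ∧-true₁ e′ , ≡ᵇ-true (a % p) r (∧-true₂ {F a} e′)
    where
    ≡ᵇ-true : ∀ m n → (m ≡ᵇ n) ≡ true → m ≡ n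
    ≡ᵇ-true m n e = does-true⁻ (m ≟ n) e
  negate : ℕ → ℕ
  negate r = (r * q) % p
  p∣negate : ∀ r → p ∣ negate r + r
  p∣negate r = %-∣ {p} {r * q} {r} (subst (p ∣_) (trans (*-suc r q) (+-comm r (r * q))) (n∣m*n r))
  total : ∀ r → r ∈ select hB (upTo p) → Σ ℕ λ r′ → r′ ∈ select (not ∘ hA) (upTo p) × (r < p × p ∣ r′ + r)
  total r r∈ = negate r , ∈-filter⁺ (λ x → not (hA x) ≟ᵇ true) (∈-upTo⁺ (m%n<n (r * q) p)) (excluded (hA (negate r)) refl) , ∈-upTo⁻ (proj₁ f) , p∣negate r
    where
    f = ∈-filter⁻ (λ x → hB x ≟ᵇ true) {xs = upTo p} r∈
    excluded : ∀ b → hA (negate r) ≡ b → not (hA (negate r)) ≡ true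
    excluded false e = cong not e
    excluded true  e = let (a , Aa , ea) = hit⁻ A (negate r) e ; (b , Bb , eb) = hit⁻ B r (proj₂ f) in
      ⊥-elim (disjoint a b Aa Bb (∣-% {p} {a} {b} (subst (p ∣_) (+-comm b (a % p)) (∣-% {p} {b} {a % p} (subst (p ∣_) (trans (cong₂ _+_ (sym ea) (sym eb)) (+-comm (a % p) (b % p))) (p∣negate r))))))
  injective : ∀ r r₁ r′ → r < p × p ∣ r′ + r → r₁ < p × p ∣ r′ + r₁ → r ≡ r₁
  injective r r₁ r′ (r< , d) (r₁< , d₁) with r ≟ r₁
  ... | yes e = e
  ... | no r≢r₁ = ⊥-elim (<⇒≱ (dist< r r₁ p r< r₁<) (∣⇒≤ {{>-nonZero (dist≢0 r r₁ r≢r₁)}} (∣dist p r′ r r₁ d d₁)))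

module AtScale (D : Decomposition) (k m s₁ t r₀ M : ℕ) (k≥1 : 1 ≤ k) (m≥1 : 1 ≤ m) (s≥ : 100 ≤ suc s₁) (t≥1 : 1 ≤ t)
  (Z : Sizes D (k * suc s₁) r₀ M) (r₀≤t : r₀ ≤ t) (n≤M : 2 * (k * suc s₁) * (4 * t) ≤ M) (n₀≤t : Decomposition.n₀ D ≤ t) where
  open Decomposition D
  s S N X : ℕ
  s = suc s₁
  S = k * s
  N = 2 * S * (4 * t)
  X = 2 ^ N

  S≥ : 100 ≤ S
  S≥ = ≤-trans s≥ (m≤n*m s k {{>-nonZero k≥1}})

  n₀≤* : ∀ c → 1 ≤ c → n₀ ≤ 2 * S * (c * t)
  n₀≤* c c≥1 = ≤-trans n₀≤t (≤-trans (m≤n*m t c {{>-nonZero c≥1}}) (m≤n*m (c * t) (2 * S) {{m*n≢0 2 S {{_}} {{>-nonZero (≤-trans (m≤m+n 1 99) S≥)}}}}))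

  f : ℕ → Bool
  f n = does (n ∈? LA N) ∧ does (2 ^ (2 * S * t) ≤? n)

  f⁺ : ∀ a → a ∈ LA N → 2 ^ (2 * S * t) ≤ a → f a ≡ true
  f⁺ a a∈ a≥ = cong₂ _∧_ (dec-true (a ∈? LA N) a∈) (dec-true (2 ^ (2 * S * t) ≤? a) a≥)

  f⁻ : ∀ a → f a ≡ true → a ∈ LA N × 2 ^ (2 * S * t) ≤ a
  f⁻ a e = does-true⁻ (a ∈? LA N) (∧-true₁ e) , does-true⁻ (2 ^ (2 * S * t) ≤? a) (∧-true₂ {does (a ∈? LA N)} e)

  f-subset : SubsetOf f X
  f-subset a e = LA-pos N a (proj₁ (f⁻ a e)) , <⇒≤ (LA-bound N (n₀≤* 4 (s≤s z≤n)) a (proj₁ (f⁻ a e)))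

  half : ℕ
  half = 2 * S * (2 * t)

  t≤2t : t ≤ 2 * t
  t≤2t = m≤n*m t 2

  half≤N : half ≤ N
  half≤N = *-monoʳ-≤ (2 * S) (*-monoˡ-≤ t (m≤m+n 2 2))

  big small : List ℕ
  big = filter (2 ^ (2 * S * t) ≤?_) (LA half)
  small = filter (_<? 2 ^ (2 * S * t)) (LA half)

  length-half : length (LA half) ≤ length big + length small
  length-half = subst (length (LA half) ≤_) (length-++ big) (card-⊆ (LA-unique half) λ a a∈ → by-size a a∈ (a <? 2 ^ (2 * S * t)))
    where
    by-size : ∀ a → a ∈ LA half → Dec (a < 2 ^ (2 * S * t)) → a ∈ big ++ small
    by-size a a∈ (yes a<) = ∈-++⁺ʳ big (∈-filter⁺ (_<? 2 ^ (2 * S * t)) a∈ a<)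
    by-size a a∈ (no a≮)  = ∈-++⁺ˡ (∈-filter⁺ (2 ^ (2 * S * t) ≤?_) a∈ (≮⇒≥ a≮))

  length-small : length small ≤ 2 ^ ((S + 4) * t)
  length-small = Sizes.up Z t r₀≤t (≤-trans (*-monoʳ-≤ (2 * S) (m≤n*m t 4)) n≤M) small (filter⁺ (_<? 2 ^ (2 * S * t)) (LA-unique half))
    λ a a∈ → let g = ∈-filter⁻ (_<? 2 ^ (2 * S * t)) {xs = LA half} a∈ in LA-mono (≤-trans half≤N n≤M) a (proj₁ g) , proj₂ g

  length-big : 2 ^ (2 * S * t) ≤ length big * 2 ^ (11 * t)
  length-big = *-cancelʳ-≤ _ _ (2 ^ (2 * S * t)) {{m^n≢0 2 (2 * S * t)}}
    (≤-trans (≤-reflexive (trans (pow+ (2 * S * t) (2 * S * t)) (cong (2 ^_) (lem₀ S t))))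
      (≤-trans twice (≤-trans (*-monoʳ-≤ (length big) (≤-trans (*-monoˡ-≤ x (2^-mono {1} t≥1)) (≤-reflexive (pow+ t ((S + 5) * (2 * t))))))
        (≤-reflexive (trans (cong (λ e → length big * 2 ^ e) (lem₁ S t)) (trans (cong (length big *_) (sym (pow+ (11 * t) (2 * S * t)))) (sym (*-assoc (length big) _ _))))))))
    where
    lem₀ : ∀ S t → 2 * S * t + 2 * S * t ≡ 2 * S * (2 * t)
    lem₀ = ℕS.solve-∀
    lem₁ : ∀ S t → t + (S + 5) * (2 * t) ≡ 11 * t + 2 * S * t
    lem₁ = ℕS.solve-∀
    x Y : ℕ
    x = 2 ^ ((S + 5) * (2 * t))
    Y = 2 ^ half
    2*small : 2 * (length small * x) ≤ Y
    2*small = ≤-trans (*-monoʳ-≤ 2 (*-monoˡ-≤ x length-small)) (≤-trans (≤-reflexive (trans (cong (2 *_) (pow+ ((S + 4) * t) ((S + 5) * (2 * t)))) refl)) (2^-mono exponent))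
      where
      exponent : 1 + ((S + 4) * t + (S + 5) * (2 * t)) ≤ half
      exponent = ≤-trans (+-monoˡ-≤ _ t≥1) (≤-trans (≤-reflexive (lem S t)) (≤-trans (*-monoˡ-≤ t (+-monoʳ-≤ (3 * S) (≤-trans (m≤m+n 15 85) S≥))) (≤-reflexive (lem′ S t))))
        where
        lem : ∀ S t → t + ((S + 4) * t + (S + 5) * (2 * t)) ≡ (3 * S + 15) * t
        lem = ℕS.solve-∀
        lem′ : ∀ S t → (3 * S + S) * t ≡ 2 * S * (2 * t)
        lem′ = ℕS.solve-∀
    twice : Y ≤ length big * (2 * x)
    twice = +-cancelʳ-≤ Y _ _ (≤-trans (≤-reflexive (lem Y)) (≤-trans (*-monoʳ-≤ 2 (≤-trans (Sizes.low Z (2 * t) (≤-trans r₀≤t t≤2t) (≤-trans half≤N n≤M)) (*-monoˡ-≤ x length-half)))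
      (≤-trans (≤-reflexive (lem′ (length big) (length small) x)) (+-monoʳ-≤ (length big * (2 * x)) 2*small))))
      where
      lem : ∀ y → y + y ≡ 2 * y
      lem = ℕS.solve-∀
      lem′ : ∀ a b x → 2 * ((a + b) * x) ≡ a * (2 * x) + 2 * (b * x)
      lem′ = ℕS.solve-∀

  big≤smallCount : length big ≤ smallCount f X
  big≤smallCount = subst (length big ≤_) (sym (count≡length g (range X))) (card-⊆ (filter⁺ (2 ^ (2 * S * t) ≤?_) (LA-unique half)) member)
    where
    g : ℕ → Bool
    g n = f n ∧ ((n * n) ≤ᵇ X)
    member : ∀ a → a ∈ big → a ∈ select g (range X)
    member a a∈ = ∈-filter⁺ (λ x → g x ≟ᵇ true) (∈-range a X (LA-pos half a a∈half) (≤-trans (m≤m*n a a {{>-nonZero (LA-pos half a a∈half)}}) a²≤X))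
        (cong₂ _∧_ (f⁺ a (LA-mono half≤N a a∈half) (proj₂ h)) (dec-true (a * a ≤? X) a²≤X))
      where
      h = ∈-filter⁻ (2 ^ (2 * S * t) ≤?_) {xs = LA half} a∈
      a∈half = proj₁ h
      a<2^half = LA-bound half (n₀≤* 2 (s≤s z≤n)) a a∈half
      lem : ∀ S t → 2 * S * (2 * t) + 2 * S * (2 * t) ≡ 2 * S * (4 * t)
      lem = ℕS.solve-∀
      a²≤X : a * a ≤ X
      a²≤X = ≤-trans (*-mono-≤ (<⇒≤ a<2^half) (<⇒≤ a<2^half)) (≤-reflexive (trans (pow+ half half) (cong (2 ^_) (lem S t))))

  X^ : ∀ j → X ^ j ≡ 2 ^ (N * j)
  X^ = ^-*-assoc 2 N

  not-small : ¬ (smallCount f X ^ (4 * k) * X ^ (4 * m) ≤ X ^ k)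
  not-small le = <⇒≱ exponents (2^-cancel-≤ compare′)
    where
    G = length big
    compare′ : 2 ^ (2 * S * t * (4 * k) + N * (4 * m)) ≤ 2 ^ (N * k + 11 * t * (4 * k))
    compare′ = ≤-trans (≤-reflexive (trans (sym (pow+ (2 * S * t * (4 * k)) (N * (4 * m)))) (cong₂ _*_ (sym (^-*-assoc 2 (2 * S * t) (4 * k))) (sym (X^ (4 * m))))))
      (≤-trans (*-monoˡ-≤ (X ^ (4 * m)) (≤-trans (^-monoˡ-≤ (4 * k) length-big) (≤-reflexive (^-distribʳ-* (4 * k) G (2 ^ (11 * t))))))
        (≤-trans (≤-reflexive (lem (G ^ (4 * k)) ((2 ^ (11 * t)) ^ (4 * k)) (X ^ (4 * m))))
          (≤-trans (*-monoˡ-≤ ((2 ^ (11 * t)) ^ (4 * k)) (≤-trans (*-monoˡ-≤ (X ^ (4 * m)) (^-monoˡ-≤ (4 * k) big≤smallCount)) le))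
            (≤-reflexive (trans (cong₂ _*_ (X^ k) (^-*-assoc 2 (11 * t) (4 * k))) (pow+ (N * k) (11 * t * (4 * k))))))))
      where
      lem : ∀ g x y → g * x * y ≡ g * y * x
      lem = ℕS.solve-∀
    exponents : N * k + 11 * t * (4 * k) < 2 * S * t * (4 * k) + N * (4 * m)
    exponents = ≤-trans (≤-trans (≤-trans (≤-reflexive (sym (+-suc (N * k) _))) (+-monoʳ-≤ (N * k) (≤-trans (+-monoˡ-≤ (11 * t * (4 * k)) (*-mono-≤ t≥1 k≥1)) (≤-reflexive (lem₁ t k)))))
        (+-monoʳ-≤ (N * k) (≤-trans (*-monoˡ-≤ (t * k) (≤-trans (m≤m+n 45 55) s≥)) (≤-trans (m≤n*m (s * (t * k)) 32) (≤-trans (≤-reflexive (lem₂ k s t)) (m≤m*n (N * 4) m {{>-nonZero m≥1}}))))))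
      (≤-reflexive (lem₃ k s t m))
      where
      lem₁ : ∀ t k → t * k + 11 * t * (4 * k) ≡ 45 * (t * k)
      lem₁ = ℕS.solve-∀
      lem₂ : ∀ k s t → 32 * (s * (t * k)) ≡ 2 * (k * s) * (4 * t) * 4
      lem₂ = ℕS.solve-∀
      lem₃ : ∀ k s t m → 2 * (k * s) * (4 * t) * k + 2 * (k * s) * (4 * t) * 4 * m ≡ 2 * (k * s) * t * (4 * k) + 2 * (k * s) * (4 * t) * (4 * m)
      lem₃ = ℕS.solve-∀

  Bounded : ℤ → Set
  Bounded z = ∣ z ∣ ^ s ≤ X ^ 1

  bounded : ∀ z → Bounded z → ∣ z ∣ ≤ 2 ^ (8 * k * t)
  bounded z le = ^-cancelˡ-≤ (∣ z ∣) (2 ^ (8 * k * t)) s (s≤s z≤n) (≤-trans le (≤-reflexive (trans (X^ 1) (trans (cong (2 ^_) (lem k s t)) (sym (^-*-assoc 2 (8 * k * t) s))))))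
    where
    lem : ∀ k s t → 2 * (k * s) * (4 * t) * 1 ≡ 8 * k * t * s
    lem = ℕS.solve-∀

  patch : ∀ ψ → Bounded (qa ψ) → Bounded (qb ψ) → Bounded (qc ψ) → Bounded (qd ψ) →
    (L : List ℕ) → length L ^ (2 * k) * X ^ (2 * m) ≤ X ^ k → (∀ n → f n ≡ true → InImage ψ n ⊎ n ∈ L) → Patch D k s t
  patch ψ ha hb hc hd L few image = record
    { α = α ; β = β ; α≥1 = α≥1 ; α≤ = α≤ ; β≤ = β≤ ; exc = L ; exc≤ = exc≤
    ; root = λ a a∈ a≥ a∉ → root a a≥ (Data.Sum.[ id , ⊥-elim ∘ a∉ ]′ (image a (f⁺ a a∈ a≥))) }
    where
    A = + 4 ℤ.* qa ψ ℤ.* qd ψ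
    α = ∣ A ∣
    β = discriminant ψ
    η = 8 * k * t
    η2 : ∀ c → 2 ^ c * (2 ^ η * 2 ^ η) ≡ 2 ^ (16 * k * t + c)
    η2 c = trans (cong (2 ^ c *_) (pow+ η η)) (trans (pow+ c (η + η)) (cong (2 ^_) (lem k t c)))
      where
      lem : ∀ k t c → c + (8 * k * t + 8 * k * t) ≡ 16 * k * t + c
      lem = ℕS.solve-∀
    abs4 : ∀ x y → ∣ + 4 ℤ.* x ℤ.* y ∣ ≡ 4 * (∣ x ∣ * ∣ y ∣)
    abs4 x y = trans (ℤP.abs-* (+ 4 ℤ.* x) y) (trans (cong (_* ∣ y ∣) (ℤP.abs-* (+ 4) x)) (*-assoc 4 (∣ x ∣) (∣ y ∣)))
    α≤ : α ≤ 2 ^ (16 * k * t + 2)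
    α≤ = ≤-trans (≤-reflexive (abs4 (qa ψ) (qd ψ))) (≤-trans (*-monoʳ-≤ 4 (*-mono-≤ (bounded (qa ψ) ha) (bounded (qd ψ) hd))) (≤-reflexive (η2 2)))
    β≤ : ∣ β ∣ ≤ 2 ^ (16 * k * t + 3)
    β≤ = ≤-trans (ℤP.∣i-j∣≤∣i∣+∣j∣ (qb ψ ℤ.* qb ψ) (+ 4 ℤ.* qa ψ ℤ.* qc ψ))
      (≤-trans (+-mono-≤ (≤-trans (≤-reflexive (ℤP.abs-* (qb ψ) (qb ψ))) (*-mono-≤ (bounded (qb ψ) hb) (bounded (qb ψ) hb)))
          (≤-trans (≤-reflexive (abs4 (qa ψ) (qc ψ))) (*-monoʳ-≤ 4 (*-mono-≤ (bounded (qa ψ) ha) (bounded (qc ψ) hc)))))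
        (≤-trans (≤-trans (≤-reflexive (lem (2 ^ η * 2 ^ η))) (*-monoˡ-≤ (2 ^ η * 2 ^ η) (m≤m+n 5 3))) (≤-reflexive (η2 3))))
      where
      lem : ∀ x → x + 4 * x ≡ 5 * x
      lem = ℕS.solve-∀
    α≥1 : 1 ≤ α
    α≥1 = n≢0⇒n>0 λ e → nonzero (ℤP.∣i∣≡0⇒i≡0 {A} e)
      where
      nonzero : ¬ (A ≡ + 0)
      nonzero e with ℤP.i*j≡0⇒i≡0∨j≡0 (+ 4 ℤ.* qa ψ) e
      ... | inj₂ d≡0 = qd≢0 ψ d≡0
      ... | inj₁ 4a≡0 with ℤP.i*j≡0⇒i≡0∨j≡0 (+ 4) 4a≡0
      ...   | inj₂ a≡0 = qa≢0 ψ a≡0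
    exc≤ : length L * 2 ^ (8 * s * t) ≤ 2 ^ (4 * S * t)
    exc≤ = ^-cancelˡ-≤ _ _ (2 * k) (≤-trans k≥1 (m≤n*m k 2))
      (≤-trans (≤-reflexive (trans (^-distribʳ-* (2 * k) (length L) (2 ^ (8 * s * t))) (cong (length L ^ (2 * k) *_) (trans (^-*-assoc 2 (8 * s * t) (2 * k)) (trans (cong (2 ^_) (lem k s t)) (sym (X^ 2)))))))
        (≤-trans (*-monoʳ-≤ (length L ^ (2 * k)) (^-monoʳ-≤ X {{m^n≢0 2 N}} (*-monoʳ-≤ 2 m≥1)))
          (≤-trans few (≤-reflexive (trans (X^ k) (trans (cong (2 ^_) (lem′ k s t)) (sym (^-*-assoc 2 (4 * S * t) (2 * k)))))))))
      where
      lem : ∀ k s t → 8 * s * t * (2 * k) ≡ 2 * (k * s) * (4 * t) * 2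
      lem = ℕS.solve-∀
      lem′ : ∀ k s t → 2 * (k * s) * (4 * t) * k ≡ 4 * (k * s) * t * (2 * k)
      lem′ = ℕS.solve-∀
    β<a : ∀ a → 2 ^ (2 * S * t) ≤ a → ∣ β ∣ < a
    β<a a a≥ = ≤-<-trans β≤ (<-≤-trans (^-monoʳ-< 2 (s≤s (s≤s z≤n)) exponent) a≥)
      where
      exponent : 16 * k * t + 3 < 2 * S * t
      exponent = ≤-trans (≤-trans (≤-reflexive (sym (+-suc (16 * k * t) 3))) (+-monoʳ-≤ (16 * k * t) (*-monoʳ-≤ 4 (*-mono-≤ k≥1 t≥1))))
        (≤-trans (≤-reflexive (lem₁ k t)) (≤-trans (*-monoˡ-≤ (k * t) (≤-trans (m≤m+n 20 80) (≤-trans s≥ (m≤n*m s 2)))) (≤-reflexive (lem₂ k s t))))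
        where
        lem₁ : ∀ k t → 16 * k * t + 4 * (k * t) ≡ 20 * (k * t)
        lem₁ = ℕS.solve-∀
        lem₂ : ∀ k s t → 2 * s * (k * t) ≡ 2 * (k * s) * t
        lem₂ = ℕS.solve-∀
    -- For α < 0 the values α a + β are negative.
    signed : ∀ A a u → 1 ≤ ∣ A ∣ → ∣ β ∣ < a → + (u * u) ≡ A ℤ.* + a ℤ.+ β → + (u * u) ≡ + (∣ A ∣ * a) ℤ.+ β
    signed (+ n) a u _ _ e = trans e (cong (ℤ._+ β) (sym (ℤP.pos-* n a)))
    signed ℤ.-[1+ n ] a u _ β<a e = ⊥-elim (<⇒≱ β<a (≤-trans (m≤n*m a (suc n)) (≤-trans (m≤n+m (suc n * a) (u * u)) (≤-reflexive (cong ∣_∣ total)))))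
      where
      lem : ∀ x a β → (ℤ.- x) ℤ.* a ℤ.+ β ℤ.+ x ℤ.* a ≡ β
      lem = ℤS.solve-∀
      total : + (u * u + suc n * a) ≡ β
      total = trans (ℤP.pos-+ (u * u) (suc n * a)) (trans (cong₂ ℤ._+_ e (ℤP.pos-* (suc n) a)) (lem (+ suc n) (+ a) β))
    root : ∀ a → 2 ^ (2 * S * t) ≤ a → InImage ψ a → Σ ℕ λ u → + (u * u) ≡ + (α * a) ℤ.+ β
    root a a≥ im = let (u , e) = image-square ψ a im in u , signed A a u α≥1 (β<a a a≥) e

numerator≥1 : ∀ c → ℚ.Positive c → 1 ≤ ∣ ℚ.ℚ.numerator c ∣
numerator≥1 (mkℚ (+ suc m) _ _) _ = s≤s z≤n
numerator≥1 (mkℚ (+ zero) _ _) record { pos = () }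
numerator≥1 (mkℚ ℤ.-[1+ _ ] _ _) record { pos = () }

1/suc : ℕ → ℚ
1/suc s₁ = mkℚ (+ 1) s₁ (λ {i} → Cop.1-coprimeTo (suc s₁) {i})

weaken-sizes : ∀ {D S r r′ M} → r ≤ r′ → Sizes D S r M → Sizes D S r′ M
weaken-sizes r≤r′ Z = record
  { pure = pure
  ; up = λ r″ le → up r″ (≤-trans r≤r′ le)
  ; low = λ r″ le → low r″ (≤-trans r≤r′ le) }
  where open Sizes Z

ConjectureAt : ℚ → ℚ → ℕ → Set
ConjectureAt ρ c X = ∀ (A B : ℕ → Bool) → SubsetOf A X → SubsetOf B X →
  (∀ p → Prime p → 0 ≤ p → p ^ 4 ≤ X → resCount A X p + resCount B X p ≤ suc p) →
  (PowBound (smallCount A X) X 4 c ⊎ PowBound (smallCount B X) X 4 c)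
  ⊎ (Σ RatQuad λ ψA → Σ RatQuad λ ψB → HeightAtMost ψA X ρ × HeightAtMost ψB X ρ × FewExceptions A ψA X c × FewExceptions B ψB X c)

module ApplyConjecture (D : Decomposition) (c : ℚ) (c>0 : ℚ.Positive c) (s₁ t r₀ M : ℕ) where
  open Decomposition D

  private
    s k S X : ℕ
    s = suc s₁
    k = ℚ.ℚ.denominatorℕ c
    S = k * s
    X = 2 ^ (2 * S * (4 * t))

  module At (s≥ : 100 ≤ s) (t≥1 : 1 ≤ t) (ZA : Sizes D (k * s) r₀ M) (ZB : Sizes (swap D) (k * s) r₀ M)
    (r₀≤t : r₀ ≤ t) (n≤M : 2 * (k * s) * (4 * t) ≤ M) (n₀≤t : n₀ ≤ t) (N₀≤t : N₀ ≤ t)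
    (conjecture : ConjectureAt (1/suc s₁) c X) where
    private
      m = ∣ ℚ.ℚ.numerator c ∣
      k≥1 : 1 ≤ k
      k≥1 = s≤s z≤n
      module A = AtScale D k m s₁ t r₀ M k≥1 (numerator≥1 c c>0) s≥ t≥1 ZA r₀≤t n≤M n₀≤t
      module B = AtScale (swap D) k m s₁ t r₀ M k≥1 (numerator≥1 c c>0) s≥ t≥1 ZB r₀≤t n≤M n₀≤t

      disjoint : ∀ p → Prime p → p ^ 4 ≤ X → ∀ a b → A.f a ≡ true → B.f b ≡ true → ¬ (p ∣ a + b)
      disjoint p pp p⁴≤X a b fa fb p∣ = <⇒≢ (≤-<-trans p≤a (m<m+n a (LB-pos _ b (proj₁ (B.f⁻ b fb))))) (prime∣prime pp
          (Sizes.pure ZA a b (LA-mono n≤M a (proj₁ (A.f⁻ a fa))) (LB-mono n≤M b (proj₁ (B.f⁻ b fb))) (≤-trans (≤-trans N₀≤ a≥) (m≤m+n a b))) p∣)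
        where
        a≥ = proj₂ (A.f⁻ a fa)
        lem : ∀ S t → 2 * S * (4 * t) ≡ 2 * S * t * 4
        lem = ℕS.solve-∀
        p≤a : p ≤ a
        p≤a = ≤-trans (^-cancelˡ-≤ p (2 ^ (2 * S * t)) 4 (s≤s z≤n) (≤-trans p⁴≤X (≤-reflexive (trans (cong (2 ^_) (lem S t)) (sym (^-*-assoc 2 (2 * S * t) 4)))))) a≥
        t≤ : t ≤ 2 * S * t
        t≤ = m≤n*m t (2 * S) {{m*n≢0 2 S {{_}} {{>-nonZero (≤-trans (m≤m+n 1 99) A.S≥)}}}}
        N₀≤ : N₀ ≤ 2 ^ (2 * S * t)
        N₀≤ = ≤-trans (≤-trans N₀≤t t≤) (<⇒≤ (n<2^n (2 * S * t)))

      local : ∀ p → Prime p → 0 ≤ p → p ^ 4 ≤ X → resCount A.f X p + resCount B.f X p ≤ suc p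
      local zero    pp _ _ = z≤n
      local (suc q) pp _ p⁴≤X = ≤-trans (residues≤ A.f B.f X q (disjoint (suc q) pp p⁴≤X)) (n≤1+n (suc q))

    patches : Patch D k s t × Patch (swap D) k s t
    patches = outcome (conjecture A.f B.f A.f-subset B.f-subset local)
      where
      outcome : (PowBound (smallCount A.f X) X 4 c ⊎ PowBound (smallCount B.f X) X 4 c)
        ⊎ (Σ RatQuad λ ψA → Σ RatQuad λ ψB → HeightAtMost ψA X (1/suc s₁) × HeightAtMost ψB X (1/suc s₁) × FewExceptions A.f ψA X c × FewExceptions B.f ψB X c) →
        Patch D k s t × Patch (swap D) k s t
      outcome (inj₁ (inj₁ small)) = ⊥-elim (A.not-small small)
      outcome (inj₁ (inj₂ small)) = ⊥-elim (B.not-small small)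
      outcome (inj₂ (ψA , ψB , (a₁ , a₂ , a₃ , a₄) , (b₁ , b₂ , b₃ , b₄) , (LA , fewA , inA) , (LB , fewB , inB))) =
        A.patch ψA a₁ a₂ a₃ a₄ LA fewA inA , B.patch ψB b₁ b₂ b₃ b₄ LB fewB inB

impure : Conjecture → ∀ s₁ → 1000 ≤ suc s₁ → ∀ D → Σ ℕ λ M → ¬ Decomposition.Pure D M
impure conjecture s₁ s≥ D = M , λ pure → contradict (weaken-sizes (m≤m+n (proj₁ zA) (proj₁ zB)) (proj₂ zA M pure))
    (weaken-sizes (m≤n+m (proj₁ zB) (proj₁ zA)) (proj₂ zB M (swap-pure D M pure)))
  where
  open Decomposition D
  s = suc s₁
  conj = conjecture (1/suc s₁) _
  c = proj₁ conj
  c>0 = proj₁ (proj₂ conj)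
  k = ℚ.ℚ.denominatorℕ c
  X₁ = proj₁ (proj₂ (proj₂ conj) 0)
  k≥1 : 1 ≤ k
  k≥1 = s≤s z≤n
  S≥1 : 1 ≤ k * s
  S≥1 = *-mono-≤ k≥1 (s≤s (z≤n {s₁}))
  zA = sizes D (k * s) S≥1
  zB = sizes (swap D) (k * s) S≥1
  r₀ t M : ℕ
  r₀ = proj₁ zA + proj₁ zB
  t = 128 * s + (r₀ + (n₀ + (N₀ + (P₀ + X₁))))
  M = 2 * (k * s) * (4 * (8 * k * t))
  rest₁ : r₀ + (n₀ + (N₀ + (P₀ + X₁))) ≤ t
  rest₁ = m≤n+m _ (128 * s)
  rest₂ : n₀ + (N₀ + (P₀ + X₁)) ≤ t
  rest₂ = m+n≤o⇒n≤o r₀ rest₁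
  rest₃ : N₀ + (P₀ + X₁) ≤ t
  rest₃ = m+n≤o⇒n≤o n₀ rest₂
  rest₄ : P₀ + X₁ ≤ t
  rest₄ = m+n≤o⇒n≤o N₀ rest₃
  Q : Parameters D k s t r₀ M
  Q = record { k≥1 = k≥1 ; s≥ = s≥ ; t≥ = m≤m+n (128 * s) _ ; r₀≤t = m+n≤o⇒m≤o r₀ rest₁ ; n₀≤t = m+n≤o⇒m≤o n₀ rest₂
    ; N₀≤t = m+n≤o⇒m≤o N₀ rest₃ ; P₀≤t = m+n≤o⇒m≤o P₀ rest₄ ; M≥ = ≤-refl }
  open Parameters Q using (s≥100; module Index; n₀≤t; N₀≤t)
  contradict : Sizes D (k * s) r₀ M → Sizes (swap D) (k * s) r₀ M → ⊥
  contradict ZA ZB = Contradiction.contradiction D k s t r₀ M Q ZA ZB (λ j lo hi → proj₁ (at j lo hi)) (λ j lo hi → proj₂ (at j lo hi))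
    where
    at : ∀ j → k ≤ j → j ≤ 8 * k → Patch D k s (j * t) × Patch (swap D) k s (j * t)
    at j lo hi = ApplyConjecture.At.patches D c c>0 s₁ (j * t) r₀ M s≥100 jt≥1 ZA ZB r₀≤jt n≤M (≤-trans n₀≤t t≤jt) (≤-trans N₀≤t t≤jt)
      (proj₂ (proj₂ (proj₂ conj) 0) (2 ^ (2 * (k * s) * (4 * (j * t)))) X₁≤)
      where
      open Index j lo hi
      X₁≤ : X₁ ≤ 2 ^ (2 * (k * s) * (4 * (j * t)))
      X₁≤ = ≤-trans (≤-trans (m+n≤o⇒n≤o P₀ rest₄) (≤-trans t≤jt (≤-trans (m≤n*m (j * t) 4) (m≤n*m (4 * (j * t)) (2 * (k * s)) {{m*n≢0 2 (k * s) {{_}} {{>-nonZero S≥1}}}}))))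
        (<⇒≤ (n<2^n (2 * (k * s) * (4 * (j * t)))))

module Summands (𝒜 ℬ : ℕ → Set) (𝒜-pos : ∀ n → 𝒜 n → 1 ≤ n) (ℬ-pos : ∀ n → ℬ n → 1 ≤ n)
  (x y : ℕ) (𝒜x : 𝒜 x) (𝒜y : 𝒜 y) (x≢y : x ≢ y) (z w : ℕ) (ℬz : ℬ z) (ℬw : ℬ w) (z≢w : z ≢ w)
  (P₀ : ℕ) (represent : ∀ p → P₀ ≤ p → Prime p → InSumset 𝒜 ℬ p) (N : ℕ) where

  record Pair′ (n : ℕ) : Set where
    field
      a b  : ℕ
      𝒜a   : 𝒜 a
      ℬb   : ℬ b
      a≤   : a < n ⊎ a ≡ x
      b≤   : b < n ⊎ b ≡ z
      sums : P₀ ≤ n → Prime n → a + b ≡ n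

  pair : ∀ n → Pair′ n
  pair n = choose (P₀ ≤? n) (prime? n)
    where
    default : (P₀ ≤ n → Prime n → x + z ≡ n) → Pair′ n
    default e = record { a = x ; b = z ; 𝒜a = 𝒜x ; ℬb = ℬz ; a≤ = inj₂ refl ; b≤ = inj₂ refl ; sums = e }
    choose : Dec (P₀ ≤ n) → Dec (Prime n) → Pair′ n
    choose (no P₀≰n) _       = default λ P₀≤n _ → ⊥-elim (P₀≰n P₀≤n)
    choose (yes _) (no ¬pn)  = default λ _ pn → ⊥-elim (¬pn pn)
    choose (yes P₀≤n) (yes pn) = let (a , b , 𝒜a , ℬb , e) = represent n P₀≤n pn in
      record { a = a ; b = b ; 𝒜a = 𝒜a ; ℬb = ℬb ; a≤ = inj₁ (subst (a <_) e (m<m+n a (ℬ-pos b ℬb)))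
             ; b≤ = inj₁ (subst (b <_) e (m<n+m b (𝒜-pos a 𝒜a))) ; sums = λ _ _ → e }

  α β : ℕ → ℕ
  α n = Pair′.a (pair n)
  β n = Pair′.b (pair n)

  raw collect : (ℕ → ℕ) → ℕ → ℕ → ℕ → List ℕ
  raw g u v n = u ∷ v ∷ map g (upTo (suc (2 ^ n)))
  collect g u v n = deduplicate _≟_ (raw g u v n)

  collect⁻ : ∀ g u v n a → a ∈ collect g u v n → a ≡ u ⊎ a ≡ v ⊎ (Σ ℕ λ i → i ≤ 2 ^ n × a ≡ g i)
  collect⁻ g u v n a a∈ = cases (∈-deduplicate⁻ _≟_ (raw g u v n) a∈)
    where
    cases : a ∈ u ∷ v ∷ map g (upTo (suc (2 ^ n))) → a ≡ u ⊎ a ≡ v ⊎ (Σ ℕ λ i → i ≤ 2 ^ n × a ≡ g i)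
    cases (here e)           = inj₁ e
    cases (there (here e))   = inj₂ (inj₁ e)
    cases (there (there a∈)) = let (i , i∈ , e) = ∈-map⁻ g a∈ in inj₂ (inj₂ (i , ≤-pred (∈-upTo⁻ i∈) , e))

  collect-g : ∀ g u v n i → i ≤ 2 ^ n → g i ∈ collect g u v n
  collect-g g u v n i i≤ = ∈-deduplicate⁺ _≟_ {xs = raw g u v n} (there (there (∈-map⁺ g (∈-upTo⁺ (s≤s i≤)))))

  collect-mono : ∀ g u v {m n} → m ≤ n → ∀ a → a ∈ collect g u v m → a ∈ collect g u v n
  collect-mono g u v {m} {n} m≤n a a∈ = cases (collect⁻ g u v m a a∈)
    where
    cases : a ≡ u ⊎ a ≡ v ⊎ (Σ ℕ λ i → i ≤ 2 ^ m × a ≡ g i) → a ∈ collect g u v n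
    cases (inj₁ e)                    = ∈-deduplicate⁺ _≟_ {xs = raw g u v n} (here e)
    cases (inj₂ (inj₁ e))             = ∈-deduplicate⁺ _≟_ {xs = raw g u v n} (there (here e))
    cases (inj₂ (inj₂ (i , i≤ , refl))) = collect-g g u v n i (≤-trans i≤ (2^-mono m≤n))

  collect-all : ∀ (T : ℕ → Set) g u v n → T u → T v → (∀ i → i ≤ 2 ^ n → T (g i)) → ∀ a → a ∈ collect g u v n → T a
  collect-all T g u v n Tu Tv Tg a a∈ = cases (collect⁻ g u v n a a∈)
    where
    cases : a ≡ u ⊎ a ≡ v ⊎ (Σ ℕ λ i → i ≤ 2 ^ n × a ≡ g i) → T a
    cases (inj₁ refl)                    = Tu
    cases (inj₂ (inj₁ refl))             = Tv
    cases (inj₂ (inj₂ (i , i≤ , refl))) = Tg i i≤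

  collect-two : ∀ g u v n → u ≢ v → 2 ≤ length (collect g u v n)
  collect-two g u v n u≢v = card-⊆ {xs = u ∷ v ∷ []} ((u≢v ∷ []) ∷ [] ∷ []) member
    where
    member : ∀ a → a ∈ u ∷ v ∷ [] → a ∈ collect g u v n
    member a (here e)         = ∈-deduplicate⁺ _≟_ {xs = raw g u v n} (here e)
    member a (there (here e)) = ∈-deduplicate⁺ _≟_ {xs = raw g u v n} (there (here e))

  LA LB : ℕ → List ℕ
  LA = collect α x y
  LB = collect β z w

  LA⊆ : ∀ n a → a ∈ LA n → 𝒜 a
  LA⊆ n = collect-all 𝒜 α x y n 𝒜x 𝒜y λ i _ → Pair′.𝒜a (pair i)

  LB⊆ : ∀ n b → b ∈ LB n → ℬ b
  LB⊆ n = collect-all ℬ β z w n ℬz ℬw λ i _ → Pair′.ℬb (pair i)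

  below : ∀ {u n} → u ≤ n → u < 2 ^ n
  below {u} {n} u≤n = ≤-<-trans u≤n (n<2^n n)

  n₀ : ℕ
  n₀ = (x + y) + (z + w)

  decomposition : Decomposition
  decomposition = record
    { P₀ = P₀ ; N₀ = N + 2 ; n₀ = n₀ ; LA = LA ; LB = LB
    ; LA-unique = λ n → deduplicate-! (raw α x y n) ; LB-unique = λ n → deduplicate-! (raw β z w n)
    ; LA-mono = collect-mono α x y ; LB-mono = collect-mono β z w
    ; LA-bound = λ n n₀≤n → collect-all (_< 2 ^ n) α x y n (below (≤-trans x≤n₀ n₀≤n)) (below (≤-trans y≤n₀ n₀≤n))
        λ i i≤ → Data.Sum.[ (λ lt → <-≤-trans lt i≤) , (λ e → subst (_< 2 ^ n) (sym e) (below (≤-trans x≤n₀ n₀≤n))) ]′ (Pair′.a≤ (pair i))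
    ; LB-bound = λ n n₀≤n → collect-all (_< 2 ^ n) β z w n (below (≤-trans z≤n₀ n₀≤n)) (below (≤-trans w≤n₀ n₀≤n))
        λ i i≤ → Data.Sum.[ (λ lt → <-≤-trans lt i≤) , (λ e → subst (_< 2 ^ n) (sym e) (below (≤-trans z≤n₀ n₀≤n))) ]′ (Pair′.b≤ (pair i))
    ; cover = λ n p pp P₀≤p p≤ → α p , β p , collect-g α x y n p p≤ , collect-g β z w n p p≤ , Pair′.sums (pair p) P₀≤p pp
    ; LA-pos = λ n a a∈ → 𝒜-pos a (LA⊆ n a a∈) ; LB-pos = λ n b b∈ → ℬ-pos b (LB⊆ n b b∈)
    ; LA-two = collect-two α x y n₀ x≢y ; LB-two = collect-two β z w n₀ z≢w }
    where
    x≤n₀ : x ≤ n₀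
    x≤n₀ = ≤-trans (m≤m+n x y) (m≤m+n (x + y) (z + w))
    y≤n₀ : y ≤ n₀
    y≤n₀ = ≤-trans (m≤n+m y x) (m≤m+n (x + y) (z + w))
    z≤n₀ : z ≤ n₀
    z≤n₀ = ≤-trans (m≤m+n z w) (m≤n+m (z + w) (x + y))
    w≤n₀ : w ≤ n₀
    w≤n₀ = ≤-trans (m≤n+m w z) (m≤n+m (z + w) (x + y))

  Goal : Set
  Goal = Σ ℕ λ n → N ≤ n × Composite n × InSumset 𝒜 ℬ n

  open Decomposition decomposition using (Pure)

  composite-or-pure : ∀ M → Goal ⊎ Pure M
  composite-or-pure M = search (any? (λ a → any? (λ b → composite-sum? a b) (LB M)) (LA M))
    where
    composite-sum? : ∀ a b → Dec (N ≤ a + b × Composite (a + b))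
    composite-sum? a b = (N ≤? a + b) ×-dec composite? (a + b)
    search : Dec (Any (λ a → Any (λ b → N ≤ a + b × Composite (a + b)) (LB M)) (LA M)) → Goal ⊎ Pure M
    search (yes found) =
      let (a , a∈ , found′) = find found ; (b , b∈ , N≤ , comp) = find found′ in
      inj₁ (a + b , N≤ , comp , a , b , LA⊆ M a a∈ , LB⊆ M b b∈ , refl)
    search (no none) = inj₂ λ a b a∈ b∈ N+2≤ → ¬composite⇒prime {{n>1⇒nonTrivial (≤-trans (m≤n+m 2 N) N+2≤)}}
      λ comp → none (lose a∈ (lose b∈ (≤-trans (m≤m+n N 2) N+2≤ , comp)))

theorem1p8 : Conjecture →
    ∀ (𝒜 ℬ : ℕ → Set) →
    (∀ n → 𝒜 n → 1 ≤ n) → (∀ n → ℬ n → 1 ≤ n) →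
    HasTwoElements 𝒜 → HasTwoElements ℬ →
    (Σ ℕ λ P₀ → ∀ p → P₀ ≤ p → Prime p → InSumset 𝒜 ℬ p) →
    ∀ (N : ℕ) → Σ ℕ λ n → N ≤ n × Composite n × InSumset 𝒜 ℬ n
theorem1p8 conjecture 𝒜 ℬ 𝒜-pos ℬ-pos (x , y , 𝒜x , 𝒜y , x≢y) (z , w , ℬz , ℬw , z≢w) (P₀ , represent) N =
  Data.Sum.[ id , (λ pure → ⊥-elim (proj₂ failure pure)) ]′ (composite-or-pure (proj₁ failure))
  where
  open Summands 𝒜 ℬ 𝒜-pos ℬ-pos x y 𝒜x 𝒜y x≢y z w ℬz ℬw z≢w P₀ represent N
  failure : Σ ℕ λ M → ¬ Decomposition.Pure decomposition M
  failure = impure conjecture 999 ≤-refl decomposition
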